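{- Let $T$ be a consistent computably enumerable theory (in the language of arithmetic) containing Robinson arithmetic $Q$, and let $\mathcal{L}_T$ be the lattice, under inclusion, of the c.e. extensions of $T$ that are closed under logical inference. Then $\mathrm{Th}(\mathcal{L}_T)$ is undecidable. -}

module Defs where

open import Level using (Level; Lift; lift) renaming (suc to lsuc; zero to lzero)
open import Data.Nat using (ℕ; zero; suc; _+_; _<_)
open import Data.Fin using (Fin; toℕ) renaming (zero to fzero; suc to fsuc)
open import Data.Vec using (Vec; []; _∷_; lookup)
open import Data.Product using (Σ; _×_; _,_)
open import Data.Sum using (_⊎_)
open import Data.Empty using (⊥)
open import Relation.Binary.PropositionalEquality using () renaming (_≡_ to _≡'_)

data Code : ℕ → Set where
  zer  : ∀ {n} → Code n
  succ : Code 1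
  proj : ∀ {n} → Fin n → Code n
  comp : ∀ {m n} → Code m → (Fin m → Code n) → Code n
  prec : ∀ {n} → Code n → Code (suc (suc n)) → Code (suc n)
  mu   : ∀ {n} → Code (suc n) → Code n

data Eval : ∀ {n} → Code n → Vec ℕ n → ℕ → Set where
  ev-zer   : ∀ {n} {xs : Vec ℕ n} → Eval zer xs 0
  ev-succ  : ∀ {x} → Eval succ (x ∷ []) (suc x)
  ev-proj  : ∀ {n} {xs : Vec ℕ n} (i : Fin n) → Eval (proj i) xs (lookup xs i)
  ev-comp  : ∀ {m n} {f : Code m} {gs : Fin m → Code n} {xs : Vec ℕ n} {z}
             (ys : Vec ℕ m) → (∀ i → Eval (gs i) xs (lookup ys i)) →
             Eval f ys z → Eval (comp f gs) xs z
  ev-prec0 : ∀ {n} {g : Code n} {h : Code (suc (suc n))} {xs z} →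
             Eval g xs z → Eval (prec g h) (0 ∷ xs) z
  ev-precS : ∀ {n} {g : Code n} {h : Code (suc (suc n))} {xs k r z} →
             Eval (prec g h) (k ∷ xs) r → Eval h (k ∷ r ∷ xs) z →
             Eval (prec g h) (suc k ∷ xs) z
  ev-mu    : ∀ {n} {f : Code (suc n)} {xs : Vec ℕ n} {y} →
             Eval f (y ∷ xs) 0 →
             (∀ k → k < y → Σ ℕ (λ v → Eval f (k ∷ xs) (suc v))) →
             Eval (mu f) xs y

IsCE : (ℕ → Set) → Set
IsCE A = Σ (Code 1) λ e → ∀ n →
  (A n → Σ ℕ (Eval e (n ∷ []))) × (Σ ℕ (Eval e (n ∷ [])) → A n)

IsDecidable₁ : (ℕ → Set₁) → Set₁
IsDecidable₁ A = Σ (Code 1) λ e →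
  (∀ n → Σ ℕ (Eval e (n ∷ []))) ×
  (∀ n → (Eval e (n ∷ []) 0 → A n) × (A n → Lift (lsuc lzero) (Eval e (n ∷ []) 0)))

-- Cantor pairing (a bijection ℕ × ℕ → ℕ), used for Gödel numbering.
tri : ℕ → ℕ
tri zero    = zero
tri (suc n) = suc n + tri n

⟨_,_⟩ : ℕ → ℕ → ℕ
⟨ a , b ⟩ = tri (a + b) + b

data Term (n : ℕ) : Set where
  var   : Fin n → Term n
  `0    : Term n
  `S    : Term n → Term n
  _`+_  : Term n → Term n → Term n
  _`·_  : Term n → Term n → Term n

infixr 5 _⇒_
data Formula (n : ℕ) : Set where
  `⊥   : Formula n
  _≐_  : Term n → Term n → Formula n
  _⇒_  : Formula n → Formula n → Formula n
  ∀'   : Formula (suc n) → Formula n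

Sentence : Set
Sentence = Formula 0

¬' : ∀ {n} → Formula n → Formula n
¬' φ = φ ⇒ `⊥

_∨'_ : ∀ {n} → Formula n → Formula n → Formula n
φ ∨' ψ = ¬' φ ⇒ ψ

∃' : ∀ {n} → Formula (suc n) → Formula n
∃' φ = ¬' (∀' (¬' φ))

liftR : ∀ {n m} → (Fin n → Fin m) → Fin (suc n) → Fin (suc m)
liftR ρ fzero    = fzero
liftR ρ (fsuc i) = fsuc (ρ i)

renT : ∀ {n m} → (Fin n → Fin m) → Term n → Term m
renT ρ (var i)  = var (ρ i)
renT ρ `0       = `0
renT ρ (`S t)   = `S (renT ρ t)
renT ρ (s `+ t) = renT ρ s `+ renT ρ t
renT ρ (s `· t) = renT ρ s `· renT ρ t

renF : ∀ {n m} → (Fin n → Fin m) → Formula n → Formula m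
renF ρ `⊥      = `⊥
renF ρ (s ≐ t) = renT ρ s ≐ renT ρ t
renF ρ (φ ⇒ ψ) = renF ρ φ ⇒ renF ρ ψ
renF ρ (∀' φ)  = ∀' (renF (liftR ρ) φ)

liftS : ∀ {n m} → (Fin n → Term m) → Fin (suc n) → Term (suc m)
liftS σ fzero    = var fzero
liftS σ (fsuc i) = renT fsuc (σ i)

subT : ∀ {n m} → (Fin n → Term m) → Term n → Term m
subT σ (var i)  = σ i
subT σ `0       = `0
subT σ (`S t)   = `S (subT σ t)
subT σ (s `+ t) = subT σ s `+ subT σ t
subT σ (s `· t) = subT σ s `· subT σ t

subF : ∀ {n m} → (Fin n → Term m) → Formula n → Formula m
subF σ `⊥      = `⊥
subF σ (s ≐ t) = subT σ s ≐ subT σ t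
subF σ (φ ⇒ ψ) = subF σ φ ⇒ subF σ ψ
subF σ (∀' φ)  = ∀' (subF (liftS σ) φ)

single : ∀ {n} → Term n → Fin (suc n) → Term n
single t fzero    = t
single t (fsuc i) = var i

_[_] : ∀ {n} → Formula (suc n) → Term n → Formula n
φ [ t ] = subF (single t) φ

wk : ∀ {n} → Formula n → Formula (suc n)
wk = renF fsuc

closedAt : ∀ {n} → Sentence → Formula n
closedAt = renF (λ ())

-- Logical axioms of a Hilbert-style calculus (Mendelson-style) with equality.
data LogAx {n : ℕ} : Formula n → Set where
  ax-K   : ∀ φ ψ → LogAx (φ ⇒ ψ ⇒ φ)
  ax-S   : ∀ φ ψ χ → LogAx ((φ ⇒ ψ ⇒ χ) ⇒ (φ ⇒ ψ) ⇒ φ ⇒ χ)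
  ax-DNE : ∀ φ → LogAx (¬' (¬' φ) ⇒ φ)
  ax-inst : ∀ (φ : Formula (suc n)) (t : Term n) → LogAx (∀' φ ⇒ φ [ t ])
  ax-dist : ∀ (φ : Formula n) (ψ : Formula (suc n)) → LogAx (∀' (wk φ ⇒ ψ) ⇒ φ ⇒ ∀' ψ)
  ax-refl : ∀ (t : Term n) → LogAx (t ≐ t)
  ax-subst : ∀ (s t : Term n) (φ : Formula (suc n)) → LogAx ((s ≐ t) ⇒ φ [ s ] ⇒ φ [ t ])

data _⊢_ (Γ : Sentence → Set) : ∀ {n} → Formula n → Set where
  hyp : ∀ {n} {φ : Sentence} → Γ φ → Γ ⊢ closedAt {n} φ
  ax  : ∀ {n} {φ : Formula n} → LogAx φ → Γ ⊢ φ
  mp  : ∀ {n} {φ ψ : Formula n} → Γ ⊢ (φ ⇒ ψ) → Γ ⊢ φ → Γ ⊢ ψ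
  gen : ∀ {n} {φ : Formula (suc n)} → Γ ⊢ φ → Γ ⊢ ∀' φ

x₀ x₁ : ∀ {n} → Term (suc (suc n))
x₀ = var fzero
x₁ = var (fsuc fzero)

data Q : Sentence → Set where
  Q1 : Q (∀' (¬' (`S (var fzero) ≐ `0)))
  Q2 : Q (∀' (∀' ((`S x₁ ≐ `S x₀) ⇒ (x₁ ≐ x₀))))
  Q3 : Q (∀' ((var fzero ≐ `0) ∨' ∃' (var (fsuc fzero) ≐ `S (var fzero))))
  Q4 : Q (∀' ((var fzero `+ `0) ≐ var fzero))
  Q5 : Q (∀' (∀' ((x₁ `+ `S x₀) ≐ `S (x₁ `+ x₀))))
  Q6 : Q (∀' ((var fzero `· `0) ≐ `0))
  Q7 : Q (∀' (∀' ((x₁ `· `S x₀) ≐ ((x₁ `· x₀) `+ x₁))))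

codeT : ∀ {n} → Term n → ℕ
codeT (var i)  = ⟨ 0 , toℕ i ⟩
codeT `0       = ⟨ 1 , 0 ⟩
codeT (`S t)   = ⟨ 2 , codeT t ⟩
codeT (s `+ t) = ⟨ 3 , ⟨ codeT s , codeT t ⟩ ⟩
codeT (s `· t) = ⟨ 4 , ⟨ codeT s , codeT t ⟩ ⟩

codeF : ∀ {n} → Formula n → ℕ
codeF `⊥      = ⟨ 0 , 0 ⟩
codeF (s ≐ t) = ⟨ 1 , ⟨ codeT s , codeT t ⟩ ⟩
codeF (φ ⇒ ψ) = ⟨ 2 , ⟨ codeF φ , codeF ψ ⟩ ⟩
codeF (∀' φ)  = ⟨ 3 , codeF φ ⟩

IsCETheory : (Sentence → Set) → Set
IsCETheory T = IsCE (λ k → Σ Sentence λ φ → (codeF φ ≡' k) × T φ)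

Consistent : (Sentence → Set) → Set
Consistent T = T ⊢ falsum → ⊥
  where
  falsum : Sentence
  falsum = `⊥

record Ext (T : Sentence → Set) : Set₁ where
  field
    mem      : Sentence → Set
    ce       : IsCETheory mem
    extends  : ∀ φ → T φ → mem φ
    closed   : ∀ φ → mem ⊢ φ → mem φ
open Ext public

data LTerm (n : ℕ) : Set where
  lvar : Fin n → LTerm n
  _∧ₗ_ : LTerm n → LTerm n → LTerm n
  _∨ₗ_ : LTerm n → LTerm n → LTerm n

data LFormula (n : ℕ) : Set where
  ⊥ₗ   : LFormula n
  _≈ₗ_ : LTerm n → LTerm n → LFormula n
  _⇒ₗ_ : LFormula n → LFormula n → LFormula n
  ∀ₗ   : LFormula (suc n) → LFormula n

codeLT : ∀ {n} → LTerm n → ℕ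
codeLT (lvar i) = ⟨ 0 , toℕ i ⟩
codeLT (s ∧ₗ t) = ⟨ 1 , ⟨ codeLT s , codeLT t ⟩ ⟩
codeLT (s ∨ₗ t) = ⟨ 2 , ⟨ codeLT s , codeLT t ⟩ ⟩

codeLF : ∀ {n} → LFormula n → ℕ
codeLF ⊥ₗ       = ⟨ 0 , 0 ⟩
codeLF (s ≈ₗ t) = ⟨ 1 , ⟨ codeLT s , codeLT t ⟩ ⟩
codeLF (φ ⇒ₗ ψ) = ⟨ 2 , ⟨ codeLF φ , codeLF ψ ⟩ ⟩
codeLF (∀ₗ φ)   = ⟨ 3 , codeLF φ ⟩

-- Interpretation in L_T: meet = intersection, join = deductive closure of union.
-- (Both are again c.e. closed extensions of T, i.e. the lattice operations of L_T.)
module _ (T : Sentence → Set) where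

  Env : ℕ → Set₁
  Env n = Fin n → Ext T

  ⟦_⟧ₜ : ∀ {n} → LTerm n → Env n → Sentence → Set
  ⟦ lvar i ⟧ₜ ρ φ = mem (ρ i) φ
  ⟦ s ∧ₗ t ⟧ₜ ρ φ = ⟦ s ⟧ₜ ρ φ × ⟦ t ⟧ₜ ρ φ
  ⟦ s ∨ₗ t ⟧ₜ ρ φ = (λ ψ → ⟦ s ⟧ₜ ρ ψ ⊎ ⟦ t ⟧ₜ ρ ψ) ⊢ φ

  extendEnv : ∀ {n} → Ext T → Env n → Env (suc n)
  extendEnv A ρ fzero    = A
  extendEnv A ρ (fsuc i) = ρ i

  Sat : ∀ {n} → LFormula n → Env n → Set₁
  Sat ⊥ₗ       ρ = Lift (lsuc lzero) ⊥
  Sat (s ≈ₗ t) ρ = Lift (lsuc lzero)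
                     (∀ φ → (⟦ s ⟧ₜ ρ φ → ⟦ t ⟧ₜ ρ φ) × (⟦ t ⟧ₜ ρ φ → ⟦ s ⟧ₜ ρ φ))
  Sat (φ ⇒ₗ ψ) ρ = Sat φ ρ → Sat ψ ρ
  Sat (∀ₗ φ)   ρ = (A : Ext T) → Sat φ (extendEnv A ρ)

  ThL : ℕ → Set₁
  ThL k = Σ (LFormula 0) λ σ → Lift (lsuc lzero) (codeLF σ ≡' k) × Sat σ (λ ())

-- An extension of T is read as the ideal of the sentences that it refutes, and the complemented elements of the lattice
-- are the principal ideals.  Rosser sentences split every consistent sentence, which yields disjoint "labels" c_n, a
-- leftmost completion of each c_n, and disjoint "slots" (n , m , v) of colours v that converge to it as m grows.
-- Every arithmetical set X of slots is coded by one c.e. ideal: membership in X is an iterated limit of bounded truth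
-- values, and slots nested one level deeper for each limit make "no slot of X is seen" a first-order property.
-- For a suitable arithmetical, cohesive choice of labels b_k and of slots, every c.e. ideal W eventually contains either
-- all or none of the chosen slots of colour v, so that W names a set of colours.  The W naming a single colour are
-- definable, and b_k witnesses one instance of addition or multiplication; thus the natural numbers are interpreted with
-- parameters.  The sentences "some interpreted model of Q satisfies χ at the number with the code of χ" then let a
-- decision procedure for the theory separate the theorems of Q from their negations, which is refuted by a Rosser formula.
module Submission where

open import Defs
open import Level using (Lift; lift; lower) renaming (suc to lsuc; zero to lzero; _⊔_ to _⊔ˡ_)
open import Data.Nat using (ℕ; zero; suc; pred; _+_; _*_; _∸_; _≤_; _<_; z≤n; s≤s; s≤s⁻¹; _⊔_; _≤?_; _<?_; _≟_; _!)
open import Data.Nat.Properties hiding (_≟_; _≤?_; _<?_; ⊓-glb)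
open import Data.Nat.Divisibility using (_∣_; divides; ∣-trans; m∣m*n; ∣m+n∣m⇒∣n; ∣1⇒≡1; ∣⇒≤; ∣n⇒∣m*n; m≤n⇒m!∣n!)
open import Data.Nat.DivMod using (_/_; _%_; m≡m%n+[m/n]*n; m%n<n)
open import Data.Nat.Coprimality using (Coprime; coprime-divisor)
open import Data.Nat.Solver using (module +-*-Solver)
open import Data.Fin using (Fin; toℕ; fromℕ<; #_; _↑ˡ_; _↑ʳ_) renaming (zero to fzero; suc to fsuc)
open import Data.Fin.Properties using (toℕ<n; toℕ-fromℕ<; toℕ-injective; toℕ-↑ʳ)
open import Data.Bool using (Bool; true; false; not; _∧_; _∨_)
open import Data.Vec using (Vec; []; _∷_; lookup; tabulate; _++_)
open import Data.Vec.Properties using (tabulate-cong; tabulate∘lookup; lookup∘tabulate; lookup-++ˡ; lookup-++ʳ)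
open import Data.List using (List; []; _∷_; length; foldr; map) renaming (_++_ to _⧺_; lookup to llookup)
open import Data.List.Membership.Propositional using (_∈_)
open import Data.List.Membership.Propositional.Properties using (∈-++⁺ˡ; ∈-++⁺ʳ; ∈-++⁻)
open import Data.List.Membership.DecPropositional _≟_ using (_∈?_)
open import Data.List.Relation.Unary.Any using (here; there)
open import Data.List.Relation.Unary.All using (All; []; _∷_)
import Data.List.Relation.Unary.All as All
import Data.List.Relation.Unary.All.Properties as AllP
open import Data.Product using (Σ; _×_; _,_; proj₁; proj₂)
open import Data.Sum using (_⊎_; inj₁; inj₂)
open import Data.Empty using (⊥; ⊥-elim)
open import Data.Unit using (⊤; tt)
open import Relation.Nullary using (¬_; Dec; yes; no)
open import Relation.Nullary.Decidable using (¬?; _×-dec_; decidable-stable)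
open import Relation.Binary.PropositionalEquality using (_≡_; refl; sym; trans; cong; cong₂; subst; subst₂)
open import Relation.Binary.Definitions using (tri<; tri≈; tri>)

-- The quantifiers of the lattice language range over all c.e. ideals, and an arbitrary one may
-- contain some slots of a colour and omit others. Cohesion removes this freedom from some label on,
-- which is what makes the colours of an ideal well defined. The price is that the chosen slots form
-- only an arithmetical set and do not generate a c.e. ideal themselves; the iterated limits
-- compensate, with at least one level of nesting for each of the nested existential quantifiers of
-- the definition. Finiteness becomes expressible because finitely many slots, or labels, lie below
-- a complemented element of a parameter ideal. The decoded structure is required only to satisfy Q
-- and need not be standard: a theorem of Q holds in the standard structure, a sentence refuted by Q
-- holds in none, and this suffices for separation. No classical principle is assumed. A consistent
-- cell or a greedy truth value exists only under a double negation, so existence is expressed in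
-- the lattice by a negated universal quantifier.

-- Cantor pairing and Gödel numbers of formulas

module Pairing where

  tri-double : ∀ n → tri n + tri n ≡ n * suc n
  tri-double zero = refl
  tri-double (suc n) = trans (lem (tri n) n) (trans (cong (λ z → suc n + suc n + z) (tri-double n)) (lem' n))
    where
    open +-*-Solver
    lem : ∀ t n → (suc n + t) + (suc n + t) ≡ suc n + suc n + (t + t)
    lem = solve 2 (λ t n → (con 1 :+ n :+ t) :+ (con 1 :+ n :+ t) := con 1 :+ n :+ (con 1 :+ n) :+ (t :+ t)) refl
    lem' : ∀ n → suc n + suc n + n * suc n ≡ suc n * suc (suc n)
    lem' = solve 1 (λ n → con 1 :+ n :+ (con 1 :+ n) :+ n :* (con 1 :+ n) := (con 1 :+ n) :* (con 2 :+ n)) refl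

  -- Twice a triangular number is a polynomial, so the graph of pairing becomes a single equation
  -- between terms of arithmetic; this is the form used in `graph`.
  pair-double' : ∀ u v → ⟨ u , v ⟩ + ⟨ u , v ⟩ ≡ (u + v) * suc (u + v) + (v + v)
  pair-double' u v = trans (lem (tri (u + v)) v) (cong (_+ (v + v)) (tri-double (u + v)))
    where
    open +-*-Solver
    lem : ∀ t v → (t + v) + (t + v) ≡ (t + t) + (v + v)
    lem = solve 2 (λ t v → (t :+ v) :+ (t :+ v) := (t :+ t) :+ (v :+ v)) refl

  tri-mono : ∀ {a b} → a ≤ b → tri a ≤ tri b
  tri-mono z≤n = z≤n
  tri-mono (s≤s p) = +-mono-≤ (s≤s p) (tri-mono p)

  tri-gap : ∀ a b c d → a + b < c + d → ⟨ a , b ⟩ < ⟨ c , d ⟩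
  tri-gap a b c d p = begin-strict
    tri (a + b) + b <⟨ +-monoʳ-< (tri (a + b)) (s≤s (m≤n+m b a)) ⟩
    tri (a + b) + suc (a + b) ≡⟨ +-comm (tri (a + b)) _ ⟩
    tri (suc (a + b)) ≤⟨ tri-mono p ⟩
    tri (c + d) ≤⟨ m≤m+n _ d ⟩
    ⟨ c , d ⟩ ∎
    where open ≤-Reasoning

  pair-inj' : ∀ {a b c d} → ⟨ a , b ⟩ ≡ ⟨ c , d ⟩ → a ≡ c × b ≡ d
  pair-inj' {a} {b} {c} {d} e with <-cmp (a + b) (c + d)
  ... | tri< p _ _ = ⊥-elim (<⇒≢ (tri-gap a b c d p) e)
  ... | tri> _ _ p = ⊥-elim (<⇒≢ (tri-gap c d a b p) (sym e))
  ... | tri≈ _ s _ with +-cancelˡ-≡ (tri (a + b)) b d (trans e (cong (λ z → tri z + d) (sym s)))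
  ...   | refl = +-cancelʳ-≡ b a c s , refl

  pair≥₁' : ∀ a b → a ≤ ⟨ a , b ⟩
  pair≥₁' a b = ≤-trans (m≤m+n a b) (≤-trans (go (a + b)) (m≤m+n _ b))
    where
    go : ∀ n → n ≤ tri n
    go zero = z≤n
    go (suc n) = m≤m+n (suc n) (tri n)

  pair≥₂' : ∀ a b → b ≤ ⟨ a , b ⟩
  pair≥₂' a b = m≤n+m b _

  unpair' : ∀ x → Σ ℕ λ u → Σ ℕ λ v → x ≡ ⟨ u , v ⟩
  unpair' zero = 0 , 0 , refl
  unpair' (suc x) with unpair' x
  -- At the end of an antidiagonal the walk moves on to the start of the next one.
  ... | zero , v , e = suc v , 0 ,
    trans (cong suc e) (trans (cong suc (+-comm (tri v) v)) (sym (trans (+-identityʳ _) (cong tri (+-identityʳ (suc v))))))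
  ... | suc u , v , e = u , suc v ,
    trans (cong suc e) (trans (sym (+-suc (tri (suc u + v)) v)) (cong (λ z → tri z + suc v) (sym (+-suc u v))))

  -- Abstract, since the codes of concrete formulas are too large to be evaluated.
  abstract
    ⌊_,_⌋ : ℕ → ℕ → ℕ
    ⌊ a , b ⌋ = ⟨ a , b ⟩

    pair≡ : ∀ a b → ⌊ a , b ⌋ ≡ ⟨ a , b ⟩
    pair≡ a b = refl

    pair-double : ∀ u v → ⌊ u , v ⌋ + ⌊ u , v ⌋ ≡ (u + v) * suc (u + v) + (v + v)
    pair-double = pair-double'

    pair-inj : ∀ {a b c d} → ⌊ a , b ⌋ ≡ ⌊ c , d ⌋ → a ≡ c × b ≡ d
    pair-inj {a} {b} {c} {d} = pair-inj' {a} {b} {c} {d}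

    pair≥₁ : ∀ a b → a ≤ ⌊ a , b ⌋
    pair≥₁ = pair≥₁'

    pair≥₂ : ∀ a b → b ≤ ⌊ a , b ⌋
    pair≥₂ = pair≥₂'

    pair-mono : ∀ {a b c d} → a ≤ c → b ≤ d → ⌊ a , b ⌋ ≤ ⌊ c , d ⌋
    pair-mono p q = +-mono-≤ (tri-mono (+-mono-≤ p q)) q

    unpair : ∀ x → Σ ℕ λ u → Σ ℕ λ v → x ≡ ⌊ u , v ⌋
    unpair = unpair'

  cdT : ∀ {n} → Term n → ℕ
  cdT (var i)  = ⌊ 0 , toℕ i ⌋
  cdT `0       = ⌊ 1 , 0 ⌋
  cdT (`S t)   = ⌊ 2 , cdT t ⌋
  cdT (s `+ t) = ⌊ 3 , ⌊ cdT s , cdT t ⌋ ⌋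
  cdT (s `· t) = ⌊ 4 , ⌊ cdT s , cdT t ⌋ ⌋

  cdF : ∀ {n} → Formula n → ℕ
  cdF `⊥      = ⌊ 0 , 0 ⌋
  cdF (s ≐ t) = ⌊ 1 , ⌊ cdT s , cdT t ⌋ ⌋
  cdF (φ ⇒ ψ) = ⌊ 2 , ⌊ cdF φ , cdF ψ ⌋ ⌋
  cdF (∀' φ)  = ⌊ 3 , cdF φ ⌋

  pair-cong : ∀ a {x y} → x ≡ y → ⌊ a , x ⌋ ≡ ⟨ a , y ⟩
  pair-cong a refl = pair≡ a _

  pair-cong₂ : ∀ {x y x' y'} → x ≡ y → x' ≡ y' → ⌊ x , x' ⌋ ≡ ⟨ y , y' ⟩
  pair-cong₂ refl refl = pair≡ _ _

  cdT≡ : ∀ {n} (t : Term n) → cdT t ≡ codeT t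
  cdT≡ (var i)  = pair≡ 0 (toℕ i)
  cdT≡ `0       = pair≡ 1 0
  cdT≡ (`S t)   = pair-cong 2 (cdT≡ t)
  cdT≡ (s `+ t) = pair-cong 3 (pair-cong₂ (cdT≡ s) (cdT≡ t))
  cdT≡ (s `· t) = pair-cong 4 (pair-cong₂ (cdT≡ s) (cdT≡ t))

  cdF≡ : ∀ {n} (φ : Formula n) → cdF φ ≡ codeF φ
  cdF≡ `⊥      = pair≡ 0 0
  cdF≡ (s ≐ t) = pair-cong 1 (pair-cong₂ (cdT≡ s) (cdT≡ t))
  cdF≡ (φ ⇒ ψ) = pair-cong 2 (pair-cong₂ (cdF≡ φ) (cdF≡ ψ))
  cdF≡ (∀' φ)  = pair-cong 3 (cdF≡ φ)

open Pairing

-- Arithmetical and bounded formulas, and their evaluation by recursive codes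

module ArithmeticalFormulas where

  ev : ∀ {n} → Term n → Vec ℕ n → ℕ
  ev (var i)  xs = lookup xs i
  ev `0       xs = 0
  ev (`S t)   xs = suc (ev t xs)
  ev (s `+ t) xs = ev s xs + ev t xs
  ev (s `· t) xs = ev s xs * ev t xs

  evs : ∀ {n m} → (Fin n → Term m) → Vec ℕ m → Vec ℕ n
  evs σ xs = tabulate (λ i → ev (σ i) xs)

  ev-ren : ∀ {n m} (ρ : Fin n → Fin m) (t : Term n) (xs : Vec ℕ m) →
    ev (renT ρ t) xs ≡ ev t (tabulate (λ i → lookup xs (ρ i)))
  ev-ren ρ (var i)  xs = sym (lookup∘tabulate _ i)
  ev-ren ρ `0       xs = refl
  ev-ren ρ (`S t)   xs = cong suc (ev-ren ρ t xs)
  ev-ren ρ (s `+ t) xs = cong₂ _+_ (ev-ren ρ s xs) (ev-ren ρ t xs)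
  ev-ren ρ (s `· t) xs = cong₂ _*_ (ev-ren ρ s xs) (ev-ren ρ t xs)

  ev-wk : ∀ {n} (t : Term n) (x : ℕ) (xs : Vec ℕ n) → ev (renT fsuc t) (x ∷ xs) ≡ ev t xs
  ev-wk t x xs = trans (ev-ren fsuc t (x ∷ xs)) (cong (ev t) (tabulate∘lookup xs))

  ev-sub : ∀ {n m} (σ : Fin n → Term m) (t : Term n) (xs : Vec ℕ m) → ev (subT σ t) xs ≡ ev t (evs σ xs)
  ev-sub σ (var i)  xs = sym (lookup∘tabulate _ i)
  ev-sub σ `0       xs = refl
  ev-sub σ (`S t)   xs = cong suc (ev-sub σ t xs)
  ev-sub σ (s `+ t) xs = cong₂ _+_ (ev-sub σ s xs) (ev-sub σ t xs)
  ev-sub σ (s `· t) xs = cong₂ _*_ (ev-sub σ s xs) (ev-sub σ t xs)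

  evs-lift : ∀ {n m} (σ : Fin n → Term m) x (xs : Vec ℕ m) → evs (liftS σ) (x ∷ xs) ≡ x ∷ evs σ xs
  evs-lift σ x xs = cong (x ∷_) (tabulate-cong (λ i → ev-wk (σ i) x xs))

  -- Arithmetical formulas; those without negation (b = false) define the c.e. relations.
  data AF (b : Bool) : ℕ → Set where
    eq   : ∀ {n} → Term n → Term n → AF b n
    and  : ∀ {n} → AF b n → AF b n → AF b n
    or   : ∀ {n} → AF b n → AF b n → AF b n
    ex   : ∀ {n} → AF b (suc n) → AF b n
    all< : ∀ {n} → Term n → AF b (suc n) → AF b n
    neg  : ∀ {n} → b ≡ true → AF b n → AF b n

  ⟦_⟧ : ∀ {b n} → AF b n → Vec ℕ n → Set
  ⟦ eq s t ⟧   xs = ev s xs ≡ ev t xs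
  ⟦ and φ ψ ⟧  xs = ⟦ φ ⟧ xs × ⟦ ψ ⟧ xs
  ⟦ or φ ψ ⟧   xs = ⟦ φ ⟧ xs ⊎ ⟦ ψ ⟧ xs
  ⟦ ex φ ⟧     xs = Σ ℕ λ x → ⟦ φ ⟧ (x ∷ xs)
  ⟦ all< t φ ⟧ xs = ∀ k → k < ev t xs → ⟦ φ ⟧ (k ∷ xs)
  ⟦ neg _ φ ⟧  xs = ¬ ⟦ φ ⟧ xs

  _⇔_ : ∀ {a b} → Set a → Set b → Set _
  A ⇔ B = (A → B) × (B → A)

  subA : ∀ {b n m} → (Fin n → Term m) → AF b n → AF b m
  subA σ (eq s t)   = eq (subT σ s) (subT σ t)
  subA σ (and φ ψ)  = and (subA σ φ) (subA σ ψ)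
  subA σ (or φ ψ)   = or (subA σ φ) (subA σ ψ)
  subA σ (ex φ)     = ex (subA (liftS σ) φ)
  subA σ (all< t φ) = all< (subT σ t) (subA (liftS σ) φ)
  subA σ (neg p φ)  = neg p (subA σ φ)

  sub-sem : ∀ {b n m} (σ : Fin n → Term m) (φ : AF b n) xs → ⟦ subA σ φ ⟧ xs ⇔ ⟦ φ ⟧ (evs σ xs)
  sub-sem σ (eq s t) xs rewrite ev-sub σ s xs | ev-sub σ t xs = (λ z → z) , (λ z → z)
  sub-sem σ (and φ ψ) xs =
    (λ { (p , q) → proj₁ (sub-sem σ φ xs) p , proj₁ (sub-sem σ ψ xs) q }) ,
    (λ { (p , q) → proj₂ (sub-sem σ φ xs) p , proj₂ (sub-sem σ ψ xs) q })
  sub-sem σ (or φ ψ) xs =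
    (λ { (inj₁ p) → inj₁ (proj₁ (sub-sem σ φ xs) p) ; (inj₂ p) → inj₂ (proj₁ (sub-sem σ ψ xs) p) }) ,
    (λ { (inj₁ p) → inj₁ (proj₂ (sub-sem σ φ xs) p) ; (inj₂ p) → inj₂ (proj₂ (sub-sem σ ψ xs) p) })
  sub-sem σ (ex φ) xs =
    (λ { (x , p) → x , subst ⟦ φ ⟧ (evs-lift σ x xs) (proj₁ (sub-sem (liftS σ) φ (x ∷ xs)) p) }) ,
    (λ { (x , p) → x , proj₂ (sub-sem (liftS σ) φ (x ∷ xs)) (subst ⟦ φ ⟧ (sym (evs-lift σ x xs)) p) })
  sub-sem σ (all< t φ) xs =
    (λ f k k< → subst ⟦ φ ⟧ (evs-lift σ k xs)
       (proj₁ (sub-sem (liftS σ) φ (k ∷ xs)) (f k (subst (k <_) (sym (ev-sub σ t xs)) k<)))) ,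
    (λ f k k< → proj₂ (sub-sem (liftS σ) φ (k ∷ xs))
       (subst ⟦ φ ⟧ (sym (evs-lift σ k xs)) (f k (subst (k <_) (ev-sub σ t xs) k<))))
  sub-sem σ (neg p φ) xs = (λ f z → f (proj₂ (sub-sem σ φ xs) z)) , (λ f z → f (proj₁ (sub-sem σ φ xs) z))

  -- A minimal basis, since bounded formulas are later evaluated by codes, decided in Q and
  -- translated to positive formulas, each time by recursion. Their decidability makes the classical
  -- abbreviations `bor` and `ball<` harmless.
  data BF : ℕ → Set where
    beq  : ∀ {n} → Term n → Term n → BF n
    band : ∀ {n} → BF n → BF n → BF n
    bneg : ∀ {n} → BF n → BF n
    bex< : ∀ {n} → Term n → BF (suc n) → BF n

  B⟦_⟧ : ∀ {n} → BF n → Vec ℕ n → Set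
  B⟦ beq s t ⟧  xs = ev s xs ≡ ev t xs
  B⟦ band φ ψ ⟧ xs = B⟦ φ ⟧ xs × B⟦ ψ ⟧ xs
  B⟦ bneg φ ⟧   xs = ¬ B⟦ φ ⟧ xs
  B⟦ bex< t φ ⟧ xs = Σ ℕ λ k → k < ev t xs × B⟦ φ ⟧ (k ∷ xs)

  any<? : ∀ {ℓ} {P : ℕ → Set ℓ} → (∀ k → Dec (P k)) → ∀ n → Dec (Σ ℕ λ k → k < n × P k)
  any<? d zero = no λ { (_ , () , _) }
  any<? d (suc n) with any<? d n
  ... | yes (k , k< , p) = yes (k , m≤n⇒m≤1+n k< , p)
  ... | no ¬p with d n
  ...   | yes p = yes (n , ≤-refl , p)
  ...   | no ¬q = no λ { (k , s≤s k≤ , p) → case (m≤n⇒m<n∨m≡n k≤) k p }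
    where
    case : ∀ {k} → k < n ⊎ k ≡ n → ∀ k' → _ → ⊥
    case {k} (inj₁ k<) _ p = ¬p (k , k< , p)
    case (inj₂ refl) _ p = ¬q p

  bdec : ∀ {n} (φ : BF n) xs → Dec (B⟦ φ ⟧ xs)
  bdec (beq s t)  xs = ev s xs ≟ ev t xs
  bdec (band φ ψ) xs = bdec φ xs ×-dec bdec ψ xs
  bdec (bneg φ)   xs = ¬? (bdec φ xs)
  bdec (bex< t φ) xs = any<? (λ k → bdec φ (k ∷ xs)) (ev t xs)

  bor : ∀ {n} → BF n → BF n → BF n
  bor φ ψ = bneg (band (bneg φ) (bneg ψ))

  ball< : ∀ {n} → Term n → BF (suc n) → BF n
  ball< t φ = bneg (bex< t (bneg φ))

  bor-elim : ∀ {n} (φ ψ : BF n) xs → B⟦ bor φ ψ ⟧ xs → B⟦ φ ⟧ xs ⊎ B⟦ ψ ⟧ xs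
  bor-elim φ ψ xs h with bdec φ xs
  ... | yes p = inj₁ p
  ... | no ¬p = inj₂ (decidable-stable (bdec ψ xs) λ ¬q → h (¬p , ¬q))

  ball-elim : ∀ {n} (t : Term n) (φ : BF (suc n)) xs → B⟦ ball< t φ ⟧ xs → ∀ k → k < ev t xs → B⟦ φ ⟧ (k ∷ xs)
  ball-elim t φ xs h k k< = decidable-stable (bdec φ (k ∷ xs)) λ n → h (k , k< , n)

  wkβ : ∀ {n} → (ℕ → Term n) → ℕ → Term (suc n)
  wkβ β i = renT fsuc (β i)

  -- The quantifier at depth i is bounded by β i.
  bnd : ∀ {b n} → AF b n → (ℕ → Term n) → BF n
  bnd (eq s t)   β = beq s t
  bnd (and φ ψ)  β = band (bnd φ β) (bnd ψ β)
  bnd (or φ ψ)   β = bor (bnd φ β) (bnd ψ β)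
  bnd (ex φ)     β = bex< (β 0) (bnd φ (wkβ (λ i → β (suc i))))
  bnd (all< t φ) β = ball< t (bnd φ (wkβ β))
  bnd (neg _ φ)  β = bneg (bnd φ β)

  bnd-sound : ∀ {n} (φ : AF false n) β xs → B⟦ bnd φ β ⟧ xs → ⟦ φ ⟧ xs
  bnd-sound (eq s t)   β xs p = p
  bnd-sound (and φ ψ)  β xs (p , q) = bnd-sound φ β xs p , bnd-sound ψ β xs q
  bnd-sound (or φ ψ)   β xs p with bor-elim (bnd φ β) (bnd ψ β) xs p
  ... | inj₁ q = inj₁ (bnd-sound φ β xs q)
  ... | inj₂ q = inj₂ (bnd-sound ψ β xs q)
  bnd-sound (ex φ)     β xs (k , _ , p) = k , bnd-sound φ _ (k ∷ xs) p
  bnd-sound (all< t φ) β xs p k k< = bnd-sound φ _ (k ∷ xs) (ball-elim t (bnd φ (wkβ β)) xs p k k<)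

  sup< : {P : ℕ → ℕ → Set} (n : ℕ) → (∀ k → k < n → Σ ℕ λ w → ∀ v → w ≤ v → P k v) →
    Σ ℕ λ w → ∀ k → k < n → ∀ v → w ≤ v → P k v
  sup< zero f = 0 , λ _ ()
  sup< (suc n) f with sup< n (λ k k< → f k (m≤n⇒m≤1+n k<)) | f n ≤-refl
  ... | w , p | w' , p' = w ⊔ w' , λ { k (s≤s k≤) v le → go (m≤n⇒m<n∨m≡n k≤) v le }
    where
    go : ∀ {k} → k < n ⊎ k ≡ n → ∀ v → w ⊔ w' ≤ v → _
    go (inj₁ k<) v le = p _ k< v (m⊔n≤o⇒m≤o w w' le)
    go (inj₂ refl) v le = p' v (m⊔n≤o⇒n≤o w w' le)

  Above : ∀ {n} → ℕ → (ℕ → Term n) → Vec ℕ n → Set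
  Above w β xs = ∀ i → w ≤ ev (β i) xs

  -- The bound is asked to work for every larger v as well, so that the bounds of two subformulas,
  -- or of the finitely many instances of a bounded quantifier, can be merged by a maximum. The
  -- substitution is general because each binder lifts it.
  bnd-complete : ∀ {n} (φ : AF false n) xs → ⟦ φ ⟧ xs → Σ ℕ λ w → ∀ v → w ≤ v →
    ∀ {m} (σ : Fin n → Term m) ys → evs σ ys ≡ xs → ∀ β → Above v β ys → B⟦ bnd (subA σ φ) β ⟧ ys
  bnd-complete (eq s t)   xs p = 0 , λ { _ _ σ ys refl _ _ → trans (ev-sub σ s ys) (trans p (sym (ev-sub σ t ys))) }
  bnd-complete (and φ ψ)  xs (p , q) with bnd-complete φ xs p | bnd-complete ψ xs q
  ... | w , f | w' , g = w ⊔ w' , λ v le σ ys e β ab →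
      f v (m⊔n≤o⇒m≤o w w' le) σ ys e β ab , g v (m⊔n≤o⇒n≤o w w' le) σ ys e β ab
  bnd-complete (or φ ψ)   xs (inj₁ p) with bnd-complete φ xs p
  ... | w , f = w , λ v le σ ys e β ab → λ { (a , _) → a (f v le σ ys e β ab) }
  bnd-complete (or φ ψ)   xs (inj₂ p) with bnd-complete ψ xs p
  ... | w , f = w , λ v le σ ys e β ab → λ { (_ , a) → a (f v le σ ys e β ab) }
  bnd-complete (ex φ)     xs (x , p) with bnd-complete φ (x ∷ xs) p
  ... | w , f = suc x ⊔ w , λ v le σ ys e β ab → x , ≤-trans (m⊔n≤o⇒m≤o (suc x) w le) (ab 0) ,
      f v (m⊔n≤o⇒n≤o (suc x) w le) (liftS σ) (x ∷ ys) (trans (evs-lift σ x ys) (cong (x ∷_) e)) _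
        (λ i → subst (v ≤_) (sym (ev-wk (β (suc i)) x ys)) (ab (suc i)))
  bnd-complete (all< t φ) xs p with sup< (ev t xs) (λ k k< → bnd-complete φ (k ∷ xs) (p k k<))
  ... | w , f = w , λ { v le σ ys refl β ab (k , k< , n) →
      n (f k (subst (k <_) (ev-sub σ t ys) k<) v le (liftS σ) (k ∷ ys) (evs-lift σ k ys) _
           (λ i → subst (v ≤_) (sym (ev-wk (β i) k ys)) (ab i))) }

  Realizes : ∀ {n} → Code n → (Vec ℕ n → ℕ) → Set
  Realizes c f = ∀ xs → Eval c xs (f xs)

  vec2 : ∀ {A : Set} → A → A → Fin 2 → A
  vec2 a b fzero = a
  vec2 a b (fsuc fzero) = b

  comp1 : ∀ {n} → Code 1 → Code n → Code n
  comp1 c d = comp c (λ _ → d)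

  comp2 : ∀ {n} → Code 2 → Code n → Code n → Code n
  comp2 c d e = comp c (vec2 d e)

  run1 : ∀ {n} {c : Code 1} {d : Code n} {xs y z} → Eval d xs y → Eval c (y ∷ []) z → Eval (comp1 c d) xs z
  run1 p q = ev-comp (_ ∷ []) (λ { fzero → p }) q

  run2 : ∀ {n} {c : Code 2} {d e : Code n} {xs y y' z} → Eval d xs y → Eval e xs y' → Eval c (y ∷ y' ∷ []) z →
    Eval (comp2 c d e) xs z
  run2 p p' q = ev-comp (_ ∷ _ ∷ []) (λ { fzero → p ; (fsuc fzero) → p' }) q

  addC : Code 2
  addC = prec (proj fzero) (comp1 succ (proj (fsuc fzero)))

  addR : ∀ x y → Eval addC (x ∷ y ∷ []) (x + y)
  addR zero y = ev-prec0 (ev-proj fzero)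
  addR (suc x) y = ev-precS (addR x y) (run1 (ev-proj (fsuc fzero)) ev-succ)

  mulC : Code 2
  mulC = prec zer (comp2 addC (proj (fsuc (fsuc fzero))) (proj (fsuc fzero)))

  mulR : ∀ x y → Eval mulC (x ∷ y ∷ []) (x * y)
  mulR zero y = ev-prec0 ev-zer
  mulR (suc x) y = ev-precS (mulR x y) (run2 (ev-proj (fsuc (fsuc fzero))) (ev-proj (fsuc fzero)) (addR y (x * y)))

  predC : Code 1
  predC = prec zer (proj fzero)

  predR : ∀ x → Eval predC (x ∷ []) (pred x)
  predR zero = ev-prec0 ev-zer
  predR (suc x) = ev-precS (predR x) (ev-proj fzero)

  subC : Code 2
  subC = prec (proj fzero) (comp1 predC (proj (fsuc fzero)))

  subR : ∀ k y → Eval subC (k ∷ y ∷ []) (y ∸ k)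
  subR zero y = ev-prec0 (ev-proj fzero)
  subR (suc k) y = subst (Eval subC (suc k ∷ y ∷ [])) (pred[m∸n]≡m∸[1+n] y k)
    (ev-precS (subR k y) (run1 (ev-proj (fsuc fzero)) (predR (y ∸ k))))

  one : ∀ {n} → Code n
  one = comp1 succ zer

  oneR : ∀ {n} {xs : Vec ℕ n} → Eval one xs 1
  oneR = run1 ev-zer ev-succ

  termC : ∀ {n} → Term n → Code n
  termC (var i)  = proj i
  termC `0       = zer
  termC (`S t)   = comp1 succ (termC t)
  termC (s `+ t) = comp2 addC (termC s) (termC t)
  termC (s `· t) = comp2 mulC (termC s) (termC t)

  termR : ∀ {n} (t : Term n) → Realizes (termC t) (ev t)
  termR (var i)  xs = ev-proj i
  termR `0       xs = ev-zer
  termR (`S t)   xs = run1 (termR t xs) ev-succ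
  termR (s `+ t) xs = run2 (termR s xs) (termR t xs) (addR _ _)
  termR (s `· t) xs = run2 (termR s xs) (termR t xs) (mulR _ _)

  prod< : (ℕ → ℕ) → ℕ → ℕ
  prod< f zero = 1
  prod< f (suc k) = f k * prod< f k

  prodC : ∀ {n} → Code (suc n) → Code (suc n)
  prodC c = prec one (comp2 mulC (comp c λ { fzero → proj fzero ; (fsuc i) → proj (fsuc (fsuc i)) }) (proj (fsuc fzero)))

  prodR : ∀ {n} {c : Code (suc n)} {f} → Realizes c f → ∀ k xs →
    Eval (prodC c) (k ∷ xs) (prod< (λ j → f (j ∷ xs)) k)
  prodR r zero xs = ev-prec0 oneR
  prodR {f = f} r (suc k) xs = ev-precS (prodR r k xs)
    (run2 (ev-comp (k ∷ xs) (λ { fzero → ev-proj fzero ; (fsuc i) → ev-proj (fsuc (fsuc i)) }) (r (k ∷ xs)))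
          (ev-proj (fsuc fzero)) (mulR _ _))

  prod-zero : ∀ f n → prod< f n ≡ 0 → Σ ℕ λ k → k < n × f k ≡ 0
  prod-zero f (suc n) p with m*n≡0⇒m≡0∨n≡0 (f n) p
  ... | inj₁ q = n , ≤-refl , q
  ... | inj₂ q with prod-zero f n q
  ...   | k , k< , r = k , m≤n⇒m≤1+n k< , r

  zero-prod : ∀ f n k → k < n → f k ≡ 0 → prod< f n ≡ 0
  zero-prod f (suc n) k (s≤s k≤) e with m≤n⇒m<n∨m≡n k≤
  ... | inj₁ k< = trans (cong (f n *_) (zero-prod f n k k< e)) (*-zeroʳ (f n))
  ... | inj₂ refl = cong (_* prod< f n) e

  -- Zero stands for truth, in agreement with `mu`, which searches for a zero. Hence conjunction
  -- becomes a sum and bounded existence a product.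
  char : ∀ {n} → BF n → Vec ℕ n → ℕ
  char (beq s t)  xs = (ev s xs ∸ ev t xs) + (ev t xs ∸ ev s xs)
  char (band φ ψ) xs = char φ xs + char ψ xs
  char (bneg φ)   xs = 1 ∸ char φ xs
  char (bex< t φ) xs = prod< (λ k → char φ (k ∷ xs)) (ev t xs)

  charC : ∀ {n} → BF n → Code n
  charC (beq s t)  = comp2 addC (comp2 subC (termC t) (termC s)) (comp2 subC (termC s) (termC t))
  charC (band φ ψ) = comp2 addC (charC φ) (charC ψ)
  charC (bneg φ)   = comp2 subC (charC φ) one
  charC (bex< t φ) = comp (prodC (charC φ)) λ { fzero → termC t ; (fsuc i) → proj i }

  charR : ∀ {n} (φ : BF n) → Realizes (charC φ) (char φ)
  charR (beq s t)  xs = run2 (run2 (termR t xs) (termR s xs) (subR _ _)) (run2 (termR s xs) (termR t xs) (subR _ _)) (addR _ _)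
  charR (band φ ψ) xs = run2 (charR φ xs) (charR ψ xs) (addR _ _)
  charR (bneg φ)   xs = run2 (charR φ xs) oneR (subR _ _)
  charR (bex< t φ) xs = ev-comp (ev t xs ∷ xs) (λ { fzero → termR t xs ; (fsuc i) → ev-proj i }) (prodR (charR φ) _ xs)

  char-correct : ∀ {n} (φ : BF n) xs → B⟦ φ ⟧ xs ⇔ (char φ xs ≡ 0)
  char-correct (beq s t) xs =
    (λ e → cong₂ _+_ (m≤n⇒m∸n≡0 (≤-reflexive e)) (m≤n⇒m∸n≡0 (≤-reflexive (sym e)))) ,
    (λ e → ≤-antisym (m∸n≡0⇒m≤n (m+n≡0⇒m≡0 _ e)) (m∸n≡0⇒m≤n (m+n≡0⇒n≡0 (ev s xs ∸ ev t xs) e)))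
  char-correct (band φ ψ) xs =
    (λ { (p , q) → cong₂ _+_ (proj₁ (char-correct φ xs) p) (proj₁ (char-correct ψ xs) q) }) ,
    (λ e → proj₂ (char-correct φ xs) (m+n≡0⇒m≡0 _ e) , proj₂ (char-correct ψ xs) (m+n≡0⇒n≡0 (char φ xs) e))
  char-correct (bneg φ) xs with char φ xs | char-correct φ xs
  ... | zero  | f , g = (λ n → ⊥-elim (n (g refl))) , (λ ())
  ... | suc c | f , g = (λ _ → m≤n⇒m∸n≡0 {1} {suc c} (s≤s z≤n)) , (λ _ p → case (f p))
    where
    case : suc c ≡ 0 → ⊥
    case ()
  char-correct (bex< t φ) xs =
    (λ { (k , k< , p) → zero-prod _ (ev t xs) k k< (proj₁ (char-correct φ (k ∷ xs)) p) }) ,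
    (λ e → let (k , k< , z) = prod-zero _ (ev t xs) e in k , k< , proj₂ (char-correct φ (k ∷ xs)) z)

  lookup-ext : ∀ {n} (xs ys : Vec ℕ n) → (∀ i → lookup xs i ≡ lookup ys i) → xs ≡ ys
  lookup-ext [] [] h = refl
  lookup-ext (x ∷ xs) (y ∷ ys) h = cong₂ _∷_ (h fzero) (lookup-ext xs ys (λ i → h (fsuc i)))

  -- For `mu`, the smaller of two results would be a zero at a place where the other run demands a
  -- positive value.
  eval-det : ∀ {n} {c : Code n} {xs a b} → Eval c xs a → Eval c xs b → a ≡ b
  eval-det ev-zer ev-zer = refl
  eval-det ev-succ ev-succ = refl
  eval-det (ev-proj i) (ev-proj .i) = refl
  eval-det (ev-comp ys gs f) (ev-comp ys' gs' f') with lookup-ext ys ys' (λ i → eval-det (gs i) (gs' i))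
  ... | refl = eval-det f f'
  eval-det (ev-prec0 p) (ev-prec0 q) = eval-det p q
  eval-det (ev-precS p q) (ev-precS p' q') with eval-det p p'
  ... | refl = eval-det q q'
  eval-det {a = a} {b} (ev-mu p l) (ev-mu q m) with <-cmp a b
  ... | tri≈ _ e _ = e
  ... | tri< a<b _ _ with eval-det p (proj₂ (m a a<b))
  ...   | ()
  eval-det {a = a} {b} (ev-mu p l) (ev-mu q m) | tri> _ _ b<a with eval-det q (proj₂ (l b b<a))
  ...   | ()

  searchC : ∀ {n} → BF (suc n) → Code n
  searchC φ = mu (charC φ)

  search-least : ∀ {n} (φ : BF (suc n)) xs w → B⟦ φ ⟧ (w ∷ xs) →
    Σ ℕ λ y → B⟦ φ ⟧ (y ∷ xs) × (∀ k → k < y → ¬ B⟦ φ ⟧ (k ∷ xs))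
  search-least φ xs zero p = 0 , p , λ _ ()
  search-least φ xs (suc w) p with any<? (λ k → bdec φ (k ∷ xs)) (suc w)
  ... | no n = suc w , p , λ k k< q → n (k , k< , q)
  ... | yes (k , k< , q) = go (suc w) k k< q
    where
    go : ∀ m k → k < m → B⟦ φ ⟧ (k ∷ xs) → Σ ℕ λ y → B⟦ φ ⟧ (y ∷ xs) × (∀ k → k < y → ¬ B⟦ φ ⟧ (k ∷ xs))
    go (suc m) k k< q with any<? (λ j → bdec φ (j ∷ xs)) k
    ... | no n = k , q , λ j j< r → n (j , j< , r)
    ... | yes (j , j< , r) = go m j (≤-trans j< (s≤s⁻¹ k<)) r

  searchR : ∀ {n} (φ : BF (suc n)) xs → (Σ ℕ λ w → B⟦ φ ⟧ (w ∷ xs)) ⇔ Σ ℕ (Eval (searchC φ) xs)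
  searchR {n} φ xs = to , from
    where
    nz : ∀ k → ¬ B⟦ φ ⟧ (k ∷ xs) → Σ ℕ λ v → char φ (k ∷ xs) ≡ suc v
    nz k np with char φ (k ∷ xs) | proj₂ (char-correct φ (k ∷ xs))
    ... | zero  | g = ⊥-elim (np (g refl))
    ... | suc v | g = v , refl
    to : (Σ ℕ λ w → B⟦ φ ⟧ (w ∷ xs)) → Σ ℕ (Eval (searchC φ) xs)
    to (w , p) with search-least φ xs w p
    ... | y , q , m = y , ev-mu (subst (Eval (charC φ) (y ∷ xs)) (proj₁ (char-correct φ _) q) (charR φ _))
                         (λ k k< → proj₁ (nz k (m k k<)) , subst (Eval (charC φ) (k ∷ xs)) (proj₂ (nz k (m k k<))) (charR φ _))
    from : Σ ℕ (Eval (searchC φ) xs) → Σ ℕ λ w → B⟦ φ ⟧ (w ∷ xs)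
    from (y , ev-mu p _) = y , proj₂ (char-correct φ _) (eval-det (charR φ _) p)

  wkA : ∀ {b n} → AF b n → AF b (suc n)
  wkA = subA (λ i → var (fsuc i))

  wkA-sem : ∀ {b n} (φ : AF b n) x xs → ⟦ wkA φ ⟧ (x ∷ xs) ⇔ ⟦ φ ⟧ xs
  wkA-sem φ x xs = subst (λ v → ⟦ wkA φ ⟧ (x ∷ xs) ⇔ ⟦ φ ⟧ v) (tabulate∘lookup xs) (sub-sem (λ i → var (fsuc i)) φ (x ∷ xs))

  -- Normal form: the extra variable 0 bounds all existential witnesses.
  nf : ∀ {n} → AF false n → BF (suc n)
  nf φ = bnd (wkA φ) (λ _ → var fzero)

  nf-sem : ∀ {n} (φ : AF false n) xs → ⟦ φ ⟧ xs ⇔ (Σ ℕ λ w → B⟦ nf φ ⟧ (w ∷ xs))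
  nf-sem φ xs =
    (λ p → let w , f = bnd-complete φ xs p in
           w , f w ≤-refl (λ i → var (fsuc i)) (w ∷ xs) (tabulate∘lookup xs) _ (λ _ → ≤-refl)) ,
    (λ { (w , p) → proj₁ (wkA-sem φ w xs) (bnd-sound (wkA φ) _ (w ∷ xs) p) })

  -- One unbounded search, for a common bound on all the witnesses, semidecides a positive formula.
  ce-AF : ∀ {P : ℕ → Set} (φ : AF false 1) → (∀ x → P x ⇔ ⟦ φ ⟧ (x ∷ [])) → IsCE P
  ce-AF φ h = searchC (nf φ) , λ x →
    (λ p → proj₁ (searchR (nf φ) (x ∷ [])) (proj₁ (nf-sem φ _) (proj₁ (h x) p))) ,
    (λ p → proj₂ (h x) (proj₂ (nf-sem φ _) (proj₂ (searchR (nf φ) (x ∷ [])) p)))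

open ArithmeticalFormulas

-- A definability calculus with pairing terms and semantic atoms

module Definability where

  num : ∀ {n} → ℕ → Term n
  num zero    = `0
  num (suc k) = `S (num k)

  ev-num : ∀ {n} k (xs : Vec ℕ n) → ev (num k) xs ≡ k
  ev-num zero xs = refl
  ev-num (suc k) xs = cong suc (ev-num k xs)

  double-inj : ∀ a b → a + a ≡ b + b → a ≡ b
  double-inj a b e with <-cmp a b
  ... | tri≈ _ p _ = p
  ... | tri< p _ _ = ⊥-elim (<⇒≢ (+-mono-< p p) e)
  ... | tri> _ _ p = ⊥-elim (<⇒≢ (+-mono-< p p) (sym e))

  data XT (n : ℕ) : Set where
    xv : Fin n → XT n
    xn : ℕ → XT n
    xsu : XT n → XT n
    xp xadd xmul : XT n → XT n → XT n

  xev : ∀ {n} → XT n → Vec ℕ n → ℕ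
  xev (xv i) e = lookup e i
  xev (xn k) e = k
  xev (xsu t) e = suc (xev t e)
  xev (xp s t) e = ⌊ xev s e , xev t e ⌋
  xev (xadd s t) e = xev s e + xev t e
  xev (xmul s t) e = xev s e * xev t e

  xevs : ∀ {n m} → Vec (XT n) m → Vec ℕ n → Vec ℕ m
  xevs [] e = []
  xevs (t ∷ ts) e = xev t e ∷ xevs ts e

  _⇔∘_ : {A B C : Set} → A ⇔ B → B ⇔ C → A ⇔ C
  (f , g) ⇔∘ (h , k) = (λ a → h (f a)) , (λ c → g (k c))

  ⇔sym : {A B : Set} → A ⇔ B → B ⇔ A
  ⇔sym (f , g) = g , f

  Def : Bool → ∀ {n} → (Vec ℕ n → Set) → Set
  Def b {n} P = Σ (AF b n) λ φ → ∀ e → P e ⇔ ⟦ φ ⟧ e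

  liftA : ∀ {b n} → AF false n → AF b n
  liftA (eq s t) = eq s t
  liftA (and φ ψ) = and (liftA φ) (liftA ψ)
  liftA (or φ ψ) = or (liftA φ) (liftA ψ)
  liftA (ex φ) = ex (liftA φ)
  liftA (all< t φ) = all< t (liftA φ)

  liftA-sem : ∀ {b n} (φ : AF false n) e → ⟦ φ ⟧ e ⇔ ⟦ liftA {b} φ ⟧ e
  liftA-sem (eq s t) e = (λ z → z) , (λ z → z)
  liftA-sem (and φ ψ) e = (λ { (p , q) → proj₁ (liftA-sem φ e) p , proj₁ (liftA-sem ψ e) q }) ,
    (λ { (p , q) → proj₂ (liftA-sem φ e) p , proj₂ (liftA-sem ψ e) q })
  liftA-sem (or φ ψ) e =
    (λ { (inj₁ p) → inj₁ (proj₁ (liftA-sem φ e) p) ; (inj₂ p) → inj₂ (proj₁ (liftA-sem ψ e) p) }) ,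
    (λ { (inj₁ p) → inj₁ (proj₂ (liftA-sem φ e) p) ; (inj₂ p) → inj₂ (proj₂ (liftA-sem ψ e) p) })
  liftA-sem (ex φ) e = (λ { (x , p) → x , proj₁ (liftA-sem φ _) p }) , (λ { (x , p) → x , proj₂ (liftA-sem φ _) p })
  liftA-sem (all< t φ) e = (λ f k l → proj₁ (liftA-sem φ _) (f k l)) , (λ f k l → proj₂ (liftA-sem φ _) (f k l))

  liftD : ∀ {b n} {P : Vec ℕ n → Set} → Def false P → Def b P
  liftD (φ , h) = liftA φ , λ e → h e ⇔∘ liftA-sem φ e

  -- Atoms are arbitrary predicates that come with a definition. Thus `X⟦_⟧` unfolds to the intended
  -- proposition, and many definability proofs are the identity.
  data XF (b : Bool) : ℕ → Set₁ where
    at    : ∀ {n m} {P : Vec ℕ m → Set} → Def b P → Vec (XT n) m → XF b n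
    xeq   : ∀ {n} → XT n → XT n → XF b n
    xlt   : ∀ {n} → XT n → XT n → XF b n
    xand  : ∀ {n} → XF b n → XF b n → XF b n
    xor   : ∀ {n} → XF b n → XF b n → XF b n
    xex   : ∀ {n} → XF b (suc n) → XF b n
    xall< : ∀ {n} → XT n → XF b (suc n) → XF b n
    xneg  : ∀ {n} → b ≡ true → XF b n → XF b n

  X⟦_⟧ : ∀ {b n} → XF b n → Vec ℕ n → Set
  X⟦ at {P = P} _ ts ⟧ e = P (xevs ts e)
  X⟦ xeq s t ⟧   e = xev s e ≡ xev t e
  X⟦ xlt s t ⟧   e = xev s e < xev t e
  X⟦ xand φ ψ ⟧  e = X⟦ φ ⟧ e × X⟦ ψ ⟧ e
  X⟦ xor φ ψ ⟧   e = X⟦ φ ⟧ e ⊎ X⟦ ψ ⟧ e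
  X⟦ xex φ ⟧     e = Σ ℕ λ x → X⟦ φ ⟧ (x ∷ e)
  X⟦ xall< t φ ⟧ e = ∀ k → k < xev t e → X⟦ φ ⟧ (k ∷ e)
  X⟦ xneg _ φ ⟧  e = ¬ X⟦ φ ⟧ e

  0F : ∀ {n} → Fin (suc n)
  0F = fzero
  1F : ∀ {n} → Fin (suc (suc n))
  1F = fsuc 0F
  2F : ∀ {n} → Fin (suc (suc (suc n)))
  2F = fsuc 1F
  3F : ∀ {n} → Fin (suc (suc (suc (suc n))))
  3F = fsuc 2F

  out : ∀ {n m} → Fin m → (Fin n → Fin m) → Fin (suc n) → Term m
  out z ρ fzero = var z
  out z ρ (fsuc i) = var (ρ i)

  -- Pairing is not a term of arithmetic, so an extended term can enter a formula only through the
  -- relation between its value, in variable 0, and its variables.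
  graph : ∀ {b n} → XT n → AF b (suc n)
  graph (xv i) = eq (var 0F) (var (fsuc i))
  graph (xn k) = eq (var 0F) (num k)
  graph (xsu t) = ex (and (subA (out 0F (λ i → fsuc (fsuc i))) (graph t)) (eq (var 1F) (`S (var 0F))))
  graph (xp s t) = ex (ex (and (and (subA (out 1F (λ i → fsuc (fsuc (fsuc i)))) (graph s)) (subA (out 0F (λ i → fsuc (fsuc (fsuc i)))) (graph t)))
    (eq (var 2F `+ var 2F) (((var 1F `+ var 0F) `· `S (var 1F `+ var 0F)) `+ (var 0F `+ var 0F)))))
  graph (xadd s t) = ex (ex (and (and (subA (out 1F (λ i → fsuc (fsuc (fsuc i)))) (graph s)) (subA (out 0F (λ i → fsuc (fsuc (fsuc i)))) (graph t)))
    (eq (var 2F) (var 1F `+ var 0F))))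
  graph (xmul s t) = ex (ex (and (and (subA (out 1F (λ i → fsuc (fsuc (fsuc i)))) (graph s)) (subA (out 0F (λ i → fsuc (fsuc (fsuc i)))) (graph t)))
    (eq (var 2F) (var 1F `· var 0F))))

  out-sem : ∀ {b n m} (φ : AF b (suc n)) z (ρ : Fin n → Fin m) e e' →
    (∀ i → lookup e (ρ i) ≡ lookup e' i) → ⟦ subA (out z ρ) φ ⟧ e ⇔ ⟦ φ ⟧ (lookup e z ∷ e')
  out-sem φ z ρ e e' h = subst (λ v → ⟦ subA (out z ρ) φ ⟧ e ⇔ ⟦ φ ⟧ (lookup e z ∷ v))
    (trans (tabulate-cong h) (tabulate∘lookup e')) (sub-sem (out z ρ) φ e)

  graph-sem : ∀ {b n} (t : XT n) z e → ⟦ graph {b} t ⟧ (z ∷ e) ⇔ (z ≡ xev t e)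
  graph-sem (xv i) z e = (λ p → p) , (λ p → p)
  graph-sem {b} (xn k) z e rewrite ev-num k (z ∷ e) = (λ p → p) , (λ p → p)
  graph-sem {b} (xsu t) z e =
    (λ { (u , p , q) → trans q (cong suc (proj₁ (h u ⇔∘ graph-sem t u e) p)) }) ,
    (λ q → xev t e , proj₂ (h (xev t e) ⇔∘ graph-sem t _ e) refl , q)
    where h = λ u → out-sem (graph {b} t) 0F (λ i → fsuc (fsuc i)) (u ∷ z ∷ e) e (λ _ → refl)
  graph-sem {b} (xp s t) z e =
    (λ { (u , v , (p , p') , q) → double-inj _ _ (trans q (trans (sym (pair-double u v))
       (cong₂ (λ a b → ⌊ a , b ⌋ + ⌊ a , b ⌋) (proj₁ (h u v ⇔∘ graph-sem s u e) p) (proj₁ (k u v ⇔∘ graph-sem t v e) p')))) }) ,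
    (λ { refl → xev s e , xev t e , (proj₂ (h _ _ ⇔∘ graph-sem s _ e) refl , proj₂ (k _ _ ⇔∘ graph-sem t _ e) refl) , pair-double (xev s e) (xev t e) })
    where
    h = λ u v → out-sem (graph {b} s) 1F (λ i → fsuc (fsuc (fsuc i))) (v ∷ u ∷ z ∷ e) e (λ _ → refl)
    k = λ u v → out-sem (graph {b} t) 0F (λ i → fsuc (fsuc (fsuc i))) (v ∷ u ∷ z ∷ e) e (λ _ → refl)
  graph-sem {b} (xadd s t) z e =
    (λ { (u , v , (p , p') , q) → trans q (cong₂ _+_ (proj₁ (h u v ⇔∘ graph-sem s u e) p) (proj₁ (k u v ⇔∘ graph-sem t v e) p')) }) ,
    (λ { refl → xev s e , xev t e , (proj₂ (h _ _ ⇔∘ graph-sem s _ e) refl , proj₂ (k _ _ ⇔∘ graph-sem t _ e) refl) , refl })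
    where
    h = λ u v → out-sem (graph {b} s) 1F (λ i → fsuc (fsuc (fsuc i))) (v ∷ u ∷ z ∷ e) e (λ _ → refl)
    k = λ u v → out-sem (graph {b} t) 0F (λ i → fsuc (fsuc (fsuc i))) (v ∷ u ∷ z ∷ e) e (λ _ → refl)
  graph-sem {b} (xmul s t) z e =
    (λ { (u , v , (p , p') , q) → trans q (cong₂ _*_ (proj₁ (h u v ⇔∘ graph-sem s u e) p) (proj₁ (k u v ⇔∘ graph-sem t v e) p')) }) ,
    (λ { refl → xev s e , xev t e , (proj₂ (h _ _ ⇔∘ graph-sem s _ e) refl , proj₂ (k _ _ ⇔∘ graph-sem t _ e) refl) , refl })
    where
    h = λ u v → out-sem (graph {b} s) 1F (λ i → fsuc (fsuc (fsuc i))) (v ∷ u ∷ z ∷ e) e (λ _ → refl)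
    k = λ u v → out-sem (graph {b} t) 0F (λ i → fsuc (fsuc (fsuc i))) (v ∷ u ∷ z ∷ e) e (λ _ → refl)

  exN : ∀ {b n} m → AF b (m + n) → AF b n
  exN zero φ = φ
  exN (suc m) φ = exN m (ex φ)

  exN-sem : ∀ {b n} m (φ : AF b (m + n)) e → ⟦ exN m φ ⟧ e ⇔ (Σ (Vec ℕ m) λ ys → ⟦ φ ⟧ (ys ++ e))
  exN-sem zero φ e = (λ p → [] , p) , (λ { ([] , p) → p })
  exN-sem (suc m) φ e = exN-sem m (ex φ) e ⇔∘ ((λ { (ys , y , p) → (y ∷ ys) , p }) , (λ { ((y ∷ ys) , p) → ys , y , p }))

  bigAnd : ∀ {b n} m → (Fin m → AF b n) → AF b n
  bigAnd zero f = eq `0 `0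
  bigAnd (suc m) f = and (f fzero) (bigAnd m (λ i → f (fsuc i)))

  bigAnd-sem : ∀ {b n} m (f : Fin m → AF b n) e → ⟦ bigAnd m f ⟧ e ⇔ (∀ i → ⟦ f i ⟧ e)
  bigAnd-sem zero f e = (λ _ ()) , (λ _ → refl)
  bigAnd-sem (suc m) f e =
    (λ { (p , q) fzero → p ; (p , q) (fsuc i) → proj₁ (bigAnd-sem m _ e) q i }) ,
    (λ g → g fzero , proj₂ (bigAnd-sem m _ e) (λ i → g (fsuc i)))

  lookup-xevs : ∀ {n m} (ts : Vec (XT n) m) e i → lookup (xevs ts e) i ≡ xev (lookup ts i) e
  lookup-xevs (t ∷ ts) e fzero = refl
  lookup-xevs (t ∷ ts) e (fsuc i) = lookup-xevs ts e i

  -- Relational composition φ ∘ gs, where gs i is the graph of the i-th argument (output in variable 0).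
  compA : ∀ {b n} m → AF b m → (Fin m → AF b (suc n)) → AF b n
  compA {n = n} m φ gs = exN m (and (bigAnd m (λ i → subA (out (i ↑ˡ n) (m ↑ʳ_)) (gs i))) (subA (λ i → var (i ↑ˡ n)) φ))

  compA-sem : ∀ {b n} m (φ : AF b m) (gs : Fin m → AF b (suc n)) e →
    ⟦ compA m φ gs ⟧ e ⇔ (Σ (Vec ℕ m) λ ys → (∀ i → ⟦ gs i ⟧ (lookup ys i ∷ e)) × ⟦ φ ⟧ ys)
  compA-sem {n = n} m φ gs e = exN-sem m _ e ⇔∘
    ((λ { (ys , p , q) → ys , (λ i → proj₁ (g ys i) (proj₁ (bigAnd-sem m _ (ys ++ e)) p i)) , proj₁ (f ys) q }) ,
     (λ { (ys , p , q) → ys , proj₂ (bigAnd-sem m _ (ys ++ e)) (λ i → proj₂ (g ys i) (p i)) , proj₂ (f ys) q }))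
    where
    g : ∀ (ys : Vec ℕ m) i → ⟦ subA (out (i ↑ˡ n) (m ↑ʳ_)) (gs i) ⟧ (ys ++ e) ⇔ ⟦ gs i ⟧ (lookup ys i ∷ e)
    g ys i = subst (λ z → ⟦ subA (out (i ↑ˡ n) (m ↑ʳ_)) (gs i) ⟧ (ys ++ e) ⇔ ⟦ gs i ⟧ (z ∷ e)) (lookup-++ˡ ys e i)
               (out-sem (gs i) (i ↑ˡ n) (m ↑ʳ_) (ys ++ e) e (lookup-++ʳ ys e))
    f : ∀ (ys : Vec ℕ m) → ⟦ subA (λ i → var (i ↑ˡ n)) φ ⟧ (ys ++ e) ⇔ ⟦ φ ⟧ ys
    f ys = subst (λ v → ⟦ subA (λ i → var (i ↑ˡ n)) φ ⟧ (ys ++ e) ⇔ ⟦ φ ⟧ v)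
             (trans (tabulate-cong (lookup-++ˡ ys e)) (tabulate∘lookup ys)) (sub-sem (λ i → var (i ↑ˡ n)) φ (ys ++ e))

  ltA : ∀ {b} → AF b 2
  ltA = ex (eq (`S (var 0F `+ var 1F)) (var 2F))

  ltA-sem : ∀ {b} x y → ⟦ ltA {b} ⟧ (x ∷ y ∷ []) ⇔ (x < y)
  ltA-sem x y = (λ { (d , refl) → s≤s (m≤n+m x d) }) , (λ p → y ∸ suc x , trans (sym (+-suc (y ∸ suc x) x)) (m∸n+n≡m p))

  skip : ∀ {n} → Fin (suc n) → Term (suc (suc n))
  skip fzero = var 0F
  skip (fsuc i) = var (fsuc (fsuc i))

  xA : ∀ {b n} → XF b n → AF b n
  xA (at {m = m} (φ , _) ts) = compA m φ (λ i → graph (lookup ts i))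
  xA (xeq s t) = compA 2 (eq (var 0F) (var 1F)) (λ i → graph (lookup (s ∷ t ∷ []) i))
  xA (xlt s t) = compA 2 ltA (λ i → graph (lookup (s ∷ t ∷ []) i))
  xA (xand φ ψ) = and (xA φ) (xA ψ)
  xA (xor φ ψ) = or (xA φ) (xA ψ)
  xA (xex φ) = ex (xA φ)
  -- The bound is first named by a variable, since `all<` accepts only a term of arithmetic; `skip`
  -- then jumps over this variable.
  xA (xall< t φ) = ex (and (graph t) (all< (var 0F) (subA skip (xA φ))))
  xA (xneg p φ) = neg p (xA φ)

  compX : ∀ {b n m} (φ : AF b m) (ts : Vec (XT n) m) e →
    ⟦ compA m φ (λ i → graph (lookup ts i)) ⟧ e ⇔ ⟦ φ ⟧ (xevs ts e)
  compX {m = m} φ ts e = compA-sem m φ _ e ⇔∘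
    ((λ { (ys , g , p) → subst ⟦ φ ⟧ (lookup-ext ys (xevs ts e) (λ i → trans (proj₁ (graph-sem (lookup ts i) _ e) (g i)) (sym (lookup-xevs ts e i)))) p }) ,
     (λ p → xevs ts e , (λ i → proj₂ (graph-sem (lookup ts i) _ e) (lookup-xevs ts e i)) , p))

  xA-sem : ∀ {b n} (φ : XF b n) e → X⟦ φ ⟧ e ⇔ ⟦ xA φ ⟧ e
  xA-sem (at (φ , h) ts) e = h (xevs ts e) ⇔∘ ⇔sym (compX φ ts e)
  xA-sem {b} (xeq s t) e = ⇔sym (compX {b} (eq (var 0F) (var 1F)) (s ∷ t ∷ []) e)
  xA-sem {b} (xlt s t) e = ⇔sym (compX {b} ltA (s ∷ t ∷ []) e ⇔∘ ltA-sem {b} _ _)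
  xA-sem (xand φ ψ) e = (λ { (p , q) → proj₁ (xA-sem φ e) p , proj₁ (xA-sem ψ e) q }) ,
    (λ { (p , q) → proj₂ (xA-sem φ e) p , proj₂ (xA-sem ψ e) q })
  xA-sem (xor φ ψ) e =
    (λ { (inj₁ p) → inj₁ (proj₁ (xA-sem φ e) p) ; (inj₂ p) → inj₂ (proj₁ (xA-sem ψ e) p) }) ,
    (λ { (inj₁ p) → inj₁ (proj₂ (xA-sem φ e) p) ; (inj₂ p) → inj₂ (proj₂ (xA-sem ψ e) p) })
  xA-sem (xex φ) e = (λ { (x , p) → x , proj₁ (xA-sem φ _) p }) , (λ { (x , p) → x , proj₂ (xA-sem φ _) p })
  xA-sem {b} (xall< t φ) e =
    (λ f → xev t e , proj₂ (graph-sem t _ e) refl , λ k k< → proj₂ (s (xev t e) k) (proj₁ (xA-sem φ (k ∷ e)) (f k k<))) ,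
    (λ { (u , g , f) k k< → proj₂ (xA-sem φ (k ∷ e)) (proj₁ (s u k) (f k (subst (k <_) (sym (proj₁ (graph-sem t u e) g)) k<))) })
    where
    s : ∀ u k → ⟦ subA skip (xA φ) ⟧ (k ∷ u ∷ e) ⇔ ⟦ xA φ ⟧ (k ∷ e)
    s u k = subst (λ v → ⟦ subA skip (xA φ) ⟧ (k ∷ u ∷ e) ⇔ ⟦ xA φ ⟧ (k ∷ v)) (tabulate∘lookup e)
      (sub-sem skip (xA φ) (k ∷ u ∷ e))
  xA-sem (xneg p φ) e = (λ f q → f (proj₂ (xA-sem φ e) q)) , (λ f q → f (proj₁ (xA-sem φ e) q))

  def : ∀ {b n} (φ : XF b n) → Def b X⟦ φ ⟧
  def φ = xA φ , xA-sem φ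

  defP : ∀ {b n} {P : Vec ℕ n → Set} (φ : XF b n) → (∀ e → P e ⇔ X⟦ φ ⟧ e) → Def b P
  defP φ h = xA φ , λ e → h e ⇔∘ xA-sem φ e

open Definability

-- Coded finite sets, and definability of inductively generated relations

module HornPrograms where

  -- A finite set of numbers is coded by (a , b): x belongs to it iff 1 + (x + 1) b divides a.

  Mem : ℕ → ℕ → ℕ → Set
  Mem x a b = suc (suc x * b) ∣ a

  modulus : ∀ {n} → XT n → XT n → XT n
  modulus x b = xsu (xmul (xsu x) b)

  Mem3 nMem3 : Vec ℕ 3 → Set
  Mem3 (x ∷ a ∷ b ∷ []) = Mem x a b
  nMem3 (x ∷ a ∷ b ∷ []) = ¬ Mem x a b

  abstract
    memD : ∀ {b} → Def b Mem3
    memD = defP (xex (xeq (xv 2F) (xmul (xv 0F) (modulus (xv 1F) (xv 3F)))))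
      λ { (x ∷ a ∷ b ∷ []) → (λ { (divides q e) → q , e }) , (λ { (q , e) → divides q e }) }

  abstract
    -- A nonzero remainder expresses non-divisibility positively. The closure condition on a coded
    -- set needs this, because c.e. formulas have no negation.
    nmemD : ∀ {b} → Def b nMem3
    nmemD = defP (xex (xex (xand (xeq (xv 3F) (xadd (xmul (xv 1F) (modulus (xv 2F) (xv (fsuc 3F)))) (xsu (xv 0F))))
                                (xlt (xsu (xv 0F)) (modulus (xv 2F) (xv (fsuc 3F)))))))
      λ { (x ∷ a ∷ b ∷ []) → to x a b , from x a b }
      where
      to : ∀ x a b → ¬ Mem x a b → Σ ℕ λ q → Σ ℕ λ r → a ≡ q * suc (suc x * b) + suc r × suc r < suc (suc x * b)
      to x a b nd with a % suc (suc x * b) | m≡m%n+[m/n]*n a (suc (suc x * b)) | m%n<n a (suc (suc x * b))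
      ... | zero  | e | _ = ⊥-elim (nd (divides (a / suc (suc x * b)) e))
      ... | suc r | e | l = a / suc (suc x * b) , r , trans e (+-comm (suc r) _) , l
      from : ∀ x a b → (Σ ℕ λ q → Σ ℕ λ r → a ≡ q * suc (suc x * b) + suc r × suc r < suc (suc x * b)) → ¬ Mem x a b
      from x a b (q , r , refl , l) d =
        <⇒≱ l (∣⇒≤ (∣m+n∣m⇒∣n d (divides q refl)))

  m∣n! : ∀ m n → 0 < m → m ≤ n → m ∣ n !
  m∣n! (suc m) n _ le = ∣-trans (m∣m*n (m !)) (m≤n⇒m!∣n! le)

  -- A common divisor d divides (y + 1) times the first modulus minus (x + 1) times the second,
  -- which is y - x. This number is positive and at most N, hence divides `N !`; so d divides `N !`
  -- and therefore 1.
  modulus-coprime : ∀ N x y → x < y → y < N → Coprime (suc (suc x * N !)) (suc (suc y * N !))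
  modulus-coprime N x y x<y y<N {d} (p , q) = ∣1⇒≡1 (subst (d ∣_) (m+n∸n≡m 1 (suc x * N !)) d∣1)
    where
    b = N !
    open +-*-Solver
    lem : ∀ x k b → (suc x + k + 1) * suc (suc x * b) + 0 ≡ suc x * suc ((suc x + k + 1) * b) + suc k
    lem = solve 3 (λ x k b → (con 1 :+ x :+ k :+ con 1) :* (con 1 :+ (con 1 :+ x) :* b) :+ con 0
                        := (con 1 :+ x) :* (con 1 :+ (con 1 :+ x :+ k :+ con 1) :* b) :+ (con 1 :+ k)) refl
    k = y ∸ suc x
    yk : suc x + k + 1 ≡ suc y
    yk = trans (+-comm (suc x + k) 1) (cong suc (m+[n∸m]≡n x<y))
    h : suc y * suc (suc x * b) + 0 ≡ suc x * suc (suc y * b) + suc k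
    h = subst (λ z → z * suc (suc x * b) + 0 ≡ suc x * suc (z * b) + suc k) yk (lem x k b)
    d∣k : d ∣ suc k
    d∣k = ∣m+n∣m⇒∣n (subst (d ∣_) h (subst (d ∣_) (sym (+-identityʳ _)) (∣n⇒∣m*n (suc y) p))) (∣n⇒∣m*n (suc x) q)
    d∣b : d ∣ b
    d∣b = ∣-trans d∣k (m∣n! (suc k) N (s≤s z≤n) (≤-trans (s≤s (m∸n≤m y (suc x))) y<N))
    d∣1 : d ∣ 1 + suc x * b ∸ suc x * b
    d∣1 = subst (d ∣_) (sym (m+n∸n≡m 1 (suc x * b)))
      (∣m+n∣m⇒∣n {m = suc x * b} (subst (d ∣_) (+-comm 1 (suc x * b)) p) (∣n⇒∣m*n (suc x) d∣b))

  Coprime-sym : ∀ {m n} → Coprime m n → Coprime n m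
  Coprime-sym c (p , q) = c (q , p)

  setProd : ℕ → List ℕ → ℕ
  setProd b [] = 1
  setProd b (x ∷ L) = suc (suc x * b) * setProd b L

  setProd-∈ : ∀ b {x} L → x ∈ L → Mem x (setProd b L) b
  setProd-∈ b (x ∷ L) (here refl) = m∣m*n (setProd b L)
  setProd-∈ b (y ∷ L) (there p) = ∣n⇒∣m*n (suc (suc y * b)) (setProd-∈ b L p)

  -- The modulus of x is coprime to every factor and can be cancelled against them one by one, until
  -- it would have to divide 1.
  setProd-∉ : ∀ N {x} L → x < N → All (_< N) L → ¬ x ∈ L → ¬ Mem x (setProd (N !) L) (N !)
  setProd-∉ N {x} [] x<N _ _ m = absurd (m*n≡0⇒m≡0∨n≡0 (suc x) (suc-injective (∣1⇒≡1 m)))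
    where
    absurd : suc x ≡ 0 ⊎ N ! ≡ 0 → ⊥
    absurd (inj₂ e) = <⇒≢ (≤-trans (s≤s z≤n) (∣⇒≤ {{N !≢0}} (m∣n! 1 N (s≤s z≤n) (≤-trans (s≤s z≤n) x<N)))) (sym e)
  setProd-∉ N {x} (y ∷ L) x<N (y<N ∷ lt) nin m with <-cmp x y
  ... | tri≈ _ refl _ = nin (here refl)
  ... | tri< l _ _ = setProd-∉ N L x<N lt (λ z → nin (there z)) (coprime-divisor (modulus-coprime N x y l y<N) m)
  ... | tri> _ _ l = setProd-∉ N L x<N lt (λ z → nin (there z)) (coprime-divisor (Coprime-sym (modulus-coprime N y x l x<N)) m)

  listMax : (L : List ℕ) → Σ ℕ λ N → All (_< N) L
  listMax [] = 0 , []
  listMax (x ∷ L) with listMax L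
  ... | N , h = suc x ⊔ N , m≤m⊔n (suc x) N ∷ All.map (λ p → ≤-trans p (m≤n⊔m (suc x) N)) h

  -- The code answers correctly only below N, so N is returned with it; M lets the caller ask for a
  -- sufficiently large range.
  codeSet : (L : List ℕ) (M : ℕ) → Σ ℕ λ a → Σ ℕ λ b → Σ ℕ λ N → M ≤ N × All (_< N) L ×
    (∀ x → x < N → x ∈ L → Mem x a b) × (∀ x → x < N → ¬ x ∈ L → ¬ Mem x a b)
  codeSet L M = setProd ((N₀ ⊔ M) !) L , (N₀ ⊔ M) ! , N₀ ⊔ M , m≤n⊔m N₀ M , lt ,
     (λ x _ p → setProd-∈ _ L p) , (λ x l p → setProd-∉ (N₀ ⊔ M) L l lt p)
    where
    N₀ = proj₁ (listMax L)
    lt : All (_< N₀ ⊔ M) L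
    lt = All.map (λ p → ≤-trans p (m≤m⊔n N₀ M)) (proj₂ (listMax L))

  -- Horn programs over numbers; their least models are definable.

  record Clause (b : Bool) : Set₁ where
    constructor clause
    field
      nv    : ℕ
      side  : XF b nv
      prems : List (XT nv)
      concl : XT nv
  open Clause public

  Program : Bool → Set₁
  Program b = List (Clause b)

  AllP : ∀ {n} → (ℕ → Set) → List (XT n) → Vec ℕ n → Set
  AllP P [] e = ⊤
  AllP P (t ∷ []) e = P (xev t e)
  AllP P (t ∷ t' ∷ ts) e = P (xev t e) × AllP P (t' ∷ ts) e

  AllP-map : ∀ {n} {P P' : ℕ → Set} (ts : List (XT n)) e → (∀ x → P x → P' x) → AllP P ts e → AllP P' ts e
  AllP-map [] e f _ = _
  AllP-map (t ∷ []) e f p = f _ p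
  AllP-map (t ∷ t' ∷ ts) e f (p , q) = f _ p , AllP-map (t' ∷ ts) e f q

  _⇔×_ : {A B C D : Set} → A ⇔ B → C ⇔ D → (A × C) ⇔ (B × D)
  (f , g) ⇔× (h , k) = (λ { (a , c) → f a , h c }) , (λ { (b , d) → g b , k d })

  data Der {b} (cs : Program b) : ℕ → Set where
    der : ∀ {f} (i : Fin (length cs)) (e : Vec ℕ (nv (llookup cs i))) → X⟦ side (llookup cs i) ⟧ e →
          AllP (Der cs) (prems (llookup cs i)) e → f ≡ xev (concl (llookup cs i)) e → Der cs f

  module _ {b} (cs : Program b) (P : ℕ → Set)
    (step : ∀ i e → X⟦ side (llookup cs i) ⟧ e → AllP (λ f → Der cs f × P f) (prems (llookup cs i)) e → P (xev (concl (llookup cs i)) e)) where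

    foldDer : ∀ {f} → Der cs f → P f
    foldDerAll : ∀ {n} (ts : List (XT n)) e → AllP (Der cs) ts e → AllP (λ f → Der cs f × P f) ts e
    foldDer (der i e s ps refl) = step i e s (foldDerAll (prems (llookup cs i)) e ps)
    foldDerAll [] e p = _
    foldDerAll (t ∷ []) e p = p , foldDer p
    foldDerAll (t ∷ t' ∷ ts) e (p , q) = (p , foldDer p) , foldDerAll (t' ∷ ts) e q

  module _ {b} (cs : Program b) where

    -- One derivation step whose premises have smaller rank.
    Step : (ℕ → ℕ → Set) → ℕ → ℕ → Set
    Step M r g = Σ (Fin (length cs)) λ i → Σ (Vec ℕ (nv (llookup cs i))) λ e →
      g ≡ xev (concl (llookup cs i)) e × X⟦ side (llookup cs i) ⟧ e ×
      AllP (λ p → Σ ℕ λ r' → r' < r × M r' p) (prems (llookup cs i)) e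

    Step-map : ∀ {M M' : ℕ → ℕ → Set} {r g} → (∀ r' p → M r' p → M' r' p) → Step M r g → Step M' r g
    Step-map f (i , e , q , s , ps) = i , e , q , s , AllP-map (prems (llookup cs i)) e (λ { p (r' , l , m) → r' , l , f r' p m }) ps

    Closed : List ℕ → Set
    Closed L = ∀ r g → ⌊ r , g ⌋ ∈ L → Step (λ r' p → ⌊ r' , p ⌋ ∈ L) r g

    Closed-++ : ∀ {L L'} → Closed L → Closed L' → Closed (L ⧺ L')
    Closed-++ {L} h h' r g m with ∈-++⁻ L m
    ... | inj₁ p = Step-map (λ _ _ → ∈-++⁺ˡ) (h r g p)
    ... | inj₂ p = Step-map (λ _ _ → ∈-++⁺ʳ L) (h' r g p)

    Witness : ℕ → Set
    Witness f = Σ ℕ λ r → Σ (List ℕ) λ L → ⌊ r , f ⌋ ∈ L × Closed L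

    gather : ∀ {n} (ts : List (XT n)) e → AllP (λ f → Der cs f × Witness f) ts e →
      Σ ℕ λ R → Σ (List ℕ) λ L → Closed L × AllP (λ p → Σ ℕ λ r' → r' < R × ⌊ r' , p ⌋ ∈ L) ts e
    gather [] e _ = 0 , [] , (λ _ _ ()) , _
    gather (t ∷ []) e (_ , r , L , m , h) = suc r , L , h , r , ≤-refl , m
    gather (t ∷ t' ∷ ts) e ((_ , r , L , m , h) , q) with gather (t' ∷ ts) e q
    ... | R , L' , h' , ps = suc r ⊔ R , L ⧺ L' , Closed-++ h h' ,
      (r , m≤m⊔n (suc r) R , ∈-++⁺ˡ m) ,
      AllP-map (t' ∷ ts) e (λ { p (r' , l , m') → r' , ≤-trans l (m≤n⊔m (suc r) R) , ∈-++⁺ʳ L m' }) ps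

    witness : ∀ {f} → Der cs f → Witness f
    witness = foldDer cs Witness λ i e s ps → let R , L , h , qs = gather (prems (llookup cs i)) e ps in
      R , ⌊ R , xev (concl (llookup cs i)) e ⌋ ∷ L , here refl , λ { r g (here eqn) → hd i e s R L qs r g (pair-inj eqn) ; r g (there m) → Step-map (λ _ _ → there) (h r g m) }
      where
      hd : ∀ i e → X⟦ side (llookup cs i) ⟧ e → ∀ R L → AllP (λ p → Σ ℕ λ r' → r' < R × ⌊ r' , p ⌋ ∈ L) (prems (llookup cs i)) e →
        ∀ r g → r ≡ R × g ≡ xev (concl (llookup cs i)) e → Step (λ r' p → ⌊ r' , p ⌋ ∈ (⌊ R , xev (concl (llookup cs i)) e ⌋ ∷ L)) r g
      hd i e s R L qs .R ._ (refl , refl) = i , e , refl , s , AllP-map (prems (llookup cs i)) e (λ { p (r' , l , m) → r' , l , there m }) qs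

    xren : ∀ {n m} → (Fin n → Fin m) → XT n → XT m
    xren ρ (xv i) = xv (ρ i)
    xren ρ (xn k) = xn k
    xren ρ (xsu t) = xsu (xren ρ t)
    xren ρ (xp s t) = xp (xren ρ s) (xren ρ t)
    xren ρ (xadd s t) = xadd (xren ρ s) (xren ρ t)
    xren ρ (xmul s t) = xmul (xren ρ s) (xren ρ t)

    xren-ev : ∀ {n m} (ρ : Fin n → Fin m) t e e' → (∀ i → lookup e (ρ i) ≡ lookup e' i) → xev (xren ρ t) e ≡ xev t e'
    xren-ev ρ (xv i) e e' h = h i
    xren-ev ρ (xn k) e e' h = refl
    xren-ev ρ (xsu t) e e' h = cong suc (xren-ev ρ t e e' h)
    xren-ev ρ (xp s t) e e' h = cong₂ ⌊_,_⌋ (xren-ev ρ s e e' h) (xren-ev ρ t e e' h)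
    xren-ev ρ (xadd s t) e e' h = cong₂ _+_ (xren-ev ρ s e e' h) (xren-ev ρ t e e' h)
    xren-ev ρ (xmul s t) e e' h = cong₂ _*_ (xren-ev ρ s e e' h) (xren-ev ρ t e e' h)

    xexN : ∀ {n} m → XF b (m + n) → XF b n
    xexN zero φ = φ
    xexN (suc m) φ = xexN m (xex φ)

    xexN-sem : ∀ {n} m (φ : XF b (m + n)) e → X⟦ xexN m φ ⟧ e ⇔ (Σ (Vec ℕ m) λ ys → X⟦ φ ⟧ (ys ++ e))
    xexN-sem zero φ e = (λ p → [] , p) , (λ { ([] , p) → p })
    xexN-sem (suc m) φ e = xexN-sem m (xex φ) e ⇔∘ ((λ { (ys , y , p) → (y ∷ ys) , p }) , (λ { ((y ∷ ys) , p) → ys , y , p }))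

    -- The context below a clause is  g r' x r N b a f.
    premF : ∀ {k} → XT k → XF b (k + 8)
    premF {k} t = xex (xand (xlt (xv 0F) (v 1F)) (xand (xlt (xp (xv 0F) t') (v (fsuc 3F))) (at memD (xp (xv 0F) t' ∷ v (fsuc (fsuc (fsuc 3F))) ∷ v (fsuc (fsuc 3F)) ∷ []))))
      where
      v : Fin 8 → XT (suc (k + 8))
      v i = xv (fsuc (k ↑ʳ i))
      t' = xren (λ i → fsuc (i ↑ˡ 8)) t

    premsF : ∀ {k} → List (XT k) → XF b (k + 8)
    premsF [] = xeq (xn 0) (xn 0)
    premsF (t ∷ []) = premF t
    premsF (t ∷ t' ∷ ts) = xand (premF t) (premsF (t' ∷ ts))

    clauseF : (c : Clause b) → XF b 8
    clauseF c = xexN (nv c) (xand (xeq (xv (nv c ↑ʳ fzero)) (xren (_↑ˡ 8) (concl c)))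
                            (xand (at (def (side c)) (tabulate (λ i → xv (i ↑ˡ 8)))) (premsF (prems c))))

    clausesF : Program b → XF b 8
    clausesF [] = xlt (xn 0) (xn 0)
    clausesF (c ∷ ds) = xor (clauseF c) (clausesF ds)

    module _ (g r' x r N b' a f : ℕ) where
      ctx : Vec ℕ 8
      ctx = g ∷ r' ∷ x ∷ r ∷ N ∷ b' ∷ a ∷ f ∷ []

      M : ℕ → ℕ → Set
      M r'' p = ⌊ r'' , p ⌋ < N × Mem ⌊ r'' , p ⌋ a b'

      premF-sem : ∀ {k} (t : XT k) e → X⟦ premF t ⟧ (e ++ ctx) ⇔ (Σ ℕ λ r'' → r'' < r' × M r'' (xev t e))
      premF-sem {k} t e =
        (λ { (r'' , p , q , m) → r'' , subst (r'' <_) (lookup-++ʳ e ctx 1F) p ,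
               subst₂ (λ u w → ⌊ r'' , u ⌋ < w) (te r'') (lookup-++ʳ e ctx (fsuc 3F)) q ,
               mm r'' (te r'') (lookup-++ʳ e ctx (fsuc (fsuc (fsuc 3F)))) (lookup-++ʳ e ctx (fsuc (fsuc 3F))) m }) ,
        (λ { (r'' , p , q , m) → r'' , subst (r'' <_) (sym (lookup-++ʳ e ctx 1F)) p ,
               subst₂ (λ u w → ⌊ r'' , u ⌋ < w) (sym (te r'')) (sym (lookup-++ʳ e ctx (fsuc 3F))) q ,
               mm r'' (sym (te r'')) (sym (lookup-++ʳ e ctx (fsuc (fsuc (fsuc 3F))))) (sym (lookup-++ʳ e ctx (fsuc (fsuc 3F)))) m })
        where
        te : ∀ r'' → xev (xren (λ i → fsuc (i ↑ˡ 8)) t) (r'' ∷ (e ++ ctx)) ≡ xev t e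
        te r'' = xren-ev _ t _ e (lookup-++ˡ e ctx)
        mm : ∀ r'' {u u' v v' w w'} → u ≡ u' → v ≡ v' → w ≡ w' → Mem ⌊ r'' , u ⌋ v w → Mem ⌊ r'' , u' ⌋ v' w'
        mm _ refl refl refl m = m

      premsF-sem : ∀ {k} (ts : List (XT k)) e → X⟦ premsF ts ⟧ (e ++ ctx) ⇔ AllP (λ p → Σ ℕ λ r'' → r'' < r' × M r'' p) ts e
      premsF-sem [] e = _ , (λ _ → refl)
      premsF-sem (t ∷ []) e = premF-sem t e
      premsF-sem (t ∷ t' ∷ ts) e = premF-sem t e ⇔× premsF-sem (t' ∷ ts) e

      vars-sem : ∀ {k} (e : Vec ℕ k) → xevs (tabulate (λ i → xv (i ↑ˡ 8))) (e ++ ctx) ≡ e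
      vars-sem e = lookup-ext _ e λ i → trans (lookup-xevs (tabulate (λ i → xv (i ↑ˡ 8))) (e ++ ctx) i)
        (trans (cong (λ z → xev z (e ++ ctx)) (lookup∘tabulate (λ i → xv (i ↑ˡ 8)) i)) (lookup-++ˡ e ctx i))

      clauseF-sem : ∀ c → X⟦ clauseF c ⟧ ctx ⇔ (Σ (Vec ℕ (nv c)) λ e → g ≡ xev (concl c) e × X⟦ side c ⟧ e × AllP (λ p → Σ ℕ λ r'' → r'' < r' × M r'' p) (prems c) e)
      clauseF-sem c = xexN-sem (nv c) _ ctx ⇔∘
        ((λ { (e , p , q , s) → e , trans (sym (lookup-++ʳ e ctx fzero)) (trans p (xren-ev _ (concl c) _ e (lookup-++ˡ e ctx))) ,
                subst X⟦ side c ⟧ (vars-sem e) q , proj₁ (premsF-sem (prems c) e) s }) ,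
         (λ { (e , p , q , s) → e , trans (lookup-++ʳ e ctx fzero) (trans p (sym (xren-ev _ (concl c) _ e (lookup-++ˡ e ctx)))) ,
                subst X⟦ side c ⟧ (sym (vars-sem e)) q , proj₂ (premsF-sem (prems c) e) s }))

      clausesF-sem : ∀ ds → X⟦ clausesF ds ⟧ ctx ⇔ (Σ (Fin (length ds)) λ i → Σ (Vec ℕ (nv (llookup ds i))) λ e → g ≡ xev (concl (llookup ds i)) e × X⟦ side (llookup ds i) ⟧ e × AllP (λ p → Σ ℕ λ r'' → r'' < r' × M r'' p) (prems (llookup ds i)) e)
      clausesF-sem [] = (λ ()) , (λ { (() , _) })
      clausesF-sem (c ∷ ds) =
        (λ { (inj₁ p) → fzero , proj₁ (clauseF-sem c) p ; (inj₂ p) → let i , q = proj₁ (clausesF-sem ds) p in fsuc i , q }) ,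
        (λ { (fzero , p) → inj₁ (proj₂ (clauseF-sem c) p) ; (fsuc i , p) → inj₂ (proj₂ (clausesF-sem ds) (i , p)) })

    entryF : XF b 6
    entryF = xor (at nmemD (xv 0F ∷ xv (fsuc 3F) ∷ xv 3F ∷ [])) (xex (xex (xand (xeq (xv 2F) (xp (xv 1F) (xv 0F))) (clausesF cs))))

    -- Derivability is witnessed by a coded finite set of pairs of a rank and a fact, each supported
    -- by pairs of smaller rank in the same set. The ranks exclude circular support, and N marks the
    -- range in which the code is trusted.
    lfpF : XF b 1
    lfpF = xex (xex (xex (xex (xand (at memD (xp (xv 0F) (xv (fsuc 3F)) ∷ xv 3F ∷ xv 2F ∷ []))
      (xand (xlt (xp (xv 0F) (xv (fsuc 3F))) (xv 1F))
        (xall< (xv 1F) entryF))))))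

    Der₁ : Vec ℕ 1 → Set
    Der₁ (f ∷ []) = Der cs f

    abstract
      derD : Def b Der₁
      derD = defP lfpF λ { (f ∷ []) → to f , from f }
        where
        to : ∀ f → Der cs f → X⟦ lfpF ⟧ (f ∷ [])
        to f d with witness d
        ... | r , L , m , h with codeSet L (suc ⌊ r , f ⌋)
        ...   | a , b' , N , l , lt , yes' , no' =
          a , b' , N , r , yes' _ l m , l , λ x x<N → go x x<N (x ∈? L)
          where
          go : ∀ x → x < N → Dec (x ∈ L) → X⟦ entryF ⟧ (x ∷ r ∷ N ∷ b' ∷ a ∷ f ∷ [])
          go x x<N (no n) = inj₁ (no' x x<N n)
          go x x<N (yes p) with unpair x
          ... | (u , v , refl) = inj₂ (u , v , refl ,
                  proj₂ (clausesF-sem v u ⌊ u , v ⌋ r N b' a f cs) (Step-map (λ r' p q → All.lookup lt q , yes' _ (All.lookup lt q) q) (h u v p)))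
        from : ∀ f → X⟦ lfpF ⟧ (f ∷ []) → Der cs f
        -- Induction on the rank unwinds the coded set into a derivation.
        from f (a , b' , N , r , m , l , h) = go (suc r) r f ≤-refl l m
          where
          go : ∀ n r g → r < n → ⌊ r , g ⌋ < N → Mem ⌊ r , g ⌋ a b' → Der cs g
          go (suc n) r₁ g (s≤s r≤n) l m with h ⌊ r₁ , g ⌋ l
          ... | inj₁ nm = ⊥-elim (nm m)
          ... | inj₂ (r' , g' , e , c) with pair-inj {r₁} {g} {r'} {g'} e
          ...   | refl , refl with proj₁ (clausesF-sem g r₁ ⌊ r₁ , g ⌋ r N b' a f cs) c
          ...     | i , env , e' , s , ps = der i env s (AllP-map (prems (llookup cs i)) env (λ { p (r'' , l' , l₂ , m₂) → go n r'' p (≤-trans l' r≤n) l₂ m₂ }) ps) e'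

open HornPrograms

-- Graphs of recursive functions, and c.e. sets as positive formulas

module ComputableRelations where

  xvars : ∀ {n m} → (Fin n → Fin m) → Vec (XT m) n
  xvars ρ = tabulate (λ i → xv (ρ i))

  xvars-ev : ∀ {n m} (ρ : Fin n → Fin m) e e' → (∀ i → lookup e (ρ i) ≡ lookup e' i) → xevs (xvars ρ) e ≡ e'
  xvars-ev ρ e e' h = lookup-ext _ e' λ i → trans (lookup-xevs (xvars ρ) e i)
    (trans (cong (λ t → xev t e) (lookup∘tabulate (λ j → xv (ρ j)) i)) (h i))

  encV : ∀ {n} → Vec ℕ n → ℕ
  encV [] = 0
  encV (x ∷ xs) = ⌊ x , encV xs ⌋

  encX : ∀ {n m} → Vec (XT m) n → XT m
  encX [] = xn 0
  encX (t ∷ ts) = xp t (encX ts)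

  encX-ev : ∀ {n m} (ts : Vec (XT m) n) e → xev (encX ts) e ≡ encV (xevs ts e)
  encX-ev [] e = refl
  encX-ev (t ∷ ts) e = cong ⌊ xev t e ,_⌋ (encX-ev ts e)

  encV-inj : ∀ {n} (v w : Vec ℕ n) → encV v ≡ encV w → v ≡ w
  encV-inj [] [] e = refl
  encV-inj (x ∷ v) (y ∷ w) e with pair-inj {x} {encV v} {y} {encV w} e
  ... | refl , q = cong (x ∷_) (encV-inj v w q)

  EvalV : ∀ {n} → Code n → Vec ℕ (suc n) → Set
  EvalV c (z ∷ xs) = Eval c xs z

  module Prec {n} (g : Code n) (h : Code (suc (suc n)))
    (G : Def false (EvalV g)) (H : Def false (EvalV h)) where

    vs : ∀ {m} → (Fin n → Fin m) → XT m
    vs ρ = encX (xvars ρ)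

    vs-ev : ∀ {m} (ρ : Fin n → Fin m) e e' → (∀ i → lookup e (ρ i) ≡ lookup e' i) → xev (vs ρ) e ≡ encV e'
    vs-ev ρ e e' p = trans (encX-ev (xvars ρ) e) (cong encV (xvars-ev ρ e e' p))

    -- Primitive recursion as a least fixed point: a fact pairs the recursion argument with the
    -- value reached there and with the parameters.
    prog : Program false
    prog = clause (suc n) (at G (xv 0F ∷ xvars fsuc)) [] (xp (xn 0) (xp (xv 0F) (vs fsuc)))
         ∷ clause (suc (suc (suc n))) (at H (xv 2F ∷ xv 0F ∷ xv 1F ∷ xvars (λ i → fsuc (fsuc (fsuc i)))))
             (xp (xv 0F) (xp (xv 1F) (vs (λ i → fsuc (fsuc (fsuc i))))) ∷ [])
             (xp (xsu (xv 0F)) (xp (xv 2F) (vs (λ i → fsuc (fsuc (fsuc i))))))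
         ∷ []

    fact : ℕ → ℕ → Vec ℕ n → ℕ
    fact k z xs = ⌊ k , ⌊ z , encV xs ⌋ ⌋

    complete : ∀ {k xs z} → Eval (prec g h) (k ∷ xs) z → Der prog (fact k z xs)
    complete {xs = xs} {z} (ev-prec0 p) = der fzero (z ∷ xs)
      (subst (λ v → Eval g v z) (sym (xvars-ev fsuc (z ∷ xs) xs (λ _ → refl))) p) _
      (cong (λ w → ⌊ 0 , ⌊ z , w ⌋ ⌋) (sym (vs-ev fsuc (z ∷ xs) xs (λ _ → refl))))
    complete {xs = xs} {z} (ev-precS {k = k} {r = r} p q) = der (fsuc fzero) (k ∷ r ∷ z ∷ xs)
      (subst (λ v → Eval h (k ∷ r ∷ v) z) (sym (xvars-ev _ (k ∷ r ∷ z ∷ xs) xs (λ _ → refl))) q)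
      (subst (λ w → Der prog ⌊ k , ⌊ r , w ⌋ ⌋) (sym (vs-ev _ (k ∷ r ∷ z ∷ xs) xs (λ _ → refl))) (complete p))
      (cong (λ w → ⌊ suc k , ⌊ z , w ⌋ ⌋) (sym (vs-ev _ (k ∷ r ∷ z ∷ xs) xs (λ _ → refl))))

    fact-inj : ∀ {k k' z z' xs w} → ⌊ k , ⌊ z , w ⌋ ⌋ ≡ fact k' z' xs → k ≡ k' × z ≡ z' × w ≡ encV xs
    fact-inj {k} {k'} {z} {z'} {xs} {w} e with pair-inj {k} {_} {k'} e
    ... | p , q with pair-inj {z} {w} {z'} q
    ...   | r , s = p , r , s

    sound : ∀ {f} → Der prog f → ∀ k z xs → f ≡ fact k z xs → Eval (prec g h) (k ∷ xs) z
    sound = foldDer prog (λ f → ∀ k z xs → f ≡ fact k z xs → Eval (prec g h) (k ∷ xs) z) step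
      where
      step : ∀ i e → X⟦ side (llookup prog i) ⟧ e → AllP (λ f → Der prog f × (∀ k z xs → f ≡ fact k z xs → Eval (prec g h) (k ∷ xs) z)) (prems (llookup prog i)) e →
        ∀ k z xs → xev (concl (llookup prog i)) e ≡ fact k z xs → Eval (prec g h) (k ∷ xs) z
      step fzero (z' ∷ ys) s _ k z xs e with fact-inj {0} {k} {z'} {z} {xs} e
      ... | refl , refl , q with encV-inj ys xs (trans (sym (vs-ev fsuc (z' ∷ ys) ys (λ _ → refl))) q)
      ...   | refl = ev-prec0 (subst (λ v → Eval g v z) (xvars-ev fsuc (z' ∷ ys) ys (λ _ → refl)) s)
      step (fsuc fzero) (k' ∷ r ∷ z' ∷ ys) s (_ , ih) k z xs e with fact-inj {suc k'} {k} {z'} {z} {xs} e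
      ... | refl , refl , q with encV-inj ys xs (trans (sym (vs-ev _ (k' ∷ r ∷ z' ∷ ys) ys (λ _ → refl))) q)
      ...   | refl = ev-precS (ih k' r ys (cong (λ w → ⌊ k' , ⌊ r , w ⌋ ⌋) (vs-ev _ (k' ∷ r ∷ z' ∷ ys) ys (λ _ → refl))))
                       (subst (λ v → Eval h (k' ∷ r ∷ v) z) (xvars-ev _ (k' ∷ r ∷ z' ∷ ys) ys (λ _ → refl)) s)

    abstract
      precD : Def false (EvalV (prec g h))
      precD = defP (at (derD prog) (xp (xv 1F) (xp (xv 0F) (vs (λ i → fsuc (fsuc i)))) ∷ []))
        λ { (z ∷ k ∷ xs) →
          (λ p → subst (λ w → Der prog ⌊ k , ⌊ z , w ⌋ ⌋) (sym (vs-ev _ (z ∷ k ∷ xs) xs (λ _ → refl))) (complete p)) ,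
          (λ d → sound d k z xs (cong (λ w → ⌊ k , ⌊ z , w ⌋ ⌋) (vs-ev _ (z ∷ k ∷ xs) xs (λ _ → refl)))) }

  abstract
    -- Only `prec` needs an inductive definition. Minimisation is a bounded quantifier over the
    -- places before the zero, and composition is relational.
    codeD : ∀ {n} (c : Code n) → Def false (EvalV c)
    codeD zer = defP (xeq (xv 0F) (xn 0)) λ { (z ∷ xs) → (λ { ev-zer → refl }) , (λ { refl → ev-zer }) }
    codeD succ = defP (xeq (xv 0F) (xsu (xv 1F))) λ { (z ∷ x ∷ []) → (λ { ev-succ → refl }) , (λ { refl → ev-succ }) }
    codeD (proj i) = defP (xeq (xv 0F) (xv (fsuc i))) λ { (z ∷ xs) → (λ { (ev-proj .i) → refl }) , (λ { refl → ev-proj i }) }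
    codeD {n} (comp {m} f gs) = compA (suc m) (proj₁ (codeD f)) args , λ { (z ∷ xs) →
      (λ { (ev-comp ys p q) → proj₂ (compA-sem (suc m) _ args (z ∷ xs))
         (z ∷ ys , (λ { fzero → refl ; (fsuc i) → proj₂ (arg i (lookup ys i) z xs) (p i) }) , proj₁ (proj₂ (codeD f) (z ∷ ys)) q) }) ,
      (λ p → from (proj₁ (compA-sem (suc m) _ args (z ∷ xs)) p)) }
      where
      args : Fin (suc m) → AF false (suc (suc n))
      -- The extra first argument copies the output z, because the graph of f expects its output
      -- together with its inputs.
      args fzero = eq (var 0F) (var 1F)
      args (fsuc i) = subA (out 0F (λ j → fsuc (fsuc j))) (proj₁ (codeD (gs i)))
      arg : ∀ i y z xs → ⟦ args (fsuc i) ⟧ (y ∷ z ∷ xs) ⇔ Eval (gs i) xs y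
      arg i y z xs = out-sem (proj₁ (codeD (gs i))) 0F _ (y ∷ z ∷ xs) xs (λ _ → refl) ⇔∘ ⇔sym (proj₂ (codeD (gs i)) (y ∷ xs))
      from : ∀ {z xs} → (Σ (Vec ℕ (suc m)) λ ys → (∀ i → ⟦ args i ⟧ (lookup ys i ∷ z ∷ xs)) × ⟦ proj₁ (codeD f) ⟧ ys) → Eval (comp f gs) xs z
      from {z} {xs} (y ∷ ys , p , q) with p fzero
      ... | refl = ev-comp ys (λ i → proj₁ (arg i (lookup ys i) z xs) (p (fsuc i))) (proj₂ (proj₂ (codeD f) (y ∷ ys)) q)
    codeD (prec g h) = Prec.precD g h (codeD g) (codeD h)
    codeD (mu f) = defP (xand (at (codeD f) (xn 0 ∷ xv 0F ∷ xvars fsuc))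
                              (xall< (xv 0F) (xex (at (codeD f) (xsu (xv 0F) ∷ xv 1F ∷ xvars (λ i → fsuc (fsuc (fsuc i))))))))
      λ { (y ∷ xs) →
        (λ { (ev-mu p l) → subst (λ v → Eval f (y ∷ v) 0) (sym (xvars-ev fsuc (y ∷ xs) xs (λ _ → refl))) p ,
             λ k k< → let v , q = l k k< in v , subst (λ w → Eval f (k ∷ w) (suc v)) (sym (xvars-ev _ (v ∷ k ∷ y ∷ xs) xs (λ _ → refl))) q }) ,
        (λ { (p , l) → ev-mu (subst (λ v → Eval f (y ∷ v) 0) (xvars-ev fsuc (y ∷ xs) xs (λ _ → refl)) p)
             (λ k k< → let v , q = l k k< in v , subst (λ w → Eval f (k ∷ w) (suc v)) (xvars-ev _ (v ∷ k ∷ y ∷ xs) xs (λ _ → refl)) q) }) }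

  pred₁ : (ℕ → Set) → Vec ℕ 1 → Set
  pred₁ P (x ∷ []) = P x

  CE⇒Def : ∀ {P : ℕ → Set} → IsCE P → Def false (pred₁ P)
  CE⇒Def (e , h) = defP (xex (at (codeD e) (xv 0F ∷ xv 1F ∷ []))) λ { (x ∷ []) → h x }

  Def⇒CE : ∀ {P : ℕ → Set} → Def false (pred₁ P) → IsCE P
  Def⇒CE (φ , h) = ce-AF φ (λ x → h (x ∷ []))

open ComputableRelations

-- Substitution lemmas, and natural deduction derived from the Hilbert calculus

module NaturalDeduction where

  -- Substitution algebra, with pointwise equal substitutions in place of function extensionality.

  renT-sub : ∀ {n m} (ρ : Fin n → Fin m) t → renT ρ t ≡ subT (λ i → var (ρ i)) t
  renT-sub ρ (var i) = refl
  renT-sub ρ `0 = refl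
  renT-sub ρ (`S t) = cong `S (renT-sub ρ t)
  renT-sub ρ (s `+ t) = cong₂ _`+_ (renT-sub ρ s) (renT-sub ρ t)
  renT-sub ρ (s `· t) = cong₂ _`·_ (renT-sub ρ s) (renT-sub ρ t)

  subT-ext : ∀ {n m} {σ τ : Fin n → Term m} → (∀ i → σ i ≡ τ i) → ∀ t → subT σ t ≡ subT τ t
  subT-ext h (var i) = h i
  subT-ext h `0 = refl
  subT-ext h (`S t) = cong `S (subT-ext h t)
  subT-ext h (s `+ t) = cong₂ _`+_ (subT-ext h s) (subT-ext h t)
  subT-ext h (s `· t) = cong₂ _`·_ (subT-ext h s) (subT-ext h t)

  subT-id : ∀ {n} (t : Term n) → subT var t ≡ t
  subT-id (var i) = refl
  subT-id `0 = refl
  subT-id (`S t) = cong `S (subT-id t)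
  subT-id (s `+ t) = cong₂ _`+_ (subT-id s) (subT-id t)
  subT-id (s `· t) = cong₂ _`·_ (subT-id s) (subT-id t)

  subT-subT : ∀ {n m k} (τ : Fin m → Term k) (σ : Fin n → Term m) t → subT τ (subT σ t) ≡ subT (λ i → subT τ (σ i)) t
  subT-subT τ σ (var i) = refl
  subT-subT τ σ `0 = refl
  subT-subT τ σ (`S t) = cong `S (subT-subT τ σ t)
  subT-subT τ σ (s `+ t) = cong₂ _`+_ (subT-subT τ σ s) (subT-subT τ σ t)
  subT-subT τ σ (s `· t) = cong₂ _`·_ (subT-subT τ σ s) (subT-subT τ σ t)

  subT-renT : ∀ {n m k} (τ : Fin m → Term k) (ρ : Fin n → Fin m) t → subT τ (renT ρ t) ≡ subT (λ i → τ (ρ i)) t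
  subT-renT τ ρ t = trans (cong (subT τ) (renT-sub ρ t)) (subT-subT τ _ t)

  renT-subT : ∀ {n m k} (ρ : Fin m → Fin k) (σ : Fin n → Term m) t → renT ρ (subT σ t) ≡ subT (λ i → renT ρ (σ i)) t
  renT-subT ρ σ t = trans (renT-sub ρ (subT σ t)) (trans (subT-subT _ σ t) (subT-ext (λ i → sym (renT-sub ρ (σ i))) t))

  liftS-ext : ∀ {n m} {σ τ : Fin n → Term m} → (∀ i → σ i ≡ τ i) → ∀ i → liftS σ i ≡ liftS τ i
  liftS-ext h fzero = refl
  liftS-ext h (fsuc i) = cong (renT fsuc) (h i)

  subF-ext : ∀ {n m} {σ τ : Fin n → Term m} → (∀ i → σ i ≡ τ i) → ∀ φ → subF σ φ ≡ subF τ φ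
  subF-ext h `⊥ = refl
  subF-ext h (s ≐ t) = cong₂ _≐_ (subT-ext h s) (subT-ext h t)
  subF-ext h (φ ⇒ ψ) = cong₂ _⇒_ (subF-ext h φ) (subF-ext h ψ)
  subF-ext h (∀' φ) = cong ∀' (subF-ext (liftS-ext h) φ)

  renF-sub : ∀ {n m} (ρ : Fin n → Fin m) φ → renF ρ φ ≡ subF (λ i → var (ρ i)) φ
  renF-sub ρ `⊥ = refl
  renF-sub ρ (s ≐ t) = cong₂ _≐_ (renT-sub ρ s) (renT-sub ρ t)
  renF-sub ρ (φ ⇒ ψ) = cong₂ _⇒_ (renF-sub ρ φ) (renF-sub ρ ψ)
  renF-sub ρ (∀' φ) = cong ∀' (trans (renF-sub (liftR ρ) φ) (subF-ext (λ { fzero → refl ; (fsuc i) → refl }) φ))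

  subF-id : ∀ {n} {σ : Fin n → Term n} → (∀ i → σ i ≡ var i) → ∀ φ → subF σ φ ≡ φ
  subF-id h `⊥ = refl
  subF-id h (s ≐ t) = cong₂ _≐_ (trans (subT-ext h s) (subT-id s)) (trans (subT-ext h t) (subT-id t))
  subF-id h (φ ⇒ ψ) = cong₂ _⇒_ (subF-id h φ) (subF-id h ψ)
  subF-id h (∀' φ) = cong ∀' (subF-id (λ { fzero → refl ; (fsuc i) → cong (renT fsuc) (h i) }) φ)

  liftS-liftS : ∀ {n m k} {τ : Fin m → Term k} {σ : Fin n → Term m} {υ : Fin n → Term k} →
    (∀ i → subT τ (σ i) ≡ υ i) → ∀ i → subT (liftS τ) (liftS σ i) ≡ liftS υ i
  liftS-liftS h fzero = refl
  liftS-liftS {τ = τ} {σ} h (fsuc i) = trans (subT-renT (liftS τ) fsuc (σ i))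
    (trans (sym (renT-subT fsuc τ (σ i))) (cong (renT fsuc) (h i)))

  subF-subF : ∀ {n m k} {τ : Fin m → Term k} {σ : Fin n → Term m} {υ : Fin n → Term k} →
    (∀ i → subT τ (σ i) ≡ υ i) → ∀ φ → subF τ (subF σ φ) ≡ subF υ φ
  subF-subF h `⊥ = refl
  subF-subF {τ = τ} {σ} h (s ≐ t) = cong₂ _≐_ (trans (subT-subT τ σ s) (subT-ext h s)) (trans (subT-subT τ σ t) (subT-ext h t))
  subF-subF h (φ ⇒ ψ) = cong₂ _⇒_ (subF-subF h φ) (subF-subF h ψ)
  subF-subF h (∀' φ) = cong ∀' (subF-subF (liftS-liftS h) φ)

  subF-renF : ∀ {n m k} {τ : Fin m → Term k} {ρ : Fin n → Fin m} {υ : Fin n → Term k} →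
    (∀ i → τ (ρ i) ≡ υ i) → ∀ φ → subF τ (renF ρ φ) ≡ subF υ φ
  subF-renF {τ = τ} h φ = trans (cong (subF τ) (renF-sub _ φ)) (subF-subF h φ)

  renF-subF : ∀ {n m k} {ρ : Fin m → Fin k} {σ : Fin n → Term m} {υ : Fin n → Term k} →
    (∀ i → renT ρ (σ i) ≡ υ i) → ∀ φ → renF ρ (subF σ φ) ≡ subF υ φ
  renF-subF {ρ = ρ} {σ} h φ = trans (renF-sub ρ (subF σ φ)) (subF-subF (λ i → trans (sym (renT-sub ρ (σ i))) (h i)) φ)

  subF-closed : ∀ {n m} (σ : Fin n → Term m) (φ : Sentence) → subF σ (closedAt φ) ≡ closedAt φ
  subF-closed σ φ = trans (subF-renF {υ = λ ()} (λ ()) φ) (sym (trans (renF-sub (λ ()) φ) (subF-ext (λ ()) φ)))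

  wk-closed : ∀ {n} (φ : Sentence) → wk (closedAt {n} φ) ≡ closedAt φ
  wk-closed φ = trans (renF-sub fsuc _) (subF-closed _ φ)

  closed₀ : (φ : Sentence) → closedAt {0} φ ≡ φ
  closed₀ φ = trans (renF-sub (λ ()) φ) (subF-id (λ ()) φ)

  codeT-ren : ∀ {n m} (ρ : Fin n → Fin m) → (∀ i → toℕ (ρ i) ≡ toℕ i) → ∀ t → cdT (renT ρ t) ≡ cdT t
  codeT-ren ρ h (var i) = cong ⌊ 0 ,_⌋ (h i)
  codeT-ren ρ h `0 = refl
  codeT-ren ρ h (`S t) = cong ⌊ 2 ,_⌋ (codeT-ren ρ h t)
  codeT-ren ρ h (s `+ t) = cong₂ (λ a b → ⌊ 3 , ⌊ a , b ⌋ ⌋) (codeT-ren ρ h s) (codeT-ren ρ h t)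
  codeT-ren ρ h (s `· t) = cong₂ (λ a b → ⌊ 4 , ⌊ a , b ⌋ ⌋) (codeT-ren ρ h s) (codeT-ren ρ h t)

  codeF-ren : ∀ {n m} (ρ : Fin n → Fin m) → (∀ i → toℕ (ρ i) ≡ toℕ i) → ∀ φ → cdF (renF ρ φ) ≡ cdF φ
  codeF-ren ρ h `⊥ = refl
  codeF-ren ρ h (s ≐ t) = cong₂ (λ a b → ⌊ 1 , ⌊ a , b ⌋ ⌋) (codeT-ren ρ h s) (codeT-ren ρ h t)
  codeF-ren ρ h (φ ⇒ ψ) = cong₂ (λ a b → ⌊ 2 , ⌊ a , b ⌋ ⌋) (codeF-ren ρ h φ) (codeF-ren ρ h ψ)
  codeF-ren ρ h (∀' φ) = cong ⌊ 3 ,_⌋ (codeF-ren (liftR ρ) (λ { fzero → refl ; (fsuc i) → cong suc (h i) }) φ)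

  codeF-closed : ∀ {n} (φ : Sentence) → cdF (closedAt {n} φ) ≡ cdF φ
  codeF-closed φ = codeF-ren _ (λ ()) φ

  _⟪_⟫ : ∀ {n} → Formula 1 → Term n → Formula n
  φ ⟪ t ⟫ = subF (λ _ → t) φ

  sub-inst : ∀ {n m} (σ : Fin n → Term m) φ t → subF σ (φ [ t ]) ≡ subF (liftS σ) φ [ subT σ t ]
  sub-inst σ φ t = trans (subF-subF {υ = υ} (λ { fzero → refl ; (fsuc i) → refl }) φ) (sym (subF-subF h φ))
    where
    υ : _ → _
    υ fzero = subT σ t
    υ (fsuc i) = σ i
    h : ∀ i → subT (single (subT σ t)) (liftS σ i) ≡ υ i
    h fzero = refl
    h (fsuc i) = trans (subT-renT _ fsuc (σ i)) (subT-id (σ i))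

  sub-wk : ∀ {n m} (σ : Fin n → Term m) φ → subF (liftS σ) (wk φ) ≡ wk (subF σ φ)
  sub-wk σ φ = trans (subF-renF {υ = λ i → renT fsuc (σ i)} (λ i → refl) φ) (sym (renF-subF (λ i → refl) φ))

  module Logic (Γ : Sentence → Set) where

    infix 3 _≈⊢_
    _≈⊢_ : ∀ {n} {φ ψ : Formula n} → φ ≡ ψ → Γ ⊢ φ → Γ ⊢ ψ
    refl ≈⊢ d = d

    -- Hypotheses are sentences, so substitution leaves them fixed. This allows a schema to be
    -- proved once for variables and then instantiated.
    sub⊢ : ∀ {n m} {φ : Formula n} (σ : Fin n → Term m) → Γ ⊢ φ → Γ ⊢ subF σ φ
    sub⊢ σ (hyp {φ = φ} p) = sym (subF-closed σ φ) ≈⊢ hyp p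
    sub⊢ σ (ax (ax-K φ ψ)) = ax (ax-K _ _)
    sub⊢ σ (ax (ax-S φ ψ χ)) = ax (ax-S _ _ _)
    sub⊢ σ (ax (ax-DNE φ)) = ax (ax-DNE _)
    sub⊢ σ (ax (ax-inst φ t)) = cong (∀' (subF (liftS σ) φ) ⇒_) (sym (sub-inst σ φ t)) ≈⊢ ax (ax-inst _ _)
    sub⊢ σ (ax (ax-dist φ ψ)) = cong (λ z → ∀' (z ⇒ subF (liftS σ) ψ) ⇒ subF σ φ ⇒ ∀' (subF (liftS σ) ψ)) (sym (sub-wk σ φ)) ≈⊢ ax (ax-dist _ _)
    sub⊢ σ (ax (ax-refl t)) = ax (ax-refl _)
    sub⊢ σ (ax (ax-subst s t φ)) = cong₂ (λ a b → (subT σ s ≐ subT σ t) ⇒ a ⇒ b) (sym (sub-inst σ φ s)) (sym (sub-inst σ φ t)) ≈⊢ ax (ax-subst _ _ _)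
    sub⊢ σ (mp d e) = mp (sub⊢ σ d) (sub⊢ σ e)
    sub⊢ σ (gen d) = gen (sub⊢ (liftS σ) d)

    -- Natural deduction with open assumptions; the head of the list is the most recent one.
    _⇛_ : ∀ {n} → List (Formula n) → Formula n → Formula n
    [] ⇛ φ = φ
    (ψ ∷ Δ) ⇛ φ = Δ ⇛ (ψ ⇒ φ)

    infix 2 _⊩_
    -- A record and not an abbreviation: Δ and φ could not be recovered from the formula `Δ ⇛ φ`.
    record _⊩_ {n} (Δ : List (Formula n)) (φ : Formula n) : Set where
      constructor nd
      field un : Γ ⊢ (Δ ⇛ φ)
    open _⊩_ public

    kk : ∀ {n} Δ {φ : Formula n} → Γ ⊢ φ → Γ ⊢ (Δ ⇛ φ)
    kk [] d = d
    kk (ψ ∷ Δ) d = kk Δ (mp (ax (ax-K _ _)) d)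

    mpΔ : ∀ {n} Δ {φ ψ : Formula n} → Γ ⊢ (Δ ⇛ (φ ⇒ ψ)) → Γ ⊢ (Δ ⇛ φ) → Γ ⊢ (Δ ⇛ ψ)
    mpΔ [] d e = mp d e
    mpΔ (χ ∷ Δ) d e = mpΔ Δ (mpΔ Δ (kk Δ (ax (ax-S _ _ _))) d) e

    thm : ∀ {n Δ} {φ : Formula n} → Γ ⊢ φ → Δ ⊩ φ
    thm {Δ = Δ} d = nd (kk Δ d)

    infixl 4 _$$_
    _$$_ : ∀ {n Δ} {φ ψ : Formula n} → Δ ⊩ φ ⇒ ψ → Δ ⊩ φ → Δ ⊩ ψ
    _$$_ {Δ = Δ} (nd d) (nd e) = nd (mpΔ Δ d e)

    -- The deduction theorem is immediate because the most recent assumption is the innermost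
    -- antecedent of `_⇛_`.
    lam : ∀ {n Δ} {φ ψ : Formula n} → φ ∷ Δ ⊩ ψ → Δ ⊩ φ ⇒ ψ
    lam (nd d) = nd d

    h0 : ∀ {n Δ} {φ : Formula n} → φ ∷ Δ ⊩ φ
    h0 {Δ = Δ} {φ} = nd (kk Δ (mp (mp (ax (ax-S φ (φ ⇒ φ) φ)) (ax (ax-K _ _))) (ax (ax-K _ _))))

    up : ∀ {n Δ} {φ ψ : Formula n} → Δ ⊩ φ → ψ ∷ Δ ⊩ φ
    up {Δ = Δ} (nd d) = nd (mpΔ Δ (kk Δ (ax (ax-K _ _))) d)

    h1 : ∀ {n Δ} {φ ψ : Formula n} → ψ ∷ φ ∷ Δ ⊩ φ
    h1 = up h0

    h2 : ∀ {n Δ} {φ ψ χ : Formula n} → χ ∷ ψ ∷ φ ∷ Δ ⊩ φ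
    h2 = up h1

    raa : ∀ {n Δ} {φ : Formula n} → ¬' φ ∷ Δ ⊩ `⊥ → Δ ⊩ φ
    raa d = thm (ax (ax-DNE _)) $$ lam d

    efq : ∀ {n Δ} {φ : Formula n} → Δ ⊩ `⊥ → Δ ⊩ φ
    efq d = raa (up d)

    genΔ : ∀ {n} Δ {φ : Formula (suc n)} → Γ ⊢ (map wk Δ ⇛ φ) → Γ ⊢ (Δ ⇛ ∀' φ)
    genΔ [] d = gen d
    genΔ (ψ ∷ Δ) d = mpΔ Δ (kk Δ (ax (ax-dist _ _))) (genΔ Δ d)

    allI : ∀ {n Δ} {φ : Formula (suc n)} → map wk Δ ⊩ φ → Δ ⊩ ∀' φ
    allI {Δ = Δ} (nd d) = nd (genΔ Δ d)

    allE : ∀ {n Δ} {φ : Formula (suc n)} t → Δ ⊩ ∀' φ → Δ ⊩ φ [ t ]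
    allE t d = thm (ax (ax-inst _ t)) $$ d

    exI : ∀ {n Δ} {φ : Formula (suc n)} t → Δ ⊩ φ [ t ] → Δ ⊩ ∃' φ
    exI t d = lam (allE t h0 $$ up d)

    exE : ∀ {n Δ} {φ : Formula (suc n)} {ψ} → Δ ⊩ ∃' φ → φ ∷ map wk Δ ⊩ wk ψ → Δ ⊩ ψ
    exE d e = raa (up d $$ allI (lam (h1 $$ up' e)))
      where
      up' : ∀ {n Δ} {φ ψ χ : Formula n} → φ ∷ Δ ⊩ ψ → φ ∷ χ ∷ Δ ⊩ ψ
      up' d = up (up (lam d)) $$ h0

    _∧'_ : ∀ {n} → Formula n → Formula n → Formula n
    φ ∧' ψ = ¬' (φ ⇒ ¬' ψ)

    conj : ∀ {n Δ} {φ ψ : Formula n} → Δ ⊩ φ → Δ ⊩ ψ → Δ ⊩ φ ∧' ψ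
    conj d e = lam (h0 $$ up d $$ up e)

    fst : ∀ {n Δ} {φ ψ : Formula n} → Δ ⊩ φ ∧' ψ → Δ ⊩ φ
    fst d = raa (up d $$ lam (efq (h1 $$ h0)))

    snd : ∀ {n Δ} {φ ψ : Formula n} → Δ ⊩ φ ∧' ψ → Δ ⊩ ψ
    snd d = raa (up d $$ lam (up (h0)))

    orE : ∀ {n Δ} {φ ψ χ : Formula n} → Δ ⊩ φ ∨' ψ → Δ ⊩ φ ⇒ χ → Δ ⊩ ψ ⇒ χ → Δ ⊩ χ
    orE d e f = raa (h0 $$ (up f $$ (up d $$ lam (h1 $$ (up (up e) $$ h0)))))

    orL : ∀ {n Δ} {φ ψ : Formula n} → Δ ⊩ φ → Δ ⊩ φ ∨' ψ
    orL d = lam (efq (h0 $$ up d))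

    orR : ∀ {n Δ} {φ ψ : Formula n} → Δ ⊩ ψ → Δ ⊩ φ ∨' ψ
    orR d = lam (up d)

    substΔ : ∀ {n Δ} (φ : Formula (suc n)) {s t : Term n} → Δ ⊩ s ≐ t → Δ ⊩ φ [ s ] → Δ ⊩ φ [ t ]
    substΔ φ d e = thm (ax (ax-subst _ _ φ)) $$ d $$ e

    v₀ : ∀ {n} → Term (suc n)
    v₀ = var fzero

    sgl : ∀ {n} → Term n → Term n → Fin 2 → Term n
    sgl s t fzero = t
    sgl s t (fsuc _) = s

    done : ∀ {n} {φ : Formula n} → [] ⊩ φ → Γ ⊢ φ
    done = un

    -- For variables the two instances in `ax-subst` compute to the desired equations; arbitrary
    -- terms would require transports, and `sub⊢` supplies them all at once.
    sym⊢ : Γ ⊢ ((x₁ {0} ≐ x₀) ⇒ (x₀ ≐ x₁))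
    sym⊢ = done (lam (substΔ (var fzero ≐ var 2F) {x₁} {x₀} h0 (thm (ax (ax-refl x₁)))))

    esym : ∀ {n Δ} {s t : Term n} → Δ ⊩ s ≐ t → Δ ⊩ t ≐ s
    esym {s = s} {t} d = thm (sub⊢ (sgl s t) sym⊢) $$ d

    tri₃ : ∀ {n} → Term n → Term n → Term n → Fin 3 → Term n
    tri₃ a b c fzero = c
    tri₃ a b c (fsuc fzero) = b
    tri₃ a b c (fsuc (fsuc _)) = a

    trans⊢ : Γ ⊢ ((var {3} 2F ≐ var 1F) ⇒ (var 1F ≐ var 0F) ⇒ (var 2F ≐ var 0F))
    trans⊢ = done (lam (lam (substΔ (var 3F ≐ var fzero) {var 1F} {var 0F} h0 h1)))

    etrans : ∀ {n Δ} {s t u : Term n} → Δ ⊩ s ≐ t → Δ ⊩ t ≐ u → Δ ⊩ s ≐ u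
    etrans {s = s} {t} {u} d e = thm (sub⊢ (tri₃ s t u) trans⊢) $$ d $$ e

    congS⊢ : Γ ⊢ ((x₁ {0} ≐ x₀) ⇒ (`S x₁ ≐ `S x₀))
    congS⊢ = done (lam (substΔ (`S (var 2F) ≐ `S (var fzero)) {x₁} {x₀} h0 (thm (ax (ax-refl _)))))

    ecS : ∀ {n Δ} {s t : Term n} → Δ ⊩ s ≐ t → Δ ⊩ `S s ≐ `S t
    ecS {s = s} {t} d = thm (sub⊢ (sgl s t) congS⊢) $$ d

    congR : ∀ (o : ∀ {n} → Term n → Term n → Term n) →
      (∀ {n m} (σ : Fin n → Term m) s t → subT σ (o s t) ≡ o (subT σ s) (subT σ t)) → ∀ {n Δ} {s t u : Term n} → Δ ⊩ s ≐ t → Δ ⊩ o u s ≐ o u t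
    congR o h {s = s} {t} {u} d = thm (eqn ≈⊢ sub⊢ (tri₃ s t u) (un (lam {Δ = []} {φ = var {3} 2F ≐ var 1F} {ψ = o (var 0F) (var 2F) ≐ o (var 0F) (var 1F)} body))) $$ d
      where
      eqn : (s ≐ t) ⇒ (subT (tri₃ s t u) (o (var 0F) (var 2F)) ≐ subT (tri₃ s t u) (o (var 0F) (var 1F))) ≡ (s ≐ t) ⇒ (o u s ≐ o u t)
      eqn = cong₂ (λ a b → (s ≐ t) ⇒ (a ≐ b)) (h _ _ _) (h _ _ _)
      body : (var {3} 2F ≐ var 1F) ∷ [] ⊩ o (var 0F) (var 2F) ≐ o (var 0F) (var 1F)
      body = nd (cong₂ (λ a b → (var {3} 2F ≐ var 1F) ⇒ (a ≐ b)) (h _ _ _) (h _ _ _) ≈⊢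
               un (substΔ {Δ = (var {3} 2F ≐ var 1F) ∷ []} (o (var 1F) (var 3F) ≐ o (var 1F) (var 0F)) h0
                 (thm (sym (cong₂ _≐_ (h _ _ _) (h _ _ _)) ≈⊢ ax (ax-refl _)))))

    ec+ʳ : ∀ {n Δ} {s t u : Term n} → Δ ⊩ s ≐ t → Δ ⊩ (u `+ s) ≐ (u `+ t)
    ec+ʳ = congR _`+_ (λ _ _ _ → refl)
    ec·ʳ : ∀ {n Δ} {s t u : Term n} → Δ ⊩ s ≐ t → Δ ⊩ (u `· s) ≐ (u `· t)
    ec·ʳ = congR _`·_ (λ _ _ _ → refl)
    ec+ˡ : ∀ {n Δ} {s t u : Term n} → Δ ⊩ s ≐ t → Δ ⊩ (s `+ u) ≐ (t `+ u)
    ec+ˡ = congR (λ a b → b `+ a) (λ _ _ _ → refl)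
    ec·ˡ : ∀ {n Δ} {s t u : Term n} → Δ ⊩ s ≐ t → Δ ⊩ (s `· u) ≐ (t `· u)
    ec·ˡ = congR (λ a b → b `· a) (λ _ _ _ → refl)

open NaturalDeduction

-- Robinson arithmetic: decision of bounded formulas, and Rosser separation

module RobinsonArithmetic where

  num-sub : ∀ {n m} (σ : Fin n → Term m) k → subT σ (num k) ≡ num k
  num-sub σ zero = refl
  num-sub σ (suc k) = cong `S (num-sub σ k)

  num-ren : ∀ {n m} (ρ : Fin n → Fin m) k → renT ρ (num k) ≡ num k
  num-ren ρ zero = refl
  num-ren ρ (suc k) = cong `S (num-ren ρ k)

  -- The smaller term stands on the right of the sum, because addition in Q recurs on its second
  -- argument and commutativity is not among the axioms.
  lt : ∀ {n} → Term n → Term n → Formula n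
  lt s t = ∃' ((`S (var fzero) `+ renT fsuc s) ≐ renT fsuc t)

  sub-ren-lift : ∀ {n m} (σ : Fin n → Term m) t → subT (liftS σ) (renT fsuc t) ≡ renT fsuc (subT σ t)
  sub-ren-lift σ t = trans (subT-renT (liftS σ) fsuc t) (sym (renT-subT fsuc σ t))

  lt-sub : ∀ {n m} (σ : Fin n → Term m) s t → subF σ (lt s t) ≡ lt (subT σ s) (subT σ t)
  lt-sub σ s t = cong₂ (λ a b → ∃' ((`S (var fzero) `+ a) ≐ b)) (sub-ren-lift σ s) (sub-ren-lift σ t)

  single-wk : ∀ {n} (s : Term n) t → subT (single s) (renT fsuc t) ≡ t
  single-wk s t = trans (subT-renT (single s) fsuc t) (subT-id t)

  sub1-sub : ∀ {n m k} (σ : Fin n → Term m) (τ : Fin m → Term k) {υ} (φ : Formula n) → (∀ i → subT τ (σ i) ≡ υ i) → subF τ (subF σ φ) ≡ subF υ φ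
  sub1-sub σ τ φ h = subF-subF h φ

  self : (χ : Formula 1) → χ ⟪ var fzero ⟫ ≡ χ
  self χ = subF-id (λ { fzero → refl }) χ

  tr : ∀ {n} → BF n → Formula n
  tr (beq s t) = s ≐ t
  tr (band φ ψ) = ¬' (tr φ ⇒ ¬' (tr ψ))
  tr (bneg φ) = ¬' (tr φ)
  tr (bex< t φ) = ∃' (¬' (lt (var fzero) (renT fsuc t) ⇒ ¬' (tr φ)))

  nums : ∀ {n} → Vec ℕ n → Fin n → Term 0
  nums xs i = num (lookup xs i)

  module QLogic (Γ : Sentence → Set) (q : ∀ φ → Q φ → Γ φ) where
    open Logic Γ public

    q1 : ∀ {n Δ} (t : Term n) → Δ ⊩ ¬' (`S t ≐ `0)
    q1 t = allE t (thm (hyp (q _ Q1)))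

    open2 : {φ : Formula 2} → Γ ⊢ ∀' (∀' φ) → Γ ⊢ φ
    open2 {φ} d = e ≈⊢ mp (ax (ax-inst _ (var 0F))) (mp (ax (ax-inst _ (var 1F))) (sub⊢ {m = 2} (λ ()) d))
      where
      υ : Fin 2 → Term 3
      υ fzero = var fzero
      υ (fsuc i) = var 2F
      e : subF (single (var 0F)) (subF (liftS (single (var 1F))) (subF (liftS (liftS (λ ()))) φ)) ≡ φ
      e = trans (cong (subF (single (var 0F))) (subF-subF {υ = υ} (λ { fzero → refl ; (fsuc fzero) → refl }) φ))
          (trans (subF-subF {υ = var} (λ { fzero → refl ; (fsuc fzero) → refl }) φ) (subF-id (λ _ → refl) φ))

    q0 : ∀ {φ} → Q φ → Γ ⊢ φ
    q0 {φ} p = closed₀ φ ≈⊢ hyp (q φ p)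

    q2 : ∀ {n Δ} (s t : Term n) → Δ ⊩ (`S s ≐ `S t) ⇒ (s ≐ t)
    q2 s t = thm (sub⊢ (sgl s t) (open2 (q0 Q2)))

    q3 : ∀ {n Δ} (t : Term n) → Δ ⊩ (t ≐ `0) ∨' ∃' (renT fsuc t ≐ `S (var fzero))
    q3 t = allE t (thm (hyp (q _ Q3)))

    q4 : ∀ {n Δ} (t : Term n) → Δ ⊩ (t `+ `0) ≐ t
    q4 t = allE t (thm (hyp (q _ Q4)))

    q5 : ∀ {n Δ} (s t : Term n) → Δ ⊩ (s `+ `S t) ≐ `S (s `+ t)
    q5 s t = thm (sub⊢ (sgl s t) (open2 (q0 Q5)))

    q6 : ∀ {n Δ} (t : Term n) → Δ ⊩ (t `· `0) ≐ `0
    q6 t = allE t (thm (hyp (q _ Q6)))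

    q7 : ∀ {n Δ} (s t : Term n) → Δ ⊩ (s `· `S t) ≐ ((s `· t) `+ s)
    q7 s t = thm (sub⊢ (sgl s t) (open2 (q0 Q7)))

    cast : ∀ {n Δ} {φ ψ : Formula n} → φ ≡ ψ → Δ ⊩ φ → Δ ⊩ ψ
    cast refl d = d

    num-add : ∀ a b → [] ⊩ (num a `+ num b) ≐ num {0} (a + b)
    num-add a zero = cast (cong (λ z → (num a `+ `0) ≐ num z) (sym (+-identityʳ a))) (q4 _)
    num-add a (suc b) = cast (cong (λ z → (num a `+ `S (num b)) ≐ num z) (sym (+-suc a b)))
      (etrans (q5 _ _) (ecS (num-add a b)))

    num-mul : ∀ a b → [] ⊩ (num a `· num b) ≐ num {0} (a * b)
    num-mul a zero = cast (cong (λ z → (num a `· `0) ≐ num z) (sym (*-zeroʳ a))) (q6 _)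
    num-mul a (suc b) = cast (cong (λ z → (num a `· `S (num b)) ≐ num z) (trans (+-comm (a * b) a) (sym (*-suc a b))))
      (etrans (q7 _ _) (etrans (ec+ˡ (num-mul a b)) (num-add (a * b) a)))

    eval⊢ : ∀ {n} (t : Term n) xs → [] ⊩ subT (nums xs) t ≐ num (ev t xs)
    eval⊢ (var i) xs = thm (ax (ax-refl _))
    eval⊢ `0 xs = thm (ax (ax-refl _))
    eval⊢ (`S t) xs = ecS (eval⊢ t xs)
    eval⊢ (s `+ t) xs = etrans (ec+ˡ (eval⊢ s xs)) (etrans (ec+ʳ (eval⊢ t xs)) (num-add _ _))
    eval⊢ (s `· t) xs = etrans (ec·ˡ (eval⊢ s xs)) (etrans (ec·ʳ (eval⊢ t xs)) (num-mul _ _))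

    num≢ : ∀ a b → ¬ a ≡ b → [] ⊩ ¬' (num {0} a ≐ num b)
    num≢ zero zero h = ⊥-elim (h refl)
    num≢ zero (suc b) h = lam (q1 _ $$ esym h0)
    num≢ (suc a) zero h = q1 _
    num≢ (suc a) (suc b) h = lam (up (num≢ a b (λ e → h (cong suc e))) $$ (q2 _ _ $$ h0))

    leib : ∀ {n Δ} (χ : Formula 1) {s t : Term n} → Δ ⊩ s ≐ t → Δ ⊩ χ ⟪ s ⟫ → Δ ⊩ χ ⟪ t ⟫
    leib χ {s} {t} d e = subst (_ ⊩_) (sub1-sub _ _ χ (λ _ → refl))
      (substΔ (χ ⟪ var fzero ⟫) {s} {t} d (subst (_ ⊩_) (sym (sub1-sub _ _ χ (λ _ → refl))) e))

    ¬lt0 : Γ ⊢ (lt (var {1} 0F) `0 ⇒ `⊥)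
    ¬lt0 = done (lam (exE h0 (orE (q3 (var 1F))
      (lam (q1 (var 0F) $$ etrans (esym (q4 _)) (etrans (ec+ʳ (esym h0)) h1)))
      (lam (exE h0 (q1 (`S (var 1F) `+ var 0F) $$ etrans (esym (q5 _ _)) (etrans (ec+ʳ (esym h0)) h2)))))))

    zero-lt : Γ ⊢ ((x₁ ≐ `0) ⇒ lt (x₁ {0}) (`S x₀))
    zero-lt = done (lam (exI (var 0F) (etrans (ec+ʳ h0) (q4 _))))

    lt-down : Γ ⊢ ((var {3} 2F ≐ `S (var 1F)) ⇒ lt (var 2F) (`S (var 0F)) ⇒ lt (var 1F) (var 0F))
    lt-down = done (lam (lam (exE h0 (exI (var 0F) (q2 _ _ $$ etrans (esym (q5 _ _)) (etrans (ec+ʳ (esym h2)) h0))))))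

    lt-up : Γ ⊢ ((var {3} 2F ≐ `S (var 1F)) ⇒ lt (var 1F) (var 0F) ⇒ lt (var 2F) (`S (var 0F)))
    lt-up = done (lam (lam (exE h0 (exI (var 0F) (etrans (ec+ʳ h2) (etrans (q5 _ _) (ecS h0)))))))

    lt-up' : Γ ⊢ ((var {3} 2F ≐ `S (var 1F)) ⇒ lt (var 0F) (`S (var 1F)) ⇒ lt (`S (var 0F)) (`S (var 2F)))
    lt-up' = done (lam (lam (exE h0 (exI (var 0F) (etrans (q5 _ _) (ecS (etrans h0 (esym h2))))))))

    lt-resp : Γ ⊢ ((var {3} 2F ≐ var 1F) ⇒ lt (var 0F) (var 2F) ⇒ lt (var 0F) (var 1F))
    lt-resp = done (lam (lam (exE h0 (exI (var 0F) (etrans h0 h2)))))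

    -- External induction on the numeral: by Q3 the variable is zero or a successor, and in the
    -- second case the claim for N applies to the shifted formula χ(S x).
    bounded : ∀ N (χ : Formula 1) → (∀ k → k < N → Γ ⊢ (χ ⟪ num {0} k ⟫)) → Γ ⊢ (lt (var {1} 0F) (num N) ⇒ χ)
    bounded zero χ _ = done (lam (efq (thm ¬lt0 $$ h0)))
    bounded (suc N) χ h = done (lam (orE (q3 (var 0F)) (lam base) (lam (exE h0 step))))
      where
      Δ₁ : List (Formula 1)
      Δ₁ = lt (var 0F) (num (suc N)) ∷ []
      base : (var 0F ≐ `0) ∷ Δ₁ ⊩ χ
      base = cast (self χ) (leib χ (esym h0) (thm (sub1-sub _ _ χ (λ _ → refl) ≈⊢ sub⊢ {m = 1} (λ ()) (h 0 (s≤s z≤n)))))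
      χ' : Formula 1
      χ' = χ ⟪ `S (var 0F) ⟫
      ih : Γ ⊢ (lt (var {1} 0F) (num N) ⇒ χ')
      ih = bounded N χ' (λ k k< → sym (sub1-sub _ _ χ (λ _ → refl)) ≈⊢ h (suc k) (s≤s k<))
      ih₂ : Γ ⊢ (lt (var {2} 0F) (num N) ⇒ χ ⟪ `S (var 0F) ⟫)
      ih₂ = cong₂ _⇒_ (trans (lt-sub _ (var 0F) (num N)) (cong (lt (var 0F)) (num-sub _ N))) (sub1-sub _ _ χ (λ _ → refl)) ≈⊢ sub⊢ (λ _ → var 0F) ih
      Δ₂ : List (Formula 2)
      Δ₂ = (var 1F ≐ `S (var 0F)) ∷ map wk (∃' (renT fsuc (var 0F) ≐ `S (var fzero)) ∷ Δ₁)
      wklt : wk (lt (var 0F) (num (suc N))) ≡ lt (var {2} 1F) (`S (num N))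
      wklt = trans (renF-sub fsuc (lt (var 0F) (num (suc N)))) (trans (lt-sub _ (var 0F) (num (suc N))) (cong (λ z → lt (var 1F) (`S z)) (num-sub _ N)))
      step : Δ₂ ⊩ wk χ
      step = subst (Δ₂ ⊩_) (trans (subF-ext (λ { fzero → refl }) χ) (sym (renF-sub fsuc χ)))
        (leib χ {`S (var 0F)} {var 1F} (esym h0) (thm ih₂ $$ (thm (sub⊢ (tri₃ (var 1F) (var 0F) (num N)) lt-down) $$ h0 $$ subst (Δ₂ ⊩_) wklt h2)))

    -- Q has no induction, but comparison with a numeral needs only the external one, with Q3 for
    -- the case distinction.
    trichotomy : ∀ N → Γ ⊢ (lt (var {1} 0F) (num N) ∨' lt (num N) (`S (var 0F)))
    trichotomy zero = done (orR (exI (var 0F) (q4 _)))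
    trichotomy (suc N) = done (orE (q3 (var 0F))
        (lam (orL (thm (sub⊢ (sgl (var 0F) (num N)) zero-lt) $$ h0)))
        (lam (exE h0 step)))
      where
      Δ₂ : List (Formula 2)
      Δ₂ = (var 1F ≐ `S (var 0F)) ∷ wk (∃' (renT {n = 1} fsuc (var 0F) ≐ `S (var fzero))) ∷ []
      ih₂ : Γ ⊢ (lt (var {2} 0F) (num N) ∨' lt (num N) (`S (var 0F)))
      ih₂ = cong₂ _∨'_ (trans (lt-sub (λ _ → var 0F) (var 0F) (num N)) (cong (lt (var 0F)) (num-sub _ N)))
                       (trans (lt-sub (λ _ → var 0F) (num N) (`S (var 0F))) (cong (λ z → lt z (`S (var 0F))) (num-sub _ N)))
            ≈⊢ sub⊢ (λ _ → var 0F) (trichotomy N)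
      goal : lt (var {2} 1F) (`S (num N)) ∨' lt (`S (num N)) (`S (var 1F)) ≡ wk (lt (var 0F) (num (suc N)) ∨' lt (num (suc N)) (`S (var 0F)))
      goal = sym (trans (renF-sub fsuc (lt (var 0F) (num (suc N)) ∨' lt (num (suc N)) (`S (var 0F))))
        (cong₂ _∨'_ (trans (lt-sub _ (var 0F) (num (suc N))) (cong (λ z → lt (var 1F) (`S z)) (num-sub _ N)))
                    (trans (lt-sub _ (num (suc N)) (`S (var 0F))) (cong (λ z → lt (`S z) (`S (var 1F))) (num-sub _ N)))))
      step : Δ₂ ⊩ wk (lt (var 0F) (num (suc N)) ∨' lt (num (suc N)) (`S (var 0F)))
      step = subst (Δ₂ ⊩_) goal (orE (thm ih₂)
        (lam (orL (thm (sub⊢ (tri₃ (var 1F) (var 0F) (num N)) lt-up) $$ h1 $$ h0)))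
        (lam (orR (thm (sub⊢ (tri₃ (var 1F) (var 0F) (num N)) lt-up') $$ h1 $$ h0))))

    lt-num : ∀ k N (τ : Term 0) → k < N → [] ⊩ τ ≐ num N → [] ⊩ lt (num k) τ
    lt-num k N τ k<N e = exI (num (N ∸ suc k)) (subst ([] ⊩_) (sym (cong₂ (λ a b → (`S (num (N ∸ suc k)) `+ a) ≐ b) (single-wk _ (num k)) (single-wk _ τ)))
      (etrans (subst (λ z → [] ⊩ (`S (num (N ∸ suc k)) `+ num k) ≐ num z) (trans (sym (+-suc (N ∸ suc k) k)) (m∸n+n≡m k<N)) (num-add (suc (N ∸ suc k)) k)) (esym e)))

    -- A false bounded existential is refuted by `bounded` from the refutations of its finitely many
    -- instances, after the bounding term has been replaced by its numeral value.
    decide : ∀ {n} (φ : BF n) xs → (B⟦ φ ⟧ xs → [] ⊩ subF (nums xs) (tr φ)) × (¬ B⟦ φ ⟧ xs → [] ⊩ ¬' (subF (nums xs) (tr φ)))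
    decide (beq s t) xs =
      (λ e → etrans (eval⊢ s xs) (subst (λ z → [] ⊩ num z ≐ subT (nums xs) t) (sym e) (esym (eval⊢ t xs)))) ,
      (λ ne → lam (up (num≢ _ _ ne) $$ etrans (esym (up (eval⊢ s xs))) (etrans h0 (up (eval⊢ t xs)))))
    decide (band φ ψ) xs =
      (λ { (p , p') → conj (proj₁ (decide φ xs) p) (proj₁ (decide ψ xs) p') }) ,
      (λ n → go n (bdec φ xs))
      where
      go : ¬ (B⟦ φ ⟧ xs × B⟦ ψ ⟧ xs) → Dec (B⟦ φ ⟧ xs) → [] ⊩ ¬' (subF (nums xs) (tr φ) ∧' subF (nums xs) (tr ψ))
      go n (no np) = lam (up (proj₂ (decide φ xs) np) $$ fst h0)
      go n (yes p) = lam (up (proj₂ (decide ψ xs) (λ p' → n (p , p'))) $$ snd {φ = subF (nums xs) (tr φ)} h0)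
    decide (bneg φ) xs = proj₂ (decide φ xs) , (λ n → go n (bdec φ xs))
      where
      go : ¬ ¬ B⟦ φ ⟧ xs → Dec (B⟦ φ ⟧ xs) → [] ⊩ ¬' (¬' (subF (nums xs) (tr φ)))
      go n (yes p) = lam (h0 $$ up (proj₁ (decide φ xs) p))
      go n (no np) = ⊥-elim (n np)
    decide (bex< t φ) xs = subst (λ z → (B⟦ bex< t φ ⟧ xs → [] ⊩ ∃' z) × (¬ B⟦ bex< t φ ⟧ xs → [] ⊩ ¬' (∃' z))) (sym eqn) (pos , neg')
      where
      χ : Formula 1
      χ = subF (liftS (nums xs)) (tr φ)
      τ : Term 0
      τ = subT (nums xs) t
      eqn : subF (liftS (nums xs)) (¬' (lt (var fzero) (renT fsuc t) ⇒ ¬' (tr φ))) ≡ lt (var fzero) (renT fsuc τ) ∧' χ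
      eqn = cong (λ z → z ∧' χ) (trans (lt-sub (liftS (nums xs)) (var fzero) (renT fsuc t)) (cong (lt (var fzero)) (sub-ren-lift (nums xs) t)))
      χk : ∀ k → χ ⟪ num {0} k ⟫ ≡ subF (nums (k ∷ xs)) (tr φ)
      χk k = subF-subF (λ { fzero → refl ; (fsuc i) → trans (subT-renT _ fsuc (num (lookup xs i))) (num-sub _ (lookup xs i)) }) (tr φ)
      χ[k] : ∀ k → χ [ num k ] ≡ χ ⟪ num {0} k ⟫
      χ[k] k = subF-ext (λ { fzero → refl }) χ
      pos : B⟦ bex< t φ ⟧ xs → [] ⊩ ∃' (lt (var fzero) (renT fsuc τ) ∧' χ)
      pos (k , k< , p) = exI (num k) (subst ([] ⊩_) (sym (cong₂ _∧'_ (trans (lt-sub _ (var fzero) (renT fsuc τ)) (cong (lt (num k)) (single-wk _ τ))) (trans (χ[k] k) (χk k))))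
        (conj (lt-num k _ τ k< (eval⊢ t xs)) (proj₁ (decide φ (k ∷ xs)) p)))
      cases : ¬ B⟦ bex< t φ ⟧ xs → Γ ⊢ (lt (var {1} 0F) (num (ev t xs)) ⇒ ¬' χ)
      cases n = bounded (ev t xs) (¬' χ) (λ k k< → cong ¬' (sym (χk k)) ≈⊢ done (proj₂ (decide φ (k ∷ xs)) (λ p → n (k , k< , p))))
      neg' : ¬ B⟦ bex< t φ ⟧ xs → [] ⊩ ¬' (∃' (lt (var fzero) (renT fsuc τ) ∧' χ))
      neg' n = lam (exE h0 (thm (cases n) $$ (thm (sub⊢ (tri₃ (renT fsuc τ) (num (ev t xs)) (var 0F)) lt-resp) $$ thm τe $$ fst h0) $$ snd {φ = lt (var fzero) (renT fsuc τ)} h0))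
        where
        τe : Γ ⊢ (renT fsuc τ ≐ num (ev t xs))
        τe = cong₂ _≐_ (sym (renT-sub fsuc τ)) (num-sub _ (ev t xs)) ≈⊢ sub⊢ (λ i → var (fsuc i)) (done (eval⊢ t xs))

  vn : ∀ {n} → Term n → ℕ → Fin 2 → Term n
  vn t k fzero = t
  vn t k (fsuc _) = num k

  -- Rosser's separation: the formula asserts that A is witnessed before B.
  module Separation (A B : AF false 1) where

    sepBody : Formula 2
    sepBody = ¬' (tr (nf A) ⇒ ¬' (∀' (lt (var 0F) (`S (var 1F)) ⇒ ¬' (renF (λ { fzero → 0F ; (fsuc i) → 2F }) (tr (nf B))))))

    sepF : Formula 1
    sepF = ∃' sepBody

    module _ (Γ : Sentence → Set) (q : ∀ φ → Q φ → Γ φ) where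
      open QLogic Γ q

      private
        χB : ℕ → Formula 1
        χB n = ¬' (subF (vn (var 0F) n) (tr (nf B)))

        χA : ℕ → Formula 1
        χA n = subF (vn (var 0F) n) (tr (nf A))

        χB-k : ∀ n k → χB n ⟪ num {0} k ⟫ ≡ ¬' (subF (nums (k ∷ n ∷ [])) (tr (nf B)))
        χB-k n k = cong ¬' (subF-subF (λ { fzero → refl ; (fsuc fzero) → num-sub _ n }) (tr (nf B)))

        χA-k : ∀ n k → χA n ⟪ num {0} k ⟫ ≡ subF (nums (k ∷ n ∷ [])) (tr (nf A))
        χA-k n k = subF-subF (λ { fzero → refl ; (fsuc fzero) → num-sub _ n }) (tr (nf A))

        body : ∀ n → subF (liftS (λ _ → num {0} n)) sepBody ≡ χA n ∧' ∀' (lt (var 0F) (`S (var 1F)) ⇒ χB n ⟪ var 0F ⟫)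
        body n = cong₂ (λ a b → a ∧' ∀' (lt (var 0F) (`S (var 1F)) ⇒ ¬' b))
          (subF-ext (λ { fzero → refl ; (fsuc fzero) → num-ren fsuc n }) (tr (nf A)))
          (trans (subF-renF {υ = vn (var 0F) n} (λ { fzero → refl ; (fsuc fzero) → trans (cong (renT fsuc) (num-ren fsuc n)) (num-ren fsuc n) }) (tr (nf B)))
                 (sym (subF-subF (λ { fzero → refl ; (fsuc fzero) → num-sub _ n }) (tr (nf B)))))

      sep-pos : ∀ n w → B⟦ nf A ⟧ (w ∷ n ∷ []) → (∀ k → k < suc w → ¬ B⟦ nf B ⟧ (k ∷ n ∷ [])) → Γ ⊢ (sepF ⟪ num {0} n ⟫)
      sep-pos n w a b = done (subst (λ z → [] ⊩ ∃' z) (sym (body n)) (exI (num w) (subst ([] ⊩_) (sym eqn)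
          (conj (proj₁ (decide (nf A) (w ∷ n ∷ [])) a) (allI (thm all))))))
        where
        all : Γ ⊢ (lt (var {1} 0F) (num (suc w)) ⇒ χB n)
        all = bounded (suc w) (χB n) (λ k k< → sym (χB-k n k) ≈⊢ done (proj₂ (decide (nf B) (k ∷ n ∷ [])) (b k k<)))
        eqn : (χA n ∧' ∀' (lt (var 0F) (`S (var 1F)) ⇒ χB n ⟪ var 0F ⟫)) [ num w ] ≡ subF (nums (w ∷ n ∷ [])) (tr (nf A)) ∧' ∀' (lt (var {1} 0F) (num (suc w)) ⇒ χB n)
        eqn = cong₂ _∧'_ (trans (subF-ext (λ { fzero → refl }) (χA n)) (χA-k n w))
          (cong₂ (λ a b → ∀' (a ⇒ b)) (trans (lt-sub (liftS (single (num w))) (var 0F) (`S (var 1F))) (cong (λ z → lt (var 0F) (`S z)) (num-ren fsuc w)))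
             (trans (subF-subF {υ = λ _ → var 0F} (λ _ → refl) (χB n)) (self (χB n))))

      -- A supposed witness of A lies below w, where every candidate is refuted, or it is at least
      -- w, and then the witness w of B violates the second conjunct. This is why A must fail
      -- strictly below w, whereas `sep-pos` needs B to fail up to and including w.
      sep-neg : ∀ n w → B⟦ nf B ⟧ (w ∷ n ∷ []) → (∀ k → k < w → ¬ B⟦ nf A ⟧ (k ∷ n ∷ [])) → Γ ⊢ ¬' (sepF ⟪ num {0} n ⟫)
      sep-neg n w b a = done (subst (λ z → [] ⊩ ¬' (∃' z)) (sym (body n)) (lam (exE h0 (orE (thm (trichotomy w))
          (lam (thm noA $$ h0 $$ fst h1))
          (lam (thm yesB' $$' (allE (num w) (snd {φ = χA n} h1) $$'' h0)))))))
        where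
        noA : Γ ⊢ (lt (var {1} 0F) (num w) ⇒ ¬' (χA n))
        noA = bounded w (¬' (χA n)) (λ k k< → cong ¬' (sym (χA-k n k)) ≈⊢ done (proj₂ (decide (nf A) (k ∷ n ∷ [])) (a k k<)))
        Δ : List (Formula 1)
        Δ = lt (num w) (`S (var 0F)) ∷ (χA n ∧' ∀' (lt (var 0F) (`S (var 1F)) ⇒ χB n ⟪ var 0F ⟫)) ∷ map wk (∃' (χA n ∧' ∀' (lt (var 0F) (`S (var 1F)) ⇒ χB n ⟪ var 0F ⟫)) ∷ [])
        bw : Formula 1
        bw = subF (vn (num w) n) (tr (nf B))
        yesB' : Γ ⊢ bw
        yesB' = subF-subF (λ { fzero → num-sub _ w ; (fsuc fzero) → num-sub _ n }) (tr (nf B)) ≈⊢ sub⊢ (λ ()) (done (proj₁ (decide (nf B) (w ∷ n ∷ [])) b))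
        _$$''_ : Δ ⊩ (lt (var 0F) (`S (var 1F)) ⇒ χB n ⟪ var 0F ⟫) [ num w ] → Δ ⊩ lt (num w) (`S (var 0F)) → Δ ⊩ ¬' bw
        d $$'' e = subst (Δ ⊩_) (cong₂ _⇒_ (lt-sub (single (num w)) (var 0F) (`S (var 1F))) (cong ¬' (trans (subF-subF {υ = λ _ → num w} (λ _ → refl) (subF (vn (var 0F) n) (tr (nf B))))
             (subF-subF (λ { fzero → refl ; (fsuc fzero) → num-sub _ n }) (tr (nf B)))))) d $$ e
        _$$'_ : Δ ⊩ bw → Δ ⊩ ¬' bw → Δ ⊩ `⊥
        d $$' e = e $$ d

      -- A and B are not assumed to be disjoint. If B is witnessed no later than A, then B itself is
      -- returned, and in each application this alternative is either absurd or equally useful.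
      sep₁ : ∀ n → ⟦ A ⟧ (n ∷ []) → Γ ⊢ (sepF ⟪ num {0} n ⟫) ⊎ ⟦ B ⟧ (n ∷ [])
      sep₁ n a with proj₁ (nf-sem A (n ∷ [])) a
      ... | w , p with any<? (λ k → bdec (nf B) (k ∷ n ∷ [])) (suc w)
      ...   | yes (k , _ , b) = inj₂ (proj₂ (nf-sem B (n ∷ [])) (k , b))
      ...   | no nb = inj₁ (sep-pos n w p (λ k k< b → nb (k , k< , b)))

      sep₂ : ∀ n → ⟦ B ⟧ (n ∷ []) → Γ ⊢ ¬' (sepF ⟪ num {0} n ⟫) ⊎ ⟦ A ⟧ (n ∷ [])
      sep₂ n b with proj₁ (nf-sem B (n ∷ [])) b
      ... | w , p with any<? (λ k → bdec (nf A) (k ∷ n ∷ [])) w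
      ...   | yes (k , _ , a) = inj₂ (proj₂ (nf-sem A (n ∷ [])) (k , a))
      ...   | no na = inj₁ (sep-neg n w p (λ k k< a → na (k , k< , a)))

    abstract
      separator : Formula 1
      separator = sepF

      separator-pos : (Γ : Sentence → Set) → (∀ φ → Q φ → Γ φ) → ∀ n → ⟦ A ⟧ (n ∷ []) → Γ ⊢ (separator ⟪ num {0} n ⟫) ⊎ ⟦ B ⟧ (n ∷ [])
      separator-pos = sep₁

      separator-neg : (Γ : Sentence → Set) → (∀ φ → Q φ → Γ φ) → ∀ n → ⟦ B ⟧ (n ∷ []) → Γ ⊢ ¬' (separator ⟪ num {0} n ⟫) ⊎ ⟦ A ⟧ (n ∷ [])
      separator-neg = sep₂

open RobinsonArithmetic

-- Arithmetisation of terms, formulas, weakening and substitution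

module SyntaxCodes where

  tagT restT : ∀ {n} → Term n → ℕ
  tagT (var i) = 0
  tagT `0 = 1
  tagT (`S t) = 2
  tagT (s `+ t) = 3
  tagT (s `· t) = 4
  restT (var i) = toℕ i
  restT `0 = 0
  restT (`S t) = cdT t
  restT (s `+ t) = ⌊ cdT s , cdT t ⌋
  restT (s `· t) = ⌊ cdT s , cdT t ⌋

  tagF restF : ∀ {n} → Formula n → ℕ
  tagF `⊥ = 0
  tagF (s ≐ t) = 1
  tagF (φ ⇒ ψ) = 2
  tagF (∀' φ) = 3
  restF `⊥ = 0
  restF (s ≐ t) = ⌊ cdT s , cdT t ⌋
  restF (φ ⇒ ψ) = ⌊ cdF φ , cdF ψ ⌋
  restF (∀' φ) = cdF φ

  codeT-split : ∀ {n} (t : Term n) → cdT t ≡ ⌊ tagT t , restT t ⌋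
  codeT-split (var i) = refl
  codeT-split `0 = refl
  codeT-split (`S t) = refl
  codeT-split (s `+ t) = refl
  codeT-split (s `· t) = refl

  codeF-split : ∀ {n} (φ : Formula n) → cdF φ ≡ ⌊ tagF φ , restF φ ⌋
  codeF-split `⊥ = refl
  codeF-split (s ≐ t) = refl
  codeF-split (φ ⇒ ψ) = refl
  codeF-split (∀' φ) = refl

  splitT : ∀ {n} (t : Term n) {g x} → cdT t ≡ ⌊ g , x ⌋ → tagT t ≡ g × restT t ≡ x
  splitT t {g} {x} e = pair-inj {tagT t} {restT t} {g} {x} (trans (sym (codeT-split t)) e)

  splitF : ∀ {n} (φ : Formula n) {g x} → cdF φ ≡ ⌊ g , x ⌋ → tagF φ ≡ g × restF φ ≡ x
  splitF φ {g} {x} e = pair-inj {tagF φ} {restF φ} {g} {x} (trans (sym (codeF-split φ)) e)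

  pinj : ∀ a b {c d} → ⌊ a , b ⌋ ≡ ⌊ c , d ⌋ → a ≡ c × b ≡ d
  pinj a b {c} {d} = pair-inj {a} {b} {c} {d}

  codeT-inj : ∀ {n} (s t : Term n) → cdT s ≡ cdT t → s ≡ t
  codeT-inj s t e = go s t (splitT s (trans e (codeT-split t)))
    where
    go : ∀ {n} (s t : Term n) → tagT s ≡ tagT t × restT s ≡ restT t → s ≡ t
    go (var i) (var j) (_ , q) = cong var (toℕ-injective q)
    go `0 `0 _ = refl
    go (`S s) (`S t) (_ , q) = cong `S (codeT-inj s t q)
    go (s `+ s') (t `+ t') (_ , q) with pinj (cdT s) (cdT s') {cdT t} {cdT t'} q
    ... | a , b = cong₂ _`+_ (codeT-inj s t a) (codeT-inj s' t' b)
    go (s `· s') (t `· t') (_ , q) with pinj (cdT s) (cdT s') {cdT t} {cdT t'} q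
    ... | a , b = cong₂ _`·_ (codeT-inj s t a) (codeT-inj s' t' b)

  codeF-inj : ∀ {n} (φ ψ : Formula n) → cdF φ ≡ cdF ψ → φ ≡ ψ
  codeF-inj φ ψ e = go φ ψ (splitF φ (trans e (codeF-split ψ)))
    where
    go : ∀ {n} (φ ψ : Formula n) → tagF φ ≡ tagF ψ × restF φ ≡ restF ψ → φ ≡ ψ
    go `⊥ `⊥ _ = refl
    go (s ≐ s') (t ≐ t') (_ , q) with pinj (cdT s) (cdT s') {cdT t} {cdT t'} q
    ... | a , b = cong₂ _≐_ (codeT-inj s t a) (codeT-inj s' t' b)
    go (φ ⇒ φ') (ψ ⇒ ψ') (_ , q) with pinj (cdF φ) (cdF φ') {cdF ψ} {cdF ψ'} q
    ... | a , b = cong₂ _⇒_ (codeF-inj φ ψ a) (codeF-inj φ' ψ' b)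
    go (∀' φ) (∀' ψ) (_ , q) = cong ∀' (codeF-inj φ ψ q)

  cV cS cA : ∀ {n} → XT n → XT n
  cV t = xp (xn 0) t
  cS t = xp (xn 2) t
  cA t = xp (xn 3) t

  c0 cBot : ∀ {n} → XT n
  c0 = xp (xn 1) (xn 0)
  cBot = xp (xn 0) (xn 0)

  c+ c· cE c⇒ : ∀ {n} → XT n → XT n → XT n
  c+ s t = xp (xn 3) (xp s t)
  c· s t = xp (xn 4) (xp s t)
  cE s t = xp (xn 1) (xp s t)
  c⇒ s t = xp (xn 2) (xp s t)

  ok : ∀ {b n} → XF b n
  ok = xeq (xn 0) (xn 0)

  4F : ∀ {n} → Fin (suc (suc (suc (suc (suc n)))))
  4F = fsuc 3F
  5F : ∀ {n} → Fin (suc (suc (suc (suc (suc (suc n))))))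
  5F = fsuc 4F

  IsTm IsFm : ℕ → ℕ → Set
  IsTm n k = Σ (Term n) λ t → cdT t ≡ k
  IsFm n k = Σ (Formula n) λ φ → cdF φ ≡ k

  rel₂ : (ℕ → ℕ → Set) → Vec ℕ 2 → Set
  rel₂ R (a ∷ b ∷ []) = R a b

  rel₃ : (ℕ → ℕ → ℕ → Set) → Vec ℕ 3 → Set
  rel₃ R (a ∷ b ∷ c ∷ []) = R a b c

  -- Facts carry the number of free variables, since a code does not determine the context of the
  -- term.
  tmProg : Program false
  tmProg = clause 2 (xlt (xv 1F) (xv 0F)) [] (xp (xv 0F) (cV (xv 1F)))
         ∷ clause 1 ok [] (xp (xv 0F) c0)
         ∷ clause 2 ok (xp (xv 0F) (xv 1F) ∷ []) (xp (xv 0F) (cS (xv 1F)))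
         ∷ clause 3 ok (xp (xv 0F) (xv 1F) ∷ xp (xv 0F) (xv 2F) ∷ []) (xp (xv 0F) (c+ (xv 1F) (xv 2F)))
         ∷ clause 3 ok (xp (xv 0F) (xv 1F) ∷ xp (xv 0F) (xv 2F) ∷ []) (xp (xv 0F) (c· (xv 1F) (xv 2F)))
         ∷ []

  tm-complete : ∀ {n} (t : Term n) → Der tmProg ⌊ n , cdT t ⌋
  tm-complete {n} (var i) = der 0F (n ∷ toℕ i ∷ []) (toℕ<n i) tt refl
  tm-complete {n} `0 = der 1F (n ∷ []) refl tt refl
  tm-complete {n} (`S t) = der 2F (n ∷ cdT t ∷ []) refl (tm-complete t) refl
  tm-complete {n} (s `+ t) = der 3F (n ∷ cdT s ∷ cdT t ∷ []) refl (tm-complete s , tm-complete t) refl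
  tm-complete {n} (s `· t) = der 4F (n ∷ cdT s ∷ cdT t ∷ []) refl (tm-complete s , tm-complete t) refl

  TmMeaning FmMeaning : ℕ → Set
  TmMeaning f = ∀ n k → f ≡ ⌊ n , k ⌋ → IsTm n k
  FmMeaning f = ∀ n k → f ≡ ⌊ n , k ⌋ → IsFm n k

  tm-sound : ∀ {f} → Der tmProg f → TmMeaning f
  tm-sound = foldDer tmProg TmMeaning step
    where
    step : ∀ i e → X⟦ side (llookup tmProg i) ⟧ e → AllP (λ f → Der tmProg f × TmMeaning f) (prems (llookup tmProg i)) e → TmMeaning (xev (concl (llookup tmProg i)) e)
    step fzero (n ∷ i ∷ []) l _ n' k' e with pinj n _ {n'} {k'} e
    ... | refl , q = var (fromℕ< l) , trans (cong ⌊ 0 ,_⌋ (toℕ-fromℕ< l)) q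
    step (fsuc fzero) (n ∷ []) _ _ n' k' e with pinj n _ {n'} {k'} e
    ... | refl , q = `0 , q
    step (fsuc (fsuc fzero)) (n ∷ k ∷ []) _ (_ , ih) n' k' e with pinj n _ {n'} {k'} e | ih n k refl
    ... | refl , q | t , refl = `S t , q
    step (fsuc (fsuc (fsuc fzero))) (n ∷ k ∷ l ∷ []) _ ((_ , ih) , (_ , ih')) n' k' e with pinj n _ {n'} {k'} e | ih n k refl | ih' n l refl
    ... | refl , q | s , refl | t , refl = (s `+ t) , q
    step (fsuc (fsuc (fsuc (fsuc fzero)))) (n ∷ k ∷ l ∷ []) _ ((_ , ih) , (_ , ih')) n' k' e with pinj n _ {n'} {k'} e | ih n k refl | ih' n l refl
    ... | refl , q | s , refl | t , refl = (s `· t) , q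

  abstract
    tmD : Def false (rel₂ IsTm)
    tmD = defP (at (derD tmProg) (xp (xv 0F) (xv 1F) ∷ []))
      λ { (n ∷ k ∷ []) → (λ { (t , refl) → tm-complete t }) , (λ d → tm-sound d n k refl) }

  fmProg : Program false
  fmProg = clause 1 ok [] (xp (xv 0F) cBot)
         ∷ clause 3 (xand (at tmD (xv 0F ∷ xv 1F ∷ [])) (at tmD (xv 0F ∷ xv 2F ∷ []))) [] (xp (xv 0F) (cE (xv 1F) (xv 2F)))
         ∷ clause 3 ok (xp (xv 0F) (xv 1F) ∷ xp (xv 0F) (xv 2F) ∷ []) (xp (xv 0F) (c⇒ (xv 1F) (xv 2F)))
         ∷ clause 2 ok (xp (xsu (xv 0F)) (xv 1F) ∷ []) (xp (xv 0F) (cA (xv 1F)))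
         ∷ []

  fm-complete : ∀ {n} (φ : Formula n) → Der fmProg ⌊ n , cdF φ ⌋
  fm-complete {n} `⊥ = der 0F (n ∷ []) refl tt refl
  fm-complete {n} (s ≐ t) = der 1F (n ∷ cdT s ∷ cdT t ∷ []) ((s , refl) , (t , refl)) tt refl
  fm-complete {n} (φ ⇒ ψ) = der 2F (n ∷ cdF φ ∷ cdF ψ ∷ []) refl (fm-complete φ , fm-complete ψ) refl
  fm-complete {n} (∀' φ) = der 3F (n ∷ cdF φ ∷ []) refl (fm-complete φ) refl

  fm-sound : ∀ {f} → Der fmProg f → FmMeaning f
  fm-sound = foldDer fmProg FmMeaning step
    where
    step : ∀ i e → X⟦ side (llookup fmProg i) ⟧ e → AllP (λ f → Der fmProg f × FmMeaning f) (prems (llookup fmProg i)) e → FmMeaning (xev (concl (llookup fmProg i)) e)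
    step fzero (n ∷ []) _ _ n' k' e with pinj n _ {n'} {k'} e
    ... | refl , q = `⊥ , q
    step (fsuc fzero) (n ∷ k ∷ l ∷ []) ((s , refl) , (t , refl)) _ n' k' e with pinj n _ {n'} {k'} e
    ... | refl , q = (s ≐ t) , q
    step (fsuc (fsuc fzero)) (n ∷ k ∷ l ∷ []) _ ((_ , ih) , (_ , ih')) n' k' e with pinj n _ {n'} {k'} e | ih n k refl | ih' n l refl
    ... | refl , q | s , refl | t , refl = (s ⇒ t) , q
    step (fsuc (fsuc (fsuc fzero))) (n ∷ k ∷ []) _ (_ , ih) n' k' e with pinj n _ {n'} {k'} e | ih (suc n) k refl
    ... | refl , q | s , refl = ∀' s , q

  abstract
    fmD : Def false (rel₂ IsFm)
    fmD = defP (at (derD fmProg) (xp (xv 0F) (xv 1F) ∷ []))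
      λ { (n ∷ k ∷ []) → (λ { (t , refl) → fm-complete t }) , (λ d → fm-sound d n k refl) }

  -- Substitution on codes.  An operation o acts on variables through Va and is lifted under a binder by Lf;
  -- Rp o σ says that o represents the substitution σ.
  module SubCode
    (Va : ℕ → ℕ → ℕ → Set) (VaD : Def false (rel₃ Va)) (Lf : ℕ → ℕ → Set) (LfD : Def false (rel₂ Lf))
    (Rp : ∀ {n m} → ℕ → (Fin n → Term m) → Set)
    (va-to : ∀ {n m o} {σ : Fin n → Term m} → Rp o σ → ∀ i → Va o (toℕ i) (cdT (σ i)))
    (va-from : ∀ {n m o} {σ : Fin n → Term m} → Rp o σ → ∀ i k → Va o (toℕ i) k → k ≡ cdT (σ i))
    (lf-to : ∀ {n m o} {σ : Fin n → Term m} → Rp o σ → Σ ℕ (Lf o))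
    (lf-from : ∀ {n m o o'} {σ : Fin n → Term m} → Rp o σ → Lf o o' → Rp o' (liftS σ)) where

    rtProg : Program false
    rtProg = clause 3 (at VaD (xv 0F ∷ xv 1F ∷ xv 2F ∷ [])) [] (xp (xv 0F) (xp (cV (xv 1F)) (xv 2F)))
           ∷ clause 1 ok [] (xp (xv 0F) (xp c0 c0))
           ∷ clause 3 ok (xp (xv 0F) (xp (xv 1F) (xv 2F)) ∷ []) (xp (xv 0F) (xp (cS (xv 1F)) (cS (xv 2F))))
           ∷ clause 5 ok (xp (xv 0F) (xp (xv 1F) (xv 2F)) ∷ xp (xv 0F) (xp (xv 3F) (xv 4F)) ∷ []) (xp (xv 0F) (xp (c+ (xv 1F) (xv 3F)) (c+ (xv 2F) (xv 4F))))
           ∷ clause 5 ok (xp (xv 0F) (xp (xv 1F) (xv 2F)) ∷ xp (xv 0F) (xp (xv 3F) (xv 4F)) ∷ []) (xp (xv 0F) (xp (c· (xv 1F) (xv 3F)) (c· (xv 2F) (xv 4F))))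
           ∷ []

    Rt : ℕ → ℕ → ℕ → Set
    Rt o k k' = Der rtProg ⌊ o , ⌊ k , k' ⌋ ⌋

    rt-complete : ∀ {n m o} {σ : Fin n → Term m} → Rp o σ → ∀ t → Rt o (cdT t) (cdT (subT σ t))
    rt-complete {o = o} {σ} r (var i) = der 0F (o ∷ toℕ i ∷ cdT (σ i) ∷ []) (va-to r i) tt refl
    rt-complete {o = o} r `0 = der 1F (o ∷ []) refl tt refl
    rt-complete {o = o} r (`S t) = der 2F (o ∷ _ ∷ _ ∷ []) refl (rt-complete r t) refl
    rt-complete {o = o} r (s `+ t) = der 3F (o ∷ _ ∷ _ ∷ _ ∷ _ ∷ []) refl (rt-complete r s , rt-complete r t) refl
    rt-complete {o = o} r (s `· t) = der 4F (o ∷ _ ∷ _ ∷ _ ∷ _ ∷ []) refl (rt-complete r s , rt-complete r t) refl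

    -- All contexts and all substitutions represented by o are quantified over, because neither is
    -- recoverable from the codes.
    RtMeaning RfMeaning : ℕ → Set
    RtMeaning f = ∀ o k k' → f ≡ ⌊ o , ⌊ k , k' ⌋ ⌋ → ∀ {n m} {σ : Fin n → Term m} → Rp o σ → ∀ t → cdT t ≡ k → k' ≡ cdT (subT σ t)
    RfMeaning f = ∀ o k k' → f ≡ ⌊ o , ⌊ k , k' ⌋ ⌋ → ∀ {n m} {σ : Fin n → Term m} → Rp o σ → ∀ φ → cdF φ ≡ k → k' ≡ cdF (subF σ φ)

    p3 : ∀ a b c {a' b' c'} → ⌊ a , ⌊ b , c ⌋ ⌋ ≡ ⌊ a' , ⌊ b' , c' ⌋ ⌋ → a ≡ a' × b ≡ b' × c ≡ c'
    p3 a b c {a'} {b'} {c'} e with pinj a ⌊ b , c ⌋ {a'} {⌊ b' , c' ⌋} e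
    ... | p , q = p , pinj b c {b'} {c'} q

    rt-sound : ∀ {f} → Der rtProg f → RtMeaning f
    rt-sound = foldDer rtProg RtMeaning step
      where
      step : ∀ i e → X⟦ side (llookup rtProg i) ⟧ e → AllP (λ f → Der rtProg f × RtMeaning f) (prems (llookup rtProg i)) e → RtMeaning (xev (concl (llookup rtProg i)) e)
      step fzero (o ∷ i ∷ v ∷ []) h _ o' k k' e {σ = σ} r t eqn with p3 o ⌊ 0 , i ⌋ v {o'} {k} {k'} e
      ... | refl , refl , refl = go t (splitT t {0} {i} eqn) r
        where
        go : ∀ {n m} {σ : Fin n → Term m} t → tagT t ≡ 0 × restT t ≡ i → Rp o σ → v ≡ cdT (subT σ t)
        go (var j) (_ , refl) r = va-from r j v h
      step (fsuc fzero) (o ∷ []) h _ o' k k' e {σ = σ} r t eqn with p3 o ⌊ 1 , 0 ⌋ ⌊ 1 , 0 ⌋ {o'} {k} {k'} e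
      ... | refl , refl , refl = go t (splitT t {1} {0} eqn)
        where
        go : ∀ {n m} {σ : Fin n → Term m} t → tagT t ≡ 1 × restT t ≡ 0 → ⌊ 1 , 0 ⌋ ≡ cdT (subT σ t)
        go `0 _ = refl
      step (fsuc (fsuc fzero)) (o ∷ a ∷ b ∷ []) h (_ , ih) o' k k' e {σ = σ} r t eqn with p3 o ⌊ 2 , a ⌋ ⌊ 2 , b ⌋ {o'} {k} {k'} e
      ... | refl , refl , refl = go t (splitT t {2} {a} eqn) r
        where
        go : ∀ {n m} {σ : Fin n → Term m} t → tagT t ≡ 2 × restT t ≡ a → Rp o σ → ⌊ 2 , b ⌋ ≡ cdT (subT σ t)
        go (`S t) (_ , q) r = cong ⌊ 2 ,_⌋ (ih o a b refl r t q)
      step (fsuc (fsuc (fsuc fzero))) (o ∷ a ∷ b ∷ c ∷ d ∷ []) h ((_ , ih) , (_ , ih')) o' k k' e {σ = σ} r t eqn with p3 o ⌊ 3 , ⌊ a , c ⌋ ⌋ ⌊ 3 , ⌊ b , d ⌋ ⌋ {o'} {k} {k'} e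
      ... | refl , refl , refl = go t (splitT t {3} {⌊ a , c ⌋} eqn) r
        where
        go : ∀ {n m} {σ : Fin n → Term m} t → tagT t ≡ 3 × restT t ≡ ⌊ a , c ⌋ → Rp o σ → ⌊ 3 , ⌊ b , d ⌋ ⌋ ≡ cdT (subT σ t)
        go (s `+ t) (_ , q) r with pinj (cdT s) (cdT t) {a} {c} q
        ... | p , p' = cong₂ (λ x y → ⌊ 3 , ⌊ x , y ⌋ ⌋) (ih o a b refl r s p) (ih' o c d refl r t p')
      step (fsuc (fsuc (fsuc (fsuc fzero)))) (o ∷ a ∷ b ∷ c ∷ d ∷ []) h ((_ , ih) , (_ , ih')) o' k k' e {σ = σ} r t eqn with p3 o ⌊ 4 , ⌊ a , c ⌋ ⌋ ⌊ 4 , ⌊ b , d ⌋ ⌋ {o'} {k} {k'} e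
      ... | refl , refl , refl = go t (splitT t {4} {⌊ a , c ⌋} eqn) r
        where
        go : ∀ {n m} {σ : Fin n → Term m} t → tagT t ≡ 4 × restT t ≡ ⌊ a , c ⌋ → Rp o σ → ⌊ 4 , ⌊ b , d ⌋ ⌋ ≡ cdT (subT σ t)
        go (s `· t) (_ , q) r with pinj (cdT s) (cdT t) {a} {c} q
        ... | p , p' = cong₂ (λ x y → ⌊ 4 , ⌊ x , y ⌋ ⌋) (ih o a b refl r s p) (ih' o c d refl r t p')

    abstract
      rtD : Def false (rel₃ Rt)
      rtD = defP (at (derD rtProg) (xp (xv 0F) (xp (xv 1F) (xv 2F)) ∷ [])) λ { (o ∷ k ∷ k' ∷ []) → (λ z → z) , (λ z → z) }

    rfProg : Program false
    rfProg = clause 1 ok [] (xp (xv 0F) (xp cBot cBot))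
           ∷ clause 5 (xand (at rtD (xv 0F ∷ xv 1F ∷ xv 2F ∷ [])) (at rtD (xv 0F ∷ xv 3F ∷ xv 4F ∷ []))) [] (xp (xv 0F) (xp (cE (xv 1F) (xv 3F)) (cE (xv 2F) (xv 4F))))
           ∷ clause 5 ok (xp (xv 0F) (xp (xv 1F) (xv 2F)) ∷ xp (xv 0F) (xp (xv 3F) (xv 4F)) ∷ []) (xp (xv 0F) (xp (c⇒ (xv 1F) (xv 3F)) (c⇒ (xv 2F) (xv 4F))))
           ∷ clause 4 (at LfD (xv 0F ∷ xv 3F ∷ [])) (xp (xv 3F) (xp (xv 1F) (xv 2F)) ∷ []) (xp (xv 0F) (xp (cA (xv 1F)) (cA (xv 2F))))
           ∷ []

    Rf : ℕ → ℕ → ℕ → Set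
    Rf o k k' = Der rfProg ⌊ o , ⌊ k , k' ⌋ ⌋

    rf-complete : ∀ {n m o} {σ : Fin n → Term m} → Rp o σ → ∀ φ → Rf o (cdF φ) (cdF (subF σ φ))
    rf-complete {o = o} r `⊥ = der 0F (o ∷ []) refl tt refl
    rf-complete {o = o} r (s ≐ t) = der 1F (o ∷ _ ∷ _ ∷ _ ∷ _ ∷ []) (rt-complete r s , rt-complete r t) tt refl
    rf-complete {o = o} r (φ ⇒ ψ) = der 2F (o ∷ _ ∷ _ ∷ _ ∷ _ ∷ []) refl (rf-complete r φ , rf-complete r ψ) refl
    rf-complete {o = o} r (∀' φ) with lf-to r
    ... | o' , l = der 3F (o ∷ _ ∷ _ ∷ o' ∷ []) l (rf-complete (lf-from r l) φ) refl

    rf-sound : ∀ {f} → Der rfProg f → RfMeaning f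
    rf-sound = foldDer rfProg RfMeaning step
      where
      step : ∀ i e → X⟦ side (llookup rfProg i) ⟧ e → AllP (λ f → Der rfProg f × RfMeaning f) (prems (llookup rfProg i)) e → RfMeaning (xev (concl (llookup rfProg i)) e)
      step fzero (o ∷ []) h _ o' k k' e {σ = σ} r t eqn with p3 o ⌊ 0 , 0 ⌋ ⌊ 0 , 0 ⌋ {o'} {k} {k'} e
      ... | refl , refl , refl = go t (splitF t {0} {0} eqn)
        where
        go : ∀ {n m} {σ : Fin n → Term m} t → tagF t ≡ 0 × restF t ≡ 0 → ⌊ 0 , 0 ⌋ ≡ cdF (subF σ t)
        go `⊥ _ = refl
      step (fsuc fzero) (o ∷ a ∷ b ∷ c ∷ d ∷ []) (h , h') _ o' k k' e {σ = σ} r t eqn with p3 o ⌊ 1 , ⌊ a , c ⌋ ⌋ ⌊ 1 , ⌊ b , d ⌋ ⌋ {o'} {k} {k'} e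
      ... | refl , refl , refl = go t (splitF t {1} {⌊ a , c ⌋} eqn) r
        where
        go : ∀ {n m} {σ : Fin n → Term m} t → tagF t ≡ 1 × restF t ≡ ⌊ a , c ⌋ → Rp o σ → ⌊ 1 , ⌊ b , d ⌋ ⌋ ≡ cdF (subF σ t)
        go (s ≐ t) (_ , q) r with pinj (cdT s) (cdT t) {a} {c} q
        ... | p , p' = cong₂ (λ x y → ⌊ 1 , ⌊ x , y ⌋ ⌋) (rt-sound h o a b refl r s p) (rt-sound h' o c d refl r t p')
      step (fsuc (fsuc fzero)) (o ∷ a ∷ b ∷ c ∷ d ∷ []) h ((_ , ih) , (_ , ih')) o' k k' e {σ = σ} r t eqn with p3 o ⌊ 2 , ⌊ a , c ⌋ ⌋ ⌊ 2 , ⌊ b , d ⌋ ⌋ {o'} {k} {k'} e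
      ... | refl , refl , refl = go t (splitF t {2} {⌊ a , c ⌋} eqn) r
        where
        go : ∀ {n m} {σ : Fin n → Term m} t → tagF t ≡ 2 × restF t ≡ ⌊ a , c ⌋ → Rp o σ → ⌊ 2 , ⌊ b , d ⌋ ⌋ ≡ cdF (subF σ t)
        go (s ⇒ t) (_ , q) r with pinj (cdF s) (cdF t) {a} {c} q
        ... | p , p' = cong₂ (λ x y → ⌊ 2 , ⌊ x , y ⌋ ⌋) (ih o a b refl r s p) (ih' o c d refl r t p')
      step (fsuc (fsuc (fsuc fzero))) (o ∷ a ∷ b ∷ o₂ ∷ []) h (_ , ih) o' k k' e {σ = σ} r t eqn with p3 o ⌊ 3 , a ⌋ ⌊ 3 , b ⌋ {o'} {k} {k'} e
      ... | refl , refl , refl = go t (splitF t {3} {a} eqn) r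
        where
        go : ∀ {n m} {σ : Fin n → Term m} t → tagF t ≡ 3 × restF t ≡ a → Rp o σ → ⌊ 3 , b ⌋ ≡ cdF (subF σ t)
        go (∀' t) (_ , q) r = cong ⌊ 3 ,_⌋ (ih o₂ a b refl (lf-from r h) t q)

    abstract
      rfD : Def false (rel₃ Rf)
      rfD = defP (at (derD rfProg) (xp (xv 0F) (xp (xv 1F) (xv 2F)) ∷ [])) λ { (o ∷ k ∷ k' ∷ []) → (λ z → z) , (λ z → z) }

  -- The operation d is a cutoff: indices below d belong to binders already passed and stay fixed.
  WkVa : ℕ → ℕ → ℕ → Set
  WkVa d i k = (i < d × k ≡ ⌊ 0 , i ⌋) ⊎ (d < suc i × k ≡ ⌊ 0 , suc i ⌋)

  WkRp : ∀ {n m} → ℕ → (Fin n → Term m) → Set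
  WkRp {n} {m} d σ = ∀ i → Σ (Fin m) λ j → σ i ≡ var j × ((toℕ i < d × toℕ j ≡ toℕ i) ⊎ (d ≤ toℕ i × toℕ j ≡ suc (toℕ i)))

  abstract
    wkVaD : Def false (rel₃ WkVa)
    wkVaD = defP (xor (xand (xlt (xv 1F) (xv 0F)) (xeq (xv 2F) (cV (xv 1F)))) (xand (xlt (xv 0F) (xsu (xv 1F))) (xeq (xv 2F) (cV (xsu (xv 1F))))))
      λ { (a ∷ b ∷ c ∷ []) → (λ z → z) , (λ z → z) }

  abstract
    wkLfD : Def false (rel₂ (λ o o' → o' ≡ suc o))
    wkLfD = defP (xeq (xv 1F) (xsu (xv 0F))) λ { (a ∷ b ∷ []) → (λ z → z) , (λ z → z) }

  wk-va-to : ∀ {n m o} {σ : Fin n → Term m} → WkRp o σ → ∀ i → WkVa o (toℕ i) (cdT (σ i))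
  wk-va-to {σ = σ} r i with σ i | r i
  ... | _ | j , refl , inj₁ (l , e) = inj₁ (l , cong ⌊ 0 ,_⌋ e)
  ... | _ | j , refl , inj₂ (l , e) = inj₂ (s≤s l , cong ⌊ 0 ,_⌋ e)

  wk-va-from : ∀ {n m o} {σ : Fin n → Term m} → WkRp o σ → ∀ i k → WkVa o (toℕ i) k → k ≡ cdT (σ i)
  wk-va-from {σ = σ} r i k v with σ i | r i | v
  ... | _ | j , refl , inj₁ (l , e) | inj₁ (_ , q) = trans q (cong ⌊ 0 ,_⌋ (sym e))
  ... | _ | j , refl , inj₁ (l , e) | inj₂ (g , q) = ⊥-elim (<⇒≱ l (s≤s⁻¹ g))
  ... | _ | j , refl , inj₂ (l , e) | inj₁ (g , q) = ⊥-elim (<⇒≱ g l)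
  ... | _ | j , refl , inj₂ (l , e) | inj₂ (_ , q) = trans q (cong ⌊ 0 ,_⌋ (sym e))

  wk-lf : ∀ {n m o o'} {σ : Fin n → Term m} → WkRp o σ → o' ≡ suc o → WkRp o' (liftS σ)
  wk-lf r refl fzero = fzero , refl , inj₁ (s≤s z≤n , refl)
  wk-lf r refl (fsuc i) with r i
  ... | j , e , inj₁ (l , q) = fsuc j , cong (renT fsuc) e , inj₁ (s≤s l , cong suc q)
  ... | j , e , inj₂ (l , q) = fsuc j , cong (renT fsuc) e , inj₂ (s≤s l , cong suc q)

  module Wk = SubCode WkVa wkVaD (λ o o' → o' ≡ suc o) wkLfD WkRp wk-va-to wk-va-from (λ r → _ , refl) wk-lf

  wkRp₀ : ∀ {n} → WkRp {n} 0 (λ i → var (fsuc i))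
  wkRp₀ i = fsuc i , refl , inj₂ (z≤n , refl)

  -- Substitution of the term with code t for variable d; the operation is coded as ⌊ d , t ⌋.
  SbVa : ℕ → ℕ → ℕ → Set
  SbVa o i k = Σ ℕ λ d → Σ ℕ λ t → o ≡ ⌊ d , t ⌋ ×
    ((i < d × k ≡ ⌊ 0 , i ⌋) ⊎ ((i ≡ d × k ≡ t) ⊎ (Σ ℕ λ j → i ≡ suc j × d < suc j × k ≡ ⌊ 0 , j ⌋)))

  -- Under a binder the substituted term has to be weakened, which is why weakening is arithmetised
  -- before substitution.
  SbLf : ℕ → ℕ → Set
  SbLf o o' = Σ ℕ λ d → Σ ℕ λ t → Σ ℕ λ t' → o ≡ ⌊ d , t ⌋ × o' ≡ ⌊ suc d , t' ⌋ × Wk.Rt 0 t t'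

  SbAct : ∀ {n m} → ℕ → ℕ → Fin n → Term m → Set
  SbAct {n} {m} d t i s = (Σ (Fin m) λ j → s ≡ var j × toℕ i < d × toℕ j ≡ toℕ i)
    ⊎ ((toℕ i ≡ d × cdT s ≡ t) ⊎ (Σ (Fin m) λ j → s ≡ var j × toℕ i ≡ suc (toℕ j) × d ≤ toℕ j))

  SbRp : ∀ {n m} → ℕ → (Fin n → Term m) → Set
  SbRp {n} {m} o σ = Σ ℕ λ d → Σ (Term m) λ t → o ≡ ⌊ d , cdT t ⌋ × ∀ i → SbAct d (cdT t) i (σ i)

  abstract
    sbVaD : Def false (rel₃ SbVa)
    sbVaD = defP (xex (xex (xand (xeq (xv 2F) (xp (xv 1F) (xv 0F)))
        (xor (xand (xlt (xv 3F) (xv 1F)) (xeq (xv 4F) (cV (xv 3F))))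
        (xor (xand (xeq (xv 3F) (xv 1F)) (xeq (xv 4F) (xv 0F)))
             (xex (xand (xeq (xv 4F) (xsu (xv 0F))) (xand (xlt (xv 2F) (xsu (xv 0F))) (xeq (xv 5F) (cV (xv 0F)))))))))))
      λ { (a ∷ b ∷ c ∷ []) → (λ z → z) , (λ z → z) }

  abstract
    sbLfD : Def false (rel₂ SbLf)
    sbLfD = defP (xex (xex (xex (xand (xeq (xv 3F) (xp (xv 2F) (xv 1F))) (xand (xeq (xv 4F) (xp (xsu (xv 2F)) (xv 0F))) (at Wk.rtD (xn 0 ∷ xv 1F ∷ xv 0F ∷ [])))))))
      λ { (a ∷ b ∷ []) → (λ z → z) , (λ z → z) }

  sb-va-to : ∀ {n m o} {σ : Fin n → Term m} → SbRp o σ → ∀ i → SbVa o (toℕ i) (cdT (σ i))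
  sb-va-to {σ = σ} (d , t , refl , r) i = d , cdT t , refl , go (σ i) (r i)
    where
    go : ∀ s → SbAct d (cdT t) i s → (toℕ i < d × cdT s ≡ ⌊ 0 , toℕ i ⌋) ⊎ ((toℕ i ≡ d × cdT s ≡ cdT t) ⊎ (Σ ℕ λ j → toℕ i ≡ suc j × d < suc j × cdT s ≡ ⌊ 0 , j ⌋))
    go s (inj₁ (j , refl , l , e)) = inj₁ (l , cong ⌊ 0 ,_⌋ e)
    go s (inj₂ (inj₁ p)) = inj₂ (inj₁ p)
    go s (inj₂ (inj₂ (j , refl , e , l))) = inj₂ (inj₂ (toℕ j , e , s≤s l , refl))

  sb-va-from : ∀ {n m o} {σ : Fin n → Term m} → SbRp o σ → ∀ i k → SbVa o (toℕ i) k → k ≡ cdT (σ i)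
  sb-va-from {σ = σ} (d , t , refl , r) i k (d' , t' , e , v) with pinj d (cdT t) {d'} {t'} e
  ... | refl , refl = go (σ i) (r i) v
    where
    go : ∀ s → SbAct d (cdT t) i s → (toℕ i < d × k ≡ ⌊ 0 , toℕ i ⌋) ⊎ ((toℕ i ≡ d × k ≡ cdT t) ⊎ (Σ ℕ λ j → toℕ i ≡ suc j × d < suc j × k ≡ ⌊ 0 , j ⌋)) → k ≡ cdT s
    go s (inj₁ (j , refl , l , e)) (inj₁ (_ , q)) = trans q (cong ⌊ 0 ,_⌋ (sym e))
    go s (inj₁ (j , refl , l , e)) (inj₂ (inj₁ (q , _))) = ⊥-elim (<-irrefl q l)
    go s (inj₁ (j , refl , l , e)) (inj₂ (inj₂ (j' , q , g , _))) = ⊥-elim (<⇒≱ (subst (_< d) q l) (≤-trans (s≤s⁻¹ g) (n≤1+n j')))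
    go s (inj₂ (inj₁ (q , _))) (inj₁ (l , _)) = ⊥-elim (<-irrefl q l)
    go s (inj₂ (inj₁ (_ , q))) (inj₂ (inj₁ (_ , q'))) = trans q' (sym q)
    go s (inj₂ (inj₁ (q , _))) (inj₂ (inj₂ (j' , q' , g , _))) = ⊥-elim (<-irrefl (trans (sym q) q') g)
    go s (inj₂ (inj₂ (j , refl , q , l))) (inj₁ (g , _)) = ⊥-elim (<⇒≱ g (≤-trans l (subst (toℕ j ≤_) (sym q) (n≤1+n (toℕ j)))))
    go s (inj₂ (inj₂ (j , refl , q , l))) (inj₂ (inj₁ (q' , _))) = ⊥-elim (<-irrefl (trans (sym q') q) (s≤s l))
    go s (inj₂ (inj₂ (j , refl , q , l))) (inj₂ (inj₂ (j' , q' , _ , z))) = trans z (cong ⌊ 0 ,_⌋ (suc-injective (trans (sym q') q)))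

  wk-rt : ∀ {n} (t : Term n) → Wk.Rt 0 (cdT t) (cdT (renT fsuc t))
  wk-rt t = subst (λ z → Wk.Rt 0 (cdT t) (cdT z)) (sym (renT-sub fsuc t)) (Wk.rt-complete wkRp₀ t)

  sb-lf-to : ∀ {n m o} {σ : Fin n → Term m} → SbRp o σ → Σ ℕ (SbLf o)
  sb-lf-to (d , t , refl , r) = ⌊ suc d , cdT (renT fsuc t) ⌋ , d , cdT t , cdT (renT fsuc t) , refl , refl , wk-rt t

  sb-lf-from : ∀ {n m o o'} {σ : Fin n → Term m} → SbRp o σ → SbLf o o' → SbRp o' (liftS σ)
  sb-lf-from {σ = σ} (d , t , refl , r) (d' , t' , u , e , refl , w) with pinj d (cdT t) {d'} {t'} e
  ... | refl , refl = suc d , renT fsuc t , cong ⌊ suc d ,_⌋ u≡ , act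
    where
    u≡ : u ≡ cdT (renT fsuc t)
    u≡ = trans (Wk.rt-sound w 0 (cdT t) u refl wkRp₀ t refl) (cong cdT (sym (renT-sub fsuc t)))
    act : ∀ i → SbAct (suc d) (cdT (renT fsuc t)) i (liftS σ i)
    act fzero = inj₁ (fzero , refl , s≤s z≤n , refl)
    act (fsuc i) with r i
    ... | inj₁ (j , q , l , e') = inj₁ (fsuc j , cong (renT fsuc) q , s≤s l , cong suc e')
    ... | inj₂ (inj₁ (q , c)) = inj₂ (inj₁ (cong suc q , cong (λ z → cdT (renT fsuc z)) (codeT-inj (σ i) t c)))
    ... | inj₂ (inj₂ (j , q , e' , l)) = inj₂ (inj₂ (fsuc j , cong (renT fsuc) q , cong suc e' , s≤s l))

  module Sb = SubCode SbVa sbVaD SbLf sbLfD SbRp sb-va-to sb-va-from sb-lf-to sb-lf-from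

  sbRp₀ : ∀ {n} (t : Term n) → SbRp ⌊ 0 , cdT t ⌋ (single t)
  sbRp₀ t = 0 , t , refl , λ { fzero → inj₂ (inj₁ (refl , refl)) ; (fsuc i) → inj₂ (inj₂ (i , refl , refl , z≤n)) }

  sb-complete : ∀ {n} (φ : Formula (suc n)) t → Sb.Rf ⌊ 0 , cdT t ⌋ (cdF φ) (cdF (φ [ t ]))
  sb-complete φ t = Sb.rf-complete (sbRp₀ t) φ

  sb-sound : ∀ {n} (φ : Formula (suc n)) t {k} → Sb.Rf ⌊ 0 , cdT t ⌋ (cdF φ) k → k ≡ cdF (φ [ t ])
  sb-sound φ t d = Sb.rf-sound d _ _ _ refl (sbRp₀ t) φ refl

  wk-complete : ∀ {n} (φ : Formula n) → Wk.Rf 0 (cdF φ) (cdF (wk φ))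
  wk-complete φ = subst (λ z → Wk.Rf 0 (cdF φ) (cdF z)) (sym (renF-sub fsuc φ)) (Wk.rf-complete wkRp₀ φ)

  wk-sound : ∀ {n} (φ : Formula n) {k} → Wk.Rf 0 (cdF φ) k → k ≡ cdF (wk φ)
  wk-sound φ d = trans (Wk.rf-sound d _ _ _ refl wkRp₀ φ refl) (cong cdF (sym (renF-sub fsuc φ)))

open SyntaxCodes

-- Provability, Rosser sentences, and a universal c.e. relation

module ProvabilityPredicate where

  SetCode : (Sentence → Set) → ℕ → Set
  SetCode Γ k = Σ Sentence λ φ → (cdF φ ≡ k) × Γ φ

  cNeg : ∀ {n} → XT n → XT n
  cNeg t = c⇒ t cBot

  module Provability (Γ : Sentence → Set) (ΓD : Def false (pred₁ (SetCode Γ))) where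

    -- The clauses follow the axioms and rules. The first component is the number of free variables,
    -- which the rule `gen` changes.
    thProg : Program false
    thProg = clause 2 (at ΓD (xv 1F ∷ [])) [] (xp (xv 0F) (xv 1F))
      ∷ clause 3 (xand (at fmD (xv 0F ∷ xv 1F ∷ [])) (at fmD (xv 0F ∷ xv 2F ∷ []))) [] (xp (xv 0F) (c⇒ (xv 1F) (c⇒ (xv 2F) (xv 1F))))
      ∷ clause 4 (xand (at fmD (xv 0F ∷ xv 1F ∷ [])) (xand (at fmD (xv 0F ∷ xv 2F ∷ [])) (at fmD (xv 0F ∷ xv 3F ∷ [])))) []
          (xp (xv 0F) (c⇒ (c⇒ (xv 1F) (c⇒ (xv 2F) (xv 3F))) (c⇒ (c⇒ (xv 1F) (xv 2F)) (c⇒ (xv 1F) (xv 3F)))))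
      ∷ clause 2 (at fmD (xv 0F ∷ xv 1F ∷ [])) [] (xp (xv 0F) (c⇒ (cNeg (cNeg (xv 1F))) (xv 1F)))
      ∷ clause 4 (xand (at fmD (xsu (xv 0F) ∷ xv 1F ∷ [])) (xand (at tmD (xv 0F ∷ xv 2F ∷ [])) (at Sb.rfD (xp (xn 0) (xv 2F) ∷ xv 1F ∷ xv 3F ∷ [])))) []
          (xp (xv 0F) (c⇒ (cA (xv 1F)) (xv 3F)))
      ∷ clause 4 (xand (at fmD (xv 0F ∷ xv 1F ∷ [])) (xand (at fmD (xsu (xv 0F) ∷ xv 2F ∷ [])) (at Wk.rfD (xn 0 ∷ xv 1F ∷ xv 3F ∷ [])))) []
          (xp (xv 0F) (c⇒ (cA (c⇒ (xv 3F) (xv 2F))) (c⇒ (xv 1F) (cA (xv 2F)))))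
      ∷ clause 2 (at tmD (xv 0F ∷ xv 1F ∷ [])) [] (xp (xv 0F) (cE (xv 1F) (xv 1F)))
      ∷ clause 6 (xand (xand (at tmD (xv 0F ∷ xv 1F ∷ [])) (at tmD (xv 0F ∷ xv 2F ∷ []))) (xand (at fmD (xsu (xv 0F) ∷ xv 3F ∷ []))
           (xand (at Sb.rfD (xp (xn 0) (xv 1F) ∷ xv 3F ∷ xv 4F ∷ [])) (at Sb.rfD (xp (xn 0) (xv 2F) ∷ xv 3F ∷ xv 5F ∷ []))))) []
          (xp (xv 0F) (c⇒ (cE (xv 1F) (xv 2F)) (c⇒ (xv 4F) (xv 5F))))
      ∷ clause 3 ok (xp (xv 0F) (c⇒ (xv 1F) (xv 2F)) ∷ xp (xv 0F) (xv 1F) ∷ []) (xp (xv 0F) (xv 2F))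
      ∷ clause 2 ok (xp (xsu (xv 0F)) (xv 1F) ∷ []) (xp (xv 0F) (cA (xv 1F)))
      ∷ []

    th-complete : ∀ {n} {φ : Formula n} → Γ ⊢ φ → Der thProg ⌊ n , cdF φ ⌋
    th-complete {n} (hyp {φ = φ} p) = der fzero (n ∷ _ ∷ []) (φ , sym (codeF-closed φ) , p) tt refl
    th-complete {n} (ax (ax-K φ ψ)) = der (fsuc fzero) (n ∷ _ ∷ _ ∷ []) ((φ , refl) , (ψ , refl)) tt refl
    th-complete {n} (ax (ax-S φ ψ χ)) = der (fsuc (fsuc fzero)) (n ∷ _ ∷ _ ∷ _ ∷ []) ((φ , refl) , (ψ , refl) , (χ , refl)) tt refl
    th-complete {n} (ax (ax-DNE φ)) = der (fsuc (fsuc (fsuc fzero))) (n ∷ _ ∷ []) (φ , refl) tt refl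
    th-complete {n} (ax (ax-inst φ t)) = der (fsuc (fsuc (fsuc (fsuc fzero)))) (n ∷ _ ∷ _ ∷ _ ∷ []) ((φ , refl) , (t , refl) , sb-complete φ t) tt refl
    th-complete {n} (ax (ax-dist φ ψ)) = der (fsuc (fsuc (fsuc (fsuc (fsuc fzero))))) (n ∷ _ ∷ _ ∷ _ ∷ []) ((φ , refl) , (ψ , refl) , wk-complete φ) tt refl
    th-complete {n} (ax (ax-refl t)) = der (fsuc (fsuc (fsuc (fsuc (fsuc (fsuc fzero)))))) (n ∷ _ ∷ []) (t , refl) tt refl
    th-complete {n} (ax (ax-subst s t φ)) = der (fsuc (fsuc (fsuc (fsuc (fsuc (fsuc (fsuc fzero))))))) (n ∷ _ ∷ _ ∷ _ ∷ _ ∷ _ ∷ [])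
      (((s , refl) , (t , refl)) , (φ , refl) , sb-complete φ s , sb-complete φ t) tt refl
    th-complete {n} (mp d e) = der (fsuc (fsuc (fsuc (fsuc (fsuc (fsuc (fsuc (fsuc fzero)))))))) (n ∷ _ ∷ _ ∷ []) refl (th-complete d , th-complete e) refl
    th-complete {n} (gen d) = der (fsuc (fsuc (fsuc (fsuc (fsuc (fsuc (fsuc (fsuc (fsuc fzero))))))))) (n ∷ _ ∷ []) refl (th-complete d) refl

    Th : ℕ → ℕ → Set
    Th n k = Σ (Formula n) λ φ → cdF φ ≡ k × Γ ⊢ φ

    ThMeaning : ℕ → Set
    ThMeaning f = ∀ n k → f ≡ ⌊ n , k ⌋ → Th n k

    mpTh : ∀ {n a b} → Th n ⌊ 2 , ⌊ a , b ⌋ ⌋ → Th n a → Th n b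
    mpTh {n} {a} {b} (φ , e , d) (ψ , e' , d') = go φ (splitF φ {2} {⌊ a , b ⌋} e) d
      where
      go : ∀ φ → tagF φ ≡ 2 × restF φ ≡ ⌊ a , b ⌋ → Γ ⊢ φ → Th n b
      go (φ ⇒ χ) (_ , q) d with pinj (cdF φ) (cdF χ) {a} {b} q
      ... | p , p' = χ , p' , mp d (subst (Γ ⊢_) (codeF-inj ψ φ (trans e' (sym p))) d')

    th-sound : ∀ {f} → Der thProg f → ThMeaning f
    th-sound = foldDer thProg ThMeaning step
      where
      fin : ∀ {n n' k k'} → ⌊ n , k ⌋ ≡ ⌊ n' , k' ⌋ → Th n k → Th n' k'
      fin {n} {n'} {k} {k'} e t with pinj n k {n'} {k'} e
      ... | refl , refl = t
      step : ∀ i e → X⟦ side (llookup thProg i) ⟧ e → AllP (λ f → Der thProg f × ThMeaning f) (prems (llookup thProg i)) e → ThMeaning (xev (concl (llookup thProg i)) e)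
      step fzero (n ∷ k ∷ []) (φ , q , p) _ n' k' e = fin {n} {n'} {k} {k'} e (closedAt φ , trans (codeF-closed φ) q , hyp p)
      step (fsuc fzero) (n ∷ a ∷ b ∷ []) ((φ , refl) , (ψ , refl)) _ n' k' e = fin {n} {n'} {_} {k'} e (_ , refl , ax (ax-K φ ψ))
      step (fsuc (fsuc fzero)) (n ∷ a ∷ b ∷ c ∷ []) ((φ , refl) , (ψ , refl) , (χ , refl)) _ n' k' e = fin {n} {n'} {_} {k'} e (_ , refl , ax (ax-S φ ψ χ))
      step (fsuc (fsuc (fsuc fzero))) (n ∷ a ∷ []) (φ , refl) _ n' k' e = fin {n} {n'} {_} {k'} e (_ , refl , ax (ax-DNE φ))
      step (fsuc (fsuc (fsuc (fsuc fzero)))) (n ∷ a ∷ t ∷ b ∷ []) ((φ , refl) , (s , refl) , r) _ n' k' e =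
        fin {n} {n'} {_} {k'} e (_ , cong (λ z → ⌊ 2 , ⌊ ⌊ 3 , cdF φ ⌋ , z ⌋ ⌋) (sym (sb-sound φ s r)) , ax (ax-inst φ s))
      step (fsuc (fsuc (fsuc (fsuc (fsuc fzero))))) (n ∷ a ∷ b ∷ a' ∷ []) ((φ , refl) , (ψ , refl) , r) _ n' k' e =
        fin {n} {n'} {_} {k'} e (_ , cong (λ z → ⌊ 2 , ⌊ ⌊ 3 , ⌊ 2 , ⌊ z , cdF ψ ⌋ ⌋ ⌋ , ⌊ 2 , ⌊ cdF φ , ⌊ 3 , cdF ψ ⌋ ⌋ ⌋ ⌋ ⌋) (sym (wk-sound φ r)) , ax (ax-dist φ ψ))
      step (fsuc (fsuc (fsuc (fsuc (fsuc (fsuc fzero)))))) (n ∷ t ∷ []) (s , refl) _ n' k' e = fin {n} {n'} {_} {k'} e (_ , refl , ax (ax-refl s))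
      step (fsuc (fsuc (fsuc (fsuc (fsuc (fsuc (fsuc fzero))))))) (n ∷ s ∷ t ∷ a ∷ b ∷ c ∷ []) (((s' , refl) , (t' , refl)) , (φ , refl) , r , r') _ n' k' e =
        fin {n} {n'} {_} {k'} e (_ , cong₂ (λ y z → ⌊ 2 , ⌊ ⌊ 1 , ⌊ cdT s' , cdT t' ⌋ ⌋ , ⌊ 2 , ⌊ y , z ⌋ ⌋ ⌋ ⌋) (sym (sb-sound φ s' r)) (sym (sb-sound φ t' r')) , ax (ax-subst s' t' φ))
      step (fsuc (fsuc (fsuc (fsuc (fsuc (fsuc (fsuc (fsuc fzero)))))))) (n ∷ a ∷ b ∷ []) _ ((_ , ih) , (_ , ih')) n' k' e =
        fin {n} {n'} {b} {k'} e (mpTh {n} {a} {b} (ih n _ refl) (ih' n a refl))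
      step (fsuc (fsuc (fsuc (fsuc (fsuc (fsuc (fsuc (fsuc (fsuc fzero))))))))) (n ∷ a ∷ []) _ (_ , ih) n' k' e with ih (suc n) a refl
      ... | φ , refl , d = fin {n} {n'} {_} {k'} e (∀' φ , refl , gen d)

    Thm : ℕ → Set
    Thm = SetCode (λ φ → Γ ⊢ φ)

    abstract
      thmD : Def false (pred₁ Thm)
      thmD = defP (at (derD thProg) (xp (xn 0) (xv 0F) ∷ []))
        λ { (k ∷ []) → (λ { (φ , refl , d) → th-complete d }) , (λ d → th-sound d 0 k refl) }

    thm→ : ∀ (φ : Sentence) → Thm (cdF φ) → Γ ⊢ φ
    thm→ φ (ψ , e , d) = subst (Γ ⊢_) (codeF-inj ψ φ e) d

  -- The instance α n is expressed by ∀ y (y = n → α y), whose code is obtained without substitution.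

  numCode : ℕ → ℕ
  numCode k = cdT (num {0} k)

  numCode-any : ∀ {n} k → cdT (num {n} k) ≡ numCode k
  numCode-any zero = refl
  numCode-any (suc k) = cong ⌊ 2 ,_⌋ (numCode-any k)

  nuProg : Program false
  nuProg = clause 0 ok [] (xp (xn 0) c0)
         ∷ clause 2 ok (xp (xv 0F) (xv 1F) ∷ []) (xp (xsu (xv 0F)) (cS (xv 1F)))
         ∷ []

  NuMeaning : ℕ → Set
  NuMeaning f = ∀ k c → f ≡ ⌊ k , c ⌋ → c ≡ numCode k

  nu-sound : ∀ {f} → Der nuProg f → NuMeaning f
  nu-sound = foldDer nuProg NuMeaning step
    where
    step : ∀ i e → X⟦ side (llookup nuProg i) ⟧ e → AllP (λ f → Der nuProg f × NuMeaning f) (prems (llookup nuProg i)) e → NuMeaning (xev (concl (llookup nuProg i)) e)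
    step fzero [] _ _ k c e with pinj 0 _ {k} {c} e
    ... | refl , q = sym q
    step (fsuc fzero) (k' ∷ c' ∷ []) _ (_ , ih) k c e with pinj (suc k') _ {k} {c} e
    ... | refl , q = trans (sym q) (cong ⌊ 2 ,_⌋ (ih k' c' refl))

  nu-complete : ∀ k → Der nuProg ⌊ k , numCode k ⌋
  nu-complete zero = der fzero [] refl tt refl
  nu-complete (suc k) = der (fsuc fzero) (k ∷ numCode k ∷ []) refl (nu-complete k) refl

  abstract
    nuD : Def false (rel₂ (λ k c → c ≡ numCode k))
    nuD = defP (at (derD nuProg) (xp (xv 0F) (xv 1F) ∷ []))
      λ { (k ∷ c ∷ []) → (λ { refl → nu-complete k }) , (λ d → nu-sound d k c refl) }

  Says : Formula 1 → ℕ → Sentence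
  Says α n = ∀' ((var fzero ≐ num n) ⇒ α)

  saysCode : ℕ → ℕ → ℕ
  saysCode a n = ⌊ 3 , ⌊ 2 , ⌊ ⌊ 1 , ⌊ ⌊ 0 , 0 ⌋ , numCode n ⌋ ⌋ , a ⌋ ⌋ ⌋

  codeF-says : ∀ α n → cdF (Says α n) ≡ saysCode (cdF α) n
  codeF-says α n = cong (λ z → ⌊ 3 , ⌊ 2 , ⌊ ⌊ 1 , ⌊ ⌊ 0 , 0 ⌋ , z ⌋ ⌋ , cdF α ⌋ ⌋ ⌋) (numCode-any n)

  abstract
    saysD : Def false (rel₃ (λ a n c → c ≡ saysCode a n))
    saysD = defP (xex (xand (at nuD (xv 2F ∷ xv 0F ∷ [])) (xeq (xv 3F) (cA (c⇒ (cE (cV (xn 0)) (xv 0F)) (xv 1F))))))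
      λ { (a ∷ n ∷ c ∷ []) → (λ { refl → numCode n , refl , refl }) , (λ { (_ , refl , refl) → refl }) }

  module SaysLogic (Γ : Sentence → Set) (q : ∀ φ → Q φ → Γ φ) where
    open QLogic Γ q

    says-pos : ∀ α n → Γ ⊢ (α ⟪ num {0} n ⟫) → Γ ⊢ Says α n
    says-pos α n d = gen (done (lam (cast (self α) (leib α (esym h0)
      (thm (subF-subF {υ = λ _ → num n} (λ _ → num-sub _ n) α ≈⊢ sub⊢ {m = 1} (λ ()) d))))))

    says-neg : ∀ α n → Γ ⊢ ¬' (α ⟪ num {0} n ⟫) → Γ ⊢ ¬' (Says α n)
    says-neg α n d = done (lam (thm d $$ (cast eqn (allE (num n) h0) $$ thm (ax (ax-refl (num n))))))
      where
      eqn : ((var fzero ≐ num n) ⇒ α) [ num n ] ≡ ((num n ≐ num n) ⇒ (α ⟪ num n ⟫))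
      eqn = cong₂ (λ a b → (num n ≐ a) ⇒ b) (num-sub _ n) (subF-ext (λ { fzero → refl }) α)

  infixl 7 _⊓_
  _⊓_ : Sentence → Sentence → Sentence
  x ⊓ y = ¬' (x ⇒ ¬' y)

  c⊓ : ∀ {n} → XT n → XT n → XT n
  c⊓ s t = cNeg (c⇒ s (cNeg t))

  module Theory (T : Sentence → Set) (TD : Def false (pred₁ (SetCode T)))
                (q : ∀ φ → Q φ → T φ) (con : Consistent T) where
    open Provability T TD public
    open QLogic T q public
    open SaysLogic T q public

    -- Rosser sentences, with the parameter ⌊ a , n ⌋ carrying the code a of the formula itself.
    RosA RosB : Vec ℕ 1 → Set
    RosA (z ∷ []) = Σ ℕ λ a → Σ ℕ λ n → Σ ℕ λ c → z ≡ ⌊ a , n ⌋ × c ≡ saysCode a z × Thm ⌊ 2 , ⌊ n , ⌊ 2 , ⌊ c , ⌊ 0 , 0 ⌋ ⌋ ⌋ ⌋ ⌋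
    RosB (z ∷ []) = Σ ℕ λ a → Σ ℕ λ n → Σ ℕ λ c → z ≡ ⌊ a , n ⌋ × c ≡ saysCode a z × Thm ⌊ 2 , ⌊ n , c ⌋ ⌋

    abstract
      rosAD : Def false RosA
      rosAD = defP (xex (xex (xex (xand (xeq (xv 3F) (xp (xv 2F) (xv 1F))) (xand (at saysD (xv 2F ∷ xv 3F ∷ xv 0F ∷ [])) (at thmD (c⇒ (xv 1F) (cNeg (xv 0F)) ∷ [])))))))
        λ { (z ∷ []) → (λ p → p) , (λ p → p) }

    abstract
      rosBD : Def false RosB
      rosBD = defP (xex (xex (xex (xand (xeq (xv 3F) (xp (xv 2F) (xv 1F))) (xand (at saysD (xv 2F ∷ xv 3F ∷ xv 0F ∷ [])) (at thmD (c⇒ (xv 1F) (xv 0F) ∷ [])))))))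
        λ { (z ∷ []) → (λ p → p) , (λ p → p) }

    module Ros = Separation (proj₁ rosAD) (proj₁ rosBD)

    rosser : Formula 1
    rosser = Ros.separator

    -- Self-reference arises by applying the formula to a pair that contains its own code, so no
    -- fixed-point lemma is needed: at this argument, `RosA` and `RosB` speak about `F x` itself.
    F : Sentence → Sentence
    F x = Says rosser ⌊ cdF rosser , cdF x ⌋

    FCode : ℕ → ℕ
    FCode k = saysCode (cdF rosser) ⌊ cdF rosser , k ⌋

    codeF-F : ∀ x → cdF (F x) ≡ FCode (cdF x)
    codeF-F x = codeF-says rosser ⌊ cdF rosser , cdF x ⌋

    private
      toA : ∀ x → T ⊢ (x ⇒ ¬' (F x)) → ⟦ proj₁ rosAD ⟧ (⌊ cdF rosser , cdF x ⌋ ∷ [])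
      toA x d = proj₁ (proj₂ rosAD _) (cdF rosser , cdF x , _ , refl , refl , (x ⇒ ¬' (F x)) , cong (λ z → ⌊ 2 , ⌊ cdF x , ⌊ 2 , ⌊ z , ⌊ 0 , 0 ⌋ ⌋ ⌋ ⌋ ⌋) (codeF-F x) , d)

      toB : ∀ x → T ⊢ (x ⇒ F x) → ⟦ proj₁ rosBD ⟧ (⌊ cdF rosser , cdF x ⌋ ∷ [])
      toB x d = proj₁ (proj₂ rosBD _) (cdF rosser , cdF x , _ , refl , refl , (x ⇒ F x) , cong (λ z → ⌊ 2 , ⌊ cdF x , z ⌋ ⌋) (codeF-F x) , d)

      fromA : ∀ x → ⟦ proj₁ rosAD ⟧ (⌊ cdF rosser , cdF x ⌋ ∷ []) → T ⊢ (x ⇒ ¬' (F x))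
      fromA x h with proj₂ (proj₂ rosAD _) h
      ... | a , n , c , e , refl , t with pinj (cdF rosser) (cdF x) {a} {n} e
      ...   | refl , refl = thm→ (x ⇒ ¬' (F x)) (subst Thm (cong (λ z → ⌊ 2 , ⌊ cdF x , ⌊ 2 , ⌊ z , ⌊ 0 , 0 ⌋ ⌋ ⌋ ⌋ ⌋) (sym (codeF-F x))) t)

      fromB : ∀ x → ⟦ proj₁ rosBD ⟧ (⌊ cdF rosser , cdF x ⌋ ∷ []) → T ⊢ (x ⇒ F x)
      fromB x h with proj₂ (proj₂ rosBD _) h
      ... | a , n , c , e , refl , t with pinj (cdF rosser) (cdF x) {a} {n} e
      ...   | refl , refl = thm→ (x ⇒ F x) (subst Thm (cong (λ z → ⌊ 2 , ⌊ cdF x , z ⌋ ⌋) (sym (codeF-F x))) t)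

      both : ∀ x → T ⊢ (x ⇒ F x) → T ⊢ (x ⇒ ¬' (F x)) → T ⊢ ¬' x
      both x d e = done (lam (thm e $$ h0 $$ (thm d $$ h0)))

      viaPos : ∀ x → T ⊢ F x → T ⊢ (x ⇒ F x)
      viaPos x d = mp (ax (ax-K _ _)) d

      viaNeg : ∀ x → T ⊢ ¬' (F x) → T ⊢ (x ⇒ ¬' (F x))
      viaNeg x d = mp (ax (ax-K _ _)) d

    -- Rosser's argument below x. A proof of x ⇒ F x makes T refute `F x`, unless an equally welcome
    -- proof of x ⇒ ¬ F x intervenes; in both cases x implies a contradiction.
    F-pos' : ∀ x → T ⊢ (x ⇒ F x) → T ⊢ ¬' x
    F-pos' x d with Ros.separator-neg T q ⌊ cdF rosser , cdF x ⌋ (toB x d)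
    ... | inj₁ n = both x d (viaNeg x (says-neg rosser _ n))
    ... | inj₂ a = both x d (fromA x a)

    F-neg' : ∀ x → T ⊢ (x ⇒ ¬' (F x)) → T ⊢ ¬' x
    F-neg' x d with Ros.separator-pos T q ⌊ cdF rosser , cdF x ⌋ (toA x d)
    ... | inj₁ n = both x (viaPos x (says-pos rosser _ n)) d
    ... | inj₂ b = both x (fromB x b) d

    abstract
      F-pos : ∀ x → T ⊢ (x ⇒ F x) → T ⊢ ¬' x
      F-pos = F-pos'

      F-neg : ∀ x → T ⊢ (x ⇒ ¬' (F x)) → T ⊢ ¬' x
      F-neg = F-neg'

    U : ℕ → ℕ → Set
    U a n = Thm (saysCode a ⌊ a , n ⌋)

    abstract
      UD : Def false (rel₂ U)
      UD = defP (xex (xand (at saysD (xv 1F ∷ xp (xv 1F) (xv 2F) ∷ xv 0F ∷ [])) (at thmD (xv 0F ∷ []))))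
        λ { (a ∷ n ∷ []) → (λ p → _ , refl , p) , (λ { (_ , refl , p) → p }) }

    module _ {P : ℕ → Set} (PD : Def false (pred₁ P)) where
      UniA UniB : Vec ℕ 1 → Set
      UniA (z ∷ []) = Σ ℕ λ a → Σ ℕ λ n → z ≡ ⌊ a , n ⌋ × P n
      UniB (z ∷ []) = Σ ℕ λ a → Σ ℕ λ n → Σ ℕ λ c → z ≡ ⌊ a , n ⌋ × c ≡ saysCode a z × Thm c

      abstract
        uniAD : Def false UniA
        uniAD = defP (xex (xex (xand (xeq (xv 2F) (xp (xv 1F) (xv 0F))) (at PD (xv 0F ∷ []))))) λ { (z ∷ []) → (λ p → p) , (λ p → p) }

      abstract
        uniBD : Def false UniB
        uniBD = defP (xex (xex (xex (xand (xeq (xv 3F) (xp (xv 2F) (xv 1F))) (xand (at saysD (xv 2F ∷ xv 3F ∷ xv 0F ∷ [])) (at thmD (xv 0F ∷ [])))))))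
          λ { (z ∷ []) → (λ p → p) , (λ p → p) }

      module Uni = Separation (proj₁ uniAD) (proj₁ uniBD)

      -- P is separated from the provability of the separating instance itself. If P n holds, the
      -- instance is provable, either by separation or because the competing condition says so. If
      -- it is provable, then P n holds, since otherwise T would refute the instance too and be
      -- inconsistent. Such indices let one arithmetical construction refer to all c.e. ideals.
      universal' : Σ ℕ λ a → ∀ n → P n ⇔ U a n
      universal' = a₀ , λ n → to n , from n
        where
        a₀ : ℕ
        a₀ = cdF Uni.separator
        to : ∀ n → P n → U a₀ n
        to n p with Uni.separator-pos T q ⌊ a₀ , n ⌋ (proj₁ (proj₂ uniAD _) (a₀ , n , refl , p))
        ... | inj₁ d = Says Uni.separator ⌊ a₀ , n ⌋ , codeF-says Uni.separator ⌊ a₀ , n ⌋ , says-pos Uni.separator ⌊ a₀ , n ⌋ d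
        ... | inj₂ b with proj₂ (proj₂ uniBD _) b
        ...   | a , m , c , e , refl , t with pinj a₀ n {a} {m} e
        ...     | refl , refl = t
        from : ∀ n → U a₀ n → P n
        from n u with Uni.separator-neg T q ⌊ a₀ , n ⌋ (proj₁ (proj₂ uniBD _) (a₀ , n , _ , refl , refl , u))
        ... | inj₁ d = ⊥-elim (con (mp (says-neg Uni.separator ⌊ a₀ , n ⌋ d) (thm→ (Says Uni.separator ⌊ a₀ , n ⌋) (subst Thm (sym (codeF-says Uni.separator ⌊ a₀ , n ⌋)) u))))
        ... | inj₂ a with proj₂ (proj₂ uniAD _) a
        ...   | a' , m , e , p with pinj a₀ n {a'} {m} e
        ...     | refl , refl = p

      abstract
        universal : Σ ℕ λ a → ∀ n → P n ⇔ U a n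
        universal = universal'

open ProvabilityPredicate

-- Propositional tautologies, and extensions of T as c.e. ideals

module TheoriesAsIdeals where

  infixr 5 _p⇒_
  infixl 7 _p⊓_
  data PF (n : ℕ) : Set where
    pv   : Fin n → PF n
    p⊥   : PF n
    _p⇒_ : PF n → PF n → PF n

  p¬ : ∀ {n} → PF n → PF n
  p¬ p = p p⇒ p⊥

  _p⊓_ _p∨_ : ∀ {n} → PF n → PF n → PF n
  p p⊓ r = p¬ (p p⇒ p¬ r)
  p p∨ r = p¬ p p⇒ r

  pA pB pC pD : ∀ {n} → PF (suc (suc (suc (suc n))))
  pA = pv 0F
  pB = pv 1F
  pC = pv 2F
  pD = pv 3F

  PF⟦_⟧ : ∀ {n m} → PF n → Vec (Formula m) n → Formula m
  PF⟦ pv i ⟧ v = lookup v i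
  PF⟦ p⊥ ⟧ v = `⊥
  PF⟦ p p⇒ r ⟧ v = PF⟦ p ⟧ v ⇒ PF⟦ r ⟧ v

  evalP : ∀ {n} → PF n → Vec Bool n → Bool
  evalP (pv i) b = lookup b i
  evalP p⊥ b = false
  evalP (p p⇒ r) b = not (evalP p b) ∨ evalP r b

  allB : ∀ n → (Vec Bool n → Bool) → Bool
  allB zero f = f []
  allB (suc n) f = allB n (λ b → f (true ∷ b)) ∧ allB n (λ b → f (false ∷ b))

  ∧-split : ∀ a b → a ∧ b ≡ true → a ≡ true × b ≡ true
  ∧-split true true refl = refl , refl

  allB-sound : ∀ n f → allB n f ≡ true → ∀ b → f b ≡ true
  allB-sound zero f e [] = e
  allB-sound (suc n) f e (true ∷ b) = allB-sound n _ (proj₁ (∧-split _ _ e)) b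
  allB-sound (suc n) f e (false ∷ b) = allB-sound n _ (proj₂ (∧-split _ _ e)) b

  module Tautology (Γ : Sentence → Set) where
    open Logic Γ

    lit : ∀ {m} → Bool → Formula m → Formula m
    lit true φ = φ
    lit false φ = ¬' φ

    lits : ∀ {n m} → Vec Bool n → Vec (Formula m) n → List (Formula m) → List (Formula m)
    lits [] [] Δ = Δ
    lits (b ∷ bs) (x ∷ xs) Δ = lits bs xs (lit b x ∷ Δ)

    lits-weak : ∀ {n m} (b : Vec Bool n) (v : Vec (Formula m) n) {Δ φ} → Δ ⊩ φ → lits b v Δ ⊩ φ
    lits-weak [] [] d = d
    lits-weak (b ∷ bs) (x ∷ xs) d = lits-weak bs xs (up d)

    lits-lookup : ∀ {n m} (b : Vec Bool n) (v : Vec (Formula m) n) {Δ} i → lits b v Δ ⊩ lit (lookup b i) (lookup v i)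
    lits-lookup (b ∷ bs) (x ∷ xs) fzero = lits-weak bs xs h0
    lits-lookup (b ∷ bs) (x ∷ xs) (fsuc i) = lits-lookup bs xs i

    -- Kalmár's lemma: the literals of a valuation prove each formula or its negation, as the truth
    -- table says. `elimLits` then discharges the literals by cases, which yields every tautology.
    kalmar : ∀ {n m} (b : Vec Bool n) (v : Vec (Formula m) n) {Δ} (p : PF n) → lits b v Δ ⊩ lit (evalP p b) (PF⟦ p ⟧ v)
    kalmar b v (pv i) = lits-lookup b v i
    kalmar b v p⊥ = lam h0
    kalmar b v {Δ} (p p⇒ r) with evalP p b | evalP r b | kalmar b v {Δ} p | kalmar b v {Δ} r
    ... | true | true | _ | d = lam (up d)
    ... | true | false | c | d = lam (up d $$ (h0 $$ up c))
    ... | false | true | _ | d = lam (up d)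
    ... | false | false | c | d = lam (efq (up c $$ h0))

    elimLits : ∀ {n m} (v : Vec (Formula m) n) {Δ χ} → (∀ b → lits b v Δ ⊩ χ) → Δ ⊩ χ
    elimLits [] h = h []
    elimLits (x ∷ v) h = orE {φ = x} {ψ = ¬' x} (lam h0) (lam (elimLits v (λ b → h (true ∷ b)))) (lam (elimLits v (λ b → h (false ∷ b))))

    abstract
      taut : ∀ {n m} (v : Vec (Formula m) n) (p : PF n) → allB n (evalP p) ≡ true → Γ ⊢ PF⟦ p ⟧ v
      taut {n} v p e = done (elimLits v (λ b → subst (λ c → lits b v [] ⊩ lit c (PF⟦ p ⟧ v)) (allB-sound n (evalP p) e b) (kalmar b v p)))

  abstract
    weaken⊢ : ∀ {Γ Δ : Sentence → Set} → (∀ φ → Γ φ → Δ φ) → ∀ {n} {φ : Formula n} → Γ ⊢ φ → Δ ⊢ φ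
    weaken⊢ h (hyp p) = hyp (h _ p)
    weaken⊢ h (ax a) = ax a
    weaken⊢ h (mp d e) = mp (weaken⊢ h d) (weaken⊢ h e)
    weaken⊢ h (gen d) = gen (weaken⊢ h d)

  abstract
    cut⊢ : ∀ {Γ Δ : Sentence → Set} → (∀ φ → Δ φ → Γ ⊢ φ) → ∀ {n} {φ : Formula n} → Δ ⊢ φ → Γ ⊢ φ
    cut⊢ {Γ} h (hyp {φ = φ} p) = subst (Γ ⊢_) (sym (renF-sub (λ ()) φ)) (subst (Γ ⊢_) (subF-ext (λ ()) φ) (Logic.sub⊢ Γ (λ ()) (h φ p)))
    cut⊢ h (ax a) = ax a
    cut⊢ h (mp d e) = mp (cut⊢ h d) (cut⊢ h e)
    cut⊢ h (gen d) = gen (cut⊢ h d)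

  ax⊢ : ∀ {Γ : Sentence → Set} φ → Γ φ → Γ ⊢ φ
  ax⊢ {Γ} φ p = subst (Γ ⊢_) (closed₀ φ) (hyp p)

  abstract
    def⇒theory : ∀ {Γ : Sentence → Set} → Def false (pred₁ (SetCode Γ)) → IsCETheory Γ
    def⇒theory (φ , d) = Def⇒CE (φ , λ { (k ∷ []) →
      ((λ { (χ , e , p) → χ , trans (cdF≡ χ) e , p }) , (λ { (χ , e , p) → χ , trans (sym (cdF≡ χ)) e , p })) ⇔∘ d (k ∷ []) })

    theory⇒def : ∀ {Γ : Sentence → Set} → IsCETheory Γ → Def false (pred₁ (SetCode Γ))
    theory⇒def h with CE⇒Def h
    ... | φ , d = φ , λ { (k ∷ []) →
      ((λ { (χ , e , p) → χ , trans (sym (cdF≡ χ)) e , p }) , (λ { (χ , e , p) → χ , trans (cdF≡ χ) e , p })) ⇔∘ d (k ∷ []) }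

  ⋁ : List Sentence → Sentence
  ⋁ [] = `⊥
  ⋁ (x ∷ L) = x ∨' ⋁ L

  -- Elements of an extension A are read dually: x lies in the ideal of A when A refutes x.
  module Ideals (T : Sentence → Set) (TD : Def false (pred₁ (SetCode T)))
                (q : ∀ φ → Q φ → T φ) (con : Consistent T) where
    open Theory T TD q con public
    open Tautology T public

    Le : Sentence → Sentence → Set
    Le x y = T ⊢ (x ⇒ y)

    Z : Sentence → Set
    Z x = T ⊢ ¬' x

    In : Ext T → Sentence → Set
    In A x = mem A (¬' x)

    abstract
      refute : ∀ {x y} → Le x y → Z y → Z x
      refute {x} {y} d e = mp (mp (taut (x ∷ y ∷ y ∷ y ∷ []) ((pA p⇒ pB) p⇒ p¬ pB p⇒ p¬ pA) refl) d) e

    abstract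
      Le-trans : ∀ {x y z} → Le x y → Le y z → Le x z
      Le-trans {x} {y} {z} d e = mp (mp (taut (x ∷ y ∷ z ∷ z ∷ []) ((pA p⇒ pB) p⇒ (pB p⇒ pC) p⇒ pA p⇒ pC) refl) d) e

    abstract
      Le-refl : ∀ {x} → Le x x
      Le-refl {x} = taut (x ∷ x ∷ x ∷ x ∷ []) (pA p⇒ pA) refl

    abstract
      ⊓₁ : ∀ {x y} → Le (x ⊓ y) x
      ⊓₁ {x} {y} = taut (x ∷ y ∷ x ∷ x ∷ []) (pA p⊓ pB p⇒ pA) refl

    abstract
      ⊓₂ : ∀ {x y} → Le (x ⊓ y) y
      ⊓₂ {x} {y} = taut (x ∷ y ∷ x ∷ x ∷ []) (pA p⊓ pB p⇒ pB) refl

    abstract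
      ⊓-glb : ∀ {x y z} → Le z x → Le z y → Le z (x ⊓ y)
      ⊓-glb {x} {y} {z} d e = mp (mp (taut (x ∷ y ∷ z ∷ z ∷ []) ((pC p⇒ pA) p⇒ (pC p⇒ pB) p⇒ pC p⇒ pA p⊓ pB) refl) d) e

    Disj : Sentence → Sentence → Set
    Disj x y = Z (x ⊓ y)

    disj-mono : ∀ {x x' y y'} → Le x' x → Le y' y → Disj x y → Disj x' y'
    disj-mono d e = refute (⊓-glb (Le-trans ⊓₁ d) (Le-trans ⊓₂ e))

    disj-sym : ∀ {x y} → Disj x y → Disj y x
    disj-sym = refute (⊓-glb ⊓₂ ⊓₁)

    abstract
      disj-¬ : ∀ x → Disj x (¬' x)
      disj-¬ x = taut (x ∷ x ∷ x ∷ x ∷ []) (p¬ (pA p⊓ p¬ pA)) refl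

    disj-self : ∀ {x y} → Le x y → Disj x y → Z x
    disj-self d = refute (⊓-glb Le-refl d)

    mem⊢ : ∀ (A : Ext T) {φ} → T ⊢ φ → mem A φ
    mem⊢ A d = closed A _ (weaken⊢ (extends A) d)

    memMP : ∀ (A : Ext T) {φ ψ} → mem A (φ ⇒ ψ) → mem A φ → mem A ψ
    memMP A p r = closed A _ (mp (ax⊢ _ p) (ax⊢ _ r))

    abstract
      In-down : ∀ (A : Ext T) {x y} → Le x y → In A y → In A x
      In-down A {x} {y} d p = memMP A (mem⊢ A (mp (taut (x ∷ y ∷ y ∷ y ∷ []) ((pA p⇒ pB) p⇒ p¬ pB p⇒ p¬ pA) refl) d)) p

    abstract
      In-∨ : ∀ (A : Ext T) {x y} → In A x → In A y → In A (x ∨' y)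
      In-∨ A {x} {y} p r = memMP A (memMP A (mem⊢ A (taut (x ∷ y ∷ y ∷ y ∷ []) (p¬ pA p⇒ p¬ pB p⇒ p¬ (pA p∨ pB)) refl)) p) r

    abstract
      In-⋁ : ∀ (A : Ext T) {L} → All (In A) L → In A (⋁ L)
      In-⋁ A [] = mem⊢ A (taut {m = 0} (`⊥ ∷ `⊥ ∷ `⊥ ∷ `⊥ ∷ []) (p¬ p⊥) refl)
      In-⋁ A (p ∷ ps) = In-∨ A p (In-⋁ A ps)

    abstract
      ⋁-++ˡ : ∀ L L' → Le (⋁ L) (⋁ (L ⧺ L'))
      ⋁-++ˡ [] L' = taut (⋁ L' ∷ `⊥ ∷ `⊥ ∷ `⊥ ∷ []) (p⊥ p⇒ pA) refl
      ⋁-++ˡ (x ∷ L) L' = mp (taut (x ∷ ⋁ L ∷ ⋁ (L ⧺ L') ∷ `⊥ ∷ []) ((pB p⇒ pC) p⇒ (pA p∨ pB) p⇒ (pA p∨ pC)) refl) (⋁-++ˡ L L')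

    abstract
      ⋁-++ʳ : ∀ L L' → Le (⋁ L') (⋁ (L ⧺ L'))
      ⋁-++ʳ [] L' = Le-refl
      ⋁-++ʳ (x ∷ L) L' = mp (taut (x ∷ ⋁ L' ∷ ⋁ (L ⧺ L') ∷ `⊥ ∷ []) ((pB p⇒ pC) p⇒ pB p⇒ (pA p∨ pC)) refl) (⋁-++ʳ L L')

    abstract
      disj-⋁ : ∀ {x L} → All (Disj x) L → Disj x (⋁ L)
      disj-⋁ {x} [] = taut (x ∷ x ∷ x ∷ x ∷ []) (p¬ (pA p⊓ p⊥)) refl
      disj-⋁ {x} {y ∷ L} (p ∷ ps) = mp (mp (taut (x ∷ y ∷ ⋁ L ∷ x ∷ []) (p¬ (pA p⊓ pB) p⇒ p¬ (pA p⊓ pC) p⇒ p¬ (pA p⊓ (pB p∨ pC))) refl) p) (disj-⋁ ps)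

    lift-cl : ∀ {n} {φ : Sentence} → T ⊢ φ → T ⊢ closedAt {n} φ
    lift-cl {φ = φ} d = subst (T ⊢_) (trans (subF-ext (λ ()) φ) (sym (renF-sub (λ ()) φ))) (sub⊢ (λ ()) d)

    module _ (G : Sentence → Set) where

      Base : Sentence → Set
      Base φ = T φ ⊎ (Σ Sentence λ x → φ ≡ ¬' x × G x)

      abstract
        -- A derivation uses finitely many generators, and at `mp` the two lists are concatenated.
        -- At `gen` the assumption moves through the quantifier because it is closed.
        compact : ∀ {n} {φ : Formula n} → Base ⊢ φ → Σ (List Sentence) λ L → All G L × T ⊢ (closedAt (¬' (⋁ L)) ⇒ φ)
        compact (hyp (inj₁ p)) = [] , [] , mp (ax (ax-K _ _)) (hyp p)
        compact {n} (hyp (inj₂ (x , refl , g))) = x ∷ [] , g ∷ [] ,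
          taut {n = 4} {m = n} (closedAt x ∷ `⊥ ∷ `⊥ ∷ `⊥ ∷ []) (p¬ (pA p∨ p⊥) p⇒ p¬ pA) refl
        compact (ax a) = [] , [] , mp (ax (ax-K _ _)) (ax a)
        compact {n} {ψ} (mp {φ = φ} d e) with compact d | compact e
        ... | L , g , d' | L' , g' , e' = L ⧺ L' , AllP.++⁺ g g' ,
          mp (mp (mp (mp (taut {n = 6} {m = n} (closedAt (⋁ L) ∷ closedAt (⋁ L') ∷ closedAt (⋁ (L ⧺ L')) ∷ φ ∷ ψ ∷ ψ ∷ [])
            ((pA p⇒ pC) p⇒ (pB p⇒ pC) p⇒ (p¬ pA p⇒ pD p⇒ pv 4F) p⇒ (p¬ pB p⇒ pD) p⇒ p¬ pC p⇒ pv 4F) refl)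
            (lift-cl (⋁-++ˡ L L'))) (lift-cl (⋁-++ʳ L L'))) d') e'
        compact (gen {φ = φ} d) with compact d
        ... | L , g , d' = L , g , mp (ax (ax-dist _ _)) (gen (subst (λ z → T ⊢ (z ⇒ φ)) (sym (wk-closed (¬' (⋁ L)))) d'))

      module _ (GD : Def false (pred₁ (SetCode G))) where

        abstract
          baseD : Def false (pred₁ (SetCode Base))
          baseD = defP (xor (at TD (xv 0F ∷ [])) (xex (xand (xeq (xv 1F) (cNeg (xv 0F))) (at GD (xv 0F ∷ [])))))
            λ { (k ∷ []) → (λ { (φ , e , inj₁ p) → inj₁ (φ , e , p) ; (φ , refl , inj₂ (x , refl , g)) → inj₂ (cdF x , refl , x , refl , g) }) ,
                           (λ { (inj₁ (φ , e , p)) → φ , e , inj₁ p ; (inj₂ (_ , refl , x , refl , g)) → ¬' x , refl , inj₂ (x , refl , g) }) }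

        Gen : Ext T
        Gen = record
          { mem = λ φ → Base ⊢ φ
          ; ce = def⇒theory (Provability.thmD Base baseD)
          ; extends = λ φ p → ax⊢ φ (inj₁ p)
          ; closed = λ φ d → cut⊢ (λ _ e → e) d }

        gen-In : ∀ {x} → G x → In Gen x
        gen-In {x} g = ax⊢ _ (inj₂ (x , refl , g))

        abstract
          gen-fin : ∀ {x} → In Gen x → Σ (List Sentence) λ L → All G L × Le x (⋁ L)
          gen-fin {x} d with compact d
          ... | L , g , d' = L , g , mp (taut (⋁ L ∷ x ∷ x ∷ x ∷ []) ((p¬ pA p⇒ p¬ pB) p⇒ pB p⇒ pA) refl)
                (subst (λ z → T ⊢ (z ⇒ ¬' x)) (closed₀ (¬' (⋁ L))) d')

    Only : Sentence → Sentence → Set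
    Only ρ x = x ≡ ρ

    abstract
      onlyD : ∀ ρ → Def false (pred₁ (SetCode (Only ρ)))
      onlyD ρ = defP (xeq (xv 0F) (xn (cdF ρ))) λ { (k ∷ []) → (λ { (_ , refl , refl) → refl }) , (λ { refl → ρ , refl , refl }) }

    Princ : Sentence → Ext T
    Princ ρ = Gen (Only ρ) (onlyD ρ)

    abstract
      princ-Le : ∀ {ρ x} → In (Princ ρ) x → Le x ρ
      princ-Le {ρ} {x} p with gen-fin (Only ρ) (onlyD ρ) p
      ... | L , g , d = Le-trans d (go L g)
        where
        go : ∀ L → All (Only ρ) L → Le (⋁ L) ρ
        go [] [] = taut (ρ ∷ ρ ∷ ρ ∷ ρ ∷ []) (p⊥ p⇒ pA) refl
        go (x ∷ L) (refl ∷ g) = mp (taut (ρ ∷ ⋁ L ∷ ρ ∷ ρ ∷ []) ((pB p⇒ pA) p⇒ (pA p∨ pB) p⇒ pA) refl) (go L g)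

    abstract
      princ-In : ∀ {ρ x} → Le x ρ → In (Princ ρ) x
      princ-In {ρ} d = In-down (Princ ρ) d (gen-In (Only ρ) (onlyD ρ) refl)

    abstract
      mem-In : ∀ (A : Ext T) φ → mem A φ ⇔ In A (¬' φ)
      mem-In A φ = (λ p → memMP A (mem⊢ A (taut (φ ∷ φ ∷ φ ∷ φ ∷ []) (pA p⇒ p¬ (p¬ pA)) refl)) p) ,
                   (λ p → memMP A (mem⊢ A (taut (φ ∷ φ ∷ φ ∷ φ ∷ []) (p¬ (p¬ pA) p⇒ pA) refl)) p)

    abstract
      -- Both extensions are closed under conjunction, so one sentence of each suffices for a
      -- derivation from their union. Applied to a derivation of falsity, this produces the
      -- generator of a complemented element.
      joinCompact : ∀ (A B : Ext T) {n} {φ : Formula n} → (λ ψ → mem A ψ ⊎ mem B ψ) ⊢ φ →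
        Σ Sentence λ a → Σ Sentence λ b → mem A a × mem B b × T ⊢ (closedAt a ⇒ closedAt b ⇒ φ)
      joinCompact A B {n} (hyp {φ = φ} (inj₁ p)) = φ , (`⊥ ⇒ `⊥) , p , mem⊢ B (taut {n = 4} {m = 0} (`⊥ ∷ `⊥ ∷ `⊥ ∷ `⊥ ∷ []) (p⊥ p⇒ p⊥) refl) , ax (ax-K _ _)
      joinCompact A B {n} (hyp {φ = φ} (inj₂ p)) = (`⊥ ⇒ `⊥) , φ , mem⊢ A (taut {n = 4} {m = 0} (`⊥ ∷ `⊥ ∷ `⊥ ∷ `⊥ ∷ []) (p⊥ p⇒ p⊥) refl) , p ,
        taut {n = 4} {m = n} (closedAt φ ∷ `⊥ ∷ `⊥ ∷ `⊥ ∷ []) ((p⊥ p⇒ p⊥) p⇒ pA p⇒ pA) refl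
      joinCompact A B {n} (ax a) = (`⊥ ⇒ `⊥) , (`⊥ ⇒ `⊥) , mem⊢ A (taut {n = 4} {m = 0} (`⊥ ∷ `⊥ ∷ `⊥ ∷ `⊥ ∷ []) (p⊥ p⇒ p⊥) refl) , mem⊢ B (taut {n = 4} {m = 0} (`⊥ ∷ `⊥ ∷ `⊥ ∷ `⊥ ∷ []) (p⊥ p⇒ p⊥) refl) ,
        mp (ax (ax-K _ _)) (mp (ax (ax-K _ _)) (ax a))
      joinCompact A B {n} {ψ} (mp {φ = φ} d e) with joinCompact A B d | joinCompact A B e
      ... | a , b , p , r , d' | a' , b' , p' , r' , e' = a ⊓ a' , b ⊓ b' ,
        memMP A (memMP A (mem⊢ A (taut (a ∷ a' ∷ a ∷ a ∷ []) (pA p⇒ pB p⇒ pA p⊓ pB) refl)) p) p' ,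
        memMP B (memMP B (mem⊢ B (taut (b ∷ b' ∷ a ∷ a ∷ []) (pA p⇒ pB p⇒ pA p⊓ pB) refl)) r) r' ,
        mp (mp (taut {n = 6} {m = n} (closedAt a ∷ closedAt b ∷ closedAt a' ∷ closedAt b' ∷ φ ∷ ψ ∷ [])
          ((pA p⇒ pB p⇒ pv 4F p⇒ pv 5F) p⇒ (pC p⇒ pD p⇒ pv 4F) p⇒ (pA p⊓ pC) p⇒ (pB p⊓ pD) p⇒ pv 5F) refl) d') e'
      joinCompact A B (gen {φ = φ} d) with joinCompact A B d
      ... | a , b , p , r , d' = a , b , p , r , un (lam {Δ = []} (lam (thm (ax (ax-dist _ _)) $$ (thm (ax (ax-dist (closedAt a) _)) $$
          thm (gen (subst (λ z → T ⊢ (z ⇒ wk (closedAt b) ⇒ φ)) (sym (wk-closed a)) (subst (λ z → T ⊢ (closedAt a ⇒ z ⇒ φ)) (sym (wk-closed b)) d'))) $$ h1) $$ h0)))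

open TheoriesAsIdeals

-- Leftmost completions and the disjoint sentences that converge to them

module CellsAndSlots where

  lt₀ : ∀ {b n} → Term n → AF b (suc n)
  lt₀ t = ex (eq (`S (var 0F `+ var 1F)) (renT fsuc (renT fsuc t)))

  lt₀-sem : ∀ {b n} (t : Term n) k e → ⟦ lt₀ {b} t ⟧ (k ∷ e) ⇔ (k < ev t e)
  lt₀-sem t k e =
    (λ { (d , p) → subst (k <_) (trans p (w d)) (s≤s (m≤n+m k d)) }) ,
    (λ l → ev t e ∸ suc k , trans (trans (sym (+-suc (ev t e ∸ suc k) k)) (m∸n+n≡m l)) (sym (w (ev t e ∸ suc k))))
    where
    w : ∀ d → ev (renT fsuc (renT fsuc t)) (d ∷ k ∷ e) ≡ ev t e
    w d = trans (ev-wk (renT fsuc t) d (k ∷ e)) (ev-wk t k e)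

  -- Negations are pushed down to equations, where inequality becomes the existence of a positive
  -- difference. Thus a bounded formula and its negation are both positive definitions.
  bpos bnot : ∀ {n} → BF n → AF false n
  bpos (beq s t) = eq s t
  bpos (band φ ψ) = and (bpos φ) (bpos ψ)
  bpos (bneg φ) = bnot φ
  bpos (bex< t φ) = ex (and (lt₀ t) (bpos φ))
  bnot (beq s t) = ex (or (eq (`S (var 0F `+ renT fsuc s)) (renT fsuc t)) (eq (`S (var 0F `+ renT fsuc t)) (renT fsuc s)))
  bnot (band φ ψ) = or (bnot φ) (bnot ψ)
  bnot (bneg φ) = bpos φ
  bnot (bex< t φ) = all< t (bnot φ)

  bpos-sem : ∀ {n} (φ : BF n) e → B⟦ φ ⟧ e ⇔ ⟦ bpos φ ⟧ e
  bnot-sem : ∀ {n} (φ : BF n) e → (¬ B⟦ φ ⟧ e) ⇔ ⟦ bnot φ ⟧ e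
  bpos-sem (beq s t) e = (λ z → z) , (λ z → z)
  bpos-sem (band φ ψ) e = bpos-sem φ e ⇔× bpos-sem ψ e
  bpos-sem (bneg φ) e = bnot-sem φ e
  bpos-sem (bex< t φ) e =
    (λ { (k , l , p) → k , proj₂ (lt₀-sem {false} t k e) l , proj₁ (bpos-sem φ (k ∷ e)) p }) ,
    (λ { (k , l , p) → k , proj₁ (lt₀-sem {false} t k e) l , proj₂ (bpos-sem φ (k ∷ e)) p })
  bnot-sem (beq s t) e = to , from
    where
    to : ¬ ev s e ≡ ev t e → ⟦ bnot (beq s t) ⟧ e
    to ne with <-cmp (ev s e) (ev t e)
    ... | tri≈ _ p _ = ⊥-elim (ne p)
    ... | tri< l _ _ = ev t e ∸ suc (ev s e) , inj₁ (trans (cong (λ z → suc (d + z)) (ev-wk s d e)) (trans (trans (sym (+-suc d (ev s e))) (m∸n+n≡m l)) (sym (ev-wk t d e))))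
      where d = ev t e ∸ suc (ev s e)
    ... | tri> _ _ l = ev s e ∸ suc (ev t e) , inj₂ (trans (cong (λ z → suc (d + z)) (ev-wk t d e)) (trans (trans (sym (+-suc d (ev t e))) (m∸n+n≡m l)) (sym (ev-wk s d e))))
      where d = ev s e ∸ suc (ev t e)
    from : ⟦ bnot (beq s t) ⟧ e → ¬ ev s e ≡ ev t e
    from (d , inj₁ p) q = <⇒≢ (subst₂ _<_ (ev-wk s d e) (trans p (ev-wk t d e)) (s≤s (m≤n+m _ d))) q
    from (d , inj₂ p) q = <⇒≢ (subst₂ _<_ (ev-wk t d e) (trans p (ev-wk s d e)) (s≤s (m≤n+m _ d))) (sym q)
  bnot-sem (band φ ψ) e = to , from
    where
    to : ¬ (B⟦ φ ⟧ e × B⟦ ψ ⟧ e) → ⟦ bnot φ ⟧ e ⊎ ⟦ bnot ψ ⟧ e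
    to n with bdec φ e
    ... | no np = inj₁ (proj₁ (bnot-sem φ e) np)
    ... | yes p = inj₂ (proj₁ (bnot-sem ψ e) (λ r → n (p , r)))
    from : ⟦ bnot φ ⟧ e ⊎ ⟦ bnot ψ ⟧ e → ¬ (B⟦ φ ⟧ e × B⟦ ψ ⟧ e)
    from (inj₁ p) (a , _) = proj₂ (bnot-sem φ e) p a
    from (inj₂ p) (_ , b) = proj₂ (bnot-sem ψ e) p b
  bnot-sem (bneg φ) e = (λ nn → proj₁ (bpos-sem φ e) (decidable-stable (bdec φ e) nn)) , (λ p n → n (proj₂ (bpos-sem φ e) p))
  bnot-sem (bex< t φ) e =
    (λ n k l → proj₁ (bnot-sem φ (k ∷ e)) (λ p → n (k , l , p))) ,
    (λ { f (k , l , p) → proj₂ (bnot-sem φ (k ∷ e)) (f k l) p })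

  abstract
    bfD : ∀ {n} (φ : BF n) → Def false B⟦ φ ⟧
    bfD φ = bpos φ , bpos-sem φ

  abstract
    bnD : ∀ {n} (φ : BF n) → Def false (λ e → ¬ B⟦ φ ⟧ e)
    bnD φ = bnot φ , bnot-sem φ

  abstract
    exVecD : ∀ {b n} m {P : Vec ℕ (m + n) → Set} → Def b P → Def b (λ e → Σ (Vec ℕ m) λ ys → P (ys ++ e))
    exVecD m (φ , h) = exN m φ , λ e →
      ((λ { (ys , p) → ys , proj₁ (h _) p }) , (λ { (ys , p) → ys , proj₂ (h _) p })) ⇔∘ ⇔sym (exN-sem m φ e)

  -- A total enumeration of the sentences: ⌊ w , k ⌋ names the sentence with code k once w witnesses that k is such a code.

  isFm : BF 3
  isFm = nf (proj₁ fmD)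

  ⊤' : Sentence
  ⊤' = `⊥ ⇒ `⊥

  fromWitnessFm : ∀ w k → B⟦ isFm ⟧ (w ∷ 0 ∷ k ∷ []) → IsFm 0 k
  fromWitnessFm w k p = proj₂ (proj₂ fmD (0 ∷ k ∷ [])) (proj₂ (nf-sem (proj₁ fmD) (0 ∷ k ∷ [])) (w , p))

  dselAt : ∀ w k → Dec (B⟦ isFm ⟧ (w ∷ 0 ∷ k ∷ [])) → Sentence
  dselAt w k (yes p) = proj₁ (fromWitnessFm w k p)
  dselAt w k (no _) = ⊤'

  dsel : ℕ → Sentence
  dsel n = let w , k , _ = unpair n in dselAt w k (bdec isFm (w ∷ 0 ∷ k ∷ []))

  abstract
    dsel-surj : ∀ d → Σ ℕ λ n → dsel n ≡ d
    dsel-surj d with proj₁ (nf-sem (proj₁ fmD) (0 ∷ cdF d ∷ [])) (proj₁ (proj₂ fmD (0 ∷ cdF d ∷ [])) (d , refl))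
    ... | w , p = ⌊ w , cdF d ⌋ , lem
      where
      lem : dsel ⌊ w , cdF d ⌋ ≡ d
      lem with unpair ⌊ w , cdF d ⌋
      ... | w' , k' , e with pinj w (cdF d) {w'} {k'} e
      ...   | refl , refl with bdec isFm (w ∷ 0 ∷ cdF d ∷ [])
      ...     | yes p' = codeF-inj _ d (proj₂ (fromWitnessFm w (cdF d) p'))
      ...     | no n = ⊥-elim (n p)

  abstract
    dselD : Def false (rel₂ (λ n c → c ≡ cdF (dsel n)))
    dselD = defP (xex (xex (xand (xeq (xv 2F) (xp (xv 1F) (xv 0F)))
        (xor (xand (at (bfD isFm) (xv 1F ∷ xn 0 ∷ xv 0F ∷ [])) (xeq (xv 3F) (xv 0F)))
             (xand (at (bnD isFm) (xv 1F ∷ xn 0 ∷ xv 0F ∷ [])) (xeq (xv 3F) (xn (cdF ⊤'))))))))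
      λ { (n ∷ c ∷ []) → to n c , from n c }
      where
      Rel : ℕ → ℕ → ℕ → ℕ → Set
      Rel n c w k = n ≡ ⌊ w , k ⌋ × ((B⟦ isFm ⟧ (w ∷ 0 ∷ k ∷ []) × c ≡ k) ⊎ (¬ B⟦ isFm ⟧ (w ∷ 0 ∷ k ∷ []) × c ≡ cdF ⊤'))
      to : ∀ n c → c ≡ cdF (dsel n) → Σ ℕ λ w → Σ ℕ λ k → Rel n c w k
      to n c e with unpair n
      ... | w , k , e' with bdec isFm (w ∷ 0 ∷ k ∷ [])
      ...   | yes p = w , k , e' , inj₁ (p , trans e (proj₂ (fromWitnessFm w k p)))
      ...   | no np = w , k , e' , inj₂ (np , e)
      from : ∀ n c → (Σ ℕ λ w → Σ ℕ λ k → Rel n c w k) → c ≡ cdF (dsel n)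
      from n c (w , k , e , r) with unpair n
      ... | w' , k' , e' with pinj w k {w'} {k'} (trans (sym e) e')
      ...   | refl , refl with bdec isFm (w ∷ 0 ∷ k ∷ [])
      from n c (w , k , e , inj₁ (_ , q)) | _ | refl , refl | yes p = trans q (sym (proj₂ (fromWitnessFm w k p)))
      from n c (w , k , e , inj₂ (np , _)) | _ | refl , refl | yes p = ⊥-elim (np p)
      from n c (w , k , e , inj₁ (p , _)) | _ | refl , refl | no np = ⊥-elim (np p)
      from n c (w , k , e , inj₂ (_ , q)) | _ | refl , refl | no np = q

  module Cells (T : Sentence → Set) (TD : Def false (pred₁ (SetCode T)))
               (q : ∀ φ → Q φ → T φ) (con : Consistent T) where
    open Ideals T TD q con public

    F-half : ∀ {x} → Z (x ⊓ F x) → Z x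
    F-half {x} d = F-neg x (mp (taut (x ∷ F x ∷ x ∷ x ∷ []) (p¬ (pA p⊓ pB) p⇒ pA p⇒ p¬ pB) refl) d)

    F-half' : ∀ {x} → Z (x ⊓ ¬' (F x)) → Z x
    F-half' {x} d = F-pos x (mp (taut (x ∷ F x ∷ x ∷ x ∷ []) (p¬ (pA p⊓ p¬ pB) p⇒ pA p⇒ pB) refl) d)

    -- The leftmost completion of p: at stage i a part of the current cell is discarded, and then dsel i is decided;
    -- the negative decision is allowed only once the positive one has been refuted.
    data Cell (p : Sentence) : ℕ → Sentence → Set where
      cell₀ : Cell p 0 p
      cellL : ∀ {i y} → Cell p i y → Cell p (suc i) ((y ⊓ ¬' (F y)) ⊓ dsel i)
      cellR : ∀ {i y} → Cell p i y → Z ((y ⊓ ¬' (F y)) ⊓ dsel i) → Cell p (suc i) ((y ⊓ ¬' (F y)) ⊓ ¬' (dsel i))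

    cell-le : ∀ {p i y} → Cell p i y → Le y p
    cell-le cell₀ = Le-refl
    cell-le (cellL c) = Le-trans ⊓₁ (Le-trans ⊓₁ (cell-le c))
    cell-le (cellR c _) = Le-trans ⊓₁ (Le-trans ⊓₁ (cell-le c))

    Z-cases : ∀ {y} d → Z (y ⊓ d) → Z (y ⊓ ¬' d) → Z y
    Z-cases {y} d a b = mp (mp (taut (y ∷ d ∷ y ∷ y ∷ []) (p¬ (pA p⊓ pB) p⇒ p¬ (pA p⊓ p¬ pB) p⇒ p¬ pA) refl) a) b

    -- If both decisions were refuted, then so would be y ⊓ ¬ F y, and by the Rosser property y
    -- itself. Which decision is consistent is not decidable, hence the double negation.
    cell-exists : ∀ {p} → ¬ Z p → ∀ i → ¬ ¬ (Σ Sentence λ y → Cell p i y × ¬ Z y)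
    cell-exists nz zero k = k (_ , cell₀ , nz)
    cell-exists nz (suc i) k = cell-exists nz i λ { (y , c , ny) →
      k (_ , cellL c , λ z → k (_ , cellR c z , λ z' → ny (F-half' (Z-cases (dsel i) z z')))) }

    disj-lit : ∀ {x y} d → Disj (x ⊓ d) (y ⊓ ¬' d)
    disj-lit d = disj-mono ⊓₂ ⊓₂ (disj-¬ d)

    -- Different cells of one stage took opposite decisions on some `dsel i`.
    cell-same : ∀ {p i y y'} → Cell p i y → Cell p i y' → (y ≡ y') ⊎ Disj y y'
    cell-same cell₀ cell₀ = inj₁ refl
    cell-same (cellL {i} c) (cellL c') with cell-same c c'
    ... | inj₁ refl = inj₁ refl
    ... | inj₂ d = inj₂ (disj-mono (Le-trans ⊓₁ ⊓₁) (Le-trans ⊓₁ ⊓₁) d)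
    cell-same (cellL {i} c) (cellR c' _) = inj₂ (disj-lit (dsel i))
    cell-same (cellR {i} c _) (cellL c') = inj₂ (disj-sym (disj-lit (dsel i)))
    cell-same (cellR {i} c _) (cellR c' _) with cell-same c c'
    ... | inj₁ refl = inj₁ refl
    ... | inj₂ d = inj₂ (disj-mono (Le-trans ⊓₁ ⊓₁) (Le-trans ⊓₁ ⊓₁) d)

    cell-later : ∀ {p i j y y'} → i < j → Cell p i y → Cell p j y' → Le y' (y ⊓ ¬' (F y)) ⊎ Disj y y'
    cell-later {p} {i} {suc j} {y} {y'} (s≤s l) c c' = go (m≤n⇒m<n∨m≡n l) c'
      where
      parent : ∀ {z} → Cell p (suc j) z → Σ Sentence λ w → Cell p j w × Le z (w ⊓ ¬' (F w))
      parent (cellL {y = w} c) = w , c , ⊓₁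
      parent (cellR {y = w} c _) = w , c , ⊓₁
      go : i < j ⊎ i ≡ j → Cell p (suc j) y' → Le y' (y ⊓ ¬' (F y)) ⊎ Disj y y'
      go (inj₁ l) c' with parent c'
      ... | y'' , d , e with cell-later l c d
      ...   | inj₁ f = inj₁ (Le-trans e (Le-trans ⊓₁ f))
      ...   | inj₂ f = inj₂ (disj-mono Le-refl (Le-trans e ⊓₁) f)
      go (inj₂ refl) c' with parent c'
      ... | y'' , d , e with cell-same c d
      ...   | inj₁ refl = inj₁ e
      ...   | inj₂ f = inj₂ (disj-mono Le-refl (Le-trans e ⊓₁) f)

    cell-decides : ∀ {p i j y} d → dsel i ≡ d → i < j → Cell p j y → Le y d ⊎ Le y (¬' d)
    cell-decides {p} {i} {suc j} {y} d refl (s≤s l) c = go (m≤n⇒m<n∨m≡n l) c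
      where
      go : ∀ {y} → i < j ⊎ i ≡ j → Cell p (suc j) y → Le y d ⊎ Le y (¬' d)
      go (inj₂ refl) (cellL c) = inj₁ ⊓₂
      go (inj₂ refl) (cellR c _) = inj₂ ⊓₂
      go (inj₁ l) (cellL c) with cell-decides d refl l c
      ... | inj₁ f = inj₁ (Le-trans ⊓₁ (Le-trans ⊓₁ f))
      ... | inj₂ f = inj₂ (Le-trans ⊓₁ (Le-trans ⊓₁ f))
      go (inj₁ l) (cellR c _) with cell-decides d refl l c
      ... | inj₁ f = inj₁ (Le-trans ⊓₁ (Le-trans ⊓₁ f))
      ... | inj₂ f = inj₂ (Le-trans ⊓₁ (Le-trans ⊓₁ f))

    -- A later cell on the same branch lies under y ⊓ ¬ F y and so avoids the part y ⊓ F y discarded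
    -- at y; cells on different branches are disjoint anyway.
    sib-disj : ∀ {p i j y y'} → Cell p i y → Cell p j y' → (i ≡ j × y ≡ y') ⊎ Disj (y ⊓ F y) (y' ⊓ F y')
    sib-disj {i = i} {j} {y} {y'} c c' with <-cmp i j
    ... | tri≈ _ refl _ with cell-same c c'
    ...   | inj₁ e = inj₁ (refl , e)
    ...   | inj₂ d = inj₂ (disj-mono ⊓₁ ⊓₁ d)
    sib-disj {y = y} {y'} c c' | tri< l _ _ with cell-later l c c'
    ...   | inj₁ e = inj₂ (disj-mono Le-refl (Le-trans ⊓₁ e) (disj-mono ⊓₂ ⊓₂ (disj-¬ (F y))))
    ...   | inj₂ d = inj₂ (disj-mono ⊓₁ ⊓₁ d)
    sib-disj {y = y} {y'} c c' | tri> _ _ l with cell-later l c' c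
    ...   | inj₁ e = inj₂ (disj-sym (disj-mono Le-refl (Le-trans ⊓₁ e) (disj-mono ⊓₂ ⊓₂ (disj-¬ (F y')))))
    ...   | inj₂ d = inj₂ (disj-mono ⊓₁ ⊓₁ (disj-sym d))

    -- Pieces cut off one after another by Rosser sentences: an infinite family of disjoint
    -- sentences below x, all consistent when x is.
    pc : Sentence → ℕ → Sentence
    pc x zero = x ⊓ F x
    pc x (suc n) = pc (x ⊓ ¬' (F x)) n

    pc-le : ∀ x n → Le (pc x n) x
    pc-le x zero = ⊓₁
    pc-le x (suc n) = Le-trans (pc-le _ n) ⊓₁

    pc-nz : ∀ x n → Z (pc x n) → Z x
    pc-nz x zero d = F-half d
    pc-nz x (suc n) d = F-half' (pc-nz _ n d)

    pc-disj : ∀ x n m → n ≡ m ⊎ Disj (pc x n) (pc x m)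
    pc-disj x zero zero = inj₁ refl
    pc-disj x zero (suc m) = inj₂ (disj-mono ⊓₂ (Le-trans (pc-le _ m) ⊓₂) (disj-¬ (F x)))
    pc-disj x (suc n) zero = inj₂ (disj-sym (disj-mono ⊓₂ (Le-trans (pc-le _ n) ⊓₂) (disj-¬ (F x))))
    pc-disj x (suc n) (suc m) with pc-disj (x ⊓ ¬' (F x)) n m
    ... | inj₁ e = inj₁ (cong suc e)
    ... | inj₂ d = inj₂ d

    label : ℕ → Sentence
    label = pc ⊤'

    label-nz : ∀ n → ¬ Z (label n)
    label-nz n d = con (mp (pc-nz ⊤' n d) (taut (`⊥ ∷ `⊥ ∷ `⊥ ∷ `⊥ ∷ []) (pA p⇒ pA) refl))

    Slot : Vec ℕ 3 → Sentence → Set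
    Slot (n ∷ m ∷ v ∷ []) p = Σ Sentence λ y → Cell (label n) m y × p ≡ pc (y ⊓ F y) v

    slot-le : ∀ n {m v p} → Slot (n ∷ m ∷ v ∷ []) p → Le p (label n)
    slot-le n {v = v} (y , c , refl) = Le-trans (pc-le _ v) (Le-trans ⊓₁ (cell-le c))

    slot-disj : ∀ s s' {p p'} → Slot s p → Slot s' p' → (s ≡ s' × p ≡ p') ⊎ Disj p p'
    slot-disj (n ∷ m ∷ v ∷ []) (n' ∷ m' ∷ v' ∷ []) (y , c , refl) (y' , c' , refl) with pc-disj ⊤' n n'
    ... | inj₂ d = inj₂ (disj-mono (slot-le n {m} {v} (y , c , refl)) (slot-le n' {m'} {v'} (y' , c' , refl)) d)
    ... | inj₁ refl with sib-disj c c'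
    ...   | inj₂ d = inj₂ (disj-mono (pc-le _ v) (pc-le _ v') d)
    ...   | inj₁ (refl , refl) with pc-disj (y ⊓ F y) v v'
    ...     | inj₁ refl = inj₁ (refl , refl)
    ...     | inj₂ d = inj₂ d

    -- Iterated discarded parts; the first entry of the index is the most recent stage.
    data Sl : ∀ {j} → Vec ℕ (j + 3) → Sentence → Set where
      top : ∀ {s p} → Slot s p → Sl {0} s p
      sub : ∀ {j} {w : Vec ℕ (j + 3)} {p i y} → Sl {j} w p → Cell p i y → Sl {suc j} (i ∷ w) (y ⊓ F y)

    -- This makes indices recoverable: consistent overlap with a nested slot determines both its
    -- index and the sentence.
    sl-disj : ∀ {j} {w w' : Vec ℕ (j + 3)} {p p'} → Sl {j} w p → Sl {j} w' p' → (w ≡ w' × p ≡ p') ⊎ Disj p p'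
    sl-disj (top a) (top b) = slot-disj _ _ a b
    sl-disj (sub a c) (sub a' c') with sl-disj a a'
    ... | inj₂ d = inj₂ (disj-mono (Le-trans ⊓₁ (cell-le c)) (Le-trans ⊓₁ (cell-le c')) d)
    ... | inj₁ (refl , refl) with sib-disj c c'
    ...   | inj₁ (refl , refl) = inj₁ (refl , refl)
    ...   | inj₂ d = inj₂ d

open CellsAndSlots

-- Arithmetical definitions of cells, slots and the generated ideals

module CellDefinability where

  rel₄ : (ℕ → ℕ → ℕ → ℕ → Set) → Vec ℕ 4 → Set
  rel₄ R (a ∷ b ∷ c ∷ d ∷ []) = R a b c d

  encW : ∀ j → Vec ℕ (j + 3) → ℕ
  encW zero (n ∷ m ∷ v ∷ []) = ⌊ n , ⌊ m , v ⌋ ⌋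
  encW (suc j) (i ∷ w) = ⌊ i , encW j w ⌋

  encWX : ∀ {k} j → Vec (XT k) (j + 3) → XT k
  encWX zero (n ∷ m ∷ v ∷ []) = xp n (xp m v)
  encWX (suc j) (i ∷ w) = xp i (encWX j w)

  encWX-ev : ∀ {k} j (w : Vec (XT k) (j + 3)) e → xev (encWX j w) e ≡ encW j (xevs w e)
  encWX-ev zero (n ∷ m ∷ v ∷ []) e = refl
  encWX-ev (suc j) (i ∷ w) e = cong ⌊ xev i e ,_⌋ (encWX-ev j w e)

  encW-inj : ∀ j (w w' : Vec ℕ (j + 3)) → encW j w ≡ encW j w' → w ≡ w'
  encW-inj zero (n ∷ m ∷ v ∷ []) (n' ∷ m' ∷ v' ∷ []) e with pinj n ⌊ m , v ⌋ {n'} {⌊ m' , v' ⌋} e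
  ... | refl , e' with pinj m v {m'} {v'} e'
  ...   | refl , refl = refl
  encW-inj (suc j) (i ∷ w) (i' ∷ w') e with pinj i (encW j w) {i'} {encW j w'} e
  ... | refl , e' = cong (i ∷_) (encW-inj j w w' e')

  module CellDefs (T : Sentence → Set) (TD : Def false (pred₁ (SetCode T)))
                  (q : ∀ φ → Q φ → T φ) (con : Consistent T) where
    open Cells T TD q con public

    abstract
      fD : Def false (rel₂ (λ k c → c ≡ FCode k))
      fD = defP (at saysD (xn (cdF rosser) ∷ xp (xn (cdF rosser)) (xv 0F) ∷ xv 1F ∷ [])) λ { (k ∷ c ∷ []) → (λ p → p) , (λ p → p) }

    CellC : ℕ → ℕ → ℕ → Set
    CellC p i y = Σ Sentence λ P → Σ Sentence λ Y → cdF P ≡ p × cdF Y ≡ y × Cell P i Y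

    rest : ∀ {n} → XT n → XT n → XT n
    rest y f = c⊓ y (cNeg f)

    cellProg : Program false
    cellProg = clause 1 (at fmD (xn 0 ∷ xv 0F ∷ [])) [] (xp (xv 0F) (xp (xn 0) (xv 0F)))
      ∷ clause 5 (xand (at fD (xv 2F ∷ xv 3F ∷ [])) (at dselD (xv 1F ∷ xv 4F ∷ []))) (xp (xv 0F) (xp (xv 1F) (xv 2F)) ∷ [])
          (xp (xv 0F) (xp (xsu (xv 1F)) (c⊓ (rest (xv 2F) (xv 3F)) (xv 4F))))
      ∷ clause 5 (xand (at fD (xv 2F ∷ xv 3F ∷ [])) (xand (at dselD (xv 1F ∷ xv 4F ∷ [])) (at thmD (cNeg (c⊓ (rest (xv 2F) (xv 3F)) (xv 4F)) ∷ []))))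
          (xp (xv 0F) (xp (xv 1F) (xv 2F)) ∷ [])
          (xp (xv 0F) (xp (xsu (xv 1F)) (c⊓ (rest (xv 2F) (xv 3F)) (cNeg (xv 4F)))))
      ∷ []

    cell-complete : ∀ {P i Y} → Cell P i Y → Der cellProg ⌊ cdF P , ⌊ i , cdF Y ⌋ ⌋
    cell-complete {P} cell₀ = der fzero (cdF P ∷ []) (P , refl) tt refl
    cell-complete {P} (cellL {i} {y} c) = der (fsuc fzero) (cdF P ∷ i ∷ cdF y ∷ cdF (F y) ∷ cdF (dsel i) ∷ []) (codeF-F y , refl) (cell-complete c) refl
    cell-complete {P} (cellR {i} {y} c z) = der (fsuc (fsuc fzero)) (cdF P ∷ i ∷ cdF y ∷ cdF (F y) ∷ cdF (dsel i) ∷ []) (codeF-F y , refl , _ , refl , z) (cell-complete c) refl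

    CellMeaning : ℕ → Set
    CellMeaning f = ∀ p i y → f ≡ ⌊ p , ⌊ i , y ⌋ ⌋ → CellC p i y

    inj₃ : ∀ a b c {a' b' c'} → ⌊ a , ⌊ b , c ⌋ ⌋ ≡ ⌊ a' , ⌊ b' , c' ⌋ ⌋ → a ≡ a' × b ≡ b' × c ≡ c'
    inj₃ a b c {a'} {b'} {c'} e with pinj a ⌊ b , c ⌋ {a'} {⌊ b' , c' ⌋} e
    ... | p , e' = p , pinj b c {b'} {c'} e'

    code-of : ∀ {y f} Y → cdF Y ≡ y → f ≡ FCode y → f ≡ cdF (F Y)
    code-of Y refl e = trans e (sym (codeF-F Y))

    cell-sound : ∀ {f} → Der cellProg f → CellMeaning f
    cell-sound = foldDer cellProg CellMeaning step
      where
      fin : ∀ {p i y p' i' y'} → ⌊ p , ⌊ i , y ⌋ ⌋ ≡ ⌊ p' , ⌊ i' , y' ⌋ ⌋ → CellC p i y → CellC p' i' y'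
      fin {p} {i} {y} {p'} {i'} {y'} e c with inj₃ p i y {p'} {i'} {y'} e
      ... | refl , refl , refl = c
      step : ∀ i e → X⟦ side (llookup cellProg i) ⟧ e → AllP (λ f → Der cellProg f × CellMeaning f) (prems (llookup cellProg i)) e → CellMeaning (xev (concl (llookup cellProg i)) e)
      step fzero (p ∷ []) (P , e) _ p' i' y' eqn = fin {p} {0} {p} {p'} {i'} {y'} eqn (P , P , e , e , cell₀)
      step (fsuc fzero) (p ∷ i ∷ y ∷ f ∷ d ∷ []) (ef , refl) (_ , ih) p' i' y' eqn with ih p i y refl
      ... | P , Y , refl , ey , c with code-of Y ey ef | ey
      ...   | refl | refl = fin {p} {suc i} {_} {p'} {i'} {y'} eqn (P , _ , refl , refl , cellL c)
      step (fsuc (fsuc fzero)) (p ∷ i ∷ y ∷ f ∷ d ∷ []) (ef , refl , t) (_ , ih) p' i' y' eqn with ih p i y refl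
      ... | P , Y , refl , ey , c with code-of Y ey ef | ey
      ...   | refl | refl = fin {p} {suc i} {_} {p'} {i'} {y'} eqn (P , _ , refl , refl , cellR c (thm→ (¬' ((Y ⊓ ¬' (F Y)) ⊓ dsel i)) t))

    abstract
      cellD : Def false (rel₃ CellC)
      cellD = defP (at (derD cellProg) (xp (xv 0F) (xp (xv 1F) (xv 2F)) ∷ []))
        λ { (p ∷ i ∷ y ∷ []) → (λ { (P , Y , refl , refl , c) → cell-complete c }) , (λ d → cell-sound d p i y refl) }

    PcC : ℕ → ℕ → ℕ → Set
    PcC x n z = Σ Sentence λ X → cdF X ≡ x × z ≡ cdF (pc X n)

    pcProg : Program false
    pcProg = clause 2 (xand (at fmD (xn 0 ∷ xv 0F ∷ [])) (at fD (xv 0F ∷ xv 1F ∷ []))) [] (xp (xv 0F) (xp (xn 0) (c⊓ (xv 0F) (xv 1F))))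
      ∷ clause 4 (xand (at fmD (xn 0 ∷ xv 0F ∷ [])) (at fD (xv 0F ∷ xv 3F ∷ []))) (xp (rest (xv 0F) (xv 3F)) (xp (xv 1F) (xv 2F)) ∷ []) (xp (xv 0F) (xp (xsu (xv 1F)) (xv 2F)))
      ∷ []

    pc-complete : ∀ X n → Der pcProg ⌊ cdF X , ⌊ n , cdF (pc X n) ⌋ ⌋
    pc-complete X zero = der fzero (cdF X ∷ cdF (F X) ∷ []) ((X , refl) , codeF-F X) tt refl
    pc-complete X (suc n) = der (fsuc fzero) (cdF X ∷ n ∷ cdF (pc X (suc n)) ∷ cdF (F X) ∷ []) ((X , refl) , codeF-F X) (pc-complete (X ⊓ ¬' (F X)) n) refl

    PcMeaning : ℕ → Set
    PcMeaning f = ∀ p i y → f ≡ ⌊ p , ⌊ i , y ⌋ ⌋ → PcC p i y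

    pc-sound : ∀ {f} → Der pcProg f → PcMeaning f
    pc-sound = foldDer pcProg PcMeaning step
      where
      fin : ∀ {p i y p' i' y'} → ⌊ p , ⌊ i , y ⌋ ⌋ ≡ ⌊ p' , ⌊ i' , y' ⌋ ⌋ → PcC p i y → PcC p' i' y'
      fin {p} {i} {y} {p'} {i'} {y'} e c with inj₃ p i y {p'} {i'} {y'} e
      ... | refl , refl , refl = c
      step : ∀ i e → X⟦ side (llookup pcProg i) ⟧ e → AllP (λ f → Der pcProg f × PcMeaning f) (prems (llookup pcProg i)) e → PcMeaning (xev (concl (llookup pcProg i)) e)
      step fzero (x ∷ f ∷ []) ((X , refl) , ef) _ p' i' y' eqn with code-of X refl ef
      ... | refl = fin {x} {0} {_} {p'} {i'} {y'} eqn (X , refl , refl)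
      step (fsuc fzero) (x ∷ n ∷ z ∷ f ∷ []) ((X , refl) , ef) (_ , ih) p' i' y' eqn with code-of X refl ef
      ... | refl with ih _ n z refl
      ...   | Y , eY , ez with codeF-inj Y (X ⊓ ¬' (F X)) eY
      ...     | refl = fin {x} {suc n} {_} {p'} {i'} {y'} eqn (X , refl , ez)

    abstract
      pcD : Def false (rel₃ PcC)
      pcD = defP (at (derD pcProg) (xp (xv 0F) (xp (xv 1F) (xv 2F)) ∷ []))
        λ { (x ∷ n ∷ z ∷ []) → (λ { (X , refl , refl) → pc-complete X n }) , (λ d → pc-sound d x n z refl) }

    SlotC : ℕ → ℕ → ℕ → ℕ → Set
    SlotC n m v p = Σ Sentence λ P → cdF P ≡ p × Slot (n ∷ m ∷ v ∷ []) P

    abstract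
      slotD : Def false (rel₄ SlotC)
      slotD = defP (xex (xex (xex (xand (at pcD (xn (cdF ⊤') ∷ xv 3F ∷ xv 2F ∷ [])) (xand (at cellD (xv 2F ∷ xv 4F ∷ xv 1F ∷ []))
          (xand (at fD (xv 1F ∷ xv 0F ∷ [])) (at pcD (c⊓ (xv 1F) (xv 0F) ∷ xv 5F ∷ xv (fsuc 5F) ∷ []))))))))
        λ { (n ∷ m ∷ v ∷ p ∷ []) → to n m v p , from n m v p }
        where
        Body : ℕ → ℕ → ℕ → ℕ → Set
        Body n m v p = Σ ℕ λ l → Σ ℕ λ y → Σ ℕ λ f → PcC (cdF ⊤') n l × CellC l m y × f ≡ FCode y × PcC (xev (c⊓ {2} (xv 0F) (xv 1F)) (y ∷ f ∷ [])) v p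
        to : ∀ n m v p → SlotC n m v p → Body n m v p
        to n m v p (P , refl , y , c , refl) = cdF (label n) , cdF y , cdF (F y) , (⊤' , refl , refl) , (label n , y , refl , refl , c) , codeF-F y , (y ⊓ F y , refl , refl)
        from : ∀ n m v p → Body n m v p → SlotC n m v p
        from n m v p (l , y , f , (X , eX , refl) , (L , Y , eL , ey , c) , ef , (W , eW , ep)) with codeF-inj X ⊤' eX
        ... | refl with codeF-inj L (label n) eL
        ...   | refl with code-of Y ey ef | ey
        ...     | refl | refl with codeF-inj W (Y ⊓ F Y) eW
        ...       | refl = pc (Y ⊓ F Y) v , sym ep , Y , c , refl

    SlC : ℕ → ℕ → ℕ → Set
    SlC j ι q = Σ (Vec ℕ (j + 3)) λ w → Σ Sentence λ P → ι ≡ encW j w × cdF P ≡ q × Sl {j} w P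

    slProg : Program false
    slProg = clause 4 (at slotD (xv 0F ∷ xv 1F ∷ xv 2F ∷ xv 3F ∷ [])) [] (xp (xn 0) (xp (xp (xv 0F) (xp (xv 1F) (xv 2F))) (xv 3F)))
      ∷ clause 6 (xand (at cellD (xv 3F ∷ xv 2F ∷ xv 4F ∷ [])) (at fD (xv 4F ∷ xv 5F ∷ []))) (xp (xv 0F) (xp (xv 1F) (xv 3F)) ∷ [])
          (xp (xsu (xv 0F)) (xp (xp (xv 2F) (xv 1F)) (c⊓ (xv 4F) (xv 5F))))
      ∷ []

    sl-complete : ∀ {j} {w : Vec ℕ (j + 3)} {P} → Sl {j} w P → Der slProg ⌊ j , ⌊ encW j w , cdF P ⌋ ⌋
    sl-complete (top {n ∷ m ∷ v ∷ []} {p} s) = der fzero (n ∷ m ∷ v ∷ cdF p ∷ []) (p , refl , s) tt refl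
    sl-complete (sub {j} {w} {p} {i} {y} s c) = der (fsuc fzero) (j ∷ encW j w ∷ i ∷ cdF p ∷ cdF y ∷ cdF (F y) ∷ []) ((p , y , refl , refl , c) , codeF-F y) (sl-complete s) refl

    SlMeaning : ℕ → Set
    SlMeaning f = ∀ p i y → f ≡ ⌊ p , ⌊ i , y ⌋ ⌋ → SlC p i y

    sl-sound : ∀ {f} → Der slProg f → SlMeaning f
    sl-sound = foldDer slProg SlMeaning step
      where
      fin : ∀ {p i y p' i' y'} → ⌊ p , ⌊ i , y ⌋ ⌋ ≡ ⌊ p' , ⌊ i' , y' ⌋ ⌋ → SlC p i y → SlC p' i' y'
      fin {p} {i} {y} {p'} {i'} {y'} e c with inj₃ p i y {p'} {i'} {y'} e
      ... | refl , refl , refl = c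
      step : ∀ i e → X⟦ side (llookup slProg i) ⟧ e → AllP (λ f → Der slProg f × SlMeaning f) (prems (llookup slProg i)) e → SlMeaning (xev (concl (llookup slProg i)) e)
      step fzero (n ∷ m ∷ v ∷ p ∷ []) (P , e , s) _ p' i' y' eqn = fin {0} {_} {p} {p'} {i'} {y'} eqn (n ∷ m ∷ v ∷ [] , P , refl , e , top s)
      step (fsuc fzero) (j ∷ ι ∷ i ∷ r ∷ y ∷ f ∷ []) ((P , Y , eP , ey , c) , ef) (_ , ih) p' i' y' eqn with ih j ι r refl
      ... | w , R , refl , refl , s with codeF-inj P R eP
      ...   | refl with code-of Y ey ef | ey
      ...     | refl | refl = fin {suc j} {_} {_} {p'} {i'} {y'} eqn (i ∷ w , Y ⊓ F Y , refl , refl , sub s c)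

    abstract
      slD : Def false (rel₃ SlC)
      slD = defP (at (derD slProg) (xp (xv 0F) (xp (xv 1F) (xv 2F)) ∷ []))
        λ { (j ∷ ι ∷ z ∷ []) → (λ { (w , P , refl , refl , s) → sl-complete s }) , (λ d → sl-sound d j ι z refl) }

    GJ : Sentence → Set
    GJ x = Σ ℕ λ n → x ≡ label n

    GD : ℕ → Sentence → Set
    GD j x = Σ (Vec ℕ (j + 3)) λ w → Sl {j} w x

    GE : ∀ K → (Vec ℕ (K + 3) → Set) → Sentence → Set
    GE K R x = Σ (Vec ℕ (K + 3)) λ w → Sl {K} w x × R w

    GV : ℕ → Sentence → Set
    GV v x = Σ ℕ λ n → Σ ℕ λ m → Slot (n ∷ m ∷ v ∷ []) x

    abstract
      gjD : Def false (pred₁ (SetCode GJ))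
      gjD = defP (xex (at pcD (xn (cdF ⊤') ∷ xv 0F ∷ xv 1F ∷ []))) λ { (k ∷ []) →
        (λ { (_ , refl , n , refl) → n , ⊤' , refl , refl }) ,
        (λ { (n , X , e , refl) → label n , cong (λ z → cdF (pc z n)) (codeF-inj ⊤' X (sym e)) , n , refl }) }

    abstract
      gdD : ∀ j → Def false (pred₁ (SetCode (GD j)))
      gdD j = defP (xex (at slD (xn j ∷ xv 0F ∷ xv 1F ∷ []))) λ { (k ∷ []) →
        (λ { (x , refl , w , s) → encW j w , w , x , refl , refl , s }) ,
        (λ { (_ , w , x , _ , e , s) → x , e , w , s }) }

    abstract
      gvD : ∀ v → Def false (pred₁ (SetCode (GV v)))
      gvD v = defP (xex (xex (at slotD (xv 1F ∷ xv 0F ∷ xn v ∷ xv 2F ∷ [])))) λ { (k ∷ []) →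
        (λ { (x , e , n , m , s) → n , m , x , e , s }) , (λ { (n , m , x , e , s) → x , e , n , m , s }) }

    WitW : ∀ K → (Vec ℕ (K + 3) → Set) → Vec ℕ ((K + 3) + 1) → Set
    WitW K R e = SlC K (encW K (xevs (xvars (_↑ˡ 1)) e)) (lookup e ((K + 3) ↑ʳ 0F)) × R (xevs (xvars (_↑ˡ 1)) e)

    abstract
      witD : ∀ K {R} → Def false R → Def false (WitW K R)
      witD K {R} RD = defP (xand (at slD (xn K ∷ encWX K (xvars (_↑ˡ 1)) ∷ xv ((K + 3) ↑ʳ 0F) ∷ [])) (at RD (xvars (_↑ˡ 1))))
        λ e → (λ { (a , b) → subst (λ z → SlC K z (lookup e ((K + 3) ↑ʳ 0F))) (sym (encWX-ev K (xvars (_↑ˡ 1)) e)) a , b }) ,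
              (λ { (a , b) → subst (λ z → SlC K z (lookup e ((K + 3) ↑ʳ 0F))) (encWX-ev K (xvars (_↑ˡ 1)) e) a , b })

    abstract
      exWitD : ∀ K {R} → Def false R → Def false {1} (λ e → Σ (Vec ℕ (K + 3)) λ w → WitW K R (w ++ e))
      exWitD K {R} RD = exVecD {false} {1} (K + 3) {WitW K R} (witD K {R} RD)

    abstract
      -- The length of the index depends on the variable K, so its existential quantifiers are
      -- introduced by recursion, through `exVecD`.
      geD : ∀ K {R} → Def false R → Def false (pred₁ (SetCode (GE K R)))
      geD K {R} RD = proj₁ (exWitD K {R} RD) , λ { (k ∷ []) → (to k , from k) ⇔∘ proj₂ (exWitD K {R} RD) (k ∷ []) }
        where
        vs : ∀ (w : Vec ℕ (K + 3)) k → xevs (xvars (_↑ˡ 1)) (w ++ (k ∷ [])) ≡ w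
        vs w k = xvars-ev (_↑ˡ 1) (w ++ (k ∷ [])) w (lookup-++ˡ w (k ∷ []))
        to : ∀ k → SetCode (GE K R) k → Σ (Vec ℕ (K + 3)) λ w → WitW K R (w ++ (k ∷ []))
        to k (x , refl , w , s , r) = w , (w , x , cong (encW K) (vs w k) , sym (lookup-++ʳ w (k ∷ []) 0F) , s) , subst R (sym (vs w k)) r
        from : ∀ k → (Σ (Vec ℕ (K + 3)) λ w → WitW K R (w ++ (k ∷ []))) → SetCode (GE K R) k
        from k (w , (w' , x , e , eqx , s) , r) = x , trans eqx (lookup-++ʳ w (k ∷ []) 0F) , w ,
          subst (λ z → Sl {K} z x) (sym (encW-inj K w w' (trans (cong (encW K) (sym (vs w k))) e))) s , subst R (vs w k) r

    -- The open set with index e contains the point determined by p.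
    OnU : ℕ → Sentence → Set
    OnU e p = Σ ℕ λ i → Σ Sentence λ y → Cell p i y × ¬ Z y × U e (cdF (¬' y))

    Acc Live : Vec ℕ 4 → Set
    Acc (e ∷ s) = Σ Sentence λ p → Slot s p × OnU e p
    Live (_ ∷ s) = Σ Sentence λ p → Slot s p × ¬ Z p

    abstract
      -- A negation is unavoidable here: the true cell is distinguished from the refuted ones only
      -- by not being refuted.
      accD : Def true Acc
      accD = defP (xex (xex (xex (xand (at (liftD slotD) (xv 4F ∷ xv 5F ∷ xv (fsuc 5F) ∷ xv 2F ∷ []))
          (xand (at (liftD cellD) (xv 2F ∷ xv 1F ∷ xv 0F ∷ [])) (xand (xneg refl (at (liftD thmD) (cNeg (xv 0F) ∷ []))) (at (liftD UD) (xv 3F ∷ cNeg (xv 0F) ∷ []))))))))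
        λ { (e ∷ n ∷ m ∷ v ∷ []) → to e n m v , from e n m v }
        where
        Body : ℕ → ℕ → ℕ → ℕ → Set
        Body e n m v = Σ ℕ λ p → Σ ℕ λ i → Σ ℕ λ y → SlotC n m v p × CellC p i y × (¬ Thm ⌊ 2 , ⌊ y , ⌊ 0 , 0 ⌋ ⌋ ⌋) × U e ⌊ 2 , ⌊ y , ⌊ 0 , 0 ⌋ ⌋ ⌋
        to : ∀ e n m v → Acc (e ∷ n ∷ m ∷ v ∷ []) → Body e n m v
        to e n m v (p , s , i , y , c , nz , u) = cdF p , i , cdF y , (p , refl , s) , (p , y , refl , refl , c) , (λ t → nz (thm→ (¬' y) t)) , u
        from : ∀ e n m v → Body e n m v → Acc (e ∷ n ∷ m ∷ v ∷ [])
        from e n m v (_ , i , _ , (p , ep , s) , (p' , y , ep' , refl , c) , nz , u) with codeF-inj p' p (trans ep' (sym ep))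
        ... | refl = p , s , i , y , c , (λ t → nz (¬' y , refl , t)) , u

    abstract
      liveD : Def true Live
      liveD = defP (xex (xand (at (liftD slotD) (xv 2F ∷ xv 3F ∷ xv 4F ∷ xv 0F ∷ [])) (xneg refl (at (liftD thmD) (cNeg (xv 0F) ∷ [])))))
        λ { (e ∷ n ∷ m ∷ v ∷ []) → (λ { (p , s , nz) → cdF p , (p , refl , s) , (λ t → nz (thm→ (¬' p) t)) }) ,
                                   (λ { (_ , (p , refl , s) , nz) → p , s , (λ t → nz (¬' p , refl , t)) }) }

open CellDefinability

-- Arithmetical truth as an iterated limit of bounded truth

module IteratedLimits where

  infixl 1 _>>=_
  _>>=_ : ∀ {a b} {A : Set a} {B : Set b} → ¬ ¬ A → (A → ¬ ¬ B) → ¬ ¬ B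
  (m >>= f) k = m (λ a → f a k)

  dn : ∀ {a} {A : Set a} → A → ¬ ¬ A
  dn a k = k a

  em : ∀ {a} (A : Set a) → ¬ ¬ (A ⊎ ¬ A)
  em A k = k (inj₂ (λ a → k (inj₁ a)))

  dn-fin : ∀ {ℓ} {P : ℕ → Set ℓ} n → (∀ x → x < n → ¬ ¬ P x) → ¬ ¬ (∀ x → x < n → P x)
  dn-fin zero f k = k (λ _ ())
  dn-fin {P = P} (suc n) f = dn-fin n (λ x l → f x (m≤n⇒m≤1+n l)) >>= λ g → f n ≤-refl >>= λ p →
    dn λ { x (s≤s l) → go g p (m≤n⇒m<n∨m≡n l) }
    where
    go : (∀ x → x < n → P x) → P n → ∀ {x} → x < n ⊎ x ≡ n → P x
    go g p (inj₁ l) = g _ l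
    go g p (inj₂ refl) = p

  -- Truth with the quantifier at depth i bounded by b i.
  bs : ∀ {n} → AF true n → (ℕ → ℕ) → Vec ℕ n → Set
  bs (eq s t)   b e = ev s e ≡ ev t e
  bs (and φ ψ)  b e = bs φ b e × bs ψ b e
  bs (or φ ψ)   b e = ¬ (¬ bs φ b e × ¬ bs ψ b e)
  bs (ex φ)     b e = Σ ℕ λ k → k < b 0 × bs φ (λ i → b (suc i)) (k ∷ e)
  bs (all< t φ) b e = ¬ (Σ ℕ λ k → k < ev t e × ¬ bs φ b (k ∷ e))
  bs (neg _ φ)  b e = ¬ bs φ b e

  ¬⇔ : {A B : Set} → A ⇔ B → (¬ A) ⇔ (¬ B)
  ¬⇔ (f , g) = (λ n b → n (g b)) , (λ n a → n (f a))

  bnd-bs : ∀ {n m} (φ : AF true n) (σ : Fin n → Term m) β e b xs → evs σ e ≡ xs → (∀ i → ev (β i) e ≡ b i) →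
    B⟦ bnd (subA σ φ) β ⟧ e ⇔ bs φ b xs
  bnd-bs (eq s t) σ β e b xs refl h rewrite ev-sub σ s e | ev-sub σ t e = (λ z → z) , (λ z → z)
  bnd-bs (and φ ψ) σ β e b xs p h = bnd-bs φ σ β e b xs p h ⇔× bnd-bs ψ σ β e b xs p h
  bnd-bs (or φ ψ) σ β e b xs p h = ¬⇔ (¬⇔ (bnd-bs φ σ β e b xs p h) ⇔× ¬⇔ (bnd-bs ψ σ β e b xs p h))
  bnd-bs (ex φ) σ β e b xs p h =
    (λ { (k , l , q) → k , subst (k <_) (h 0) l , proj₁ (ih k) q }) , (λ { (k , l , q) → k , subst (k <_) (sym (h 0)) l , proj₂ (ih k) q })
    where ih = λ k → bnd-bs φ (liftS σ) (wkβ (λ i → β (suc i))) (k ∷ e) (λ i → b (suc i)) (k ∷ xs) (trans (evs-lift σ k e) (cong (k ∷_) p))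
                       (λ i → trans (ev-wk (β (suc i)) k e) (h (suc i)))
  bnd-bs (all< t φ) σ β e b xs refl h = ¬⇔
    ((λ { (k , l , q) → k , subst (k <_) (ev-sub σ t e) l , proj₁ (¬⇔ (ih k)) q }) , (λ { (k , l , q) → k , subst (k <_) (sym (ev-sub σ t e)) l , proj₂ (¬⇔ (ih k)) q }))
    where ih = λ k → bnd-bs φ (liftS σ) (wkβ β) (k ∷ e) b (k ∷ evs σ e) (evs-lift σ k e) (λ i → trans (ev-wk (β i) k e) (h i))
  bnd-bs (neg _ φ) σ β e b xs p h = ¬⇔ (bnd-bs φ σ β e b xs p h)

  infix 4 _≈_
  _≈_ : Set → Set → Set
  A ≈ P = (A → ¬ ¬ P) × (P → ¬ ¬ A)

  infixr 5 _◂_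
  _◂_ : ℕ → (ℕ → ℕ) → ℕ → ℕ
  (m ◂ b) zero = m
  (m ◂ b) (suc i) = b i

  -- Iterated limits, outermost bound first.
  LimB : ℕ → ((ℕ → ℕ) → Set) → Set → Set
  LimB zero f P = f (λ _ → 0) ≈ P
  LimB (suc k) f P = ¬ ¬ (Σ ℕ λ m₀ → ∀ m → m₀ ≤ m → LimB k (λ b → f (m ◂ b)) P)

  lim-stable : ∀ k {f P} → ¬ ¬ LimB k f P → LimB k f P
  lim-stable zero h = (λ a n → h λ { (u , _) → u a n }) , (λ p n → h λ { (_ , v) → v p n })
  lim-stable (suc k) h n = h λ z → z n

  lim-resp : ∀ k {f P Q} → P ≈ Q → LimB k f P → LimB k f Q
  lim-resp zero (u , v) (a , c) = (λ x → a x >>= u) , (λ x → v x >>= c)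
  lim-resp (suc k) r l = l >>= λ { (m₀ , h) → dn (m₀ , λ m le → lim-resp k r (h m le)) }

  lim-const : ∀ k {A P} → A ≈ P → LimB k (λ _ → A) P
  lim-const zero r = r
  lim-const (suc k) r = dn (0 , λ m _ → lim-const k r)

  lim-map : ∀ k (op : Set → Set) → (∀ {A P} → A ≈ P → op A ≈ op P) → ∀ {f P} → LimB k f P → LimB k (λ b → op (f b)) (op P)
  lim-map zero op r l = r l
  lim-map (suc k) op r l = l >>= λ { (m₀ , h) → dn (m₀ , λ m le → lim-map k op r (h m le)) }

  lim-map₂ : ∀ k (op : Set → Set → Set) → (∀ {A P B Q} → A ≈ P → B ≈ Q → op A B ≈ op P Q) → ∀ {f P g Q} →
    LimB k f P → LimB k g Q → LimB k (λ b → op (f b) (g b)) (op P Q)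
  lim-map₂ zero op r l l' = r l l'
  lim-map₂ (suc k) op r l l' = l >>= λ { (m₀ , h) → l' >>= λ { (m₁ , h') → dn (m₀ ⊔ m₁ , λ m le →
    lim-map₂ k op r (h m (m⊔n≤o⇒m≤o m₀ m₁ le)) (h' m (m⊔n≤o⇒n≤o m₀ m₁ le))) } }

  -- Finitely many limits have a common modulus; this is what permits an existential quantifier with
  -- a fixed bound inside the remaining limits.
  lim-fin : ∀ k n {f : ℕ → (ℕ → ℕ) → Set} {P : ℕ → Set} → (∀ x → x < n → LimB k (f x) (P x)) →
    LimB k (λ b → Σ ℕ λ x → x < n × f x b) (Σ ℕ λ x → x < n × P x)
  lim-fin zero n h = (λ { (x , l , a) → proj₁ (h x l) a >>= λ p → dn (x , l , p) }) ,
                     (λ { (x , l , p) → proj₂ (h x l) p >>= λ a → dn (x , l , a) })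
  lim-fin (suc k) n h = dn-fin n h >>= λ g → let w , q = sup< n g in
    dn (w , λ m le → lim-fin k n (λ x l → q x l m le))

  ≈¬ : ∀ {A P} → A ≈ P → (¬ A) ≈ (¬ P)
  ≈¬ (u , v) = (λ na → dn (λ p → v p na)) , (λ np → dn (λ a → u a np))

  ≈× : ∀ {A P B Q} → A ≈ P → B ≈ Q → (A × B) ≈ (P × Q)
  ≈× (u , v) (u' , v') = (λ { (a , b) → u a >>= λ p → u' b >>= λ q → dn (p , q) }) , (λ { (p , q) → v p >>= λ a → v' q >>= λ b → dn (a , b) })

  depth : ∀ {b n} → AF b n → ℕ
  depth (eq s t) = 0
  depth (and φ ψ) = depth φ ⊔ depth ψ
  depth (or φ ψ) = depth φ ⊔ depth ψ
  depth (ex φ) = suc (depth φ)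
  depth (all< t φ) = depth φ
  depth (neg _ φ) = depth φ

  -- Each level of existential nesting costs one limit. Once its bound m is fixed only finitely many
  -- instances remain, and their inner limits exist uniformly. A bounded universal quantifier
  -- already has a finite range and costs nothing.
  limit : ∀ {n} (φ : AF true n) k e → depth φ ≤ k → LimB k (λ b → bs φ b e) (⟦ φ ⟧ e)
  limit (eq s t) k e _ = lim-const k (dn , dn)
  limit (and φ ψ) k e d = lim-map₂ k _×_ ≈× (limit φ k e (m⊔n≤o⇒m≤o _ _ d)) (limit ψ k e (m⊔n≤o⇒n≤o (depth φ) _ d))
  limit (or φ ψ) k e d = lim-resp k
    ((λ n c → n ((λ p → c (inj₁ p)) , (λ q → c (inj₂ q)))) , (λ { (inj₁ p) → dn (λ { (a , _) → a p }) ; (inj₂ q) → dn (λ { (_ , a) → a q }) }))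
    (lim-map k ¬_ ≈¬ (lim-map₂ k _×_ ≈× (lim-map k ¬_ ≈¬ (limit φ k e (m⊔n≤o⇒m≤o _ _ d))) (lim-map k ¬_ ≈¬ (limit ψ k e (m⊔n≤o⇒n≤o (depth φ) _ d)))))
  limit (ex φ) (suc k) e (s≤s d) = em (Σ ℕ λ x → ⟦ φ ⟧ (x ∷ e)) >>= λ
    -- Once m exceeds a witness x, the limit value with bound m is true and no longer changes.
    { (inj₁ (x , p)) → dn (suc x , λ m le → lim-resp k ((λ { (y , _ , q) → dn (y , q) }) , (λ _ → dn (x , le , p))) (fam m))
    ; (inj₂ n) → dn (0 , λ m _ → lim-resp k ((λ { (y , _ , q) → dn (y , q) }) , (λ y → ⊥-elim (n y))) (fam m)) }
    where
    fam : ∀ m → LimB k (λ b → Σ ℕ λ x → x < m × bs φ b (x ∷ e)) (Σ ℕ λ x → x < m × ⟦ φ ⟧ (x ∷ e))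
    fam m = lim-fin k m (λ x _ → limit φ k (x ∷ e) d)
  limit (all< t φ) k e d = lim-resp k
    ((λ n → dn-fin (ev t e) (λ x l c → n (x , l , c))) , (λ f → dn (λ { (x , l , n) → n (f x l) })))
    (lim-map k ¬_ ≈¬ (lim-fin k (ev t e) (λ x _ → lim-map k ¬_ ≈¬ (limit φ k (x ∷ e) d))))
  limit (neg _ φ) k e d = lim-map k ¬_ ≈¬ (limit φ k e d)

  -- Bounded values along an index whose first entries are the bounds, most recent first.
  module Rval (φ : AF true 3) where

    rval : ∀ j → Vec ℕ (j + 3) → (ℕ → ℕ) → Set
    rval zero s b = bs φ b s
    rval (suc j) (i ∷ w) b = rval j w (i ◂ b)

    rbf : ∀ j {m} → (Fin (j + 3) → Fin m) → (ℕ → Term m) → BF m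
    rbf zero ρ β = bnd (subA (λ i → var (ρ i)) φ) β
    rbf (suc j) ρ β = rbf j (λ i → ρ (fsuc i)) λ { zero → var (ρ fzero) ; (suc i) → β i }

    rbf-sem : ∀ j {m} (ρ : Fin (j + 3) → Fin m) β e w b → (∀ i → lookup e (ρ i) ≡ lookup w i) → (∀ i → ev (β i) e ≡ b i) →
      B⟦ rbf j ρ β ⟧ e ⇔ rval j w b
    rbf-sem zero ρ β e w b h g = bnd-bs φ (λ i → var (ρ i)) β e b w
      (lookup-ext _ w (λ i → trans (lookup∘tabulate (λ x → lookup e (ρ x)) i) (h i))) g
    rbf-sem (suc j) ρ β e (i ∷ w) b h g = rbf-sem j _ _ e w (i ◂ b) (λ x → h (fsuc x)) λ { zero → h fzero ; (suc x) → g x }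

    -- The index supplies K bounds, so the default bound 0 is never consulted when the depth of φ is
    -- at most K. What remains is a decidable condition.
    Rset : ∀ K → Vec ℕ (K + 3) → Set
    Rset K w = rval K w (λ _ → 0)

    abstract
      rD : ∀ K → Def false (Rset K)
      rD K = let ψ , h = bfD (rbf K (λ i → i) (λ _ → `0)) in ψ , λ e →
        ⇔sym (rbf-sem K (λ i → i) (λ _ → `0) e e (λ _ → 0) (λ _ → refl) (λ _ → refl)) ⇔∘ h e

open IteratedLimits

-- A first-order condition for avoiding the points of an arithmetical set of slots

module NullSentences where

  module Points (T : Sentence → Set) (TD : Def false (pred₁ (SetCode T)))
                (q : ∀ φ → Q φ → T φ) (con : Consistent T) where
    open CellDefs T TD q con public

    -- A right cell exists only after its left sibling has been refuted, so at each stage at most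
    -- one cell is consistent. These cells form the leftmost path.
    cell-unique : ∀ {p i y y'} → Cell p i y → Cell p i y' → ¬ Z y → ¬ Z y' → y ≡ y'
    cell-unique cell₀ cell₀ _ _ = refl
    cell-unique (cellL {i} c) (cellL c') n n' with cell-unique c c' (λ z → n (refute (Le-trans ⊓₁ ⊓₁) z)) (λ z → n' (refute (Le-trans ⊓₁ ⊓₁) z))
    ... | refl = refl
    cell-unique (cellL c) (cellR c' z) n n' with cell-unique c c' (λ z → n (refute (Le-trans ⊓₁ ⊓₁) z)) (λ z → n' (refute (Le-trans ⊓₁ ⊓₁) z))
    ... | refl = ⊥-elim (n z)
    cell-unique (cellR c z) (cellL c') n n' with cell-unique c c' (λ z → n (refute (Le-trans ⊓₁ ⊓₁) z)) (λ z → n' (refute (Le-trans ⊓₁ ⊓₁) z))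
    ... | refl = ⊥-elim (n' z)
    cell-unique (cellR c z) (cellR c' z') n n' with cell-unique c c' (λ z → n (refute (Le-trans ⊓₁ ⊓₁) z)) (λ z → n' (refute (Le-trans ⊓₁ ⊓₁) z))
    ... | refl = refl

    cell-anc : ∀ {p i j y'} → i ≤ j → Cell p j y' → Σ Sentence λ y → Cell p i y × Le y' y
    cell-anc {j = zero} z≤n c = _ , c , Le-refl
    cell-anc {p} {i} {suc j} {y'} le c = go (m≤n⇒m<n∨m≡n le) c
      where
      go : i < suc j ⊎ i ≡ suc j → Cell p (suc j) y' → Σ Sentence λ y → Cell p i y × Le y' y
      go (inj₂ refl) c = y' , c , Le-refl
      go (inj₁ (s≤s l)) (cellL c) with cell-anc l c
      ... | y , d , e = y , d , Le-trans (Le-trans ⊓₁ ⊓₁) e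
      go (inj₁ (s≤s l)) (cellR c _) with cell-anc l c
      ... | y , d , e = y , d , Le-trans (Le-trans ⊓₁ ⊓₁) e

    cell-nested : ∀ {p i j y y'} → i ≤ j → Cell p i y → Cell p j y' → ¬ Z y → ¬ Z y' → Le y' y
    cell-nested le c c' n n' with cell-anc le c'
    ... | y'' , d , e with cell-unique c d n (λ z → n' (refute e z))
    ...   | refl = e

    -- The point determined by q lies in the open set P.
    OnP : Sentence → (Sentence → Set) → Set
    OnP q P = Σ ℕ λ i → Σ Sentence λ y → Cell q i y × ¬ Z y × P y

    On : Sentence → Sentence → Set
    On q ρ = OnP q (λ y → Le y ρ)

    Meets : Sentence → Sentence → Set
    Meets q ρ = Σ Sentence λ x → Le x q × Le x ρ × ¬ Z x

    On⇒Meets : ∀ {q ρ} → On q ρ → Meets q ρ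
    On⇒Meets (i , y , c , n , l) = y , cell-le c , l , n

    meets-⋁ : ∀ {x} (L : List Sentence) {P : Sentence → Set} → All P L → Le x (⋁ L) → ¬ Z x → ¬ ¬ (Σ Sentence λ q → P q × ¬ Z (x ⊓ q))
    meets-⋁ [] [] l n _ = n (mp (taut (_ ∷ `⊥ ∷ `⊥ ∷ `⊥ ∷ []) ((pA p⇒ p⊥) p⇒ p¬ pA) refl) l)
    meets-⋁ {x} (y ∷ L) (p ∷ ps) l n = em (Z (x ⊓ y)) >>= λ
      { (inj₂ nz) → dn (y , p , nz)
      ; (inj₁ z) → meets-⋁ L ps (mp (mp (taut (x ∷ y ∷ ⋁ L ∷ `⊥ ∷ []) ((pA p⇒ (pB p∨ pC)) p⇒ p¬ (pA p⊓ pB) p⇒ pA p⇒ pC) refl) l) z) n }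

    abstract
      D : ℕ → Ext T
      D j = Gen (GD j) (gdD j)

      D-gen : ∀ {j x} → GD j x → In (D j) x
      D-gen {j} = gen-In (GD j) (gdD j)

      D-fin : ∀ {j x} → In (D j) x → Σ (List Sentence) λ L → All (GD j) L × Le x (⋁ L)
      D-fin {j} = gen-fin (GD j) (gdD j)

  module Null (T : Sentence → Set) (TD : Def false (pred₁ (SetCode T)))
              (q₀ : ∀ φ → Q φ → T φ) (con : Consistent T) (K : ℕ) (φ : AF true 3) where
    open Points T TD q₀ con
    open Rval φ

    abstract
      -- The generators are selected by the decidable `Rset`. The set X itself, known only as a
      -- K-fold limit, never enters, and so this ideal is c.e.
      E : Ext T
      E = Gen (GE K (Rset K)) (geD K (rD K))

      E-gen : ∀ {x} → GE K (Rset K) x → In E x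
      E-gen = gen-In (GE K (Rset K)) (geD K (rD K))

      E-fin : ∀ {x} → In E x → Σ (List Sentence) λ L → All (GE K (Rset K)) L × Le x (⋁ L)
      E-fin = gen-fin (GE K (Rset K)) (geD K (rD K))

    -- NS k j ρ says that the point of no slot of X lies in ρ; k of the limits remain to be evaluated.
    NS : ℕ → ℕ → Sentence → Set
    NS zero j ρ = ∀ x → Le x ρ → In E x → ¬ ¬ Z x
    NS (suc k) j ρ = ¬ ¬ (Σ Sentence λ z → In (D (suc j)) z × (∀ w → In (D (suc j)) w → Le w ρ → Disj w z → NS k (suc j) w))

    fresh : ∀ {j} (w : Vec ℕ (j + 3)) L → All (GD (suc j)) L → Σ ℕ λ M → ∀ m → M ≤ m → ∀ {q'} → Sl {suc j} (m ∷ w) q' → All (Disj q') L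
    fresh w [] [] = 0 , λ _ _ _ → []
    fresh {j} w (x ∷ L) ((i ∷ w' , s) ∷ ps) with fresh w L ps
    ... | M , h = M ⊔ suc i , λ m le s' → go m (m⊔n≤o⇒n≤o M (suc i) le) s' (sl-disj s' s) ∷ h m (m⊔n≤o⇒m≤o M (suc i) le) s'
      where
      go : ∀ m → suc i ≤ m → ∀ {q'} → Sl {suc j} (m ∷ w) q' → (m ∷ w ≡ i ∷ w' × q' ≡ x) ⊎ Disj q' x → Disj q' x
      go m l s' (inj₂ d) = d
      go m l s' (inj₁ (refl , _)) = ⊥-elim (<-irrefl refl l)

    -- A true limit supplies, at every late stage, a subslot of q whose remaining limit is true.
    -- Taken late enough, the subslot lies below ρ and avoids z, and the induction hypothesis
    -- applied to it gives a contradiction. At the last level it is a generator of `E` that meets ρ.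
    null⇒ : ∀ k j → j + k ≡ K → ∀ {ρ} → NS k j ρ → ∀ {w q} → Sl {j} w q → ¬ Z q → LimB k (rval j w) ⊤ → ¬ On q ρ
    null⇒ zero j e {ρ} ns {w} {q} s nz (_ , r) on = r tt λ rv → go (trans (sym (+-identityʳ j)) e) s rv
      where
      y = proj₁ (proj₂ on)
      go : j ≡ K → Sl {j} w q → rval j w (λ _ → 0) → ⊥
      go refl s rv = ns y (proj₂ (proj₂ (proj₂ (proj₂ on)))) (In-down E (cell-le (proj₁ (proj₂ (proj₂ on)))) (E-gen (w , s , rv))) (proj₁ (proj₂ (proj₂ (proj₂ on))))
    null⇒ (suc k) j e {ρ} ns {w} {q} s nz lim (i₀ , y₀ , c₀ , nz₀ , l₀) =
      (ns >>= λ { (z , zD , h) → lim >>= λ { (m₀ , g) → step z zD h m₀ g (D-fin zD) } }) (λ b → b)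
      where
      step : ∀ z → In (D (suc j)) z → (∀ w → In (D (suc j)) w → Le w ρ → Disj w z → NS k (suc j) w) →
        ∀ m₀ → (∀ m → m₀ ≤ m → LimB k (λ b → rval j w (m ◂ b)) ⊤) → (Σ (List Sentence) λ L → All (GD (suc j)) L × Le z (⋁ L)) → ¬ ¬ ⊥
      step z zD h m₀ g (L , gL , zL) with fresh w L gL
      ... | M , fr = cell-exists nz m >>= λ { (y , c , ny) →
              dn (null⇒ k (suc j) (trans (sym (+-suc j k)) e)
                (h (y ⊓ F y) (D-gen (m ∷ w , sub s c)) (Le-trans ⊓₁ (Le-trans (cell-nested (m≤m⊔n i₀ (m₀ ⊔ M)) c₀ c nz₀ ny) l₀))
                  (disj-mono Le-refl zL (disj-⋁ (fr m (≤-trans (m≤n⊔m m₀ M) (m≤n⊔m i₀ _)) (sub s c)))))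
                (sub s c) (λ zz → ny (F-half zz)) (g m (≤-trans (m≤m⊔n m₀ M) (m≤n⊔m i₀ _)))
                (0 , y ⊓ F y , cell₀ , (λ zz → ny (F-half zz)) , Le-refl)) }
        -- Past the cell that puts the point into ρ, past the modulus of the limit, and past the
        -- stages used by z.
        where m = i₀ ⊔ (m₀ ⊔ M)

    -- At the last level the generators of `E` are whole slots, so every slot that ρ meets matters.
    -- At earlier levels a slot whose point is outside ρ has only finitely many subslots meeting ρ,
    -- and these can be put into z.
    OnM : ℕ → Sentence → Sentence → Set
    OnM zero = Meets
    OnM (suc k) = On

    OnM⇒Meets : ∀ k {q ρ} → OnM k q ρ → Meets q ρ
    OnM⇒Meets zero m = m
    OnM⇒Meets (suc k) o = On⇒Meets o

    -- The subslots of q at which ρ may fail to be null are covered by the list Zl.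
    Covered : ℕ → (j : ℕ) → Sentence → List Sentence → Sentence → Set
    Covered k j ρ Zl q = Σ (Vec ℕ (j + 3)) λ w → Sl {j} w q ×
      (∀ m y → Cell q m y → ¬ Z y → Le (y ⊓ F y) (⋁ Zl) ⊎ (¬ ¬ Disj (y ⊓ F y) ρ ⊎ LimB k (rval (suc j) (m ∷ w)) ⊥))

    covered-mono : ∀ {k j ρ Zl Zl' q} → Le (⋁ Zl) (⋁ Zl') → Covered k j ρ Zl q → Covered k j ρ Zl' q
    covered-mono {k} {j} {ρ} {Zl} {Zl'} {q} l (w , s , f) = w , s , λ m y c n → go m y (f m y c n)
      where
      go : ∀ m y → Le (y ⊓ F y) (⋁ Zl) ⊎ (¬ ¬ Disj (y ⊓ F y) ρ ⊎ LimB k (rval (suc j) (m ∷ w)) ⊥) → Le (y ⊓ F y) (⋁ Zl') ⊎ (¬ ¬ Disj (y ⊓ F y) ρ ⊎ LimB k (rval (suc j) (m ∷ w)) ⊥)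
      go m y (inj₁ a) = inj₁ (Le-trans a l)
      go m y (inj₂ b) = inj₂ b

    initial : ∀ {j} {w : Vec ℕ (j + 3)} {q} → Sl {j} w q → ∀ M → ¬ ¬ (Σ (List Sentence) λ Zl → All (GD (suc j)) Zl × (∀ m → m < M → ∀ y → Cell q m y → ¬ Z y → Le (y ⊓ F y) (⋁ Zl)))
    initial s zero = dn ([] , [] , λ _ ())
    initial {j} {w} {q} s (suc M) = initial s M >>= λ { (Zl , g , h) → em (Σ Sentence λ y → Cell q M y × ¬ Z y) >>= λ
      { (inj₁ (y , c , n)) → dn ((y ⊓ F y) ∷ Zl , (M ∷ w , sub s c) ∷ g , λ { m (s≤s l) y' c' n' → ext Zl h y c n m (m≤n⇒m<n∨m≡n l) y' c' n' })
      ; (inj₂ none) → dn (Zl , g , λ { m (s≤s l) y' c' n' → ext' Zl h none m (m≤n⇒m<n∨m≡n l) y' c' n' }) } }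
      where
      ext : ∀ Zl → (∀ m → m < M → ∀ y → Cell q m y → ¬ Z y → Le (y ⊓ F y) (⋁ Zl)) → ∀ y → Cell q M y → ¬ Z y →
        ∀ m → m < M ⊎ m ≡ M → ∀ y' → Cell q m y' → ¬ Z y' → Le (y' ⊓ F y') (⋁ ((y ⊓ F y) ∷ Zl))
      ext Zl h y c n m (inj₁ l) y' c' n' = Le-trans (h m l y' c' n') (⋁-++ʳ ((y ⊓ F y) ∷ []) Zl)
      ext Zl h y c n m (inj₂ refl) y' c' n' with cell-unique c c' n n'
      ... | refl = taut ((y ⊓ F y) ∷ ⋁ Zl ∷ `⊥ ∷ `⊥ ∷ []) (pA p⇒ (pA p∨ pB)) refl
      ext' : ∀ Zl → (∀ m → m < M → ∀ y → Cell q m y → ¬ Z y → Le (y ⊓ F y) (⋁ Zl)) → ¬ (Σ Sentence λ y → Cell q M y × ¬ Z y) →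
        ∀ m → m < M ⊎ m ≡ M → ∀ y' → Cell q m y' → ¬ Z y' → Le (y' ⊓ F y') (⋁ Zl)
      ext' Zl h none m (inj₁ l) y' c' n' = h m l y' c' n'
      ext' Zl h none m (inj₂ refl) y' c' n' = ⊥-elim (none (y' , c' , n'))

    -- If the point of q lies in ρ, the exceptional subslots are those before the modulus of the
    -- limit; if it lies outside, they are those up to the stage that decides ρ. Either way they are
    -- finitely many.
    cover : ∀ k j ρ → (∀ {w q} → Sl {j} w q → ¬ Z q → On q ρ → LimB (suc k) (rval j w) ⊥) → ∀ {q} → GD j q →
      ¬ ¬ (Σ (List Sentence) λ Zl → All (GD (suc j)) Zl × Covered k j ρ Zl q)
    cover k j ρ H {q} (w , s) = em (Z q) >>= λ
      { (inj₁ z) → dn ([] , [] , w , s , λ m y c n → ⊥-elim (n (refute (cell-le c) z)))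
      ; (inj₂ nz) → em (On q ρ) >>= λ
        { (inj₁ on) → H s nz on >>= λ { (m₀ , g) → initial s m₀ >>= λ { (Zl , gl , h) → dn (Zl , gl , w , s , λ m y c n → fromLim m₀ g Zl h m y c n) } }
        ; (inj₂ off) → initial s (suc N) >>= λ { (Zl , gl , h) → dn (Zl , gl , w , s , λ m y c n → fromOff off Zl h m y c n) } } }
      where
      -- The completion decides ρ at stage N. If its point is outside ρ, every later consistent cell
      -- lies under the negation of ρ.
      N = proj₁ (dsel-surj ρ)
      fromLim : ∀ m₀ → (∀ m → m₀ ≤ m → LimB k (λ b → rval j w (m ◂ b)) ⊥) → ∀ Zl → (∀ m → m < m₀ → ∀ y → Cell q m y → ¬ Z y → Le (y ⊓ F y) (⋁ Zl)) →
        ∀ m y → Cell q m y → ¬ Z y → Le (y ⊓ F y) (⋁ Zl) ⊎ (¬ ¬ Disj (y ⊓ F y) ρ ⊎ LimB k (rval (suc j) (m ∷ w)) ⊥)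
      fromLim m₀ g Zl h m y c n with m <? m₀
      ... | yes l = inj₁ (h m l y c n)
      ... | no nl = inj₂ (inj₂ (g m (≮⇒≥ nl)))
      fromOff : ¬ On q ρ → ∀ Zl → (∀ m → m < suc N → ∀ y → Cell q m y → ¬ Z y → Le (y ⊓ F y) (⋁ Zl)) →
        ∀ m y → Cell q m y → ¬ Z y → Le (y ⊓ F y) (⋁ Zl) ⊎ (¬ ¬ Disj (y ⊓ F y) ρ ⊎ LimB k (rval (suc j) (m ∷ w)) ⊥)
      fromOff off Zl h m y c n with m <? suc N
      ... | yes l = inj₁ (h m l y c n)
      ... | no nl with cell-decides ρ (proj₂ (dsel-surj ρ)) (≮⇒≥ nl) c
      ...   | inj₁ a = ⊥-elim (off (m , y , c , n , a))
      ...   | inj₂ a = inj₂ (inj₁ (dn (disj-sym (disj-mono Le-refl (Le-trans ⊓₁ a) (disj-¬ ρ)))))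

    coverAll : ∀ k j ρ → (∀ {w q} → Sl {j} w q → ¬ Z q → On q ρ → LimB (suc k) (rval j w) ⊥) → ∀ L → All (GD j) L →
      ¬ ¬ (Σ (List Sentence) λ Zl → All (GD (suc j)) Zl × All (Covered k j ρ Zl) L)
    coverAll k j ρ H [] [] = dn ([] , [] , [])
    coverAll k j ρ H (x ∷ L) (g ∷ gs) = cover k j ρ H g >>= λ { (Zl , a , c) → coverAll k j ρ H L gs >>= λ { (Zl' , a' , cs) →
      dn (Zl ⧺ Zl' , AllP.++⁺ a a' , covered-mono {Zl = Zl} {Zl ⧺ Zl'} (⋁-++ˡ Zl Zl') c ∷ All.map (covered-mono {Zl = Zl'} {Zl ⧺ Zl'} (⋁-++ʳ Zl Zl')) cs) } }

    -- Since ρ is covered by finitely many slots, z can be the finite join of all their exceptional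
    -- subslots. A subslot that meets some w below ρ and disjoint from z belongs to one of the
    -- covering slots and is not exceptional, so its remaining limit is false.
    null⇐ : ∀ k j → j + k ≡ K → ∀ {ρ} → In (D j) ρ → (∀ {w q} → Sl {j} w q → ¬ Z q → OnM k q ρ → LimB k (rval j w) ⊥) → NS k j ρ
    null⇐ zero j e {ρ} iD H x l iE nz = go (trans (sym (+-identityʳ j)) e) (E-fin iE)
      where
      go : j ≡ K → (Σ (List Sentence) λ L → All (GE K (Rset K)) L × Le x (⋁ L)) → ⊥
      go refl (L , g , xL) = meets-⋁ L g xL nz λ { (q , (w , s , r) , n) →
        proj₁ (H s (λ z → n (refute ⊓₂ z)) (x ⊓ q , ⊓₂ , Le-trans ⊓₁ l , n)) r (λ b → b) }
    null⇐ (suc k) j e {ρ} iD H with D-fin iD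
    ... | L , g , ρL = coverAll k j ρ H L g >>= λ { (Zl , gz , cs) → dn (⋁ Zl , In-⋁ (D (suc j)) (All.map D-gen gz) ,
          λ w' iw lw dw → null⇐ k (suc j) (trans (sym (+-suc j k)) e) iw (λ {w₂} {q₂} s n o → lim-stable k (sub-case Zl cs w' lw dw s n (OnM⇒Meets k o)))) }
      where
      sub-case : ∀ Zl → All (Covered k j ρ Zl) L → ∀ w' → Le w' ρ → Disj w' (⋁ Zl) → ∀ {w₂ q₂} → Sl {suc j} w₂ q₂ → ¬ Z q₂ → Meets q₂ w' → ¬ ¬ LimB k (rval (suc j) w₂) ⊥
      sub-case Zl cs w' lw dw (sub {w = w} {p} {m} {y} s c) n (x , xq , xw , nx) =
        meets-⋁ L cs (Le-trans xw (Le-trans lw ρL)) nx >>= λ { (qᵢ , (wᵢ , sᵢ , f) , nn) → go wᵢ qᵢ sᵢ f nn (sl-disj s sᵢ) }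
        where
        ny : ¬ Z y
        ny z = nx (refute (Le-trans xq ⊓₁) z)
        go : ∀ wᵢ qᵢ → Sl {j} wᵢ qᵢ → (∀ m y → Cell qᵢ m y → ¬ Z y → Le (y ⊓ F y) (⋁ Zl) ⊎ (¬ ¬ Disj (y ⊓ F y) ρ ⊎ LimB k (rval (suc j) (m ∷ wᵢ)) ⊥)) →
          ¬ Z (x ⊓ qᵢ) → (w ≡ wᵢ × p ≡ qᵢ) ⊎ Disj p qᵢ → ¬ ¬ LimB k (rval (suc j) (m ∷ w)) ⊥
        go wᵢ qᵢ sᵢ f nn (inj₂ d) = ⊥-elim (nn (disj-mono (Le-trans xq (Le-trans ⊓₁ (cell-le c))) Le-refl d))
        go wᵢ qᵢ sᵢ f nn (inj₁ (refl , refl)) with f m y c ny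
        ... | inj₁ a = ⊥-elim (nx (disj-self Le-refl (disj-mono xw (Le-trans xq a) dw)))
        ... | inj₂ (inj₁ b) = b >>= λ d → ⊥-elim (nx (disj-self Le-refl (disj-mono xq (Le-trans xw lw) d)))
        ... | inj₂ (inj₂ l) = dn l

open NullSentences

-- Cohesive choice of labels and slots

module CohesiveSlots where

  infix 4 _≋_
  -- Built from negation and conjunction only, so that it is stable and coincides with the definable
  -- form `xiff`.
  _≋_ : Set → Set → Set
  A ≋ B = ¬ (A × ¬ B) × ¬ (B × ¬ A)

  ≋sym : ∀ {A B} → A ≋ B → B ≋ A
  ≋sym (u , v) = v , u

  ≋trans : ∀ {A B C} → A ≋ B → B ≋ C → A ≋ C
  ≋trans (u , v) (u' , v') = (λ { (a , nc) → u (a , λ b → u' (b , nc)) }) , (λ { (c , na) → v' (c , λ b → v (b , na)) })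

  ≋of : ∀ {A B : Set} → (A → B) → (B → A) → A ≋ B
  ≋of f g = (λ { (a , nb) → nb (f a) }) , (λ { (b , na) → na (g b) })

  rel₅ : (ℕ → ℕ → ℕ → ℕ → ℕ → Set) → Vec ℕ 5 → Set
  rel₅ R (a ∷ b ∷ c ∷ d ∷ e ∷ []) = R a b c d e

  rel₇ : (ℕ → ℕ → ℕ → ℕ → ℕ → ℕ → ℕ → Set) → Vec ℕ 7 → Set
  rel₇ R (a ∷ b ∷ c ∷ d ∷ e ∷ f ∷ g ∷ []) = R a b c d e f g

  xiff : ∀ {n} → XF true n → XF true n → XF true n
  xiff φ ψ = xand (xneg refl (xand φ (xneg refl ψ))) (xneg refl (xand ψ (xneg refl φ)))

  -- A cohesiveness argument. A string of truth values for the tasks ⌊ e , v ⌋ is extended greedily,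
  -- keeping infinitely many n such that each colour v has infinitely many live slots (n , m , v) behaving accordingly.
  module Cohesion (Acc Live : Vec ℕ 4 → Set) (accD : Def true Acc) (liveD : Def true Live)
    (live : ∀ n v M → ¬ ¬ (Σ ℕ λ m → M < suc m × Live (0 ∷ n ∷ m ∷ v ∷ []))) where

    Mat : (ℕ → Set) → ℕ → ℕ → ℕ → ℕ → Set
    Mat S len n m v = ∀ τ → τ < len → ¬ (Σ ℕ λ e → τ ≡ ⌊ e , v ⌋ × ¬ (Acc (e ∷ n ∷ m ∷ v ∷ []) ≋ S τ))

    -- Classically: every colour v has, beyond any M, a live stage m that matches the string S. The
    -- negations keep it arithmetical in exactly the form given to `defP`.
    L : (ℕ → Set) → ℕ → ℕ → Set
    L S len n = ¬ (Σ ℕ λ v → Σ ℕ λ M → ¬ (Σ ℕ λ m → M < suc m × Live (0 ∷ n ∷ m ∷ v ∷ []) × Mat S len n m v))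

    Good : (ℕ → Set) → ℕ → Set
    Good S len = ¬ (Σ ℕ λ N → ¬ (Σ ℕ λ n → N < suc n × L S len n))

    -- The trial string of the greedy step: S below t, and the value true at t.
    St : (ℕ → Set) → ℕ → ℕ → Set
    St S t x = (x < t × S x) ⊎ x ≡ t

    Agree : ℕ → (ℕ → Set) → (ℕ → Set) → Set
    Agree len S S' = ∀ τ → τ < len → S τ ≋ S' τ

    mat-cong : ∀ {S S' len n m v} → Agree len S S' → Mat S len n m v → Mat S' len n m v
    mat-cong h f τ l (e , p , x) = f τ l (e , p , λ a → x (≋trans a (h τ l)))

    L-cong : ∀ {S S' len n} → Agree len S S' → L S len n → L S' len n
    L-cong h f (v , M , g) = f (v , M , λ { (m , l , a , c) → g (m , l , a , mat-cong h c) })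

    good-cong : ∀ {S S' len} → Agree len S S' → Good S len → Good S' len
    good-cong h f (N , g) = f (N , λ { (n , l , c) → g (n , l , L-cong h c) })

    mat-suc : ∀ {S S' len n m v} → Agree len S S' → (∀ e → len ≡ ⌊ e , v ⌋ → Acc (e ∷ n ∷ m ∷ v ∷ []) ≋ S' len) → Mat S len n m v → Mat S' (suc len) n m v
    mat-suc {S} {S'} {len} {n} {m} {v} h g f τ (s≤s l) (e , p , x) = go (m≤n⇒m<n∨m≡n l)
      where
      go : τ < len ⊎ τ ≡ len → ⊥
      go (inj₁ l') = f τ l' (e , p , λ a → x (≋trans a (h τ l')))
      go (inj₂ refl) = x (g e p)

    -- The task ⌊ e₀ , v₀ ⌋ concerns the colour v₀ alone. If a label is lost by demanding
    -- acceptance, only finitely many of its matching slots of colour v₀ are accepted. Beyond them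
    -- all are rejected, and so the label survives the demand of rejection.
    good-suc : ∀ {S S₀ S₁ len} → Agree len S S₁ → S₁ len → Agree len S S₀ → ¬ S₀ len → Good S len → ¬ Good S₁ (suc len) → Good S₀ (suc len)
    good-suc {S} {S₀} {S₁} {len} h₁ s₁ h₀ s₀ g ng (N , k) = ng λ { (N₁ , k₁) →
      g (N ⊔ N₁ , λ { (n , l , c) → k₁ (n , ≤-trans (s≤s (m≤n⊔m N N₁)) l , λ { (v₁ , M₁ , k₂) →
        k (n , ≤-trans (s≤s (m≤m⊔n N N₁)) l , λ { (v , M , k₃) → main n c v₁ M₁ k₂ v M k₃ (unpair len) }) }) }) }
      where
      main : ∀ n → L S len n → ∀ v₁ M₁ → ¬ (Σ ℕ λ m → M₁ < suc m × Live (0 ∷ n ∷ m ∷ v₁ ∷ []) × Mat S₁ (suc len) n m v₁) →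
        ∀ v M → ¬ (Σ ℕ λ m → M < suc m × Live (0 ∷ n ∷ m ∷ v ∷ []) × Mat S₀ (suc len) n m v) → (Σ ℕ λ e₀ → Σ ℕ λ v₀ → len ≡ ⌊ e₀ , v₀ ⌋) → ⊥
      main n c v₁ M₁ k₂ v M k₃ (e₀ , v₀ , eqn) with v₁ ≟ v₀
      ... | no ne = c (v₁ , M₁ , λ { (m , l , a , f) → k₂ (m , l , a , mat-suc h₁ (λ e p → ⊥-elim (ne (proj₂ (pinj e v₁ {e₀} {v₀} (trans (sym p) eqn))))) f) })
      ... | yes refl with v ≟ v₀
      ...   | no ne = c (v , M , λ { (m , l , a , f) → k₃ (m , l , a , mat-suc h₀ (λ e p → ⊥-elim (ne (proj₂ (pinj e v {e₀} {v₀} (trans (sym p) eqn))))) f) })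
      ...   | yes refl = c (v , M ⊔ M₁ , λ { (m , l , a , f) → k₃ (m , ≤-trans (s≤s (m≤m⊔n M M₁)) l , a ,
                mat-suc h₀ (λ e p → (λ { (x , _) → k₂ (m , ≤-trans (s≤s (m≤n⊔m M M₁)) l , a , mat-suc h₁ (λ e' p' → acc e e' m p p' x) f) }) , (λ { (x , _) → s₀ x })) f) })
        where
        acc : ∀ e e' m → len ≡ ⌊ e , v ⌋ → len ≡ ⌊ e' , v ⌋ → Acc (e ∷ n ∷ m ∷ v ∷ []) → Acc (e' ∷ n ∷ m ∷ v ∷ []) ≋ S₁ len
        acc e e' m p p' x with pinj e v {e'} {v} (trans (sym p) p')
        ... | refl , _ = ≋of (λ _ → s₁) (λ _ → x)

    -- The greedy rule: a task receives the value true exactly when this leaves infinitely many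
    -- suitable labels. By induction the string is determined up to equivalence, which makes it
    -- definable through codes of finite sets.
    Path : (ℕ → Set) → ℕ → Set
    Path S len = ∀ τ → τ < len → S τ ≋ Good (St S τ) (suc τ)

    st-agree : ∀ {S S' t} → Agree t S S' → Agree (suc t) (St S t) (St S' t)
    st-agree {S} {S'} {t} h τ _ = half h , half (λ x l → ≋sym (h x l))
      where
      half : ∀ {S S'} → Agree t S S' → ¬ (St S t τ × ¬ St S' t τ)
      half h (inj₁ (l , s) , n) = proj₁ (h τ l) (s , λ s' → n (inj₁ (l , s')))
      half h (inj₂ e , n) = n (inj₂ e)

    st-below : ∀ {S t} → Agree t S (St S t)
    st-below τ l = ≋of (λ s → inj₁ (l , s)) (λ { (inj₁ (_ , s)) → s ; (inj₂ refl) → ⊥-elim (<-irrefl refl l) })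

    path-unique : ∀ {S S' len len'} → Path S len → Path S' len' → ∀ τ → τ < len → τ < len' → S τ ≋ S' τ
    path-unique {S} {S'} {len} {len'} p p' τ l l' = go (suc τ) τ ≤-refl l l'
      where
      go : ∀ n τ → τ < n → τ < len → τ < len' → S τ ≋ S' τ
      go (suc n) τ (s≤s b) l l' = ≋trans (p τ l) (≋trans (≋of (good-cong ag) (good-cong (λ x y → ≋sym (ag x y)))) (≋sym (p' τ l')))
        where
        ag : Agree (suc τ) (St S τ) (St S' τ)
        ag = st-agree (λ x q → go n x (≤-trans q b) (<-trans q l) (<-trans q l'))

    path-cong : ∀ {S S' len} → Agree len S S' → Path S len → Path S' len
    path-cong h p τ l = ≋trans (≋sym (h τ l)) (≋trans (p τ l) (≋of (good-cong ag) (good-cong (λ x y → ≋sym (ag x y)))))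
      where ag = st-agree (λ x q → h x (<-trans q l))

    path-exists : ∀ len → ¬ ¬ (Σ (List ℕ) λ Λ → All (_< len) Λ × Path (_∈ Λ) len × Good (_∈ Λ) len)
    path-exists zero = dn ([] , [] , (λ _ ()) , λ { (N , f) → f (N , ≤-refl , λ { (v , M , g) → live N v M λ { (m , l , a) → g (m , l , a , λ _ ()) } }) })
    path-exists (suc len) = path-exists len >>= λ { (Λ , lt , p , g) → em (Good (St (_∈ Λ) len) (suc len)) >>= λ
      { (inj₁ g₁) → dn (len ∷ Λ , ≤-refl ∷ All.map m≤n⇒m≤1+n lt , ext Λ lt p (len ∷ Λ) (cons Λ) (≋of (λ _ → good-cong (agc Λ) g₁) (λ _ → here refl)) ,
          good-cong (λ τ l → ≋of (λ { (inj₁ (_ , s)) → there s ; (inj₂ refl) → here refl }) (λ { (here refl) → inj₂ refl ; (there s) → inj₁ (All.lookup lt s , s) })) g₁)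
      ; (inj₂ n₁) → dn (Λ , All.map m≤n⇒m≤1+n lt , ext Λ lt p Λ (λ _ _ → ≋of (λ x → x) (λ x → x)) (≋of (λ s → ⊥-elim (<-irrefl refl (All.lookup lt s))) (λ x → ⊥-elim (n₁ x))) ,
          good-suc st-below (inj₂ refl) (λ _ _ → ≋of (λ x → x) (λ x → x)) (λ s → <-irrefl refl (All.lookup lt s)) g n₁) } }
      where
      cons : ∀ Λ → Agree len (_∈ Λ) (_∈ (len ∷ Λ))
      cons Λ τ l = ≋of there (λ { (here refl) → ⊥-elim (<-irrefl refl l) ; (there s) → s })
      agc : ∀ Λ → Agree (suc len) (St (_∈ Λ) len) (St (_∈ (len ∷ Λ)) len)
      agc Λ = st-agree (cons Λ)
      ext : ∀ Λ → All (_< len) Λ → Path (_∈ Λ) len → ∀ Λ' → Agree len (_∈ Λ) (_∈ Λ') → (len ∈ Λ') ≋ Good (St (_∈ Λ') len) (suc len) → Path (_∈ Λ') (suc len)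
      ext Λ lt p Λ' h new τ (s≤s l) = go (m≤n⇒m<n∨m≡n l)
        where
        go : τ < len ⊎ τ ≡ len → (τ ∈ Λ') ≋ Good (St (_∈ Λ') τ) (suc τ)
        go (inj₁ l') = path-cong h p τ l'
        go (inj₂ refl) = new

    code-exists : ∀ len → ¬ ¬ (Σ ℕ λ a → Σ ℕ λ b → Path (λ x → Mem x a b) len × Good (λ x → Mem x a b) len)
    code-exists len = path-exists len >>= λ { (Λ , lt , p , g) → dn (code Λ p g) }
      where
      code : ∀ Λ → Path (_∈ Λ) len → Good (_∈ Λ) len → Σ ℕ λ a → Σ ℕ λ b → Path (λ x → Mem x a b) len × Good (λ x → Mem x a b) len
      code Λ p g with codeSet Λ len
      ... | a , b , N , le , _ , h , h' = a , b , path-cong ag p , good-cong ag g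
        where
        ag : Agree len (_∈ Λ) (λ x → Mem x a b)
        ag τ l = (λ { (s , n) → n (h τ (≤-trans l le) s) }) , (λ { (s , n) → h' τ (≤-trans l le) n s })

    -- A length that includes all tasks ⌊ e , v ⌋ with e and v at most k, by monotonicity of
    -- pairing.
    θ : ℕ → ℕ
    θ k = suc ⌊ k , k ⌋

    LP : ℕ → ℕ → Set
    LP k n = Σ ℕ λ a → Σ ℕ λ b → Path (λ x → Mem x a b) (θ k) × L (St (λ x → Mem x a b) (θ k)) (θ k) n

    Mt : ℕ → ℕ → ℕ → ℕ → Set
    Mt k n m v = Σ ℕ λ a → Σ ℕ λ b → Path (λ x → Mem x a b) (θ k) × Mat (St (λ x → Mem x a b) (θ k)) (θ k) n m v

    Lst : ℕ → ℕ → ℕ → Set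
    Lst k lo n = lo < suc n × LP k n × (∀ n' → n' < n → ¬ (lo < suc n' × LP k n'))

    abstract
      stD : Def true (rel₄ (λ x t a b → St (λ x → Mem x a b) t x))
      stD = defP (xor (xand (xlt (xv (# 0)) (xv (# 1))) (at memD (xv (# 0) ∷ xv (# 2) ∷ xv (# 3) ∷ []))) (xeq (xv (# 0)) (xv (# 1))))
        λ { (x ∷ t ∷ a ∷ b ∷ []) → (λ z → z) , (λ z → z) }

      matD : Def true (rel₇ (λ len n m v t a b → Mat (St (λ x → Mem x a b) t) len n m v))
      matD = defP (xall< (xv (# 0)) (xneg refl (xex (xand (xeq (xv (# 1)) (xp (xv (# 0)) (xv (# 5)))) (xneg refl
          (xiff (at accD (xv (# 0) ∷ xv (# 3) ∷ xv (# 4) ∷ xv (# 5) ∷ [])) (at stD (xv (# 1) ∷ xv (# 6) ∷ xv (# 7) ∷ xv (# 8) ∷ []))))))))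
        λ { (len ∷ n ∷ m ∷ v ∷ t ∷ a ∷ b ∷ []) → (λ z → z) , (λ z → z) }

      LD : Def true (rel₅ (λ len n t a b → L (St (λ x → Mem x a b) t) len n))
      LD = defP (xneg refl (xex (xex (xneg refl (xex (xand (xlt (xv (# 1)) (xsu (xv (# 0))))
          (xand (at liveD (xn 0 ∷ xv (# 4) ∷ xv (# 0) ∷ xv (# 2) ∷ [])) (at matD (xv (# 3) ∷ xv (# 4) ∷ xv (# 0) ∷ xv (# 2) ∷ xv (# 5) ∷ xv (# 6) ∷ xv (# 7) ∷ [])))))))))
        λ { (len ∷ n ∷ t ∷ a ∷ b ∷ []) → (λ z → z) , (λ z → z) }

      goodD : Def true (rel₄ (λ len t a b → Good (St (λ x → Mem x a b) t) len))
      goodD = defP (xneg refl (xex (xneg refl (xex (xand (xlt (xv (# 1)) (xsu (xv (# 0)))) (at LD (xv (# 2) ∷ xv (# 0) ∷ xv (# 3) ∷ xv (# 4) ∷ xv (# 5) ∷ [])))))))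
        λ { (len ∷ t ∷ a ∷ b ∷ []) → (λ z → z) , (λ z → z) }

      pathD : Def true (rel₃ (λ len a b → Path (λ x → Mem x a b) len))
      pathD = defP (xall< (xv (# 0)) (xiff (at memD (xv (# 0) ∷ xv (# 2) ∷ xv (# 3) ∷ [])) (at goodD (xsu (xv (# 0)) ∷ xv (# 0) ∷ xv (# 2) ∷ xv (# 3) ∷ []))))
        λ { (len ∷ a ∷ b ∷ []) → (λ z → z) , (λ z → z) }

      lpD : Def true (rel₂ LP)
      lpD = defP (xex (xex (xand (at pathD (xsu (xp (xv (# 2)) (xv (# 2))) ∷ xv (# 1) ∷ xv (# 0) ∷ []))
          (at LD (xsu (xp (xv (# 2)) (xv (# 2))) ∷ xv (# 3) ∷ xsu (xp (xv (# 2)) (xv (# 2))) ∷ xv (# 1) ∷ xv (# 0) ∷ [])))))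
        λ { (k ∷ n ∷ []) → (λ z → z) , (λ z → z) }

      mtD : Def true (rel₄ Mt)
      mtD = defP (xex (xex (xand (at pathD (xsu (xp (xv (# 2)) (xv (# 2))) ∷ xv (# 1) ∷ xv (# 0) ∷ []))
          (at matD (xsu (xp (xv (# 2)) (xv (# 2))) ∷ xv (# 3) ∷ xv (# 4) ∷ xv (# 5) ∷ xsu (xp (xv (# 2)) (xv (# 2))) ∷ xv (# 1) ∷ xv (# 0) ∷ [])))))
        λ { (k ∷ n ∷ m ∷ v ∷ []) → (λ z → z) , (λ z → z) }

      lstD : Def true (rel₃ Lst)
      lstD = defP (xand (xlt (xv (# 1)) (xsu (xv (# 2)))) (xand (at lpD (xv (# 0) ∷ xv (# 2) ∷ []))
          (xall< (xv (# 2)) (xneg refl (xand (xlt (xv (# 2)) (xsu (xv (# 0)))) (at lpD (xv (# 1) ∷ xv (# 0) ∷ [])))))))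
        λ { (k ∷ lo ∷ n ∷ []) → (λ z → z) , (λ z → z) }

    -- The recursion from b_k to b_(k+1). Its side conditions are arithmetical but contain
    -- negations, hence the flag `true`. Each search starts above the previous label and takes the
    -- least suitable one, so the sequence is single-valued and strictly increasing.
    chainProg : Program true
    chainProg = clause 1 (at lstD (xn 0 ∷ xn 0 ∷ xv (# 0) ∷ [])) [] (xp (xn 0) (xv (# 0)))
      ∷ clause 3 (at lstD (xsu (xv (# 0)) ∷ xsu (xv (# 1)) ∷ xv (# 2) ∷ [])) (xp (xv (# 0)) (xv (# 1)) ∷ []) (xp (xsu (xv (# 0))) (xv (# 2)))
      ∷ []

    Chain : ℕ → ℕ → Set
    Chain k n = Der chainProg ⌊ k , n ⌋

    chain-inv : ∀ {f} → Der chainProg f → ∀ k n → f ≡ ⌊ k , n ⌋ →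
      (k ≡ 0 × Lst 0 0 n) ⊎ (Σ ℕ λ k' → Σ ℕ λ n' → k ≡ suc k' × Chain k' n' × Lst (suc k') (suc n') n)
    chain-inv (der fzero (n₁ ∷ []) s _ e) k n e' with pinj 0 n₁ {k} {n} (trans (sym e) e')
    ... | refl , refl = inj₁ (refl , s)
    chain-inv (der (fsuc fzero) (k₁ ∷ n₁ ∷ n₂ ∷ []) s c e) k n e' with pinj (suc k₁) n₂ {k} {n} (trans (sym e) e')
    ... | refl , refl = inj₂ (k₁ , n₁ , refl , c , s)

    chain-LP : ∀ {k n} → Chain k n → LP k n
    chain-LP {k} {n} c with chain-inv c k n refl
    ... | inj₁ (refl , s) = proj₁ (proj₂ s)
    ... | inj₂ (_ , _ , refl , _ , s) = proj₁ (proj₂ s)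

    lst-unique : ∀ {k lo n n'} → Lst k lo n → Lst k lo n' → n ≡ n'
    lst-unique {n = n} {n'} (l , p , h) (l' , p' , h') with <-cmp n n'
    ... | tri≈ _ e _ = e
    ... | tri< a _ _ = ⊥-elim (h' n a (l , p))
    ... | tri> _ _ a = ⊥-elim (h n' a (l' , p'))

    chain-fun : ∀ k {n n'} → Chain k n → Chain k n' → n ≡ n'
    chain-fun zero {n} {n'} c c' with chain-inv c 0 n refl | chain-inv c' 0 n' refl
    ... | inj₁ (_ , s) | inj₁ (_ , s') = lst-unique s s'
    chain-fun (suc k) {n} {n'} c c' with chain-inv c (suc k) n refl | chain-inv c' (suc k) n' refl
    ... | inj₂ (_ , _ , refl , d , s) | inj₂ (_ , _ , refl , d' , s') with chain-fun k d d'
    ...   | refl = lst-unique s s'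

    chain-mono : ∀ {k n} k' {n'} → Chain k n → Chain k' n' → k < k' → n < n'
    chain-mono {k} (suc k') {n'} c c' (s≤s l) with chain-inv c' (suc k') n' refl
    ... | inj₂ (_ , _ , refl , d , s) with m≤n⇒m<n∨m≡n l
    ...   | inj₁ l' = <-trans (chain-mono k' c d l') (s≤s⁻¹ (proj₁ s))
    ...   | inj₂ refl with chain-fun k c d
    ...     | refl = s≤s⁻¹ (proj₁ s)

    chain-inj : ∀ {k k' n} → Chain k n → Chain k' n → k ≡ k'
    chain-inj {k} {k'} c c' with <-cmp k k'
    ... | tri≈ _ e _ = e
    ... | tri< a _ _ = ⊥-elim (<-irrefl refl (chain-mono k' c c' a))
    ... | tri> _ _ a = ⊥-elim (<-irrefl refl (chain-mono k c' c a))

    chain-≤ : ∀ k {n} → Chain k n → k ≤ n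
    chain-≤ zero c = z≤n
    chain-≤ (suc k) {n} c with chain-inv c (suc k) n refl
    ... | inj₂ (_ , _ , refl , d , s) = ≤-trans (s≤s (chain-≤ k d)) (s≤s⁻¹ (proj₁ s))

    least : ∀ {P : ℕ → Set} n → P n → ¬ ¬ (Σ ℕ λ n → P n × (∀ n' → n' < n → ¬ P n'))
    least {P} n p = go (suc n) n ≤-refl p
      where
      go : ∀ b n → n < b → P n → ¬ ¬ (Σ ℕ λ n → P n × (∀ n' → n' < n → ¬ P n'))
      go (suc b) n (s≤s l) p k = k (n , p , λ n' l' p' → go b n' (≤-trans l' l) p' k)

    lst-exists : ∀ k lo → ¬ ¬ (Σ ℕ λ n → Lst k lo n)
    lst-exists k lo = code-exists (θ k) >>= λ { (a , b , p , g) → (λ z → g (lo , λ { (n , l , c) → z (n , l , a , b , p , L-cong st-below c) })) >>= λ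
      { (n , q) → least {λ n → lo < suc n × LP k n} n q >>= λ { (n , (l , q) , h) → dn (n , l , q , h) } } }

    chain-exists : ∀ k → ¬ ¬ (Σ ℕ λ n → Chain k n)
    chain-exists zero = lst-exists 0 0 >>= λ { (n , s) → dn (n , der fzero (n ∷ []) s tt refl) }
    chain-exists (suc k) = chain-exists k >>= λ { (n , c) → lst-exists (suc k) (suc n) >>= λ { (n' , s) → dn (n' , der (fsuc fzero) (k ∷ n ∷ n' ∷ []) s c refl) } }

    -- The colour v belongs to the set with index e.
    π : ℕ → ℕ → Set
    π e v = ¬ ¬ (Σ ℕ λ a → Σ ℕ λ b → Path (λ x → Mem x a b) (suc ⌊ e , v ⌋) × Mem ⌊ e , v ⌋ a b)

    -- The strings behind `Mt` and `π` are both greedy, so they agree by `path-unique` on every task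
    -- that both decide.
    mt-acc : ∀ {k n m v e} → ⌊ e , v ⌋ < θ k → Mt k n m v → Acc (e ∷ n ∷ m ∷ v ∷ []) ≋ π e v
    mt-acc {k} {n} {m} {v} {e} l (a , b , p , f) =
      (λ { (x , y) → f ⌊ e , v ⌋ l (e , refl , λ h → proj₁ h (x , λ s → proj₁ (st-below {λ x → Mem x a b} {θ k} ⌊ e , v ⌋ l) (unst s , λ _ → y (dn (a , b , restrict , unst s)))) ) }) ,
      (λ { (y , nx) → y λ { (a' , b' , p' , q) → f ⌊ e , v ⌋ l (e , refl , λ h → proj₂ (path-unique p p' ⌊ e , v ⌋ l ≤-refl) (q , λ s → proj₂ h (inj₁ (l , s) , nx))) } })
      where
      restrict : Path (λ x → Mem x a b) (suc ⌊ e , v ⌋)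
      restrict τ l' = p τ (≤-trans l' l)
      unst : St (λ x → Mem x a b) (θ k) ⌊ e , v ⌋ → Mem ⌊ e , v ⌋ a b
      unst (inj₁ (_ , s)) = s
      unst (inj₂ e) = ⊥-elim (<⇒≢ l e)

    mt-many : ∀ {k n} → Chain k n → ∀ v M → ¬ ¬ (Σ ℕ λ m → M < suc m × Live (0 ∷ n ∷ m ∷ v ∷ []) × Mt k n m v)
    mt-many c v M z with chain-LP c
    ... | a , b , p , h = h (v , M , λ { (m , l , x , f) → z (m , l , x , a , b , p , f) })

    task< : ∀ {e v k} → e ≤ k → v ≤ k → ⌊ e , v ⌋ < θ k
    task< p q = s≤s (pair-mono p q)

    module _ {E : Vec ℕ 2 → Set} (ED : Def true E) where

      -- E tells which colours are switched on at the label b_k. Several relations E are coded over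
      -- one and the same cohesive choice.
      X : Vec ℕ 3 → Set
      X (n ∷ m ∷ v ∷ []) = Σ ℕ λ k → Chain k n × E (k ∷ v ∷ []) × Mt k n m v

      abstract
        xD : Def true X
        xD = defP (xex (xand (at (derD chainProg) (xp (xv (# 0)) (xv (# 1)) ∷ [])) (xand (at ED (xv (# 0) ∷ xv (# 3) ∷ [])) (at mtD (xv (# 0) ∷ xv (# 1) ∷ xv (# 2) ∷ xv (# 3) ∷ [])))))
          λ { (n ∷ m ∷ v ∷ []) → (λ z → z) , (λ z → z) }

open CohesiveSlots

-- First-order formulas over the lattice

module LatticeFormulas where

  renLT : ∀ {n m} → (Fin n → Fin m) → LTerm n → LTerm m
  renLT r (lvar i) = lvar (r i)
  renLT r (s ∧ₗ t) = renLT r s ∧ₗ renLT r t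
  renLT r (s ∨ₗ t) = renLT r s ∨ₗ renLT r t

  module Lattice (T : Sentence → Set) (TD : Def false (pred₁ (SetCode T)))
                 (q : ∀ φ → Q φ → T φ) (con : Consistent T) where
    open Points T TD q con public

    setCode∈ : ∀ {Γ : Sentence → Set} {φ} → SetCode Γ (cdF φ) ⇔ Γ φ
    setCode∈ {Γ} {φ} = (λ { (χ , e , p) → subst Γ (codeF-inj χ φ e) p }) , (λ p → φ , refl , p)

    memD' : ∀ (A : Ext T) → Def false (pred₁ (SetCode (mem A)))
    memD' A = theory⇒def (ce A)

    abstract
      meetD : ∀ (A B : Ext T) → Def false (pred₁ (SetCode (λ φ → mem A φ × mem B φ)))
      meetD A B = defP (xand (at (memD' A) (xv 0F ∷ [])) (at (memD' B) (xv 0F ∷ [])))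
        λ { (k ∷ []) → (λ { (φ , e , p , r) → (φ , e , p) , (φ , e , r) }) ,
                       (λ { ((φ , e , p) , r) → φ , e , p , proj₁ setCode∈ (subst (SetCode (mem B)) (sym e) r) }) }

      joinD : ∀ (A B : Ext T) → Def false (pred₁ (SetCode (λ φ → mem A φ ⊎ mem B φ)))
      joinD A B = defP (xor (at (memD' A) (xv 0F ∷ [])) (at (memD' B) (xv 0F ∷ [])))
        λ { (k ∷ []) → (λ { (φ , e , inj₁ p) → inj₁ (φ , e , p) ; (φ , e , inj₂ p) → inj₂ (φ , e , p) }) ,
                       (λ { (inj₁ (φ , e , p)) → φ , e , inj₁ p ; (inj₂ (φ , e , p)) → φ , e , inj₂ p }) }

    meetE joinE : Ext T → Ext T → Ext T
    meetE A B = record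
      { mem = λ φ → mem A φ × mem B φ
      ; ce = def⇒theory (meetD A B)
      ; extends = λ φ p → extends A φ p , extends B φ p
      ; closed = λ φ d → closed A φ (weaken⊢ (λ _ → proj₁) d) , closed B φ (weaken⊢ (λ _ → proj₂) d) }
    joinE A B = record
      { mem = λ φ → (λ ψ → mem A ψ ⊎ mem B ψ) ⊢ φ
      ; ce = def⇒theory (Provability.thmD _ (joinD A B))
      ; extends = λ φ p → ax⊢ φ (inj₁ (extends A φ p))
      ; closed = λ φ d → cut⊢ (λ _ e → e) d }

    infix 4 _⊑_
    -- The double negation makes the order stable, so that facts obtained only under a double
    -- negation can be fed into it.
    _⊑_ : Ext T → Ext T → Set
    A ⊑ B = ¬ ¬ (∀ φ → mem A φ → mem B φ)

    Zero : Ext T → Set₁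
    Zero W = ∀ C → W ⊑ C

    -- Complemented elements; these are the extensions by one sentence.
    Comp : Ext T → Set₁
    Comp A = ¬ (∀ B → (∀ C → meetE A B ⊑ C) → ¬ (∀ C → C ⊑ joinE A B))

    Is : Ext T → Sentence → Set
    Is A ρ = ∀ x → In A x ⇔ Le x ρ

    is-princ : ∀ ρ → Is (Princ ρ) ρ
    is-princ ρ x = princ-Le , princ-In

    is-gen : ∀ {A ρ} → Is A ρ → In A ρ
    is-gen i = proj₂ (i _) Le-refl

    is-mem : ∀ {A ρ} → Is A ρ → ∀ φ → mem A φ → Le (¬' φ) ρ
    is-mem {A} i φ p = proj₁ (i _) (proj₁ (mem-In A φ) p)

    abstract
      ¬¬-le : ∀ {φ} → Z (¬' φ) → T ⊢ φ
      ¬¬-le {φ} d = mp (taut (φ ∷ φ ∷ φ ∷ φ ∷ []) (p¬ (p¬ pA) p⇒ pA) refl) d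

    comp← : ∀ {A ρ} → Is A ρ → Comp A
    comp← {A} {ρ} i h = h (Princ (¬' ρ))
      (λ C → dn λ φ → λ { (p , r) → mem⊢ C (¬¬-le (disj-self Le-refl (disj-mono (is-mem {A} i φ p) (is-mem {Princ (¬' ρ)} (is-princ _) φ r) (disj-¬ ρ)))) })
      (λ C → dn λ φ _ → mp (mp (weaken⊢ (λ ψ t → inj₁ (extends A ψ t)) (absurd φ))
        (ax⊢ _ (inj₁ (is-gen {A} i)))) (ax⊢ _ (inj₂ (is-gen {Princ (¬' ρ)} (is-princ _)))))
      where
      abstract
        absurd : ∀ φ → T ⊢ (¬' ρ ⇒ ¬' (¬' ρ) ⇒ φ)
        absurd φ = taut (ρ ∷ φ ∷ ρ ∷ ρ ∷ []) (p¬ pA p⇒ p¬ (p¬ pA) p⇒ pB) refl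

    -- A complement B yields a in A and b in B that are jointly inconsistent. If x is in the ideal
    -- of A, then x ⊓ a is in both ideals, hence refuted; so x lies below the negation of a, and
    -- this sentence generates the ideal.
    comp→ : ∀ {A} → Comp A → ¬ ¬ (Σ Sentence λ ρ → Is A ρ)
    comp→ {A} h k = h λ B z t → z (Princ `⊥) λ z' → t (Princ ⊤') λ t' → k (is B z' (joinCompact A B (t' `⊥ bot)))
      where
      abstract
        bot : mem (Princ ⊤') `⊥
        bot = memMP (Princ ⊤') (is-gen {Princ ⊤'} (is-princ ⊤')) (mem⊢ (Princ ⊤') (taut (`⊥ ∷ `⊥ ∷ `⊥ ∷ `⊥ ∷ []) (pA p⇒ pA) refl))
        fromBot : ∀ {x} → Le x `⊥ → Z x
        fromBot d = d
        le-comp : ∀ {a b} → T ⊢ (a ⇒ b ⇒ `⊥) → Le a (¬' b)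
        le-comp d = d
        comb : ∀ {a x} → Z (x ⊓ a) → Le x (¬' a)
        comb {a} {x} d = mp (taut (a ∷ x ∷ a ∷ a ∷ []) (p¬ (pB p⊓ pA) p⇒ pB p⇒ p¬ pA) refl) d
      is : ∀ B → (∀ φ → mem A φ × mem B φ → mem (Princ `⊥) φ) → (Σ Sentence λ a → Σ Sentence λ b → mem A a × mem B b × T ⊢ (closedAt a ⇒ closedAt b ⇒ `⊥)) → Σ Sentence λ ρ → Is A ρ
      is B z (a , b , p , r , d) = ¬' a , λ x →
        (λ i → comb (fromBot (princ-Le (z (¬' (x ⊓ a)) (In-down A ⊓₁ i , In-down B (Le-trans ⊓₂ (le-comp d')) (proj₁ (mem-In B b) r)))))) ,
        (λ l → In-down A l (proj₁ (mem-In A a) p))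
        where
        d' : T ⊢ (a ⇒ b ⇒ `⊥)
        d' = subst (λ z → T ⊢ (z ⇒ b ⇒ `⊥)) (closed₀ a) (subst (λ z → T ⊢ (closedAt a ⇒ z ⇒ `⊥)) (closed₀ b) d)

    ⊑→ : ∀ {W A ρ} → Is W ρ → W ⊑ A → ¬ ¬ In A ρ
    ⊑→ {W} i l = l >>= λ f → dn (f _ (is-gen {W} i))

    ⊑← : ∀ {W A ρ} → Is W ρ → ¬ ¬ In A ρ → W ⊑ A
    ⊑← {W} {A} i l = l >>= λ p → dn λ φ m → proj₂ (mem-In A φ) (In-down A (is-mem {W} i φ m) p)

    zero→ : ∀ {W ρ} → Is W ρ → Zero W → ¬ ¬ Z ρ
    zero→ {W} i z = z (Princ `⊥) >>= λ f → dn (princ-Le (f _ (is-gen {W} i)))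

    zero← : ∀ {W ρ} → Is W ρ → ¬ ¬ Z ρ → Zero W
    zero← {W} i z C = z >>= λ d → dn λ φ m → mem⊢ C (¬¬-le (refute (is-mem {W} i φ m) d))

    is-meet : ∀ {W V ρ ζ} → Is W ρ → Is V ζ → Is (meetE W V) (ρ ⊓ ζ)
    is-meet i j x = (λ { (a , b) → ⊓-glb (proj₁ (i x) a) (proj₁ (j x) b) }) , (λ l → proj₂ (i x) (Le-trans l ⊓₁) , proj₂ (j x) (Le-trans l ⊓₂))

    ren-tsem : ∀ {n m} (r : Fin n → Fin m) t (ρ : Env T m) (ρ' : Env T n) → (∀ i φ → mem (ρ (r i)) φ ⇔ mem (ρ' i) φ) → ∀ φ → ⟦ T ⟧ₜ (renLT r t) ρ φ ⇔ ⟦ T ⟧ₜ t ρ' φ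
    ren-tsem r (lvar i) ρ ρ' h φ = h i φ
    ren-tsem r (s ∧ₗ t) ρ ρ' h φ = ren-tsem r s ρ ρ' h φ ⇔× ren-tsem r t ρ ρ' h φ
    ren-tsem r (s ∨ₗ t) ρ ρ' h φ =
      weaken⊢ (λ { ψ (inj₁ p) → inj₁ (proj₁ (ren-tsem r s ρ ρ' h ψ) p) ; ψ (inj₂ p) → inj₂ (proj₁ (ren-tsem r t ρ ρ' h ψ) p) }) ,
      weaken⊢ (λ { ψ (inj₁ p) → inj₁ (proj₂ (ren-tsem r s ρ ρ' h ψ) p) ; ψ (inj₂ p) → inj₂ (proj₂ (ren-tsem r t ρ ρ' h ψ) p) })

    record Tm n (t : Env T n → Ext T) : Set₁ where
      constructor tm
      field
        term : LTerm n
        tsem : ∀ ρ φ → ⟦ T ⟧ₜ term ρ φ ⇔ mem (t ρ) φ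
    open Tm public

    -- A formula is packaged with the equivalence of its satisfaction and a predicate of Agda. The
    -- formulas built later merely transcribe predicates, and their meaning needs no separate proof.
    record Fm {ℓ} n (P : Env T n → Set ℓ) : Set (lsuc lzero ⊔ˡ ℓ) where
      constructor fm
      field
        form : LFormula n
        sem  : ∀ ρ → Sat T form ρ ⇔ P ρ
    open Fm public

    vr : ∀ {n} (i : Fin n) → Tm n (λ ρ → ρ i)
    vr i = tm (lvar i) λ ρ φ → (λ p → p) , (λ p → p)

    infixl 7 _∩'_
    _∩'_ : ∀ {n s t} → Tm n s → Tm n t → Tm n (λ ρ → meetE (s ρ) (t ρ))
    a ∩' b = tm (term a ∧ₗ term b) λ ρ φ → tsem a ρ φ ⇔× tsem b ρ φ

    _∪'_ : ∀ {n s t} → Tm n s → Tm n t → Tm n (λ ρ → joinE (s ρ) (t ρ))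
    a ∪' b = tm (term a ∨ₗ term b) λ ρ φ →
      weaken⊢ (λ { ψ (inj₁ p) → inj₁ (proj₁ (tsem a ρ ψ) p) ; ψ (inj₂ p) → inj₂ (proj₁ (tsem b ρ ψ) p) }) ,
      weaken⊢ (λ { ψ (inj₁ p) → inj₁ (proj₂ (tsem a ρ ψ) p) ; ψ (inj₂ p) → inj₂ (proj₂ (tsem b ρ ψ) p) })

    wk' : ∀ {n t} → Tm n t → Tm (suc n) (λ ρ → t (λ i → ρ (fsuc i)))
    wk' a = tm (renLT fsuc (term a)) λ ρ φ → let r = ren-tsem fsuc (term a) ρ (λ i → ρ (fsuc i)) (λ i φ → (λ p → p) , (λ p → p)) φ ; s = tsem a (λ i → ρ (fsuc i)) φ in
      (λ x → proj₁ s (proj₁ r x)) , (λ x → proj₂ r (proj₂ s x))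

    infixr 5 _⟶_
    _⟶_ : ∀ {n ℓ ℓ'} {P : Env T n → Set ℓ} {R : Env T n → Set ℓ'} → Fm n P → Fm n R → Fm n (λ ρ → P ρ → R ρ)
    a ⟶ b = fm (form a ⇒ₗ form b) λ ρ → (λ f p → proj₁ (sem b ρ) (f (proj₂ (sem a ρ) p))) , (λ f p → proj₂ (sem b ρ) (f (proj₁ (sem a ρ) p)))

    bot' : ∀ {n} → Fm n (λ _ → ⊥)
    bot' = fm ⊥ₗ λ ρ → lower , lift

    not' : ∀ {n ℓ} {P : Env T n → Set ℓ} → Fm n P → Fm n (λ ρ → ¬ P ρ)
    not' a = a ⟶ bot'

    all' : ∀ {n ℓ} {P : Env T (suc n) → Set ℓ} → Fm (suc n) P → Fm n (λ ρ → ∀ A → P (extendEnv T A ρ))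
    all' a = fm (∀ₗ (form a)) λ ρ → (λ f A → proj₁ (sem a _) (f A)) , (λ f A → proj₂ (sem a _) (f A))

    le₀ : ∀ {n s t} → Tm n s → Tm n t → Fm n (λ ρ → ∀ φ → mem (s ρ) φ → mem (t ρ) φ)
    le₀ a b = fm ((term a ∧ₗ term b) ≈ₗ term a) λ ρ →
      (λ { (lift h) φ p → proj₁ (tsem b ρ φ) (proj₂ (proj₂ (h φ) (proj₂ (tsem a ρ φ) p))) }) ,
      (λ h → lift λ φ → proj₁ , (λ p → p , proj₂ (tsem b ρ φ) (h φ (proj₁ (tsem a ρ φ) p))))

    infix 6 _⊑'_
    _⊑'_ : ∀ {n s t} → Tm n s → Tm n t → Fm n (λ ρ → s ρ ⊑ t ρ)
    a ⊑' b = not' (not' (le₀ a b))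

    zeroF : ∀ {n t} → Tm n t → Fm n (λ ρ → Zero (t ρ))
    zeroF a = all' (wk' a ⊑' vr fzero)

    compF : ∀ {n t} → Tm n t → Fm n (λ ρ → Comp (t ρ))
    compF a = not' (all' (all' (wk' (wk' a) ∩' vr (fsuc fzero) ⊑' vr fzero) ⟶ not' (all' (vr fzero ⊑' (wk' (wk' a) ∪' vr (fsuc fzero))))))

    -- The lattice counterpart of NS.
    LNs : (k : ℕ) → (Fin k → Ext T) → Ext T → Ext T → Set₁
    LNs zero Ds E A = ∀ W → Comp W → W ⊑ A → W ⊑ E → Zero W
    LNs (suc k) Ds E A = ¬ (∀ V → Comp V → V ⊑ Ds fzero → ¬ (∀ W → Comp W → W ⊑ Ds fzero → W ⊑ A → Zero (meetE W V) → LNs k (λ i → Ds (fsuc i)) E W))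

    LNF : ∀ k {n} {Ds : Env T n → Fin k → Ext T} {E A} → (∀ i → Tm n (λ ρ → Ds ρ i)) → Tm n E → Tm n A → Fm n (λ ρ → LNs k (Ds ρ) (E ρ) (A ρ))
    LNF zero ds e a = all' (compF (vr fzero) ⟶ vr fzero ⊑' wk' a ⟶ vr fzero ⊑' wk' e ⟶ zeroF (vr fzero))
    LNF (suc k) ds e a = not' (all' (compF (vr fzero) ⟶ vr fzero ⊑' wk' (ds fzero) ⟶
      not' (all' (compF (vr fzero) ⟶ vr fzero ⊑' wk' (wk' (ds fzero)) ⟶ vr fzero ⊑' wk' (wk' a) ⟶ zeroF (vr fzero ∩' vr (fsuc fzero)) ⟶
        LNF k (λ i → wk' (wk' (ds (fsuc i)))) (wk' (wk' e)) (vr fzero)))))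

    zero-stable : ∀ {W} → ¬ ¬ Zero W → Zero W
    zero-stable h C n = h λ z → z C n

    LNs-stable : ∀ k {Ds E A} → ¬ ¬ LNs k Ds E A → LNs k Ds E A
    LNs-stable zero h W c a b C n = h λ f → f W c a b C n
    LNs-stable (suc k) h n = h λ f → f n

  module LatticeNull (T : Sentence → Set) (TD : Def false (pred₁ (SetCode T)))
              (q₀ : ∀ φ → Q φ → T φ) (con : Consistent T) (K : ℕ) (φ : AF true 3) where
    open Lattice T TD q₀ con public
    open Null T TD q₀ con K φ using (E; NS; null⇒; null⇐) public

    -- Up to double negation the complemented elements are the principal ideals, so quantifying over
    -- them amounts to quantifying over sentences.
    LN⇔NS : ∀ k j (Ds : Fin k → Ext T) → (∀ i → Ds i ≡ D (suc (j + toℕ i))) → ∀ {A ρ} → Is A ρ → LNs k Ds E A ⇔ NS k j ρ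
    LN⇔NS zero j Ds h {A} {ρ} is = to , from
      where
      to : LNs zero Ds E A → NS zero j ρ
      to f x l i = zero→ {Princ x} (is-princ x) (f (Princ x) (comp← {Princ x} (is-princ x)) (⊑← {Princ x} {A} (is-princ x) (dn (proj₂ (is x) l))) (⊑← {Princ x} {E} (is-princ x) (dn i)))
      from : NS zero j ρ → LNs zero Ds E A
      from f W c a e = zero-stable {W} (comp→ {W} c >>= λ { (x , ix) → ⊑→ {W} {A} ix a >>= λ a' → ⊑→ {W} {E} ix e >>= λ e' →
        dn (zero← {W} ix (f x (proj₁ (is x) a') e')) })
    LN⇔NS (suc k) j Ds h {A} {ρ} is = to , from
      where
      D₁ = D (suc j)
      h₀ : Ds fzero ≡ D₁
      h₀ = trans (h fzero) (cong (λ z → D (suc z)) (+-identityʳ j))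
      ih = LN⇔NS k (suc j) (λ i → Ds (fsuc i)) (λ i → trans (h (fsuc i)) (cong (λ z → D (suc z)) (+-suc j (toℕ i))))
      to : LNs (suc k) Ds E A → NS (suc k) j ρ
      to f n = f λ V c l g → (comp→ {V} c >>= λ { (ζ , iz) → ⊑→ {V} {Ds fzero} iz l >>= λ l' → dn (ζ , subst (λ X → In X ζ) h₀ l' , λ w iw lw dw →
        proj₁ (ih {Princ w} (is-princ w)) (g (Princ w) (comp← {Princ w} (is-princ w)) (⊑← {Princ w} {Ds fzero} (is-princ w) (dn (subst (λ X → In X w) (sym h₀) iw)))
          (⊑← {Princ w} {A} (is-princ w) (dn (proj₂ (is w) lw))) (zero← {meetE (Princ w) V} (is-meet {Princ w} {V} (is-princ w) iz) (dn dw)))) }) n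
      from : NS (suc k) j ρ → LNs (suc k) Ds E A
      from f g = f λ { (ζ , iz , f') → g (Princ ζ) (comp← {Princ ζ} (is-princ ζ)) (⊑← {Princ ζ} {Ds fzero} (is-princ ζ) (dn (subst (λ X → In X ζ) (sym h₀) iz)))
        λ W c l a zz → LNs-stable k (comp→ {W} c >>= λ { (w , iw) → ⊑→ {W} {Ds fzero} iw l >>= λ l' → ⊑→ {W} {A} iw a >>= λ a' →
          zero→ {meetE W (Princ ζ)} (is-meet {W} {Princ ζ} iw (is-princ ζ)) zz >>= λ dw → dn (proj₂ (ih {W} iw) (f' w (subst (λ X → In X w) h₀ l') (proj₁ (is w) a') dw)) }) }

open LatticeFormulas

-- Smallness: containing the points of only finitely many coded slots

module SmallElements where

  module Small (T : Sentence → Set) (TD : Def false (pred₁ (SetCode T))) (q₀ : ∀ φ → Q φ → T φ) (con : Consistent T)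
    (K' : ℕ) (φ : AF true 3) (X : Vec ℕ 3 → Set) (xd : ∀ s → X s ⇔ ⟦ φ ⟧ s) (dK : depth φ ≤ suc K') where
    -- At least one limit level, so that the top-level slots are tested at their points and not
    -- merely for overlap; compare `OnM`.
    K = suc K'
    open LatticeNull T TD q₀ con K φ public
    open Rval φ using (rval)

    limX : ∀ s → LimB K (rval 0 s) (X s)
    limX s = lim-resp K {λ b → bs φ b s} ((λ p → dn (proj₂ (xd s) p)) , (λ p → dn (proj₁ (xd s) p))) (limit φ K s dK)

    Ds : Fin (suc K) → Ext T
    Ds i = D (toℕ i)

    -- One more layer than nullity, over the ideal generated by the slots: it allows a finite join
    -- of slots to be set aside before avoidance of X is demanded.
    Sm : Ext T → Set₁
    Sm Y = LNs (suc K) Ds E Y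

    Seen : Ext T → Vec ℕ 3 → Sentence → Set
    Seen Y s q = Slot s q × ¬ Z q × X s × OnP q (In Y)

    slot-fresh : ∀ L → All (GD 0) L → Σ ℕ λ B → ∀ n m v {q} → Slot (n ∷ m ∷ v ∷ []) q → B ≤ m → All (Disj q) L
    slot-fresh [] [] = 0 , λ _ _ _ _ _ → []
    slot-fresh (x ∷ L) ((.(n' ∷ m' ∷ v' ∷ []) , top {n' ∷ m' ∷ v' ∷ []} s') ∷ gs) with slot-fresh L gs
    ... | B , h = B ⊔ suc m' , λ n m v s le → go n m v s (m⊔n≤o⇒n≤o B (suc m') le) (slot-disj _ _ s s') ∷ h n m v s (m⊔n≤o⇒m≤o B (suc m') le)
      where
      go : ∀ n m v {q} → Slot (n ∷ m ∷ v ∷ []) q → suc m' ≤ m → ((n ∷ m ∷ v ∷ []) ≡ (n' ∷ m' ∷ v' ∷ []) × q ≡ x) ⊎ Disj q x → Disj q x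
      go n m v s l (inj₂ d) = d
      go n m v s l (inj₁ (refl , _)) = ⊥-elim (<-irrefl refl l)

    sm→ : ∀ {Y} → Sm Y → ¬ ¬ (Σ ℕ λ B → ∀ n m v q → Seen Y (n ∷ m ∷ v ∷ []) q → m < B)
    sm→ {Y} sm k = sm λ V c l f → (comp→ {V} c >>= λ { (ζ , iz) → ⊑→ {V} {D 0} iz l >>= λ l' → dn (go V ζ iz f (D-fin l')) }) λ b → b
      where
      go : ∀ V ζ → Is V ζ → (∀ W → Comp W → W ⊑ D 0 → W ⊑ Y → Zero (meetE W V) → LNs K (λ i → Ds (fsuc i)) E W) → (Σ (List Sentence) λ L → All (GD 0) L × Le ζ (⋁ L)) → ⊥
      go V ζ iz f (L , g , zl) with slot-fresh L g
      ... | B , h = k (B , λ n m v q seen → bound n m v q seen (m <? B))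
        where
        bound : ∀ n m v q → Seen Y (n ∷ m ∷ v ∷ []) q → Dec (m < B) → m < B
        bound n m v q _ (yes l) = l
        bound n m v q (s , nz , x , i , y , c , ny , iy) (no nl) = ⊥-elim
          (null⇒ K 0 refl (proj₁ (LN⇔NS K 0 (λ i → Ds (fsuc i)) (λ i → refl) {Princ y} (is-princ y))
             (f (Princ y) (comp← {Princ y} (is-princ y)) (⊑← {Princ y} {D 0} (is-princ y) (dn (In-down (D 0) (cell-le c) (D-gen (n ∷ m ∷ v ∷ [] , top {n ∷ m ∷ v ∷ []} s)))))
               (⊑← {Princ y} {Y} (is-princ y) (dn iy))
               (zero← {meetE (Princ y) V} (is-meet {Princ y} {V} (is-princ y) iz) (dn (disj-mono (cell-le c) zl (disj-⋁ (h n m v s (≮⇒≥ nl))))))))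
            (top {n ∷ m ∷ v ∷ []} s) nz (lim-resp K {λ b → bs φ b (n ∷ m ∷ v ∷ [])} {X (n ∷ m ∷ v ∷ [])} ((λ _ → dn _) , (λ _ → dn x)) (limX (n ∷ m ∷ v ∷ []))) (i , y , c , ny , Le-refl))

    -- The join of L is the element to set aside: a seen slot is consistent with nothing outside it,
    -- so whatever remains is null by `null⇐`.
    sm← : ∀ {Y} L → All (GD 0) L → (∀ s q → Seen Y s q → Le q (⋁ L)) → Sm Y
    sm← {Y} L g h k = k (Princ (⋁ L)) (comp← {Princ (⋁ L)} (is-princ _)) (⊑← {Princ (⋁ L)} {D 0} (is-princ _) (dn (In-⋁ (D 0) (All.map D-gen g))))
      λ W c l a zz → LNs-stable K {λ i → Ds (fsuc i)} {E} {W} (comp→ {W} c >>= λ { (w , iw) → ⊑→ {W} {D 0} iw l >>= λ l' → ⊑→ {W} {Y} iw a >>= λ a' →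
        zero→ {meetE W (Princ (⋁ L))} (is-meet {W} {Princ (⋁ L)} iw (is-princ _)) zz >>= λ dw →
        dn (proj₂ (LN⇔NS K 0 (λ i → Ds (fsuc i)) (λ i → refl) {W} iw) (null⇐ K 0 refl l' (λ { (top {σ} s) nz on → lim-resp K {λ b → bs φ b σ} {X σ} ((λ x → ⊥-elim (off w dw a' {σ} s nz x on)) , (λ ())) (limX σ) }))) })
      where
      off : ∀ w → Disj w (⋁ L) → In Y w → ∀ {s q} → Slot s q → ¬ Z q → X s → On q w → ⊥
      off w dw a' {s} {q} sl nz x (i , y , c , ny , l) =
        ny (disj-self l (disj-mono (Le-trans (cell-le c) (h s q (sl , nz , x , i , y , c , ny , In-down Y l a'))) Le-refl (disj-sym dw)))

    sm←none : ∀ {Y} → (∀ s q → ¬ Seen Y s q) → Sm Y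
    sm←none {Y} h = sm← {Y} [] [] (λ s q z → ⊥-elim (h s q z))

    slot-cell : ∀ {n m v q} → ¬ Z q → (s : Slot (n ∷ m ∷ v ∷ []) q) → ¬ Z (proj₁ s) × Le q (proj₁ s)
    slot-cell {v = v} nz (y , c , refl) = (λ z → nz (refute (Le-trans (pc-le _ v) ⊓₁) z)) , Le-trans (pc-le _ v) ⊓₁

    slot-unique : ∀ s {q q'} → Slot s q → Slot s q' → ¬ Z q → ¬ Z q' → q ≡ q'
    slot-unique (n ∷ m ∷ v ∷ []) s@(y , c , e) s'@(y' , c' , e') nz nz'
      with cell-unique c c' (proj₁ (slot-cell {n} {m} {v} nz s)) (proj₁ (slot-cell {n} {m} {v} nz' s'))
    ... | refl = trans e (sym e')

    collect : ∀ B → ¬ ¬ (Σ (List Sentence) λ L → All (GD 0) L × (∀ n m v q → ⌊ n , ⌊ m , v ⌋ ⌋ < B → Slot (n ∷ m ∷ v ∷ []) q → ¬ Z q → Le q (⋁ L)))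
    collect zero = dn ([] , [] , λ _ _ _ _ ())
    collect (suc B) = collect B >>= λ { (L , g , h) → new L g h (unpair B) }
      where
      new : ∀ L → All (GD 0) L → (∀ n m v q → ⌊ n , ⌊ m , v ⌋ ⌋ < B → Slot (n ∷ m ∷ v ∷ []) q → ¬ Z q → Le q (⋁ L)) → (Σ ℕ λ n₀ → Σ ℕ λ u → B ≡ ⌊ n₀ , u ⌋) →
        ¬ ¬ (Σ (List Sentence) λ L → All (GD 0) L × (∀ n m v q → ⌊ n , ⌊ m , v ⌋ ⌋ < suc B → Slot (n ∷ m ∷ v ∷ []) q → ¬ Z q → Le q (⋁ L)))
      new L g h (n₀ , u , e) with unpair u
      ... | m₀ , v₀ , e' = em (Σ Sentence λ q → Slot (n₀ ∷ m₀ ∷ v₀ ∷ []) q × ¬ Z q) >>= λ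
        { (inj₁ (q₁ , s₁ , nz₁)) → dn (q₁ ∷ L , (n₀ ∷ m₀ ∷ v₀ ∷ [] , top {n₀ ∷ m₀ ∷ v₀ ∷ []} s₁) ∷ g , λ { n m v q (s≤s l) s nz → go₁ q₁ s₁ nz₁ n m v q s nz (m≤n⇒m<n∨m≡n l) })
        ; (inj₂ none) → dn (L , g , λ { n m v q (s≤s l) s nz → go₂ none n m v q s nz (m≤n⇒m<n∨m≡n l) }) }
        where
        same : ∀ n m v → ⌊ n , ⌊ m , v ⌋ ⌋ ≡ B → _≡_ {A = Vec ℕ 3} (n ∷ m ∷ v ∷ []) (n₀ ∷ m₀ ∷ v₀ ∷ [])
        same n m v p with pinj n ⌊ m , v ⌋ {n₀} {u} (trans p e)
        ... | refl , p' with pinj m v {m₀} {v₀} (trans p' e')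
        ...   | refl , refl = refl
        go₁ : ∀ q₁ → Slot (n₀ ∷ m₀ ∷ v₀ ∷ []) q₁ → ¬ Z q₁ → ∀ n m v q → Slot (n ∷ m ∷ v ∷ []) q → ¬ Z q → ⌊ n , ⌊ m , v ⌋ ⌋ < B ⊎ ⌊ n , ⌊ m , v ⌋ ⌋ ≡ B → Le q (⋁ (q₁ ∷ L))
        go₁ q₁ s₁ nz₁ n m v q s nz (inj₁ l) = Le-trans (h n m v q l s nz) (⋁-++ʳ (q₁ ∷ []) L)
        go₁ q₁ s₁ nz₁ n m v q s nz (inj₂ p) with same n m v p
        ... | refl with slot-unique (n ∷ m ∷ v ∷ []) s s₁ nz nz₁
        ...   | refl = taut (q₁ ∷ ⋁ L ∷ `⊥ ∷ `⊥ ∷ []) (pA p⇒ (pA p∨ pB)) refl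
        go₂ : ¬ (Σ Sentence λ q → Slot (n₀ ∷ m₀ ∷ v₀ ∷ []) q × ¬ Z q) → ∀ n m v q → Slot (n ∷ m ∷ v ∷ []) q → ¬ Z q → ⌊ n , ⌊ m , v ⌋ ⌋ < B ⊎ ⌊ n , ⌊ m , v ⌋ ⌋ ≡ B → Le q (⋁ L)
        go₂ none n m v q s nz (inj₁ l) = h n m v q l s nz
        go₂ none n m v q s nz (inj₂ p) with same n m v p
        ... | refl = ⊥-elim (none (q , s , nz))

    Sm-stable : ∀ {Y} → ¬ ¬ Sm Y → Sm Y
    Sm-stable {Y} = LNs-stable (suc K) {Ds} {E} {Y}

    -- A bounded set of indices carries only finitely many consistent slots, since each index has at
    -- most one; their join serves as the exceptional element.
    sm←fin : ∀ {Y} B → (∀ n m v q → Seen Y (n ∷ m ∷ v ∷ []) q → n < B × m < B × v < B) → Sm Y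
    sm←fin {Y} B h = Sm-stable {Y} (collect (suc ⌊ B , ⌊ B , B ⌋ ⌋) >>= λ { (L , g , f) → dn (sm← {Y} L g λ { (n ∷ m ∷ v ∷ []) q z →
      let b₁ , b₂ , b₃ = h n m v q z in f n m v q (s≤s (pair-mono (<⇒≤ b₁) (pair-mono (<⇒≤ b₂) (<⇒≤ b₃)))) (proj₁ z) (proj₁ (proj₂ z)) }) })

open SmallElements

-- Soundness of deduction in structures given by graphs

module RelationalModels where

  -- Arithmetic in a structure whose operations are given by their graphs (R false for addition, R true for multiplication);
  -- terms have values only up to Eq and double negation.
  module Model (T : Sentence → Set) (Dom : Ext T → Set₁) (Eq : Ext T → Ext T → Set₁) (zr on : Ext T)
    (R : Bool → Ext T → Ext T → Ext T → Set₁) where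

    Val : ∀ {n} → Term n → Env T n → Ext T → Set₁
    Val (var i) ρ a = Eq (ρ i) a
    Val `0 ρ a = Eq zr a
    Val (`S t) ρ a = ¬ (∀ b → Dom b → Val t ρ b → ¬ R false b on a)
    Val (s `+ t) ρ a = ¬ (∀ b → Dom b → Val s ρ b → ∀ c → Dom c → Val t ρ c → ¬ R false b c a)
    Val (s `· t) ρ a = ¬ (∀ b → Dom b → Val s ρ b → ∀ c → Dom c → Val t ρ c → ¬ R true b c a)

    Tr : ∀ {n} → Formula n → Env T n → Set₁
    Tr `⊥ ρ = Lift _ ⊥
    Tr (s ≐ t) ρ = ∀ a → Dom a → Val s ρ a → Val t ρ a
    Tr (φ ⇒ ψ) ρ = Tr φ ρ → Tr ψ ρ
    Tr (∀' φ) ρ = ∀ a → Dom a → Tr φ (extendEnv T a ρ)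

    Refl Sym Trans : Set₁
    Refl = ∀ a → Dom a → Eq a a
    Sym = ∀ a → Dom a → ∀ b → Dom b → Eq a b → Eq b a
    Trans = ∀ a → Dom a → ∀ b → Dom b → ∀ c → Dom c → Eq a b → Eq b c → Eq a c

    Total Functional Resp : Bool → Set₁
    Total t = ∀ a → Dom a → ∀ b → Dom b → ¬ (∀ c → Dom c → ¬ R t a b c)
    Functional t = ∀ a → Dom a → ∀ b → Dom b → ∀ c → Dom c → ∀ a' → Dom a' → ∀ b' → Dom b' → ∀ c' → Dom c' →
      Eq a a' → Eq b b' → R t a b c → R t a' b' c' → Eq c c'
    Resp t = ∀ a → Dom a → ∀ b → Dom b → ∀ c → Dom c → ∀ c' → Dom c' → Eq c c' → R t a b c → R t a b c'

    record Ok : Set₁ where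
      field
        e-refl  : Refl
        e-sym   : Sym
        e-trans : Trans
        d-zr    : Dom zr
        d-on    : Dom on
        r-total : ∀ t → Total t
        r-fun   : ∀ t → Functional t
        r-cong  : ∀ t → Resp t

    module Soundness (stable : ∀ a b → ¬ ¬ Eq a b → Eq a b) (o : Ok) where
      open Ok o

      InDom : ∀ {n} → Env T n → Set₁
      InDom ρ = ∀ i → Dom (ρ i)

      val-stable : ∀ {n} (t : Term n) ρ a → ¬ ¬ Val t ρ a → Val t ρ a
      val-stable (var i) ρ a = stable _ _
      val-stable `0 ρ a = stable _ _
      val-stable (`S t) ρ a h n = h λ v → v n
      val-stable (s `+ t) ρ a h n = h λ v → v n
      val-stable (s `· t) ρ a h n = h λ v → v n

      tr-stable : ∀ {n} (φ : Formula n) ρ → ¬ ¬ Tr φ ρ → Tr φ ρ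
      tr-stable `⊥ ρ h = ⊥-elim (h λ ())
      tr-stable (s ≐ t) ρ h a d v = val-stable t ρ a λ n → h λ f → n (f a d v)
      tr-stable (φ ⇒ ψ) ρ h p = tr-stable ψ ρ λ n → h λ f → n (f p)
      tr-stable (∀' φ) ρ h a d = tr-stable φ _ λ n → h λ f → n (f a d)

      val-cong : ∀ {n} (t : Term n) {ρ} → InDom ρ → ∀ {a a'} → Dom a → Dom a' → Eq a a' → Val t ρ a → Val t ρ a'
      val-cong (var i) D d d' e v = e-trans _ (D i) _ d _ d' v e
      val-cong `0 D d d' e v = e-trans _ d-zr _ d _ d' v e
      val-cong (`S t) D d d' e v n = v λ b db w r → n b db w (r-cong false b db on d-on _ d _ d' e r)
      val-cong (s `+ t) D d d' e v n = v λ b db w c dc u r → n b db w c dc u (r-cong false b db c dc _ d _ d' e r)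
      val-cong (s `· t) D d d' e v n = v λ b db w c dc u r → n b db w c dc u (r-cong true b db c dc _ d _ d' e r)

      val-fun : ∀ {n} (t : Term n) {ρ} → InDom ρ → ∀ {a a'} → Dom a → Dom a' → Val t ρ a → Val t ρ a' → Eq a a'
      val-fun (var i) D d d' v v' = e-trans _ d _ (D i) _ d' (e-sym _ (D i) _ d v) v'
      val-fun `0 D d d' v v' = e-trans _ d _ d-zr _ d' (e-sym _ d-zr _ d v) v'
      val-fun (`S t) D d d' v v' = stable _ _ λ n → v λ b db w r → v' λ b' db' w' r' →
        n (r-fun false b db on d-on _ d b' db' on d-on _ d' (val-fun t D db db' w w') (e-refl on d-on) r r')
      val-fun (s `+ t) D d d' v v' = stable _ _ λ n → v λ b db w c dc u r → v' λ b' db' w' c' dc' u' r' →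
        n (r-fun false b db c dc _ d b' db' c' dc' _ d' (val-fun s D db db' w w') (val-fun t D dc dc' u u') r r')
      val-fun (s `· t) D d d' v v' = stable _ _ λ n → v λ b db w c dc u r → v' λ b' db' w' c' dc' u' r' →
        n (r-fun true b db c dc _ d b' db' c' dc' _ d' (val-fun s D db db' w w') (val-fun t D dc dc' u u') r r')

      val-total : ∀ {n} (t : Term n) {ρ} → InDom ρ → ¬ ¬ (Σ (Ext T) λ a → Dom a × Val t ρ a)
      val-total (var i) D = dn (_ , D i , e-refl _ (D i))
      val-total `0 D = dn (zr , d-zr , e-refl zr d-zr)
      val-total (`S t) D = val-total t D >>= λ { (b , db , v) k → r-total false b db on d-on λ a da r → k (a , da , λ n → n b db v r) }
      val-total (s `+ t) D = val-total s D >>= λ { (b , db , v) → val-total t D >>= λ { (c , dc , u) k → r-total false b db c dc λ a da r → k (a , da , λ n → n b db v c dc u r) } }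
      val-total (s `· t) D = val-total s D >>= λ { (b , db , v) → val-total t D >>= λ { (c , dc , u) k → r-total true b db c dc λ a da r → k (a , da , λ n → n b db v c dc u r) } }

      val-ren : ∀ {n m} (r : Fin n → Fin m) (t : Term n) ρ ρ' → (∀ i → ρ' (r i) ≡ ρ i) → ∀ a → Val (renT r t) ρ' a ⇔ Val t ρ a
      val-ren r (var i) ρ ρ' h a = subst (λ z → Eq z a) (h i) , subst (λ z → Eq z a) (sym (h i))
      val-ren r `0 ρ ρ' h a = (λ v → v) , (λ v → v)
      val-ren r (`S t) ρ ρ' h a = (λ v n → v λ b db w → n b db (proj₁ (val-ren r t ρ ρ' h b) w)) , (λ v n → v λ b db w → n b db (proj₂ (val-ren r t ρ ρ' h b) w))
      val-ren r (s `+ t) ρ ρ' h a =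
        (λ v n → v λ b db w c dc u → n b db (proj₁ (val-ren r s ρ ρ' h b) w) c dc (proj₁ (val-ren r t ρ ρ' h c) u)) ,
        (λ v n → v λ b db w c dc u → n b db (proj₂ (val-ren r s ρ ρ' h b) w) c dc (proj₂ (val-ren r t ρ ρ' h c) u))
      val-ren r (s `· t) ρ ρ' h a =
        (λ v n → v λ b db w c dc u → n b db (proj₁ (val-ren r s ρ ρ' h b) w) c dc (proj₁ (val-ren r t ρ ρ' h c) u)) ,
        (λ v n → v λ b db w c dc u → n b db (proj₂ (val-ren r s ρ ρ' h b) w) c dc (proj₂ (val-ren r t ρ ρ' h c) u))

      tr-ren : ∀ {n m} (r : Fin n → Fin m) (φ : Formula n) ρ ρ' → (∀ i → ρ' (r i) ≡ ρ i) → Tr (renF r φ) ρ' ⇔ Tr φ ρ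
      tr-ren r `⊥ ρ ρ' h = (λ v → v) , (λ v → v)
      tr-ren r (s ≐ t) ρ ρ' h = (λ f a d v → proj₁ (val-ren r t ρ ρ' h a) (f a d (proj₂ (val-ren r s ρ ρ' h a) v))) ,
                                (λ f a d v → proj₂ (val-ren r t ρ ρ' h a) (f a d (proj₁ (val-ren r s ρ ρ' h a) v)))
      tr-ren r (φ ⇒ ψ) ρ ρ' h = (λ f p → proj₁ (tr-ren r ψ ρ ρ' h) (f (proj₂ (tr-ren r φ ρ ρ' h) p))) ,
                                (λ f p → proj₂ (tr-ren r ψ ρ ρ' h) (f (proj₁ (tr-ren r φ ρ ρ' h) p)))
      tr-ren r (∀' φ) ρ ρ' h = (λ f a d → proj₁ (ih a) (f a d)) , (λ f a d → proj₂ (ih a) (f a d))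
        where ih = λ a → tr-ren (liftR r) φ (extendEnv T a ρ) (extendEnv T a ρ') λ { fzero → refl ; (fsuc i) → h i }

      val-sub : ∀ {n m} (σ : Fin n → Term m) (t : Term n) {ρ ρ'} → InDom ρ → InDom ρ' → (∀ i → Val (σ i) ρ' (ρ i)) → ∀ a → Dom a → Val (subT σ t) ρ' a ⇔ Val t ρ a
      val-sub σ (var i) D D' h a d = val-fun (σ i) D' (D i) d (h i) , (λ e → val-cong (σ i) D' (D i) d e (h i))
      val-sub σ `0 D D' h a d = (λ v → v) , (λ v → v)
      val-sub σ (`S t) D D' h a d = (λ v n → v λ b db w → n b db (proj₁ (val-sub σ t D D' h b db) w)) , (λ v n → v λ b db w → n b db (proj₂ (val-sub σ t D D' h b db) w))
      val-sub σ (s `+ t) D D' h a d =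
        (λ v n → v λ b db w c dc u → n b db (proj₁ (val-sub σ s D D' h b db) w) c dc (proj₁ (val-sub σ t D D' h c dc) u)) ,
        (λ v n → v λ b db w c dc u → n b db (proj₂ (val-sub σ s D D' h b db) w) c dc (proj₂ (val-sub σ t D D' h c dc) u))
      val-sub σ (s `· t) D D' h a d =
        (λ v n → v λ b db w c dc u → n b db (proj₁ (val-sub σ s D D' h b db) w) c dc (proj₁ (val-sub σ t D D' h c dc) u)) ,
        (λ v n → v λ b db w c dc u → n b db (proj₂ (val-sub σ s D D' h b db) w) c dc (proj₂ (val-sub σ t D D' h c dc) u))

      ext-dom : ∀ {n} {ρ : Env T n} {a} → Dom a → InDom ρ → InDom (extendEnv T a ρ)
      ext-dom d D fzero = d
      ext-dom d D (fsuc i) = D i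

      tr-sub : ∀ {n m} (σ : Fin n → Term m) (φ : Formula n) {ρ ρ'} → InDom ρ → InDom ρ' → (∀ i → Val (σ i) ρ' (ρ i)) → Tr (subF σ φ) ρ' ⇔ Tr φ ρ
      tr-sub σ `⊥ D D' h = (λ v → v) , (λ v → v)
      tr-sub σ (s ≐ t) D D' h = (λ f a d v → proj₁ (val-sub σ t D D' h a d) (f a d (proj₂ (val-sub σ s D D' h a d) v))) ,
                                (λ f a d v → proj₂ (val-sub σ t D D' h a d) (f a d (proj₁ (val-sub σ s D D' h a d) v)))
      tr-sub σ (φ ⇒ ψ) D D' h = (λ f p → proj₁ (tr-sub σ ψ D D' h) (f (proj₂ (tr-sub σ φ D D' h) p))) ,
                                (λ f p → proj₂ (tr-sub σ ψ D D' h) (f (proj₁ (tr-sub σ φ D D' h) p)))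
      tr-sub {n} {m} σ (∀' φ) {ρ} {ρ'} D D' h = (λ f a d → proj₁ (ih a d) (f a d)) , (λ f a d → proj₂ (ih a d) (f a d))
        where
        ih : ∀ a → Dom a → Tr (subF (liftS σ) φ) (extendEnv T a ρ') ⇔ Tr φ (extendEnv T a ρ)
        ih a d = tr-sub (liftS σ) φ (ext-dom d D) (ext-dom d D') λ { fzero → e-refl a d ; (fsuc i) → proj₂ (val-ren fsuc (σ i) ρ' (extendEnv T a ρ') (λ _ → refl) (ρ i)) (h i) }

      tr-inst : ∀ {n} (φ : Formula (suc n)) (t : Term n) {ρ a} → InDom ρ → Dom a → Val t ρ a → Tr (φ [ t ]) ρ ⇔ Tr φ (extendEnv T a ρ)
      tr-inst φ t {ρ} {a} D d v = tr-sub (single t) φ (ext-dom d D) D λ { fzero → v ; (fsuc i) → e-refl _ (D i) }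

      -- Values of terms exist only under a double negation; this suffices because truth is stable,
      -- which also validates `ax-DNE`. The substitution lemma rests on values being unique up to
      -- `Eq`.
      sound : ∀ {Γ : Sentence → Set} (ρ₀ : Env T 0) → (∀ φ → Γ φ → Tr φ ρ₀) → ∀ {n} {φ : Formula n} → Γ ⊢ φ → ∀ ρ → InDom ρ → Tr φ ρ
      sound ρ₀ g (hyp {φ = φ} p) ρ D = proj₂ (tr-ren (λ ()) φ ρ₀ ρ (λ ())) (g φ p)
      sound ρ₀ g (ax (ax-K φ ψ)) ρ D p _ = p
      sound ρ₀ g (ax (ax-S φ ψ χ)) ρ D f h p = f p (h p)
      sound ρ₀ g (ax (ax-DNE φ)) ρ D h = tr-stable φ ρ λ n → lower (h λ p → ⊥-elim (n p))
      sound ρ₀ g (ax (ax-inst φ t)) ρ D f = tr-stable (φ [ t ]) ρ (val-total t D >>= λ { (a , d , v) → dn (proj₂ (tr-inst φ t D d v) (f a d)) })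
      sound ρ₀ g (ax (ax-dist φ ψ)) ρ D f p a d = f a d (proj₂ (tr-ren fsuc φ ρ (extendEnv T a ρ) (λ _ → refl)) p)
      sound ρ₀ g (ax (ax-refl t)) ρ D a d v = v
      sound ρ₀ g (ax (ax-subst s t φ)) ρ D e p = tr-stable (φ [ t ]) ρ (val-total s D >>= λ { (a , d , v) → dn (proj₂ (tr-inst φ t D d (e a d v)) (proj₁ (tr-inst φ s D d v) p)) })
      sound ρ₀ g (mp d e) ρ D = sound ρ₀ g d ρ D (sound ρ₀ g e ρ D)
      sound ρ₀ g (gen e) ρ D a d = sound ρ₀ g e _ (ext-dom d D)

open RelationalModels

-- Sets of colours, and the domain of the interpretation

module DecodedNumbers where

  module Decoding (T : Sentence → Set) (TD : Def false (pred₁ (SetCode T))) (q₀ : ∀ φ → Q φ → T φ) (con : Consistent T) where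
    open Lattice T TD q₀ con public

    record Par (m : ℕ) : Set₁ where
      field
        V0 V1 J E* : Ext T
        Ec : Fin 4 → Ext T
        Ds : Fin m → Ext T

    parE : ∀ {m} → Env T (8 + m) → Par m
    parE {m} ρ = record { V0 = ρ (# 0) ; V1 = ρ (# 1) ; J = ρ (# 2) ; E* = ρ (# 3) ; Ec = λ c → ρ (4 ↑ʳ (c ↑ˡ m)) ; Ds = λ i → ρ (8 ↑ʳ i) }

    module Pred {m} (p : Par m) where
      open Par p

      Sm* : Ext T → Set₁
      Sm* Y = LNs m Ds E* Y

      Smc : Fin 4 → Ext T → Set₁
      Smc c Y = LNs m Ds (Ec c) Y

      -- Intended meaning: W has at least one colour. The element c ranges over finite sets of
      -- labels, so W is required to be not small on labels outside any finite set.
      NN : Ext T → Set₁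
      NN W = ∀ c → Comp c → c ⊑ J → ¬ (∀ r → Comp r → r ⊑ J → Zero (meetE r c) → Sm* (meetE W r))

      -- At most one colour: with two colours, ideals naming each of them would meet W but not meet
      -- it jointly.
      Uniq : Ext T → Set₁
      Uniq W = ∀ W₁ W₂ → NN (meetE W W₁) → NN (meetE W W₂) → NN (meetE (meetE W W₁) W₂)

      Dom : Ext T → Set₁
      Dom W = ¬ (NN W → ¬ Uniq W)

      Eq : Ext T → Ext T → Set₁
      Eq W V = NN (meetE W V)

      -- For r a label b_k this says that w has a colour joined to b_k in component c. Passing to
      -- every r' that is not small makes the condition independent of a finite part of r.
      Hit : Fin 4 → Ext T → Ext T → Set₁
      Hit c w r = ∀ r' → Comp r' → r' ⊑ r → ¬ Sm* r' → ¬ Smc c (meetE w r')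

      H : Ext T → Ext T → Ext T → Ext T → Set₁
      H w₀ w₁ w₂ w₃ = ∀ c → Comp c → c ⊑ J → ¬ (∀ r → Comp r → r ⊑ J → Zero (meetE r c) → ¬ Sm* r →
        Hit (# 0) w₀ r → Hit (# 1) w₁ r → Hit (# 2) w₂ r → Hit (# 3) w₃ r → ⊥)

      -- The elements for the colours 0 and 1 are the constants of the structure and, in the first
      -- coordinate of `Rel`, the tags of addition and multiplication.
      R : Bool → Ext T → Ext T → Ext T → Set₁
      R false = H V0
      R true = H V1

    module M {m} (p : Par m) = Model T (Pred.Dom p) (Pred.Eq p) (Par.V0 p) (Par.V1 p) (Pred.R p)

  module Standard (T : Sentence → Set) (TD : Def false (pred₁ (SetCode T))) (q₀ : ∀ φ → Q φ → T φ) (con : Consistent T) where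
    open Decoding T TD q₀ con public

    liveEx : ∀ n v M → ¬ ¬ (Σ ℕ λ m → M < suc m × Live (0 ∷ n ∷ m ∷ v ∷ []))
    liveEx n v M = cell-exists (label-nz n) M >>= λ { (y , c , ny) → dn (M , ≤-refl , pc (y ⊓ F y) v , (y , c , refl) , λ z → ny (F-half (pc-nz _ v z))) }

    open Cohesion Acc Live accD liveD liveEx public

    Rel : ℕ → ℕ → ℕ → ℕ → Set
    Rel w x y z = (w ≡ 0 × x + y ≡ z) ⊎ (w ≡ 1 × x * y ≡ z)

    -- Only the colours up to k are used at b_k. So a single label carries finitely many colours,
    -- and each of them is within the range where acceptance is controlled.
    Edge* : Vec ℕ 2 → Set
    Edge* (k ∷ v ∷ []) = v < suc k

    -- The number k codes an attempt to witness Rel w x y z; the last component makes each tuple occur infinitely often.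
    Edge : Fin 4 → Vec ℕ 2 → Set
    Edge c (k ∷ v ∷ []) = Σ ℕ λ w → Σ ℕ λ x → Σ ℕ λ y → Σ ℕ λ z → Σ ℕ λ i →
      k ≡ ⌊ w , ⌊ x , ⌊ y , ⌊ z , i ⌋ ⌋ ⌋ ⌋ × Rel w x y z × v ≡ lookup (w ∷ x ∷ y ∷ z ∷ []) c

    abstract
      edge*D : Def true Edge*
      edge*D = defP (xlt (xv (# 1)) (xsu (xv (# 0)))) λ { (k ∷ v ∷ []) → (λ z → z) , (λ z → z) }

      edgeD : ∀ c → Def true (Edge c)
      edgeD c = defP (xex (xex (xex (xex (xex (xand (xeq (xv (# 5)) (xp (xv (# 4)) (xp (xv (# 3)) (xp (xv (# 2)) (xp (xv (# 1)) (xv (# 0)))))))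
          (xand (xor (xand (xeq (xv (# 4)) (xn 0)) (xeq (xadd (xv (# 3)) (xv (# 2))) (xv (# 1)))) (xand (xeq (xv (# 4)) (xn 1)) (xeq (xmul (xv (# 3)) (xv (# 2))) (xv (# 1)))))
            (xeq (xv (# 6)) (lookup ts c)))))))))
        λ { (k ∷ v ∷ []) → (λ { (w , x , y , z , i , e , r , p) → w , x , y , z , i , e , r , trans p (lookup-xevs ts (i ∷ z ∷ y ∷ x ∷ w ∷ k ∷ v ∷ []) c) }) ,
                           (λ { (w , x , y , z , i , e , r , p) → w , x , y , z , i , e , r , trans p (sym (lookup-xevs ts (i ∷ z ∷ y ∷ x ∷ w ∷ k ∷ v ∷ []) c)) }) }
        where
        ts : Vec (XT 7) 4
        ts = xv (# 4) ∷ xv (# 3) ∷ xv (# 2) ∷ xv (# 1) ∷ []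

    φ* : AF true 3
    φ* = proj₁ (xD edge*D)

    φc : Fin 4 → AF true 3
    φc c = proj₁ (xD (edgeD c))

    -- A common depth for all five coded sets, so that they share the same ideals of nested slots as
    -- parameters.
    K' : ℕ
    K' = depth φ* ⊔ (depth (φc (# 0)) ⊔ (depth (φc (# 1)) ⊔ (depth (φc (# 2)) ⊔ depth (φc (# 3)))))

    dφ* : depth φ* ≤ suc K'
    dφ* = m≤n⇒m≤1+n (m≤m⊔n _ _)

    dφc : ∀ c → depth (φc c) ≤ suc K'
    dφc c = m≤n⇒m≤1+n (≤-trans (go c) (m≤n⊔m (depth φ*) _))
      where
      d = λ c → depth (φc c)
      go : ∀ c → d c ≤ d (# 0) ⊔ (d (# 1) ⊔ (d (# 2) ⊔ d (# 3)))
      go fzero = m≤m⊔n _ _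
      go (fsuc fzero) = ≤-trans (m≤m⊔n _ _) (m≤n⊔m (d (# 0)) _)
      go (fsuc (fsuc fzero)) = ≤-trans (≤-trans (m≤m⊔n _ _) (m≤n⊔m (d (# 1)) _)) (m≤n⊔m (d (# 0)) _)
      go (fsuc (fsuc (fsuc fzero))) = ≤-trans (≤-trans (m≤n⊔m (d (# 2)) (d (# 3))) (m≤n⊔m (d (# 1)) _)) (m≤n⊔m (d (# 0)) _)

    module S = Small T TD q₀ con K' φ* (X edge*D) (proj₂ (xD edge*D)) dφ*
    module C (c : Fin 4) = Small T TD q₀ con K' (φc c) (X (edgeD c)) (proj₂ (xD (edgeD c))) (dφc c)

    J : Ext T
    J = Gen GJ gjD

    V : ℕ → Ext T
    V v = Gen (GV v) (gvD v)

    stdEnv : Env T (8 + suc (suc K'))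
    stdEnv fzero = V 0
    stdEnv (fsuc fzero) = V 1
    stdEnv (fsuc (fsuc fzero)) = J
    stdEnv (fsuc (fsuc (fsuc fzero))) = S.E
    stdEnv (fsuc (fsuc (fsuc (fsuc fzero)))) = C.E (# 0)
    stdEnv (fsuc (fsuc (fsuc (fsuc (fsuc fzero))))) = C.E (# 1)
    stdEnv (fsuc (fsuc (fsuc (fsuc (fsuc (fsuc fzero)))))) = C.E (# 2)
    stdEnv (fsuc (fsuc (fsuc (fsuc (fsuc (fsuc (fsuc fzero))))))) = C.E (# 3)
    stdEnv (fsuc (fsuc (fsuc (fsuc (fsuc (fsuc (fsuc (fsuc i)))))))) = D (toℕ i)

    par : Par (suc (suc K'))
    par = parE stdEnv

    open Pred par public

    smc : ∀ c Y → Smc c Y ⇔ C.Sm c Y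
    smc fzero Y = (λ z → z) , (λ z → z)
    smc (fsuc fzero) Y = (λ z → z) , (λ z → z)
    smc (fsuc (fsuc fzero)) Y = (λ z → z) , (λ z → z)
    smc (fsuc (fsuc (fsuc fzero))) Y = (λ z → z) , (λ z → z)

    ≋→ : ∀ {A B} → A ≋ B → A → ¬ ¬ B
    ≋→ (u , _) a n = u (a , n)

    pick : ∀ {k n} → Chain k n → ∀ v M → ¬ ¬ (Σ ℕ λ m → M ≤ m × Σ Sentence λ q → Slot (n ∷ m ∷ v ∷ []) q × ¬ Z q × Mt k n m v)
    pick c v M = mt-many c v M >>= λ { (m , l , (q , s , nz) , mt) → dn (m , s≤s⁻¹ l , q , s , nz , mt) }

    abstract
      -- By universality every extension has an index e, so that its membership questions occur
      -- among the tasks of the greedy construction.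
      index : ∀ W → Σ ℕ λ a → ∀ s → Acc (a ∷ s) ⇔ (Σ Sentence λ q → Slot s q × OnP q (In W))
      index W = let a , h = universal (memD' W) in a , λ s →
        (λ { (q , sl , i , y , c , ny , u) → q , sl , i , y , c , ny , proj₁ setCode∈ (proj₂ (h _) u) }) ,
        (λ { (q , sl , i , y , c , ny , u) → q , sl , i , y , c , ny , proj₁ (h _) (proj₂ setCode∈ u) })

    idx : Ext T → ℕ
    idx W = proj₁ (index W)

    -- The colours of the slots that W eventually contains.
    Col : Ext T → ℕ → Set
    Col W v = π (idx W) v

    Col-stable : ∀ W v → ¬ ¬ Col W v → Col W v
    Col-stable W v h n = h λ f → f n

    on-nz : ∀ {q P} → OnP q P → ¬ Z q
    on-nz (i , y , c , ny , _) z = ny (refute (cell-le c) z)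

    -- This is cohesion in use: from k ≥ `idx W` on, the task for W and v has been decided, and
    -- every matching slot obeys the decision.
    accIff : ∀ W n m v {k q} → idx W ≤ k → v ≤ k → Slot (n ∷ m ∷ v ∷ []) q → ¬ Z q → Mt k n m v → OnP q (In W) ≋ Col W v
    accIff W n m v {k} {q} a b s nz mt = ≋trans (≋of (λ on → proj₂ (proj₂ (index W) σ) (q , s , on)) (λ x → back (proj₁ (proj₂ (index W) σ) x))) (mt-acc {k} {n} {m} {v} {idx W} (task< a b) mt)
      where
      σ = n ∷ m ∷ v ∷ []
      back : (Σ Sentence λ q → Slot σ q × OnP q (In W)) → OnP q (In W)
      back (q' , s' , on) = subst (λ z → OnP z (In W)) (S.slot-unique σ s' s (on-nz {q'} {In W} on) nz) on

    on-meet : ∀ A B {q} → OnP q (In A) → OnP q (In B) → OnP q (In (meetE A B))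
    on-meet A B {q} (i , y , c , ny , a) (i' , y' , c' , ny' , b) = go (≤-total i i')
      where
      go : i ≤ i' ⊎ i' ≤ i → OnP q (In (meetE A B))
      go (inj₁ l) = i' , y' , c' , ny' , In-down A (cell-nested l c c' ny ny') a , b
      go (inj₂ l) = i , y , c , ny , a , In-down B (cell-nested l c' c ny' ny) b

    on-below : ∀ A {q ρ} → Le q ρ → OnP q (In A) → OnP q (In (meetE A (Princ ρ)))
    on-below A l (i , y , c , ny , a) = i , y , c , ny , a , princ-In (Le-trans (cell-le c) l)

    labels : ℕ → List Sentence
    labels zero = []
    labels (suc N) = label N ∷ labels N

    labels-J : ∀ N → In J (⋁ (labels N))
    labels-J N = In-⋁ J (go N)
      where
      go : ∀ N → All (In J) (labels N)
      go zero = []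
      go (suc N) = gen-In GJ gjD (N , refl) ∷ go N

    abstract
      ∨-left : ∀ {x y} → Le x (x ∨' y)
      ∨-left {x} {y} = taut (x ∷ y ∷ x ∷ x ∷ []) (pA p⇒ (pA p∨ pB)) refl

    labels-le : ∀ N n → n < N → Le (label n) (⋁ (labels N))
    labels-le (suc N) n (s≤s l) = go (m≤n⇒m<n∨m≡n l)
      where
      go : n < N ⊎ n ≡ N → Le (label n) (⋁ (labels (suc N)))
      go (inj₁ l) = Le-trans (labels-le N n l) (⋁-++ʳ (label N ∷ []) (labels N))
      go (inj₂ refl) = ∨-left {label N} {⋁ (labels N)}

    J-bound : ∀ {ζ} → In J ζ → Σ ℕ λ N → ∀ n → N ≤ n → Disj (label n) ζ
    J-bound {ζ} i with gen-fin GJ gjD i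
    ... | L , g , l with bound L g
      where
      bound : ∀ L → All GJ L → Σ ℕ λ N → ∀ n → N ≤ n → All (Disj (label n)) L
      bound [] [] = 0 , λ _ _ → []
      bound (x ∷ L) ((n' , refl) ∷ gs) with bound L gs
      ... | N , h = N ⊔ suc n' , λ n le → go n (m⊔n≤o⇒n≤o N (suc n') le) (pc-disj _ n n') ∷ h n (m⊔n≤o⇒m≤o N (suc n') le)
        where
        go : ∀ n → suc n' ≤ n → n ≡ n' ⊎ Disj (label n) (label n') → Disj (label n) (label n')
        go n l (inj₂ d) = d
        go n l (inj₁ refl) = ⊥-elim (<-irrefl refl l)
    ...   | N , h = N , λ n le → disj-mono Le-refl l (disj-⋁ (h n le))

    J-princ : ∀ {ρ n} → Le ρ (label n) → Princ ρ ⊑ J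
    J-princ {ρ} {n} l = ⊑← {Princ ρ} {J} (is-princ ρ) (dn (In-down J l (gen-In GJ gjD (n , refl))))

    le-label : ∀ n m v {q ρ} → Slot (n ∷ m ∷ v ∷ []) q → OnP q (λ y → Le y ρ) → Σ Sentence λ y → ¬ Z y × Le y ρ × Le y (label n)
    le-label n m v s (i , y , c , ny , l) = y , ny , l , Le-trans (cell-le c) (slot-le n {m} {v} s)

    on-snd : ∀ A B {q ρ} → Is B ρ → OnP q (In (meetE A B)) → OnP q (λ y → Le y ρ)
    on-snd A B ib (i , y , c , ny , _ , b) = i , y , c , ny , proj₁ (ib y) b

    on-fst : ∀ A B {q} → OnP q (In (meetE A B)) → OnP q (In A)
    on-fst A B (i , y , c , ny , a , _) = i , y , c , ny , a

    -- A label b_k with k beyond the index, the colour and the given finite set carries arbitrarily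
    -- late slots of colour v, whose points all lie in W; a bound from smallness is contradicted by
    -- one of them.
    nn← : ∀ W v → Col W v → NN W
    nn← W v cv c cc cJ f = (comp→ {c} cc >>= λ { (ζ , iz) → ⊑→ {c} {J} iz cJ >>= λ jz → go ζ iz (J-bound jz) }) (λ b → b)
      where
      go : ∀ ζ → Is c ζ → (Σ ℕ λ N → ∀ n → N ≤ n → Disj (label n) ζ) → ¬ ¬ ⊥
      go ζ iz (N , fr) = chain-exists k >>= λ { (n , ch) →
        S.sm→ {meetE W (Princ (label n))} (f (Princ (label n)) (comp← {Princ (label n)} (is-princ _)) (J-princ {label n} {n} Le-refl)
           (zero← {meetE (Princ (label n)) c} (is-meet {Princ (label n)} {c} (is-princ _) iz) (dn (fr n (≤-trans (m≤n⊔m (idx W ⊔ v) N) (chain-≤ k ch)))))) >>= λ { (B , h) →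
        pick ch v B >>= λ { (m , l , q , s , nz , mt) →
        ≋→ (≋sym (accIff W n m v (≤-trans (m≤m⊔n (idx W) v) (m≤m⊔n _ N)) vk s nz mt)) cv >>= λ on →
        dn (<-irrefl refl (≤-trans (h n m v q (s , nz , (k , ch , s≤s vk , mt) , on-below W (slot-le n {m} {v} s) on)) l)) } } }
        where
        k = (idx W ⊔ v) ⊔ N
        vk : v ≤ k
        vk = ≤-trans (m≤n⊔m (idx W) v) (m≤m⊔n _ N)

    late : ∀ {e nₑ} → Chain e nₑ → ∀ {k n m v q ρ} → Chain k n → Slot (n ∷ m ∷ v ∷ []) q → OnP q (λ y → Le y ρ) → Disj ρ (⋁ (labels nₑ)) → e ≤ k
    late {e} {nₑ} ce {k} {n} {m} {v} ck s on d with e Data.Nat.≤? k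
      where import Data.Nat
    ... | yes l = l
    ... | no nl = let y , ny , l , l' = le-label n m v s on in
      ⊥-elim (ny (disj-self Le-refl (disj-mono l (Le-trans l' (labels-le nₑ n (chain-mono e ck ce (≰⇒> nl)))) d)))

    -- The labels before b_e, with e the index of W, are set aside. Any coded slot seen elsewhere
    -- has a controlled colour and would exhibit it, so without colours nothing is seen.
    nn→ : ∀ W → NN W → ¬ ¬ (Σ ℕ λ v → Col W v)
    nn→ W nn none = (chain-exists (idx W) >>= λ { (nₑ , ce) → dn (nn (Princ (⋁ (labels nₑ))) (comp← {Princ (⋁ (labels nₑ))} (is-princ _))
        (⊑← {Princ (⋁ (labels nₑ))} {J} (is-princ _) (dn (labels-J nₑ)))
        λ r cr _ z → S.Sm-stable {meetE W r} (comp→ {r} cr >>= λ { (ρ , ir) → zero→ {meetE r (Princ (⋁ (labels nₑ)))} (is-meet {r} {Princ (⋁ (labels nₑ))} ir (is-princ _)) z >>= λ d →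
          dn (S.sm←none {meetE W r} λ { (n ∷ m ∷ v ∷ []) q (s , nz , (k , ck , vk , mt) , on) →
            proj₁ (accIff W n m v (late ce {n = n} {m} {v} ck s (on-snd W r ir on) d) (s≤s⁻¹ vk) s nz mt) (on-fst W r on , λ cv → none (v , cv)) }) })) }) (λ b → b)

    slotAt : ∀ v k → ¬ ¬ (Σ ℕ λ n → Σ ℕ λ m → Σ Sentence λ q → Slot (n ∷ m ∷ v ∷ []) q × ¬ Z q × Mt k n m v)
    slotAt v k = chain-exists k >>= λ { (n , ch) → pick ch v 0 >>= λ { (m , _ , q , s , nz , mt) → dn (n , m , q , s , nz , mt) } }

    -- One slot at a label late enough for all three indices decides the question, since its point
    -- lies in the intersection exactly when it lies in both ideals.
    col-meet : ∀ A B v → (Col A v × Col B v) ⇔ Col (meetE A B) v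
    col-meet A B v = (λ { (ca , cb) → Col-stable (meetE A B) v (slotAt v k >>= λ { (n , m , q , s , nz , mt) →
        ≋→ (≋sym (accIff A n m v ak vk s nz mt)) ca >>= λ oa → ≋→ (≋sym (accIff B n m v bk vk s nz mt)) cb >>= λ ob → ≋→ (accIff (meetE A B) n m v abk vk s nz mt) (on-meet A B oa ob) }) }) ,
      (λ cab → Col-stable A v (slotAt v k >>= λ { (n , m , q , s , nz , mt) → ≋→ (≋sym (accIff (meetE A B) n m v abk vk s nz mt)) cab >>= λ o → ≋→ (accIff A n m v ak vk s nz mt) (on-fst A B o) }) ,
               Col-stable B v (slotAt v k >>= λ { (n , m , q , s , nz , mt) → ≋→ (≋sym (accIff (meetE A B) n m v abk vk s nz mt)) cab >>= λ { (i , y , c , ny , _ , b) → ≋→ (accIff B n m v bk vk s nz mt) (i , y , c , ny , b) } }))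
      where
      k = (idx A ⊔ idx B) ⊔ (idx (meetE A B) ⊔ v)
      ak = ≤-trans (m≤m⊔n (idx A) (idx B)) (m≤m⊔n _ (idx (meetE A B) ⊔ v))
      bk = ≤-trans (m≤n⊔m (idx A) (idx B)) (m≤m⊔n _ (idx (meetE A B) ⊔ v))
      abk = ≤-trans (m≤m⊔n (idx (meetE A B)) v) (m≤n⊔m (idx A ⊔ idx B) _)
      vk = ≤-trans (m≤n⊔m (idx (meetE A B)) v) (m≤n⊔m (idx A ⊔ idx B) _)

    Names : Ext T → ℕ → Set
    Names W v = Col W v × (∀ u → Col W u → u ≡ v)

    -- The generators of `V v` contain all slots of colour v and are disjoint from every slot of
    -- another colour.
    V-names : ∀ v → Names (V v) v
    V-names v = Col-stable (V v) v (slotAt v (idx (V v) ⊔ v) >>= λ { (n , m , q , s , nz , mt) →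
          ≋→ (accIff (V v) n m v (m≤m⊔n _ _) (m≤n⊔m (idx (V v)) v) s nz mt) (0 , q , cell₀ , nz , gen-In (GV v) (gvD v) (n , m , s)) }) ,
        λ u cu → decidable-stable (u ≟ v) λ ne → (slotAt u (idx (V v) ⊔ u) >>= λ { (n , m , q , s , nz , mt) →
          ≋→ (≋sym (accIff (V v) n m u (m≤m⊔n _ _) (m≤n⊔m (idx (V v)) u) s nz mt)) cu >>= λ { (i , y , c , ny , iv) → dn (other ne n m s i y c ny (gen-fin (GV v) (gvD v) iv)) } }) (λ b → b)
      where
      other : ∀ {u} → ¬ u ≡ v → ∀ n m {q} → Slot (n ∷ m ∷ u ∷ []) q → ∀ i y → Cell q i y → ¬ Z y → (Σ (List Sentence) λ L → All (GV v) L × Le y (⋁ L)) → ⊥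
      other {u} ne n m {q} s i y c ny (L , g , l) = ny (disj-self l (disj-mono (cell-le c) Le-refl (disj-⋁ (All.map dj g))))
        where
        dj : ∀ {x} → GV v x → Disj q x
        dj (n' , m' , s') with slot-disj (n ∷ m ∷ u ∷ []) (n' ∷ m' ∷ v ∷ []) s s'
        ... | inj₁ (refl , _) = ⊥-elim (ne refl)
        ... | inj₂ d = d

    -- For two colours u and v of W, uniqueness applied to `V u` and `V v` yields a colour of their
    -- intersection, which would equal both.
    dom→ : ∀ W → Dom W → ¬ ¬ (Σ ℕ (Names W))
    dom→ W d k = d λ nn un → nn→ W nn λ { (v , cv) → k (v , cv , λ u cu → decidable-stable (u ≟ v) λ ne →
      nn→ _ (un (V u) (V v) (nn← (meetE W (V u)) u (proj₁ (col-meet W (V u) u) (cu , proj₁ (V-names u)))) (nn← (meetE W (V v)) v (proj₁ (col-meet W (V v) v) (cv , proj₁ (V-names v)))))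
        λ { (x , cx) → let a , b = proj₂ (col-meet (meetE W (V u)) (V v) x) cx in
          ne (trans (sym (proj₂ (V-names u) x (proj₂ (proj₂ (col-meet W (V u) x) a)))) (proj₂ (V-names v) x b)) }) }

    NN-stable : ∀ W → ¬ ¬ NN W → NN W
    NN-stable W h c a b f = h λ n → n c a b f

    dom← : ∀ {W v} → Names W v → Dom W
    dom← {W} {v} (cv , un) k = k (nn← W v cv) λ W₁ W₂ n₁ n₂ → NN-stable (meetE (meetE W W₁) W₂)
      (nn→ _ n₁ >>= λ { (x , cx) → nn→ _ n₂ >>= λ { (x' , cx') → dn (nn← (meetE (meetE W W₁) W₂) v
        (proj₁ (col-meet (meetE W W₁) W₂ v) (proj₁ (col-meet W W₁ v) (cv , at-v W₁ x cx) , at-v W₂ x' cx'))) } })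
      where
      at-v : ∀ W' x → Col (meetE W W') x → Col W' v
      at-v W' x c = let a , b = proj₂ (col-meet W W' x) c in subst (Col W') (un x a) b

    eq→ : ∀ {W W' v v'} → Names W v → Names W' v' → Eq W W' → v ≡ v'
    eq→ {W} {W'} {v} {v'} (_ , u) (_ , u') e = decidable-stable (v ≟ v') λ ne → nn→ _ e λ { (x , cx) →
      let a , b = proj₂ (col-meet W W' x) cx in ne (trans (sym (u x a)) (u' x b)) }

    eq← : ∀ {W W' v} → Names W v → Names W' v → Eq W W'
    eq← {W} {W'} {v} (c , _) (c' , _) = nn← (meetE W W') v (proj₁ (col-meet W W' v) (c , c'))

open DecodedNumbers

-- Decoding addition and multiplication

module DecodedOperations where

  module Relation (T : Sentence → Set) (TD : Def false (pred₁ (SetCode T))) (q₀ : ∀ φ → Q φ → T φ) (con : Consistent T) where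
    open Standard T TD q₀ con public

    same-label : ∀ n n' m v {q ρ} → Slot (n' ∷ m ∷ v ∷ []) q → OnP q (λ y → Le y ρ) → Le ρ (label n) → n' ≡ n
    same-label n n' m v {q} s on l with le-label n' m v s on | pc-disj _ n' n
    ... | y , ny , a , b | inj₁ e = e
    ... | y , ny , a , b | inj₂ d = ⊥-elim (ny (disj-self Le-refl (disj-mono b (Le-trans a l) d)))

    edge-le : ∀ c {k v} → Edge c (k ∷ v ∷ []) → v ≤ k
    edge-le fzero (w , x , y , z , i , refl , _ , refl) = pair≥₁ w _
    edge-le (fsuc fzero) (w , x , y , z , i , refl , _ , refl) = ≤-trans (pair≥₁ x _) (pair≥₂ w _)
    edge-le (fsuc (fsuc fzero)) (w , x , y , z , i , refl , _ , refl) = ≤-trans (≤-trans (pair≥₁ y _) (pair≥₂ x _)) (pair≥₂ w _)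
    edge-le (fsuc (fsuc (fsuc fzero))) (w , x , y , z , i , refl , _ , refl) = ≤-trans (≤-trans (≤-trans (pair≥₁ z i) (pair≥₂ y _)) (pair≥₂ x _)) (pair≥₂ w _)

    -- A sentence below a label that sees infinitely many coloured slots contains all but finitely many of them.
    tail : ∀ {k n} → Chain k n → ∀ {r ρ} → Is r ρ → Le ρ (label n) → ¬ Sm* r →
      ¬ ¬ (Σ ℕ λ m₁ → ∀ m y → m₁ ≤ m → Cell (label n) m y → ¬ Z y → Le y ρ)
    tail {k} {n} ck {r} {ρ} ir l nsm = cell-exists (label-nz n) m₁ >>= λ { (y₁ , c₁ , ny₁) → go y₁ c₁ ny₁ (cell-decides ρ (proj₂ (dsel-surj ρ)) ≤-refl c₁) }
      where
      m₁ = suc (proj₁ (dsel-surj ρ))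
      go : ∀ y₁ → Cell (label n) m₁ y₁ → ¬ Z y₁ → Le y₁ ρ ⊎ Le y₁ (¬' ρ) → ¬ ¬ (Σ ℕ λ m₁ → ∀ m y → m₁ ≤ m → Cell (label n) m y → ¬ Z y → Le y ρ)
      go y₁ c₁ ny₁ (inj₁ a) = dn (m₁ , λ m y le c ny → Le-trans (cell-nested le c₁ c ny₁ ny) a)
      -- If ρ misses the tail, r sees only slots of this one label, of a stage below m₁ and a colour
      -- up to k. These are finitely many, against the assumption on r.
      go y₁ c₁ ny₁ (inj₂ a) = ⊥-elim (nsm (S.sm←fin {r} (suc n + (m₁ + suc k)) λ n' m v q seen → bounds n' m v q seen))
        where
        bounds : ∀ n' m v q → S.Seen r (n' ∷ m ∷ v ∷ []) q → n' < suc n + (m₁ + suc k) × m < suc n + (m₁ + suc k) × v < suc n + (m₁ + suc k)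
        bounds n' m v q (s , nz , (k' , ck' , vk , _) , i , y , c , ny , iy) with same-label n n' m v s (i , y , c , ny , proj₁ (ir y) iy) l
        ... | refl with chain-inj ck ck'
        ...   | refl = m≤m+n (suc n) _ , ≤-trans m<m₁ (≤-trans (m≤m+n m₁ (suc k)) (m≤n+m _ (suc n))) , ≤-trans vk (≤-trans (m≤n+m (suc k) m₁) (m≤n+m _ (suc n)))
          where
          m<m₁ : m < m₁
          m<m₁ with m <? m₁
          ... | yes z = z
          ... | no nl = let ny' , qy = S.slot-cell {n} {m} {v} nz s in ⊥-elim (ny (disj-self (proj₁ (ir y) iy)
                  (disj-mono (Le-trans (cell-le c) (Le-trans qy (Le-trans (cell-nested (≮⇒≥ nl) c₁ (proj₁ (proj₂ s)) ny₁ ny') a))) Le-refl (disj-sym (disj-¬ ρ)))))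

    -- A part of the label that is not small contains a tail of cells. Arbitrarily late slots of
    -- colour x lie in this tail and have their points in w, so no bound from smallness can hold.
    hit : ∀ {k n} → Chain k n → ∀ c w x → Edge c (k ∷ x ∷ []) → idx w ≤ k → Col w x → Hit c w (Princ (label n))
    hit {k} {n} ck c w x ed wk cx r' cr' l nsm sm = (comp→ {r'} cr' >>= λ { (ρ , ir) → ⊑→ {r'} {Princ (label n)} ir l >>= λ l' → tail ck {r'} ir (princ-Le l') nsm >>= λ { (m₁ , t) →
      C.sm→ c {meetE w r'} (proj₁ (smc c (meetE w r')) sm) >>= λ { (B , h) → pick ck x (m₁ + B) >>= λ { (m , le , q , s , nz , mt) →
      ≋→ (≋sym (accIff w n m x wk (edge-le c ed) s nz mt)) cx >>= λ { (i , y , cy , ny , iw) →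
      let ny' , qy = S.slot-cell {n} {m} {x} nz s in
      dn (<-irrefl refl (≤-trans (h n m x q (s , nz , (k , ck , ed , mt) , i , y , cy , ny , iw ,
        proj₂ (ir y) (Le-trans (cell-le cy) (Le-trans qy (t m (proj₁ s) (≤-trans (m≤m+n m₁ B) le) (proj₁ (proj₂ s)) ny'))))) (≤-trans (m≤n+m B m₁) le))) } } } } }) (λ b → b)

    h← : ∀ (w : Fin 4 → Ext T) (x : Fin 4 → ℕ) → (∀ c → Names (w c) (x c)) → Rel (x (# 0)) (x (# 1)) (x (# 2)) (x (# 3)) → H (w (# 0)) (w (# 1)) (w (# 2)) (w (# 3))
    h← w x nm rel c cc cJ f = (comp→ {c} cc >>= λ { (ζ , iz) → ⊑→ {c} {J} iz cJ >>= λ jz → go ζ iz (J-bound jz) }) (λ b → b)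
      where
      go : ∀ ζ → Is c ζ → (Σ ℕ λ N → ∀ n → N ≤ n → Disj (label n) ζ) → ¬ ¬ ⊥
      go ζ iz (N , fr) = chain-exists k >>= λ { (n , ck) → dn (f (Princ (label n)) (comp← {Princ (label n)} (is-princ _)) (J-princ {label n} {n} Le-refl)
          (zero← {meetE (Princ (label n)) c} (is-meet {Princ (label n)} {c} (is-princ _) iz) (dn (fr n (≤-trans (m≤n+m N Σi) (≤-trans i≤k (chain-≤ k ck))))))
          (λ sm → (S.sm→ {Princ (label n)} sm >>= λ { (B , h) → pick ck 0 B >>= λ { (m , l , q , s , nz , mt) →
             dn (<-irrefl refl (≤-trans (h n m 0 q (s , nz , (k , ck , s≤s z≤n , mt) , 0 , q , cell₀ , nz , princ-In (slot-le n {m} {0} s))) l)) } }) (λ b → b))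
          (ht ck (# 0)) (ht ck (# 1)) (ht ck (# 2)) (ht ck (# 3))) }
        where
        Σi = idx (w (# 0)) + (idx (w (# 1)) + (idx (w (# 2)) + idx (w (# 3))))
        i = Σi + N
        -- The padding i pushes k beyond the indices of all four ideals and beyond the labels met by
        -- c.
        k = ⌊ x (# 0) , ⌊ x (# 1) , ⌊ x (# 2) , ⌊ x (# 3) , i ⌋ ⌋ ⌋ ⌋
        i≤k : i ≤ k
        i≤k = ≤-trans (≤-trans (≤-trans (pair≥₂ (x (# 3)) i) (pair≥₂ (x (# 2)) _)) (pair≥₂ (x (# 1)) _)) (pair≥₂ (x (# 0)) _)
        part : ∀ c → idx (w c) ≤ Σi
        part fzero = m≤m+n _ _
        part (fsuc fzero) = ≤-trans (m≤m+n _ _) (m≤n+m _ (idx (w (# 0))))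
        part (fsuc (fsuc fzero)) = ≤-trans (≤-trans (m≤m+n _ _) (m≤n+m _ (idx (w (# 1))))) (m≤n+m _ (idx (w (# 0))))
        part (fsuc (fsuc (fsuc fzero))) = ≤-trans (≤-trans (m≤n+m _ (idx (w (# 2)))) (m≤n+m _ (idx (w (# 1))))) (m≤n+m _ (idx (w (# 0))))
        ed : ∀ c → Edge c (k ∷ x c ∷ [])
        ed c = x (# 0) , x (# 1) , x (# 2) , x (# 3) , i , refl , rel , look c
          where
          look : ∀ c → x c ≡ lookup (x (# 0) ∷ x (# 1) ∷ x (# 2) ∷ x (# 3) ∷ []) c
          look fzero = refl
          look (fsuc fzero) = refl
          look (fsuc (fsuc fzero)) = refl
          look (fsuc (fsuc (fsuc fzero))) = refl
        ht : ∀ {n} → Chain k n → ∀ c → Hit c (w c) (Princ (label n))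
        ht ck c = hit ck c (w c) (x c) (ed c) (≤-trans (part c) (≤-trans (m≤m+n Σi N) i≤k)) (proj₁ (nm c))

    edges→rel : ∀ {k} (x : Fin 4 → ℕ) → (∀ c → Edge c (k ∷ x c ∷ [])) → Rel (x (# 0)) (x (# 1)) (x (# 2)) (x (# 3))
    edges→rel {k} x ed with ed (# 0)
    ... | a , b , c , d , i , e , rel , p₀ = subst₄ (sym p₀) (part (# 1)) (part (# 2)) (part (# 3)) rel
      where
      subst₄ : ∀ {a b c d a' b' c' d'} → a ≡ a' → b ≡ b' → c ≡ c' → d ≡ d' → Rel a b c d → Rel a' b' c' d'
      subst₄ refl refl refl refl r = r
      part : ∀ j → lookup (a ∷ b ∷ c ∷ d ∷ []) j ≡ x j
      part j with ed j
      ... | a' , b' , c' , d' , i' , e' , _ , p with pinj a ⌊ b , ⌊ c , ⌊ d , i ⌋ ⌋ ⌋ {a'} {⌊ b' , ⌊ c' , ⌊ d' , i' ⌋ ⌋ ⌋} (trans (sym e) e')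
      ...   | refl , e₁ with pinj b ⌊ c , ⌊ d , i ⌋ ⌋ {b'} {⌊ c' , ⌊ d' , i' ⌋ ⌋} e₁
      ...     | refl , e₂ with pinj c ⌊ d , i ⌋ {c'} {⌊ d' , i' ⌋} e₂
      ...       | refl , e₃ with pinj d i {d'} {i'} e₃
      ...         | refl , _ = sym p

    -- Failure of smallness means that some coded slot is seen. It sits at b_k, its colour is a
    -- colour of w by cohesion, and x is the only such colour.
    seen-edge : ∀ {e nₑ} → Chain e nₑ → ∀ c w x → Names w x → idx w ≤ e → ∀ {r ρ n k} → Is r ρ → Disj ρ (⋁ (labels nₑ)) → Le ρ (label n) → Chain k n →
      ¬ Smc c (meetE w r) → ¬ ¬ Edge c (k ∷ x ∷ [])
    seen-edge ce c w x (_ , un) we {r} {ρ} {n} {k} ir d l ck nsm ned = nsm (proj₂ (smc c (meetE w r)) (C.sm←none c {meetE w r} λ { (n' ∷ m ∷ v ∷ []) q (s , nz , (k' , ck' , ed , mt) , on) → seen n' m v q s nz k' ck' ed mt on (same-label n n' m v s (on-snd w r ir on) l) }))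
      where
      seen : ∀ n' m v q → Slot (n' ∷ m ∷ v ∷ []) q → ¬ Z q → ∀ k' → Chain k' n' → Edge c (k' ∷ v ∷ []) → Mt k' n' m v → OnP q (In (meetE w r)) → n' ≡ n → ⊥
      seen n' m v q s nz k' ck' ed mt on refl with chain-inj ck ck'
      ... | refl = proj₁ (accIff w n m v (≤-trans we (late ce {n = n} {m} {v} ck s (on-snd w r ir on) d)) (edge-le c ed) s nz mt)
                     (on-fst w r on , λ cv → ned (subst (λ z → Edge c (k ∷ z ∷ [])) (un v cv) ed))

    -- An element below finitely many labels is small when its restriction to each of them is: the
    -- stages have a common bound, and colours are bounded by k, which is at most the label.
    localise : ∀ {r ρ} → Is r ρ → (Σ ℕ λ N → ∀ n → N ≤ n → Disj (label n) ρ) → ¬ Sm* r → ¬ ¬ (Σ ℕ λ n → ¬ Sm* (meetE r (Princ (label n))))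
    localise {r} {ρ} ir (N , fr) nsm none = (dn-fin {P = Bound} N (λ n _ → (λ z → none (n , λ sm → S.sm→ {meetE r (Princ (label n))} sm z)) >>= λ { (B , h) →
        dn (B , λ B' le m v q sn → ≤-trans (h n m v q sn) le) }) >>= λ g →
      dn (fin (sup< {λ n B → ∀ m v q → S.Seen (meetE r (Princ (label n))) (n ∷ m ∷ v ∷ []) q → m < B} N g))) (λ b → b)
      where
      Bound : ℕ → Set
      Bound n = Σ ℕ λ B → ∀ B' → B ≤ B' → ∀ m v q → S.Seen (meetE r (Princ (label n))) (n ∷ m ∷ v ∷ []) q → m < B'
      fin : (Σ ℕ λ B → ∀ n → n < N → ∀ B' → B ≤ B' → ∀ m v q → S.Seen (meetE r (Princ (label n))) (n ∷ m ∷ v ∷ []) q → m < B') → ⊥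
      fin (B , h) = nsm (S.sm←fin {r} (N + B) λ n m v q sn → bounds n m v q sn)
        where
        bounds : ∀ n m v q → S.Seen r (n ∷ m ∷ v ∷ []) q → n < N + B × m < N + B × v < N + B
        bounds n m v q (s , nz , xx@(k , ck , vk , mt) , on@(i , y , c , ny , iy)) with n <? N
        ... | yes n<N = ≤-trans n<N (m≤m+n N B) ,
                h n n<N (N + B) (m≤n+m B N) m v q (s , nz , xx , on-below r (slot-le n {m} {v} s) on) ,
                ≤-trans (≤-trans vk (s≤s (chain-≤ k ck))) (≤-trans n<N (m≤m+n N B))
        ... | no nl = ⊥-elim (ny (disj-self Le-refl (disj-mono (Le-trans (cell-le c) (slot-le n {m} {v} s)) (proj₁ (ir y) iy) (fr n (≮⇒≥ nl)))))

    -- With the labels before b_e set aside, a witness r restricts to one label without becoming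
    -- small. This label must be some b_k, since no other carries coded slots. The four hits then
    -- place all four colours at the same k, which decodes to a valid instance.
    h→ : ∀ (w : Fin 4 → Ext T) (x : Fin 4 → ℕ) → (∀ c → Names (w c) (x c)) → H (w (# 0)) (w (# 1)) (w (# 2)) (w (# 3)) → ¬ ¬ Rel (x (# 0)) (x (# 1)) (x (# 2)) (x (# 3))
    h→ w x nm hh nrel = (chain-exists e >>= λ { (nₑ , ce) → dn (hh (Princ (⋁ (labels nₑ))) (comp← {Princ (⋁ (labels nₑ))} (is-princ _))
        (⊑← {Princ (⋁ (labels nₑ))} {J} (is-princ _) (dn (labels-J nₑ)))
        λ r cr rJ z nsm a₀ a₁ a₂ a₃ → (comp→ {r} cr >>= λ { (ρ , ir) → ⊑→ {r} {J} ir rJ >>= λ jr →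
          zero→ {meetE r (Princ (⋁ (labels nₑ)))} (is-meet {r} {Princ (⋁ (labels nₑ))} ir (is-princ _)) z >>= λ d →
          localise {r} ir (J-bound jr) nsm >>= λ { (n , nsm') → em (Σ ℕ λ k → Chain k n) >>= λ
            { (inj₂ noch) → ⊥-elim (nsm' (S.sm←none {meetE r (Princ (label n))} λ { (n' ∷ m ∷ v ∷ []) q (s , nz , (k , ck , _) , on) →
                noch (k , subst (Chain k) (same-label n n' m v s (on-snd r (Princ (label n)) (is-princ _) on) Le-refl) ck) }))
            ; (inj₁ (k , ck)) → edges r ρ ir n d ce k ck (λ { fzero → use r ρ ir n (# 0) a₀ nsm' ; (fsuc fzero) → use r ρ ir n (# 1) a₁ nsm' ; (fsuc (fsuc fzero)) → use r ρ ir n (# 2) a₂ nsm' ; (fsuc (fsuc (fsuc fzero))) → use r ρ ir n (# 3) a₃ nsm' }) } } }) (λ b → b)) }) (λ b → b)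
      where
      e = idx (w (# 0)) + (idx (w (# 1)) + (idx (w (# 2)) + idx (w (# 3))))
      part : ∀ c → idx (w c) ≤ e
      part fzero = m≤m+n _ _
      part (fsuc fzero) = ≤-trans (m≤m+n _ _) (m≤n+m _ (idx (w (# 0))))
      part (fsuc (fsuc fzero)) = ≤-trans (≤-trans (m≤m+n _ _) (m≤n+m _ (idx (w (# 1))))) (m≤n+m _ (idx (w (# 0))))
      part (fsuc (fsuc (fsuc fzero))) = ≤-trans (≤-trans (m≤n+m _ (idx (w (# 2)))) (m≤n+m _ (idx (w (# 1))))) (m≤n+m _ (idx (w (# 0))))
      use : ∀ r ρ → Is r ρ → ∀ n c → Hit c (w c) r → ¬ Sm* (meetE r (Princ (label n))) → ¬ Smc c (meetE (w c) (meetE r (Princ (label n))))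
      use r ρ ir n c a nsm' = a (meetE r (Princ (label n))) (comp← {meetE r (Princ (label n))} (is-meet {r} {Princ (label n)} ir (is-princ _))) (dn λ φ → proj₁) nsm'
      edges : ∀ r ρ → Is r ρ → ∀ n {nₑ} → Disj ρ (⋁ (labels nₑ)) → Chain e nₑ → ∀ k → Chain k n →
        (∀ c → ¬ Smc c (meetE (w c) (meetE r (Princ (label n))))) → ¬ ¬ ⊥
      edges r ρ ir n d ce k ck ns = e₀ (# 0) >>= λ p₀ → e₀ (# 1) >>= λ p₁ → e₀ (# 2) >>= λ p₂ → e₀ (# 3) >>= λ p₃ →
        dn (nrel (edges→rel x λ { fzero → p₀ ; (fsuc fzero) → p₁ ; (fsuc (fsuc fzero)) → p₂ ; (fsuc (fsuc (fsuc fzero))) → p₃ }))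
        where
        e₀ : ∀ c → ¬ ¬ Edge c (k ∷ x c ∷ [])
        e₀ c = seen-edge ce c (w c) (x c) (nm c) (part c) {meetE r (Princ (label n))} (is-meet {r} {Princ (label n)} ir (is-princ _)) (disj-mono ⊓₁ Le-refl d) ⊓₂ ck (ns c)

open DecodedOperations

-- The standard parameters interpret the natural numbers

module StandardNumbers where

  TrN : ∀ {n} → Formula n → Vec ℕ n → Set
  TrN `⊥ xs = ⊥
  TrN (s ≐ t) xs = ev s xs ≡ ev t xs
  TrN (φ ⇒ ψ) xs = TrN φ xs → TrN ψ xs
  TrN (∀' φ) xs = ∀ x → TrN φ (x ∷ xs)

  Q-true : ∀ φ → Q φ → TrN φ []
  Q-true _ Q1 x ()
  Q-true _ Q2 x y e = suc-injective e
  Q-true _ Q3 zero n = ⊥-elim (n refl)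
  Q-true _ Q3 (suc x) n h = h x refl
  Q-true _ Q4 x = +-identityʳ x
  Q-true _ Q5 x y = +-suc x y
  Q-true _ Q6 x = *-zeroʳ x
  Q-true _ Q7 x y = trans (*-suc x y) (+-comm x (x * y))

  module Numbers (T : Sentence → Set) (TD : Def false (pred₁ (SetCode T))) (q₀ : ∀ φ → Q φ → T φ) (con : Consistent T) where
    open Relation T TD q₀ con public
    open M par public

    op : Bool → ℕ → ℕ → ℕ
    op false = _+_
    op true = _*_

    H-stable : ∀ a b c d → ¬ ¬ H a b c d → H a b c d
    H-stable a b c d h x y z f = h λ g → g x y z f

    R-stable : ∀ t a b c → ¬ ¬ R t a b c → R t a b c
    R-stable false = H-stable (V 0)
    R-stable true = H-stable (V 1)

    h-names : ∀ {t x y z} n {a b c} → Names t n → Names x a → Names y b → Names z c → (H t x y z → ¬ ¬ Rel n a b c) × (Rel n a b c → H t x y z)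
    h-names {t} {x} {y} {z} n {a} {b} {c} nt nx ny nz = h→ w u nm , h← w u nm
      where
      w : Fin 4 → Ext T
      w = lookup (t ∷ x ∷ y ∷ z ∷ [])
      u : Fin 4 → ℕ
      u = lookup (n ∷ a ∷ b ∷ c ∷ [])
      nm : ∀ i → Names (w i) (u i)
      nm fzero = nt
      nm (fsuc fzero) = nx
      nm (fsuc (fsuc fzero)) = ny
      nm (fsuc (fsuc (fsuc fzero))) = nz

    r-names : ∀ t {x y z a b c} → Names x a → Names y b → Names z c → R t x y z ⇔ (op t a b ≡ c)
    r-names false {a = a} {b} {c} nx ny nz =
      (λ r → decidable-stable (a + b ≟ c) (proj₁ (h-names 0 (V-names 0) nx ny nz) r >>= λ { (inj₁ (_ , e)) → dn e ; (inj₂ (() , _)) })) ,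
      (λ e → proj₂ (h-names 0 (V-names 0) nx ny nz) (inj₁ (refl , e)))
    r-names true {a = a} {b} {c} nx ny nz =
      (λ r → decidable-stable (a * b ≟ c) (proj₁ (h-names 1 (V-names 1) nx ny nz) r >>= λ { (inj₁ (() , _)) ; (inj₂ (_ , e)) → dn e })) ,
      (λ e → proj₂ (h-names 1 (V-names 1) nx ny nz) (inj₂ (refl , e)))

    dom-V : ∀ v → Dom (V v)
    dom-V v = dom← {V v} (V-names v)

    eq-stable : ∀ a b → ¬ ¬ Eq a b → Eq a b
    eq-stable a b = NN-stable (meetE a b)

    named-eq : ∀ {a b u v} → Names a u → Names b v → u ≡ v → Eq a b
    named-eq na nb refl = eq← na nb

    std-ok : Ok
    std-ok = record
      { e-refl = λ a da → eq-stable a a (dom→ a da >>= λ { (u , na) → dn (eq← na na) })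
      ; e-sym = λ a da b db e → eq-stable b a (dom→ a da >>= λ { (u , na) → dom→ b db >>= λ { (v , nb) → dn (named-eq nb na (sym (eq→ na nb e))) } })
      ; e-trans = λ a da b db c dc e e' → eq-stable a c (dom→ a da >>= λ { (u , na) → dom→ b db >>= λ { (v , nb) → dom→ c dc >>= λ { (w , nc) →
          dn (named-eq na nc (trans (eq→ na nb e) (eq→ nb nc e'))) } } })
      ; d-zr = dom-V 0
      ; d-on = dom-V 1
      ; r-total = λ t a da b db n → (dom→ a da >>= λ { (u , na) → dom→ b db >>= λ { (v , nb) → dn (n (V (op t u v)) (dom-V (op t u v)) (proj₂ (r-names t na nb (V-names (op t u v))) refl)) } }) (λ x → x)
      ; r-fun = λ t a da b db c dc a' da' b' db' c' dc' ea eb r r' → eq-stable c c' (dom→ a da >>= λ { (u , na) → dom→ b db >>= λ { (v , nb) → dom→ c dc >>= λ { (w , nc) →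
          dom→ a' da' >>= λ { (u' , na') → dom→ b' db' >>= λ { (v' , nb') → dom→ c' dc' >>= λ { (w' , nc') →
          dn (named-eq nc nc' (trans (sym (proj₁ (r-names t na nb nc) r)) (trans (cong₂ (op t) (eq→ na na' ea) (eq→ nb nb' eb)) (proj₁ (r-names t na' nb' nc') r')))) } } } } } })
      ; r-cong = λ t a da b db c dc c' dc' e r → R-stable t a b c' (dom→ a da >>= λ { (u , na) → dom→ b db >>= λ { (v , nb) → dom→ c dc >>= λ { (w , nc) → dom→ c' dc' >>= λ { (w' , nc') →
          dn (proj₂ (r-names t na nb nc') (trans (proj₁ (r-names t na nb nc) r) (eq→ nc nc' e))) } } } }) }

    open Soundness eq-stable std-ok public

    Named : ∀ {n} → Env T n → Vec ℕ n → Set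
    Named ρ xs = ∀ i → Names (ρ i) (lookup xs i)

    val-nat : ∀ {n} (t : Term n) {ρ xs} → Named ρ xs → ∀ {a k} → Names a k → Val t ρ a ⇔ (ev t xs ≡ k)
    val-nat (var i) h na = (λ e → eq→ (h i) na e) , (λ e → named-eq (h i) na e)
    val-nat `0 h na = (λ e → eq→ (V-names 0) na e) , (λ e → named-eq (V-names 0) na e)
    val-nat (`S t) {ρ} {xs} h {a} {k} na =
      (λ v → decidable-stable (suc (ev t xs) ≟ k) λ ne → v λ b db w r → dom→ b db λ { (j , nb) →
        ne (trans (trans (+-comm 1 (ev t xs)) (cong (_+ 1) (proj₁ (val-nat t h nb) w))) (proj₁ (r-names false nb (V-names 1) na) r)) }) ,
      (λ e n → n (V (ev t xs)) (dom-V (ev t xs)) (proj₂ (val-nat t h (V-names (ev t xs))) refl) (proj₂ (r-names false (V-names (ev t xs)) (V-names 1) na) (trans (+-comm (ev t xs) 1) e)))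
    val-nat (s `+ t) {ρ} {xs} h {a} {k} na =
      (λ v → decidable-stable (ev s xs + ev t xs ≟ k) λ ne → v λ b db w c dc u r → dom→ b db λ { (j , nb) → dom→ c dc λ { (l , nc) →
        ne (trans (cong₂ _+_ (proj₁ (val-nat s h nb) w) (proj₁ (val-nat t h nc) u)) (proj₁ (r-names false nb nc na) r)) } }) ,
      (λ e n → n (V (ev s xs)) (dom-V (ev s xs)) (proj₂ (val-nat s h (V-names (ev s xs))) refl) (V (ev t xs)) (dom-V (ev t xs)) (proj₂ (val-nat t h (V-names (ev t xs))) refl)
        (proj₂ (r-names false (V-names (ev s xs)) (V-names (ev t xs)) na) e))
    val-nat (s `· t) {ρ} {xs} h {a} {k} na =
      (λ v → decidable-stable (ev s xs * ev t xs ≟ k) λ ne → v λ b db w c dc u r → dom→ b db λ { (j , nb) → dom→ c dc λ { (l , nc) →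
        ne (trans (cong₂ _*_ (proj₁ (val-nat s h nb) w) (proj₁ (val-nat t h nc) u)) (proj₁ (r-names true nb nc na) r)) } }) ,
      (λ e n → n (V (ev s xs)) (dom-V (ev s xs)) (proj₂ (val-nat s h (V-names (ev s xs))) refl) (V (ev t xs)) (dom-V (ev t xs)) (proj₂ (val-nat t h (V-names (ev t xs))) refl)
        (proj₂ (r-names true (V-names (ev s xs)) (V-names (ev t xs)) na) e))

    -- Every element of the domain names a number, but only under a double negation; stability of
    -- truth absorbs this at quantifiers and equations.
    tr-nat : ∀ {n} (φ : Formula n) {ρ xs} → Named ρ xs → Tr φ ρ ⇔ TrN φ xs
    tr-nat `⊥ h = lower , lift
    tr-nat (s ≐ t) {ρ} {xs} h =
      (λ f → sym (proj₁ (val-nat t h (V-names (ev s xs))) (f (V (ev s xs)) (dom-V (ev s xs)) (proj₂ (val-nat s h (V-names (ev s xs))) refl)))) ,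
      (λ e a da v → val-stable t ρ a (dom→ a da >>= λ { (k , na) → dn (proj₂ (val-nat t h na) (trans (sym e) (proj₁ (val-nat s h na) v))) }))
    tr-nat (φ ⇒ ψ) h = (λ f p → proj₁ (tr-nat ψ h) (f (proj₂ (tr-nat φ h) p))) , (λ f p → proj₂ (tr-nat ψ h) (f (proj₁ (tr-nat φ h) p)))
    tr-nat (∀' φ) {ρ} {xs} h =
      (λ f x → proj₁ (tr-nat φ (ext (V-names x))) (f (V x) (dom-V x))) ,
      (λ f a da → tr-stable φ _ (dom→ a da >>= λ { (k , na) → dn (proj₂ (tr-nat φ (ext na)) (f k)) }))
      where
      ext : ∀ {a k} → Names a k → Named (extendEnv T a ρ) (k ∷ xs)
      ext na fzero = na
      ext na (fsuc i) = h i

    Q-holds : ∀ φ → Q φ → ∀ ρ → Tr φ ρ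
    Q-holds φ p ρ = proj₂ (tr-nat φ (λ ())) (Q-true φ p)

open StandardNumbers

-- Gödel numbers of lattice formulas under renaming

module LatticeCodes where

  tagLT restLT clT : ∀ {n} → LTerm n → ℕ
  tagLT (lvar i) = 0
  tagLT (s ∧ₗ t) = 1
  tagLT (s ∨ₗ t) = 2
  restLT (lvar i) = toℕ i
  restLT (s ∧ₗ t) = ⌊ clT s , clT t ⌋
  restLT (s ∨ₗ t) = ⌊ clT s , clT t ⌋
  clT t = ⌊ tagLT t , restLT t ⌋

  tagLF restLF clF : ∀ {n} → LFormula n → ℕ
  tagLF ⊥ₗ = 0
  tagLF (s ≈ₗ t) = 1
  tagLF (φ ⇒ₗ ψ) = 2
  tagLF (∀ₗ φ) = 3
  restLF ⊥ₗ = 0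
  restLF (s ≈ₗ t) = ⌊ clT s , clT t ⌋
  restLF (φ ⇒ₗ ψ) = ⌊ clF φ , clF ψ ⌋
  restLF (∀ₗ φ) = clF φ
  clF φ = ⌊ tagLF φ , restLF φ ⌋

  clT≡ : ∀ {n} (t : LTerm n) → clT t ≡ codeLT t
  clT≡ (lvar i) = pair≡ _ _
  clT≡ (s ∧ₗ t) = trans (pair≡ _ _) (cong ⟨ 1 ,_⟩ (trans (pair≡ _ _) (cong₂ ⟨_,_⟩ (clT≡ s) (clT≡ t))))
  clT≡ (s ∨ₗ t) = trans (pair≡ _ _) (cong ⟨ 2 ,_⟩ (trans (pair≡ _ _) (cong₂ ⟨_,_⟩ (clT≡ s) (clT≡ t))))

  clF≡ : ∀ {n} (φ : LFormula n) → clF φ ≡ codeLF φ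
  clF≡ ⊥ₗ = pair≡ _ _
  clF≡ (s ≈ₗ t) = trans (pair≡ _ _) (cong ⟨ 1 ,_⟩ (trans (pair≡ _ _) (cong₂ ⟨_,_⟩ (clT≡ s) (clT≡ t))))
  clF≡ (φ ⇒ₗ ψ) = trans (pair≡ _ _) (cong ⟨ 2 ,_⟩ (trans (pair≡ _ _) (cong₂ ⟨_,_⟩ (clF≡ φ) (clF≡ ψ))))
  clF≡ (∀ₗ φ) = trans (pair≡ _ _) (cong ⟨ 3 ,_⟩ (clF≡ φ))

  clT-inj : ∀ {n} (s t : LTerm n) → clT s ≡ clT t → s ≡ t
  clT-inj s t e = go s t (pinj (tagLT s) (restLT s) {tagLT t} {restLT t} e)
    where
    go : ∀ {n} (s t : LTerm n) → tagLT s ≡ tagLT t × restLT s ≡ restLT t → s ≡ t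
    go (lvar i) (lvar j) (_ , r) = cong lvar (toℕ-injective r)
    go (s ∧ₗ s') (t ∧ₗ t') (_ , r) with pinj (clT s) (clT s') {clT t} {clT t'} r
    ... | a , b = cong₂ _∧ₗ_ (clT-inj s t a) (clT-inj s' t' b)
    go (s ∨ₗ s') (t ∨ₗ t') (_ , r) with pinj (clT s) (clT s') {clT t} {clT t'} r
    ... | a , b = cong₂ _∨ₗ_ (clT-inj s t a) (clT-inj s' t' b)

  clF-inj : ∀ {n} (φ ψ : LFormula n) → clF φ ≡ clF ψ → φ ≡ ψ
  clF-inj φ ψ e = go φ ψ (pinj (tagLF φ) (restLF φ) {tagLF ψ} {restLF ψ} e)
    where
    go : ∀ {n} (φ ψ : LFormula n) → tagLF φ ≡ tagLF ψ × restLF φ ≡ restLF ψ → φ ≡ ψ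
    go ⊥ₗ ⊥ₗ _ = refl
    go (s ≈ₗ s') (t ≈ₗ t') (_ , r) with pinj (clT s) (clT s') {clT t} {clT t'} r
    ... | a , b = cong₂ _≈ₗ_ (clT-inj s t a) (clT-inj s' t' b)
    go (φ ⇒ₗ φ') (ψ ⇒ₗ ψ') (_ , r) with pinj (clF φ) (clF φ') {clF ψ} {clF ψ'} r
    ... | a , b = cong₂ _⇒ₗ_ (clF-inj φ ψ a) (clF-inj φ' ψ' b)
    go (∀ₗ φ) (∀ₗ ψ) (_ , r) = cong ∀ₗ (clF-inj φ ψ r)

  renL : ∀ {n m} → (Fin n → Fin m) → LFormula n → LFormula m
  renL r ⊥ₗ = ⊥ₗ
  renL r (s ≈ₗ t) = renLT r s ≈ₗ renLT r t
  renL r (φ ⇒ₗ ψ) = renL r φ ⇒ₗ renL r ψ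
  renL r (∀ₗ φ) = ∀ₗ (renL (liftR r) φ)

  -- The code of a renamed formula, as a function of the new indices.
  liftI : ∀ {n k} → (Fin n → XT k) → Fin (suc n) → XT k
  liftI ι fzero = xn 0
  liftI ι (fsuc i) = xsu (ι i)

  cxT : ∀ {n k} → (Fin n → XT k) → LTerm n → XT k
  cxT ι (lvar i) = xp (xn 0) (ι i)
  cxT ι (s ∧ₗ t) = xp (xn 1) (xp (cxT ι s) (cxT ι t))
  cxT ι (s ∨ₗ t) = xp (xn 2) (xp (cxT ι s) (cxT ι t))

  cxF : ∀ {n k} → (Fin n → XT k) → LFormula n → XT k
  cxF ι ⊥ₗ = xp (xn 0) (xn 0)
  cxF ι (s ≈ₗ t) = xp (xn 1) (xp (cxT ι s) (cxT ι t))
  cxF ι (φ ⇒ₗ ψ) = xp (xn 2) (xp (cxF ι φ) (cxF ι ψ))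
  cxF ι (∀ₗ φ) = xp (xn 3) (cxF (liftI ι) φ)

  cxT-ev : ∀ {n m k} (r : Fin n → Fin m) (ι : Fin n → XT k) e → (∀ i → toℕ (r i) ≡ xev (ι i) e) → ∀ t → clT (renLT r t) ≡ xev (cxT ι t) e
  cxT-ev r ι e h (lvar i) = cong ⌊ 0 ,_⌋ (h i)
  cxT-ev r ι e h (s ∧ₗ t) = cong ⌊ 1 ,_⌋ (cong₂ ⌊_,_⌋ (cxT-ev r ι e h s) (cxT-ev r ι e h t))
  cxT-ev r ι e h (s ∨ₗ t) = cong ⌊ 2 ,_⌋ (cong₂ ⌊_,_⌋ (cxT-ev r ι e h s) (cxT-ev r ι e h t))

  lift-ev : ∀ {n m k} (r : Fin n → Fin m) (ι : Fin n → XT k) e → (∀ i → toℕ (r i) ≡ xev (ι i) e) → ∀ i → toℕ (liftR r i) ≡ xev (liftI ι i) e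
  lift-ev r ι e h fzero = refl
  lift-ev r ι e h (fsuc i) = cong suc (h i)

  cxF-ev : ∀ {n m k} (r : Fin n → Fin m) (ι : Fin n → XT k) e → (∀ i → toℕ (r i) ≡ xev (ι i) e) → ∀ φ → clF (renL r φ) ≡ xev (cxF ι φ) e
  cxF-ev r ι e h ⊥ₗ = refl
  cxF-ev r ι e h (s ≈ₗ t) = cong ⌊ 1 ,_⌋ (cong₂ ⌊_,_⌋ (cxT-ev r ι e h s) (cxT-ev r ι e h t))
  cxF-ev r ι e h (φ ⇒ₗ ψ) = cong ⌊ 2 ,_⌋ (cong₂ ⌊_,_⌋ (cxF-ev r ι e h φ) (cxF-ev r ι e h ψ))
  cxF-ev r ι e h (∀ₗ φ) = cong ⌊ 3 ,_⌋ (cxF-ev (liftR r) (liftI ι) e (lift-ev r ι e h) φ)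

open LatticeCodes

-- Lattice formulas for the interpreted structure and its truth predicate

module StructureFormulas where

  module Formulas (T : Sentence → Set) (TD : Def false (pred₁ (SetCode T))) (q₀ : ∀ φ → Q φ → T φ) (con : Consistent T) where
    open Decoding T TD q₀ con public

    -- The parameters are carried as terms, so that each formula can be written below any number of
    -- quantifiers by weakening them.
    record PT {m} N (p : Env T N → Par m) : Set₁ where
      field
        v0 : Tm N (λ ρ → Par.V0 (p ρ))
        v1 : Tm N (λ ρ → Par.V1 (p ρ))
        j  : Tm N (λ ρ → Par.J (p ρ))
        e* : Tm N (λ ρ → Par.E* (p ρ))
        ec : ∀ c → Tm N (λ ρ → Par.Ec (p ρ) c)
        ds : ∀ i → Tm N (λ ρ → Par.Ds (p ρ) i)
    open PT

    wkP : ∀ {m N} {p : Env T N → Par m} → PT N p → PT (suc N) (λ ρ → p (λ i → ρ (fsuc i)))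
    wkP P = record { v0 = wk' (v0 P) ; v1 = wk' (v1 P) ; j = wk' (j P) ; e* = wk' (e* P) ; ec = λ c → wk' (ec P c) ; ds = λ i → wk' (ds P i) }

    module _ {m : ℕ} where

      sm*F : ∀ {N p t} → PT {m} N p → Tm N t → Fm N (λ ρ → Pred.Sm* (p ρ) (t ρ))
      sm*F P a = LNF m (ds P) (e* P) a

      smcF : ∀ {N p t} c → PT {m} N p → Tm N t → Fm N (λ ρ → Pred.Smc (p ρ) c (t ρ))
      smcF c P a = LNF m (ds P) (ec P c) a

      nnF : ∀ {N p t} → PT {m} N p → Tm N t → Fm N (λ ρ → Pred.NN (p ρ) (t ρ))
      nnF P a = all' (compF (vr (# 0)) ⟶ vr (# 0) ⊑' wk' (j P) ⟶ not' (all' (compF (vr (# 0)) ⟶ vr (# 0) ⊑' wk' (wk' (j P)) ⟶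
        zeroF (vr (# 0) ∩' vr (# 1)) ⟶ sm*F (wkP (wkP P)) (wk' (wk' a) ∩' vr (# 0)))))

      uniqF : ∀ {N p t} → PT {m} N p → Tm N t → Fm N (λ ρ → Pred.Uniq (p ρ) (t ρ))
      uniqF P a = all' (all' (nnF P₂ (a₂ ∩' vr (# 1)) ⟶ nnF P₂ (a₂ ∩' vr (# 0)) ⟶ nnF P₂ ((a₂ ∩' vr (# 1)) ∩' vr (# 0))))
        where P₂ = wkP (wkP P)
              a₂ = wk' (wk' a)

      domF : ∀ {N p t} → PT {m} N p → Tm N t → Fm N (λ ρ → Pred.Dom (p ρ) (t ρ))
      domF P a = not' (nnF P a ⟶ not' (uniqF P a))

      eqF : ∀ {N p s t} → PT {m} N p → Tm N s → Tm N t → Fm N (λ ρ → Pred.Eq (p ρ) (s ρ) (t ρ))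
      eqF P a b = nnF P (a ∩' b)

      hitF : ∀ {N p s t} c → PT {m} N p → Tm N s → Tm N t → Fm N (λ ρ → Pred.Hit (p ρ) c (s ρ) (t ρ))
      hitF c P w r = all' (compF (vr (# 0)) ⟶ vr (# 0) ⊑' wk' r ⟶ not' (sm*F (wkP P) (vr (# 0))) ⟶ not' (smcF c (wkP P) (wk' w ∩' vr (# 0))))

      hF : ∀ {N p a b c d} → PT {m} N p → Tm N a → Tm N b → Tm N c → Tm N d → Fm N (λ ρ → Pred.H (p ρ) (a ρ) (b ρ) (c ρ) (d ρ))
      hF P a b c d = all' (compF (vr (# 0)) ⟶ vr (# 0) ⊑' wk' (j P) ⟶ not' (all' (compF (vr (# 0)) ⟶ vr (# 0) ⊑' wk' (wk' (j P)) ⟶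
        zeroF (vr (# 0) ∩' vr (# 1)) ⟶ not' (sm*F P₂ (vr (# 0))) ⟶
        hitF (# 0) P₂ (wk' (wk' a)) (vr (# 0)) ⟶ hitF (# 1) P₂ (wk' (wk' b)) (vr (# 0)) ⟶ hitF (# 2) P₂ (wk' (wk' c)) (vr (# 0)) ⟶ hitF (# 3) P₂ (wk' (wk' d)) (vr (# 0)) ⟶ bot')))
        where P₂ = wkP (wkP P)

      rF : ∀ {N p a b c} t → PT {m} N p → Tm N a → Tm N b → Tm N c → Fm N (λ ρ → Pred.R (p ρ) t (a ρ) (b ρ) (c ρ))
      rF false P a b c = hF P (v0 P) a b c
      rF true P a b c = hF P (v1 P) a b c

      valF : ∀ {n N p} {e : Env T N → Env T n} {a} (t : Term n) → PT {m} N p → (∀ i → Tm N (λ ρ → e ρ i)) → Tm N a → Fm N (λ ρ → M.Val (p ρ) t (e ρ) (a ρ))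
      valF (var i) P E a = eqF P (E i) a
      valF `0 P E a = eqF P (v0 P) a
      valF (`S t) P E a = not' (all' (domF (wkP P) (vr (# 0)) ⟶ valF t (wkP P) (λ i → wk' (E i)) (vr (# 0)) ⟶ not' (rF false (wkP P) (vr (# 0)) (wk' (v1 P)) (wk' a))))
      valF (s `+ t) P E a = not' (all' (domF (wkP P) (vr (# 0)) ⟶ valF s (wkP P) (λ i → wk' (E i)) (vr (# 0)) ⟶
        all' (domF (wkP (wkP P)) (vr (# 0)) ⟶ valF t (wkP (wkP P)) (λ i → wk' (wk' (E i))) (vr (# 0)) ⟶ not' (rF false (wkP (wkP P)) (vr (# 1)) (vr (# 0)) (wk' (wk' a))))))
      valF (s `· t) P E a = not' (all' (domF (wkP P) (vr (# 0)) ⟶ valF s (wkP P) (λ i → wk' (E i)) (vr (# 0)) ⟶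
        all' (domF (wkP (wkP P)) (vr (# 0)) ⟶ valF t (wkP (wkP P)) (λ i → wk' (wk' (E i))) (vr (# 0)) ⟶ not' (rF true (wkP (wkP P)) (vr (# 1)) (vr (# 0)) (wk' (wk' a))))))

      trF : ∀ {n N p} {e : Env T N → Env T n} (φ : Formula n) → PT {m} N p → (∀ i → Tm N (λ ρ → e ρ i)) → Fm N (λ ρ → M.Tr (p ρ) φ (e ρ))
      trF `⊥ P E = fm ⊥ₗ λ ρ → (λ x → x) , (λ x → x)
      trF (s ≐ t) P E = all' (domF (wkP P) (vr (# 0)) ⟶ valF s (wkP P) (λ i → wk' (E i)) (vr (# 0)) ⟶ valF t (wkP P) (λ i → wk' (E i)) (vr (# 0)))
      trF (φ ⇒ ψ) P E = trF φ P E ⟶ trF ψ P E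
      trF {n} {N} {p} {e} (∀' φ) P E = all' (domF (wkP P) (vr (# 0)) ⟶ trF {e = λ ρ → extendEnv T (ρ fzero) (e (λ i → ρ (fsuc i)))} φ (wkP P) λ { fzero → vr (# 0) ; (fsuc i) → wk' (E i) })

      allDom : ∀ {ℓ N p} {B : Env T (suc N) → Set ℓ} → PT {m} N p → Fm (suc N) B → Fm N (λ ρ → ∀ a → Pred.Dom (p ρ) a → B (extendEnv T a ρ))
      allDom P b = all' (domF (wkP P) (vr (# 0)) ⟶ b)

      module _ {N p} (P : PT {m} N p) where
        private
          P₁ = wkP P
          P₂ = wkP P₁
          P₃ = wkP P₂
          P₄ = wkP P₃
          P₅ = wkP P₄
          P₆ = wkP P₅

        reflF : Fm N (λ ρ → M.Refl (p ρ))
        reflF = allDom P (eqF P₁ (vr (# 0)) (vr (# 0)))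

        symF : Fm N (λ ρ → M.Sym (p ρ))
        symF = allDom P (allDom P₁ (eqF P₂ (vr (# 1)) (vr (# 0)) ⟶ eqF P₂ (vr (# 0)) (vr (# 1))))

        transF : Fm N (λ ρ → M.Trans (p ρ))
        transF = allDom P (allDom P₁ (allDom P₂ (eqF P₃ (vr (# 2)) (vr (# 1)) ⟶ eqF P₃ (vr (# 1)) (vr (# 0)) ⟶ eqF P₃ (vr (# 2)) (vr (# 0)))))

        totalF : ∀ t → Fm N (λ ρ → M.Total (p ρ) t)
        totalF t = allDom P (allDom P₁ (not' (allDom P₂ (not' (rF t P₃ (vr (# 2)) (vr (# 1)) (vr (# 0)))))))

        functionalF : ∀ t → Fm N (λ ρ → M.Functional (p ρ) t)
        functionalF t = allDom P (allDom P₁ (allDom P₂ (allDom P₃ (allDom P₄ (allDom P₅ (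
          eqF P₆ (vr (# 5)) (vr (# 2)) ⟶ eqF P₆ (vr (# 4)) (vr (# 1)) ⟶ rF t P₆ (vr (# 5)) (vr (# 4)) (vr (# 3)) ⟶ rF t P₆ (vr (# 2)) (vr (# 1)) (vr (# 0)) ⟶ eqF P₆ (vr (# 3)) (vr (# 0))))))))

        respF : ∀ t → Fm N (λ ρ → M.Resp (p ρ) t)
        respF t = allDom P (allDom P₁ (allDom P₂ (allDom P₃ (eqF P₄ (vr (# 1)) (vr (# 0)) ⟶ rF t P₄ (vr (# 3)) (vr (# 2)) (vr (# 1)) ⟶ rF t P₄ (vr (# 3)) (vr (# 2)) (vr (# 0))))))

open StructureFormulas

-- Sentences quantifying over all parameters

module InterpretedStructures where

  allN : ∀ n → LFormula n → LFormula 0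
  allN zero φ = φ
  allN (suc n) φ = allN n (∀ₗ φ)

  x⇒ : ∀ {k} → XT k → XT k → XT k
  x⇒ s t = xp (xn 2) (xp s t)

  x⊥ : ∀ {k} → XT k
  x⊥ = xp (xn 0) (xn 0)

  -- A counterpart of `allN` on codes. The code of a large sentence is thereby a pairing term in the
  -- codes of its varying parts, and the sentence itself never has to be evaluated.
  allX : ∀ {k} → ℕ → XT k → XT k
  allX zero t = t
  allX (suc n) t = allX n (xp (xn 3) t)

  allX-ev : ∀ {k} n φ (t : XT k) e → clF φ ≡ xev t e → clF (allN n φ) ≡ xev (allX n t) e
  allX-ev zero φ t e h = h
  allX-ev (suc n) φ t e h = allX-ev n (∀ₗ φ) (xp (xn 3) t) e (cong ⌊ 3 ,_⌋ h)

  allX-ext : ∀ {k k'} n (t : XT k) (t' : XT k') e e' → xev t e ≡ xev t' e' → xev (allX n t) e ≡ xev (allX n t') e'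
  allX-ext zero t t' e e' h = h
  allX-ext (suc n) t t' e e' h = allX-ext n _ _ e e' (cong ⌊ 3 ,_⌋ h)

  hypX : ∀ {k n} → List (LFormula n) → XT k → XT k
  hypX [] t = t
  hypX (f ∷ L) t = x⇒ (xn (clF f)) (hypX L t)

  hypX-ev : ∀ {k n} (L : List (LFormula n)) φ (t : XT k) e → clF φ ≡ xev t e → clF (foldr _⇒ₗ_ φ L) ≡ xev (hypX L t) e
  hypX-ev [] φ t e h = h
  hypX-ev (f ∷ L) φ t e h = cong (λ z → ⌊ 2 , ⌊ clF f , z ⌋ ⌋) (hypX-ev L φ t e h)

  hypX-ext : ∀ {k k' n} (L : List (LFormula n)) (t : XT k) (t' : XT k') e e' → xev t e ≡ xev t' e' → xev (hypX L t) e ≡ xev (hypX L t') e'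
  hypX-ext [] t t' e e' h = h
  hypX-ext (f ∷ L) t t' e e' h = cong (λ z → ⌊ 2 , ⌊ clF f , z ⌋ ⌋) (hypX-ext L t t' e e' h)

  module Interpretation (T : Sentence → Set) (TD : Def false (pred₁ (SetCode T))) (q₀ : ∀ φ → Q φ → T φ) (con : Consistent T) (m : ℕ) where
    open Formulas T TD q₀ con public

    P : ℕ
    P = 8 + m

    sat-ren : ∀ {n k} (r : Fin n → Fin k) φ (ρ : Env T k) (ρ' : Env T n) → (∀ i χ → mem (ρ (r i)) χ ⇔ mem (ρ' i) χ) → Sat T (renL r φ) ρ ⇔ Sat T φ ρ'
    sat-ren r ⊥ₗ ρ ρ' h = (λ z → z) , (λ z → z)
    sat-ren r (s ≈ₗ t) ρ ρ' h =
      (λ { (lift f) → lift λ χ → (λ x → proj₁ (b χ) (proj₁ (f χ) (proj₂ (a χ) x))) , (λ x → proj₁ (a χ) (proj₂ (f χ) (proj₂ (b χ) x))) }) ,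
      (λ { (lift f) → lift λ χ → (λ x → proj₂ (b χ) (proj₁ (f χ) (proj₁ (a χ) x))) , (λ x → proj₂ (a χ) (proj₂ (f χ) (proj₁ (b χ) x))) })
      where
      a = ren-tsem r s ρ ρ' h
      b = ren-tsem r t ρ ρ' h
    sat-ren r (φ ⇒ₗ ψ) ρ ρ' h = (λ f p → proj₁ (sat-ren r ψ ρ ρ' h) (f (proj₂ (sat-ren r φ ρ ρ' h) p))) ,
                                (λ f p → proj₂ (sat-ren r ψ ρ ρ' h) (f (proj₁ (sat-ren r φ ρ ρ' h) p)))
    sat-ren r (∀ₗ φ) ρ ρ' h = (λ f A → proj₁ (ih A) (f A)) , (λ f A → proj₂ (ih A) (f A))
      where ih = λ A → sat-ren (liftR r) φ (extendEnv T A ρ) (extendEnv T A ρ') λ { fzero χ → (λ z → z) , (λ z → z) ; (fsuc i) → h i }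

    sat-ext : ∀ {n} φ (ρ ρ' : Env T n) → (∀ i → ρ i ≡ ρ' i) → Sat T φ ρ → Sat T φ ρ'
    sat-ext φ ρ ρ' h s = proj₁ (sat-ren (λ i → i) φ ρ ρ' (λ i χ → subst (λ z → mem (ρ i) χ ⇔ mem z χ) (h i) ((λ z → z) , (λ z → z))))
      (proj₂ (sat-ren (λ i → i) φ ρ ρ (λ i χ → (λ z → z) , (λ z → z))) s)

    envV : ∀ {n} → Env T 0 → Vec (Ext T) n → Env T n
    envV ρ₀ [] = ρ₀
    envV ρ₀ (A ∷ v) = extendEnv T A (envV ρ₀ v)

    envV-lookup : ∀ {n} ρ₀ (v : Vec (Ext T) n) i → envV ρ₀ v i ≡ lookup v i
    envV-lookup ρ₀ (A ∷ v) fzero = refl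
    envV-lookup ρ₀ (A ∷ v) (fsuc i) = envV-lookup ρ₀ v i

    allN-sem : ∀ n φ ρ₀ → Sat T (allN n φ) ρ₀ ⇔ (∀ (v : Vec (Ext T) n) → Sat T φ (envV ρ₀ v))
    allN-sem zero φ ρ₀ = (λ { s [] → s }) , (λ f → f [])
    allN-sem (suc n) φ ρ₀ = (λ { s (A ∷ v) → proj₁ (allN-sem n (∀ₗ φ) ρ₀) s v A }) , (λ f → proj₂ (allN-sem n (∀ₗ φ) ρ₀) (λ v A → f (A ∷ v)))

    hyp-sem : ∀ {n} L φ (ρ : Env T n) → Sat T (foldr _⇒ₗ_ φ L) ρ ⇔ (All (λ f → Sat T f ρ) L → Sat T φ ρ)
    hyp-sem [] φ ρ = (λ { s [] → s }) , (λ f → f [])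
    hyp-sem (x ∷ L) φ ρ = (λ { s (p ∷ ps) → proj₁ (hyp-sem L φ ρ) (s p) ps }) , (λ f p → proj₂ (hyp-sem L φ ρ) (λ ps → f (p ∷ ps)))

    baseP : PT P parE
    baseP = record { v0 = vr (# 0) ; v1 = vr (# 1) ; j = vr (# 2) ; e* = vr (# 3) ; ec = λ c → vr (4 ↑ʳ (c ↑ˡ m)) ; ds = λ i → vr (8 ↑ʳ i) }

    noEnv : Env T 0
    noEnv ()

    axF : ∀ {φ} → Q φ → Fm P (λ ρ → M.Tr (parE ρ) φ noEnv)
    axF {φ} _ = trF {e = λ _ → noEnv} φ baseP (λ ())

    Structure : Env T P → Set₁
    Structure ρ = M.Ok (parE ρ) × (∀ φ → Q φ → M.Tr (parE ρ) φ noEnv)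

    abstract
      oks : List (LFormula P)
      oks = form (reflF baseP) ∷ form (symF baseP) ∷ form (transF baseP) ∷ form (domF baseP (PT.v0 baseP)) ∷ form (domF baseP (PT.v1 baseP))
        ∷ form (totalF baseP false) ∷ form (totalF baseP true) ∷ form (functionalF baseP false) ∷ form (functionalF baseP true)
        ∷ form (respF baseP false) ∷ form (respF baseP true)
        ∷ form (axF Q1) ∷ form (axF Q2) ∷ form (axF Q3) ∷ form (axF Q4) ∷ form (axF Q5) ∷ form (axF Q6) ∷ form (axF Q7) ∷ []

      oks-sem : ∀ ρ → All (λ f → Sat T f ρ) oks ⇔ Structure ρ
      oks-sem ρ = to , from
        where
        to : All (λ f → Sat T f ρ) oks → Structure ρ
        to (a ∷ b ∷ c ∷ d ∷ e ∷ f₀ ∷ f₁ ∷ g₀ ∷ g₁ ∷ h₀ ∷ h₁ ∷ q1 ∷ q2 ∷ q3 ∷ q4 ∷ q5 ∷ q6 ∷ q7 ∷ []) = record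
          { e-refl = proj₁ (sem (reflF baseP) ρ) a ; e-sym = proj₁ (sem (symF baseP) ρ) b ; e-trans = proj₁ (sem (transF baseP) ρ) c
          ; d-zr = proj₁ (sem (domF baseP (PT.v0 baseP)) ρ) d ; d-on = proj₁ (sem (domF baseP (PT.v1 baseP)) ρ) e
          ; r-total = λ { false → proj₁ (sem (totalF baseP false) ρ) f₀ ; true → proj₁ (sem (totalF baseP true) ρ) f₁ }
          ; r-fun = λ { false → proj₁ (sem (functionalF baseP false) ρ) g₀ ; true → proj₁ (sem (functionalF baseP true) ρ) g₁ }
          ; r-cong = λ { false → proj₁ (sem (respF baseP false) ρ) h₀ ; true → proj₁ (sem (respF baseP true) ρ) h₁ } } ,
          λ { _ Q1 → proj₁ (sem (axF Q1) ρ) q1 ; _ Q2 → proj₁ (sem (axF Q2) ρ) q2 ; _ Q3 → proj₁ (sem (axF Q3) ρ) q3 ; _ Q4 → proj₁ (sem (axF Q4) ρ) q4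
            ; _ Q5 → proj₁ (sem (axF Q5) ρ) q5 ; _ Q6 → proj₁ (sem (axF Q6) ρ) q6 ; _ Q7 → proj₁ (sem (axF Q7) ρ) q7 }
        from : Structure ρ → All (λ f → Sat T f ρ) oks
        from (o , h) = proj₂ (sem (reflF baseP) ρ) (e-refl) ∷ proj₂ (sem (symF baseP) ρ) (e-sym) ∷ proj₂ (sem (transF baseP) ρ) (e-trans)
          ∷ proj₂ (sem (domF baseP (PT.v0 baseP)) ρ) (d-zr) ∷ proj₂ (sem (domF baseP (PT.v1 baseP)) ρ) (d-on)
          ∷ proj₂ (sem (totalF baseP false) ρ) (r-total false) ∷ proj₂ (sem (totalF baseP true) ρ) (r-total true)
          ∷ proj₂ (sem (functionalF baseP false) ρ) (r-fun false) ∷ proj₂ (sem (functionalF baseP true) ρ) (r-fun true)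
          ∷ proj₂ (sem (respF baseP false) ρ) (r-cong false) ∷ proj₂ (sem (respF baseP true) ρ) (r-cong true)
          ∷ proj₂ (sem (axF Q1) ρ) (h _ Q1) ∷ proj₂ (sem (axF Q2) ρ) (h _ Q2) ∷ proj₂ (sem (axF Q3) ρ) (h _ Q3) ∷ proj₂ (sem (axF Q4) ρ) (h _ Q4)
          ∷ proj₂ (sem (axF Q5) ρ) (h _ Q5) ∷ proj₂ (sem (axF Q6) ρ) (h _ Q6) ∷ proj₂ (sem (axF Q7) ρ) (h _ Q7) ∷ []
          where open Model.Ok o

      dom₁ : LFormula (suc P)
      dom₁ = form (domF (wkP baseP) (vr (# 0)))

      dom₁-sem : ∀ a π → Sat T dom₁ (extendEnv T a π) ⇔ Pred.Dom (parE π) a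
      dom₁-sem a π = sem (domF (wkP baseP) (vr (# 0))) (extendEnv T a π)

      zero₁ : LFormula (suc P)
      zero₁ = form (eqF (wkP baseP) (wk' (PT.v0 baseP)) (vr (# 0)))

      zero₁-sem : ∀ a π → Sat T zero₁ (extendEnv T a π) ⇔ Pred.Eq (parE π) (π (# 0)) a
      zero₁-sem a π = sem (eqF (wkP baseP) (wk' (PT.v0 baseP)) (vr (# 0))) (extendEnv T a π)

      dom₂ suc₂ : LFormula (suc (suc P))
      dom₂ = form (domF (wkP (wkP baseP)) (vr (# 0)))
      suc₂ = form (rF false (wkP (wkP baseP)) (vr (# 0)) (wk' (wk' (PT.v1 baseP))) (vr (# 1)))

      dom₂-sem : ∀ b a π → Sat T dom₂ (extendEnv T b (extendEnv T a π)) ⇔ Pred.Dom (parE π) b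
      dom₂-sem b a π = sem (domF (wkP (wkP baseP)) (vr (# 0))) (extendEnv T b (extendEnv T a π))

      suc₂-sem : ∀ b a π → Sat T suc₂ (extendEnv T b (extendEnv T a π)) ⇔ Pred.R (parE π) false b (π (# 1)) a
      suc₂-sem b a π = sem (rF false (wkP (wkP baseP)) (vr (# 0)) (wk' (wk' (PT.v1 baseP))) (vr (# 1))) (extendEnv T b (extendEnv T a π))

open InterpretedStructures

-- Numerals in the lattice language, and their codes

module NumeralFormulas where

  module Numerals (T : Sentence → Set) (TD : Def false (pred₁ (SetCode T))) (q₀ : ∀ φ → Q φ → T φ) (con : Consistent T) (m : ℕ) where
    open Interpretation T TD q₀ con m public

    -- Variable 0 has the value n; the parameters are the last P of the d + P remaining variables.
    isNum : (n d : ℕ) → LFormula (suc (d + P))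
    isNum zero d = renL (liftR (d ↑ʳ_)) zero₁
    isNum (suc n) d = ∀ₗ (renL (liftR (liftR (d ↑ʳ_))) dom₂ ⇒ₗ (isNum n (suc d) ⇒ₗ (renL (liftR (liftR (d ↑ʳ_))) suc₂ ⇒ₗ ⊥ₗ))) ⇒ₗ ⊥ₗ

    isNum-sem : ∀ n d (ρ : Env T (d + P)) π a → (∀ i → ρ (d ↑ʳ i) ≡ π i) → Sat T (isNum n d) (extendEnv T a ρ) ⇔ M.Val (parE π) (num n) noEnv a
    isNum-sem zero d ρ π a h = let r = sat-ren (liftR (d ↑ʳ_)) zero₁ (extendEnv T a ρ) (extendEnv T a π)
                                        λ { fzero χ → (λ z → z) , (λ z → z) ; (fsuc i) χ → subst (λ z → mem (ρ (d ↑ʳ i)) χ ⇔ mem z χ) (h i) ((λ z → z) , (λ z → z)) }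
                                   s = zero₁-sem a π in (λ x → proj₁ s (proj₁ r x)) , (λ x → proj₂ r (proj₂ s x))
    isNum-sem (suc n) d ρ π a h =
      (λ f k → lower (f λ b x y → λ z → lift (k b (proj₁ (dom₂-sem b a π) (proj₁ (tpl b dom₂) x)) (proj₁ (ih b) y) (proj₁ (suc₂-sem b a π) (proj₁ (tpl b suc₂) z))))) ,
      (λ f k → lift (f λ b x y z → lower (k b (proj₂ (tpl b dom₂) (proj₂ (dom₂-sem b a π) x)) (proj₂ (ih b) y) (proj₂ (tpl b suc₂) (proj₂ (suc₂-sem b a π) z)))))
      where
      ih : ∀ b → Sat T (isNum n (suc d)) (extendEnv T b (extendEnv T a ρ)) ⇔ M.Val (parE π) (num n) noEnv b
      ih b = isNum-sem n (suc d) (extendEnv T a ρ) π b h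
      tpl : ∀ b φ → Sat T (renL (liftR (liftR (d ↑ʳ_))) φ) (extendEnv T b (extendEnv T a ρ)) ⇔ Sat T φ (extendEnv T b (extendEnv T a π))
      tpl b φ = sat-ren (liftR (liftR (d ↑ʳ_))) φ (extendEnv T b (extendEnv T a ρ)) (extendEnv T b (extendEnv T a π))
        λ { fzero χ → (λ z → z) , (λ z → z) ; (fsuc fzero) χ → (λ z → z) , (λ z → z) ; (fsuc (fsuc i)) χ → subst (λ z → mem (ρ (d ↑ʳ i)) χ ⇔ mem z χ) (h i) ((λ z → z) , (λ z → z)) }

    -- Below d further binders the parameter i has index d + i, so a renamed template has a code
    -- computable from d.
    ι : ∀ {k} → Fin k → Fin P → XT k
    ι d i = xadd (xv d) (xn (toℕ i))

    stepX : ∀ {k} → Fin k → XT k → XT k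
    stepX d c = x⇒ (xp (xn 3) (x⇒ (cxF (liftI (liftI (ι d))) dom₂) (x⇒ c (x⇒ (cxF (liftI (liftI (ι d))) suc₂) x⊥)))) x⊥

    -- Each successor opens one more quantifier, so the formula for n + 1 at depth d contains the
    -- one for n at depth d + 1; the depth has to be part of the fact.
    numProg : Program false
    numProg = clause 1 ok [] (xp (xv (# 0)) (xp (xn 0) (cxF (liftI (ι (# 0))) zero₁)))
      ∷ clause 3 ok (xp (xsu (xv (# 0))) (xp (xv (# 1)) (xv (# 2))) ∷ []) (xp (xv (# 0)) (xp (xsu (xv (# 1))) (stepX (# 0) (xv (# 2)))))
      ∷ []

    zero-code : ∀ d → clF (isNum 0 d) ≡ xev (cxF (liftI (ι (# 0))) zero₁) (d ∷ [])
    zero-code d = cxF-ev (liftR (d ↑ʳ_)) (liftI (ι (# 0))) (d ∷ []) (lift-ev (d ↑ʳ_) (ι (# 0)) (d ∷ []) (toℕ-↑ʳ d)) zero₁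

    suc-code : ∀ n d → clF (isNum (suc n) d) ≡ xev (stepX (# 0) (xv (# 2))) (d ∷ n ∷ clF (isNum n (suc d)) ∷ [])
    suc-code n d = cong₂ (λ x y → ⌊ 2 , ⌊ ⌊ 3 , ⌊ 2 , ⌊ x , ⌊ 2 , ⌊ clF (isNum n (suc d)) , ⌊ 2 , ⌊ y , ⌊ 0 , 0 ⌋ ⌋ ⌋ ⌋ ⌋ ⌋ ⌋ ⌋ , ⌊ 0 , 0 ⌋ ⌋ ⌋) (tpl dom₂) (tpl suc₂)
      where
      e = d ∷ n ∷ clF (isNum n (suc d)) ∷ []
      tpl : ∀ φ → clF (renL (liftR (liftR (d ↑ʳ_))) φ) ≡ xev (cxF (liftI (liftI (ι (# 0)))) φ) e
      tpl φ = cxF-ev (liftR (liftR (d ↑ʳ_))) (liftI (liftI (ι (# 0)))) e (lift-ev _ _ e (lift-ev (d ↑ʳ_) (ι (# 0)) e (toℕ-↑ʳ d))) φ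

    num-complete : ∀ n d → Der numProg ⌊ d , ⌊ n , clF (isNum n d) ⌋ ⌋
    num-complete zero d = der fzero (d ∷ []) refl tt (cong (λ z → ⌊ d , ⌊ 0 , z ⌋ ⌋) (zero-code d))
    num-complete (suc n) d = der (fsuc fzero) (d ∷ n ∷ clF (isNum n (suc d)) ∷ []) refl (num-complete n (suc d)) (cong (λ z → ⌊ d , ⌊ suc n , z ⌋ ⌋) (suc-code n d))

    num-sound : ∀ {f} → Der numProg f → ∀ d n c → f ≡ ⌊ d , ⌊ n , c ⌋ ⌋ → c ≡ clF (isNum n d)
    num-sound (der fzero (d' ∷ []) _ _ e) d n c e' with pinj d' ⌊ 0 , xev (cxF (liftI (ι (# 0))) zero₁) (d' ∷ []) ⌋ {d} {⌊ n , c ⌋} (trans (sym e) e')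
    ... | refl , e₁ with pinj 0 (xev (cxF (liftI (ι (# 0))) zero₁) (d' ∷ [])) {n} {c} e₁
    ...   | refl , e₂ = trans (sym e₂) (sym (zero-code d))
    num-sound (der (fsuc fzero) (d' ∷ n' ∷ c' ∷ []) _ p e) d n c e' with pinj d' ⌊ suc n' , xev (stepX (# 0) (xv (# 2))) (d' ∷ n' ∷ c' ∷ []) ⌋ {d} {⌊ n , c ⌋} (trans (sym e) e')
    ... | refl , e₁ with pinj (suc n') (xev (stepX (# 0) (xv (# 2))) (d' ∷ n' ∷ c' ∷ [])) {n} {c} e₁ | num-sound p (suc d) n' c' refl
    ...   | refl , e₂ | refl = trans (sym e₂) (sym (suc-code n' d))

    -- Some interpreted structure satisfies χ at the number n.
    theta : ℕ → LFormula (suc P) → LFormula 0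
    theta n χ = allN P (foldr _⇒ₗ_ (∀ₗ (dom₁ ⇒ₗ (isNum n 0 ⇒ₗ χ)) ⇒ₗ ⊥ₗ) oks) ⇒ₗ ⊥ₗ

    thetaX : ∀ {k} → XT k → XT k → XT k
    thetaX v x = x⇒ (allX P (hypX oks (x⇒ (xp (xn 3) (x⇒ (xn (clF dom₁)) (x⇒ v x))) x⊥))) x⊥

    thetaX-ext : ∀ {k k'} (v x : XT k) (v' x' : XT k') e e' → xev v e ≡ xev v' e' → xev x e ≡ xev x' e' → xev (thetaX v x) e ≡ xev (thetaX v' x') e'
    thetaX-ext v x v' x' e e' p r = cong (λ z → ⌊ 2 , ⌊ z , ⌊ 0 , 0 ⌋ ⌋ ⌋) (allX-ext P _ _ e e' (hypX-ext oks _ _ e e'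
      (cong₂ (λ y z → ⌊ 2 , ⌊ ⌊ 3 , ⌊ 2 , ⌊ clF dom₁ , ⌊ 2 , ⌊ y , z ⌋ ⌋ ⌋ ⌋ ⌋ , ⌊ 0 , 0 ⌋ ⌋ ⌋) p r)))

    theta-code : ∀ n χ {k} (v x : XT k) e → clF (isNum n 0) ≡ xev v e → clF χ ≡ xev x e → clF (theta n χ) ≡ xev (thetaX v x) e
    theta-code n χ v x e p r = cong (λ z → ⌊ 2 , ⌊ z , ⌊ 0 , 0 ⌋ ⌋ ⌋) (allX-ev P _ _ e (hypX-ev oks _ _ e
      (cong₂ (λ y z → ⌊ 2 , ⌊ ⌊ 3 , ⌊ 2 , ⌊ clF dom₁ , ⌊ 2 , ⌊ y , z ⌋ ⌋ ⌋ ⌋ ⌋ , ⌊ 0 , 0 ⌋ ⌋ ⌋) p r)))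

    At : ℕ → LFormula (suc P) → Env T P → Set₁
    At n χ π = ∀ a → Pred.Dom (parE π) a → M.Val (parE π) (num n) noEnv a → Sat T χ (extendEnv T a π)

    body-sem : ∀ n χ π → Sat T (∀ₗ (dom₁ ⇒ₗ (isNum n 0 ⇒ₗ χ))) π ⇔ At n χ π
    body-sem n χ π = (λ f a da v → f a (proj₂ (dom₁-sem a π) da) (proj₂ (isNum-sem n 0 π π a (λ _ → refl)) v)) ,
                     (λ f a da v → f a (proj₁ (dom₁-sem a π) da) (proj₁ (isNum-sem n 0 π π a (λ _ → refl)) v))

    theta→ : ∀ n χ ρ₀ → Sat T (theta n χ) ρ₀ → ¬ ¬ (Σ (Env T P) λ π → Structure π × At n χ π)
    theta→ n χ ρ₀ s k = lower (s (proj₂ (allN-sem P _ ρ₀) λ v → proj₂ (hyp-sem oks _ (envV ρ₀ v)) λ os b →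
      lift (k (envV ρ₀ v , proj₁ (oks-sem (envV ρ₀ v)) os , proj₁ (body-sem n χ (envV ρ₀ v)) b))))

    theta← : ∀ n χ ρ₀ π → Structure π → At n χ π → Sat T (theta n χ) ρ₀
    theta← n χ ρ₀ π st a s = proj₁ (hyp-sem oks _ π) (sat-ext _ (envV ρ₀ v) π (λ i → trans (envV-lookup ρ₀ v i) (lookup∘tabulate π i)) (proj₁ (allN-sem P _ ρ₀) s v))
      (proj₂ (oks-sem π) st) (proj₂ (body-sem n χ π) a)
      where v = tabulate π

    module _ (e : Code 1) where

      -- The procedure e is run on the code of `theta n χ`, where n is taken as the code of χ; the
      -- program recovers the code of the numeral formula.
      Rejects Accepts : Vec ℕ 1 → Set
      Rejects (n ∷ []) = Σ ℕ λ v → Σ ℕ λ w → Der numProg ⌊ 0 , ⌊ n , v ⌋ ⌋ × Eval e (xev (thetaX {2} (xv (# 0)) (xv (# 1))) (v ∷ n ∷ []) ∷ []) (suc w)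
      Accepts (n ∷ []) = Σ ℕ λ v → Der numProg ⌊ 0 , ⌊ n , v ⌋ ⌋ × Eval e (xev (thetaX {2} (xv (# 0)) (xv (# 1))) (v ∷ n ∷ []) ∷ []) 0

open NumeralFormulas

-- The diagonal argument against a decision procedure

module Diagonalisation where

  module Candidate (T : Sentence → Set) (TD : Def false (pred₁ (SetCode T))) (q₀ : ∀ φ → Q φ → T φ) (con : Consistent T) (e : Code 1) where
    module N = Numbers T TD q₀ con
    open Numerals T TD q₀ con (suc (suc N.K')) public

    abstract
      rejectsD : Def false (Rejects e)
      rejectsD = defP (xex (xex (xand (at (derD numProg) (xp (xn 0) (xp (xv (# 2)) (xv (# 1))) ∷ [])) (at (codeD e) (xsu (xv (# 0)) ∷ thetaX (xv (# 1)) (xv (# 2)) ∷ [])))))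
        λ { (n ∷ []) → (λ { (v , w , d , r) → v , w , d , subst (λ c → Eval e (c ∷ []) (suc w)) (same v n w) r }) ,
                       (λ { (v , w , d , r) → v , w , d , subst (λ c → Eval e (c ∷ []) (suc w)) (sym (same v n w)) r }) }
        where
        same : ∀ v n w → xev (thetaX {2} (xv (# 0)) (xv (# 1))) (v ∷ n ∷ []) ≡ xev (thetaX {3} (xv (# 1)) (xv (# 2))) (w ∷ v ∷ n ∷ [])
        same v n w = thetaX-ext (xv (# 0)) (xv (# 1)) (xv (# 1)) (xv (# 2)) (v ∷ n ∷ []) (w ∷ v ∷ n ∷ []) refl refl

      acceptsD : Def false (Accepts e)
      acceptsD = defP (xex (xand (at (derD numProg) (xp (xn 0) (xp (xv (# 1)) (xv (# 0))) ∷ [])) (at (codeD e) (xn 0 ∷ thetaX (xv (# 0)) (xv (# 1)) ∷ []))))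
        λ { (n ∷ []) → (λ z → z) , (λ z → z) }

    open Separation (proj₁ rejectsD) (proj₁ acceptsD) public

    χF : Fm (suc P) (λ ρ → M.Tr (parE (λ i → ρ (fsuc i))) separator (extendEnv T (ρ fzero) noEnv))
    χF = trF {e = λ ρ → extendEnv T (ρ fzero) noEnv} separator (wkP baseP) λ { fzero → vr fzero }

    abstract
      χ : LFormula (suc P)
      χ = form χF

      χ-sem : ∀ a π → Sat T χ (extendEnv T a π) ⇔ M.Tr (parE π) separator (extendEnv T a noEnv)
      χ-sem a π = sem χF (extendEnv T a π)

    -- The separator of rejection and acceptance is evaluated at the code of its own translation,
    -- which closes the diagonal.
    k : ℕ
    k = clF χ

  module Diagonal (T : Sentence → Set) (TD : Def false (pred₁ (SetCode T))) (q₀ : ∀ φ → Q φ → T φ) (con : Consistent T)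
    (e : Code 1) (total : ∀ n → Σ ℕ (Eval e (n ∷ []))) where
    open Candidate T TD q₀ con e

    abstract
      σ : LFormula 0
      σ = theta k χ

      c : ℕ
      c = xev (thetaX {2} (xv (# 0)) (xv (# 1))) (clF (isNum k 0) ∷ k ∷ [])

      c≡ : codeLF σ ≡ c
      c≡ = trans (sym (clF≡ σ)) (theta-code k χ (xv (# 0)) (xv (# 1)) (clF (isNum k 0) ∷ k ∷ []) refl refl)

      σ→ : ∀ ρ₀ → Sat T σ ρ₀ → ¬ ¬ (Σ (Env T P) λ π → Structure π × At k χ π)
      σ→ = theta→ k χ

      σ← : ∀ ρ₀ π → Structure π → At k χ π → Sat T σ ρ₀
      σ← = theta← k χ

      rejects : (Σ ℕ λ w → Eval e (c ∷ []) (suc w)) ⇔ Rejects e (k ∷ [])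
      rejects = (λ { (w , r) → clF (isNum k 0) , w , num-complete k 0 , r }) , to
        where
        to : Rejects e (k ∷ []) → Σ ℕ λ w → Eval e (c ∷ []) (suc w)
        to (v , w , d , r) with num-sound d 0 k v refl
        ... | refl = w , r

      accepts : Eval e (c ∷ []) 0 ⇔ Accepts e (k ∷ [])
      accepts = (λ r → clF (isNum k 0) , num-complete k 0 , r) , to
        where
        to : Accepts e (k ∷ []) → Eval e (c ∷ []) 0
        to (v , d , r) with num-sound d 0 k v refl
        ... | refl = r

    inst : ∀ (π : Env T P) (o : M.Ok (parE π)) (stable : ∀ a b → ¬ ¬ Pred.Eq (parE π) a b → Pred.Eq (parE π) a b) →
      ∀ a → Pred.Dom (parE π) a → M.Val (parE π) (num k) noEnv a → M.Tr (parE π) (separator ⟪ num k ⟫) noEnv ⇔ M.Tr (parE π) separator (extendEnv T a noEnv)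
    inst π o stable a da v = tr-sub (λ _ → num k) separator {ρ = extendEnv T a noEnv} (λ { fzero → da }) (λ ()) (λ { fzero → v })
      where open M.Soundness (parE π) stable o

    eq-stable : ∀ (π : Env T P) a b → ¬ ¬ Pred.Eq (parE π) a b → Pred.Eq (parE π) a b
    eq-stable π a b h x y z f = h λ g → g x y z f

    -- The structure behind `σ` may be nonstandard. It satisfies Q, and by soundness this already
    -- excludes a refutation in Q.
    true→ : ∀ ρ₀ → Sat T σ ρ₀ → ¬ (Q ⊢ ¬' (separator ⟪ num k ⟫))
    true→ ρ₀ s d = σ→ ρ₀ s λ { (π , (o , qs) , h) → contra π o qs h }
      where
      contra : ∀ (π : Env T P) → M.Ok (parE π) → (∀ φ → Q φ → M.Tr (parE π) φ noEnv) → At k χ π → ⊥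
      contra π o qs h = val-total (num k) {noEnv} (λ ()) λ { (a , da , v) →
        lower (sound {Q} noEnv qs d noEnv (λ ()) (proj₂ (inst π o (eq-stable π) a da v) (proj₁ (χ-sem a π) (h a da v)))) }
        where open M.Soundness (parE π) (eq-stable π) o

    -- The standard parameters give the required structure: there a theorem of Q is true.
    false→ : ∀ ρ₀ → Q ⊢ (separator ⟪ num k ⟫) → Sat T σ ρ₀
    false→ ρ₀ d = σ← ρ₀ N.stdEnv (N.std-ok , λ φ p → N.Q-holds φ p noEnv) λ a da v →
      proj₂ (χ-sem a N.stdEnv) (proj₁ (inst N.stdEnv N.std-ok N.eq-stable a da v) (N.sound {Q} noEnv (λ φ p → N.Q-holds φ p noEnv) d noEnv (λ ())))

    module _ (correct : ∀ n → (Eval e (n ∷ []) 0 → ThL T n) × (ThL T n → Lift (lsuc lzero) (Eval e (n ∷ []) 0))) where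

      -- Acceptance makes Q refute the separator at k while `σ` is declared true. Rejection makes Q
      -- prove it, hence `σ` is true and should have been accepted. In both cases the alternative
      -- left open by separation contradicts determinism of e.
      verdict : ∀ v → Eval e (c ∷ []) v → ⊥
      verdict zero r with separator-neg Q (λ _ p → p) k (proj₁ (proj₂ acceptsD (k ∷ [])) (proj₁ accepts r))
      ... | inj₂ a with proj₂ rejects (proj₂ (proj₂ rejectsD (k ∷ [])) a)
      ...   | w , r' with eval-det r r'
      ...     | ()
      verdict zero r | inj₁ d with proj₁ (correct c) r
      ...   | τ , lift p , s with clF-inj τ σ (trans (clF≡ τ) (trans p (trans (sym c≡) (sym (clF≡ σ)))))
      ...     | refl = true→ _ s d
      verdict (suc w) r with separator-pos Q (λ _ p → p) k (proj₁ (proj₂ rejectsD (k ∷ [])) (proj₁ rejects (w , r)))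
      ... | inj₂ b with eval-det r (proj₂ accepts (proj₂ (proj₂ acceptsD (k ∷ [])) b))
      ...   | ()
      verdict (suc w) r | inj₁ d with eval-det r (lower (proj₂ (correct c) (σ , lift c≡ , false→ _ d)))
      ...   | ()

      absurd : ⊥
      absurd = verdict _ (proj₂ (total c))

open Diagonalisation

theorem6p1 : (T : Sentence → Set) → IsCETheory T → Consistent T → (∀ φ → Q φ → T φ) → ¬ IsDecidable₁ (ThL T)
theorem6p1 T ce con q (e , total , correct) = Diagonal.absurd T (theory⇒def ce) q con e total correct
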